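{- For every prime $p\ge5$ and each $r\in\{1,2,3\}$, \[ F_r(q):=\Lambda_p\!\left(\frac{C(q)}{t(q)^{rp}}\right)-\frac{C(q)}{t(q)^r}\equiv0\pmod{p^4}. \] Equivalently, $\delta_{r,s}:=[q^{ -r+s}]F_r(q)\equiv0\pmod{p^4}$ for all $1\le s\le r\le3$.
   Context: Let $\chi_3(n)=\left(\frac{n}{3}\right)$, $C(q)=1+\sum_{n\ge1}c_nq^n$ with $c_n=3\sum_{d\mid n}\chi_3(d)d^4$, and $t(q)=q\prod_{n\ge1}(1-q^{3n})^{12}(1-q^n)^{ -12}$, so $C/t^j\in\mathbf{Z}((q))$. For a Laurent series $f=\sum_{n\gg-\infty}a_nq^n$, $\Lambda_p(f):=\sum_{n}a_{np}q^n$. A congruence mod $p^4$ of Laurent series means every coefficient of the difference lies in $p^4\mathbf{Z}_{(p)}$. -}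

module Defs where

open import Data.Nat as ℕ using (ℕ; zero; suc; _∸_)
open import Data.Nat.DivMod using (_%_)
open import Data.Nat.Divisibility using (_∣?_)
open import Data.Integer as ℤ using (ℤ; +_; -[1+_]; _+_; _*_; -_)
open import Data.List using (List; []; _∷_; _++_; foldr; map; upTo)
open import Relation.Nullary using (yes; no)

Series : Set
Series = ℕ → ℤ

-- Laurent series over ℤ: n ↦ [q^n] (n ∈ ℤ); all series built below are
-- bounded below (coefficients vanish for n ≪ 0).
Laurent : Set
Laurent = ℤ → ℤ

sumℤ : ℕ → (ℕ → ℤ) → ℤ
sumℤ zero    f = + 0
sumℤ (suc n) f = sumℤ n f + f n

mul : Series → Series → Series
mul f g n = sumℤ (suc n) (λ k → f k * g (n ∸ k))

one : Series
one zero    = + 1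
one (suc n) = + 0

pow : Series → ℕ → Series
pow f zero    = one
pow f (suc m) = mul f (pow f m)

-- the polynomial 1 - q^d  (used for d ≥ 1)
oneMinusQ : ℕ → Series
oneMinusQ d n with n ℕ.≟ 0 | n ℕ.≟ d
... | yes _ | _     = + 1
... | no _  | yes _ = - (+ 1)
... | no _  | no _  = + 0

prodList : List Series → Series
prodList = foldr mul one

-- Infinite product Π_{k ≥ 1} f k, valid when f k ≡ 1 (mod q^k):
-- the coefficient of q^n only involves the factors k = 1, …, n.
infProd : (ℕ → Series) → Series
infProd f n = prodList (map (λ k → f (suc k)) (upTo n)) n

nth : List ℤ → ℕ → ℤ
nth []       _       = + 0
nth (x ∷ xs) zero    = x
nth (x ∷ xs) (suc i) = nth xs i

-- coefficients b_0, …, b_n of 1/f, for f with constant term 1: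
-- b_0 = 1, b_m = - Σ_{k=1}^{m} f_k b_{m-k}
invCoeffs : Series → ℕ → List ℤ
invCoeffs f zero    = + 1 ∷ []
invCoeffs f (suc n) =
  invCoeffs f n ++ (- sumℤ (suc n) (λ i → f (suc i) * nth (invCoeffs f n) (n ∸ i)) ∷ [])

-- multiplicative inverse of a power series with constant term 1
inv : Series → Series
inv f n = nth (invCoeffs f n) n

E₁ : Series
E₁ = infProd (λ k → oneMinusQ k)

E₃ : Series
E₃ = infProd (λ k → oneMinusQ (3 ℕ.* k))

tOverQ : Series
tOverQ = mul (pow E₃ 12) (inv (pow E₁ 12))

χ₃ : ℕ → ℤ
χ₃ d with d % 3
... | 0 = + 0
... | 1 = + 1
... | _ = - (+ 1)

C : Series
C zero    = + 1
C (suc n) = + 3 * sumℤ (suc n) term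
  where
  term : ℕ → ℤ
  term i with suc i ∣? suc n
  ... | yes _ = χ₃ (suc i) * + (suc i ℕ.^ 4)
  ... | no _  = + 0

shiftDown : ℕ → Series → Laurent
shiftDown j f n with n + + j
... | + m      = f m
... | -[1+ _ ] = + 0

-- C(q) / t(q)^j = q^{-j} · C(q) · (t(q)/q)^{-j}
CoverTpow : ℕ → Laurent
CoverTpow j = shiftDown j (mul C (inv (pow tOverQ j)))

Λ : ℕ → Laurent → Laurent
Λ p f n = f (n * + p)

F : ℕ → ℕ → Laurent
F p r n = Λ p (CoverTpow (r ℕ.* p)) n ℤ.- CoverTpow r n

{-# OPTIONS --safe #-}
module Submission where

-- Put w = θt/t (θ = q d/dq), B = C/w, V : q ↦ q^p and M_j = B · V(t^j/B) · t^{-pj}, so that M_{j+1} M_{j-1} = M_j².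
-- Bol's identity expresses θ⁴(t^{-n}/B) through C t^{-n}, C t^{1-n}, C t^{2-n}.  Modulo p⁴ it turns U_p(C t^{-(pr+i)}),
-- 0 ≤ i < p, into a multiple u_{r,i} of U_p(C t^{-pr}), and then the coefficient of t^{pl+i} in M_j is
-- u_{j+l,i} D(j+l,l), where D(r,l) is the coefficient of t^l in U_p(C t^{-pr}) t^r/C.  The claim is D(r,l) ≡ 0 for l ≥ 1.
--
-- Modulo p this is the Frobenius congruence.  If D = p^a δ for l ≥ 1, compare M_{j+1} M_{j-1} = M_j² modulo p^{a+1}:
-- with g the truncation of B (as a series in t) at degree p and ε the second difference of δ in r, g² V(ε) has no terms
-- of degree ≥ 2p-1.  Unless ε ≡ 0, this makes g² a polynomial times (1 + νt)^p, hence of order e ≥ p/2 at t = -1/ν; but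
-- g inherits a differential equation from B (B^{1/3} is hypergeometric) which forces e ∈ {0,1,3} modulo p.  For p = 5 the
-- exponent e = 3 is excluded by computing one coefficient modulo 625.  So δ is linear in r; it vanishes for r = 0 and
-- r = -1, where U_p acts on the Eisenstein series C and Ct, and therefore vanishes identically.

open import Defs
open import Level as Universe using (0ℓ)
open import Data.Nat as ℕ using (ℕ; zero; suc; _∸_; _≤_; _<_; z≤n; s≤s; _^_)
import Data.Nat.Properties as ℕP
open import Data.Nat.Solver using () renaming (module +-*-Solver to ℕS)
open import Data.Nat.DivMod as DM using (_/_; _%_)
open import Data.Nat.Divisibility as ℕD using (_∣?_) renaming (_∣_ to _∣ₙ_)
open import Data.Nat.Primality as Pr using (Prime)
open import Data.Nat.Combinatorics using (nCk≡n!/k![n-k]!; k![n∸k]!∣n!; nCn≡1) renaming (_C_ to infixl 7 _choose_)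
open import Data.Fin as Fin using (Fin; toℕ)
import Data.Fin.Properties as FinP
open import Data.Integer as ℤ using (ℤ; +_; -[1+_]; _+_; _*_; -_; _-_)
import Data.Integer.Properties as ℤP
open import Data.Integer.Divisibility using (_∣_)
open import Data.Integer.Divisibility.Signed as Div using (divides; ∣ᵤ⇒∣; ∣⇒∣ᵤ) renaming (_∣_ to _∣ˢ_)
open import Data.Integer.Solver using () renaming (module +-*-Solver to ℤS)
open import Data.Integer.Tactic.RingSolver as RingSolver using (solve-∀)
open import Data.List using (List; []; _∷_; _++_; length; map; upTo)
import Data.List.Properties as LP
open import Data.Vec as Vec using (Vec)
open import Data.Maybe using (Maybe; just; nothing)
open import Data.Product using (Σ; _×_; _,_; proj₁; proj₂)
open import Data.Sum using (_⊎_; inj₁; inj₂)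
open import Data.Empty using (⊥-elim)
open import Function using (_∘_)
open import Relation.Nullary using (¬_; Dec; yes; no)
open import Relation.Binary using (IsEquivalence)
open import Relation.Binary.PropositionalEquality using (_≡_; refl; sym; trans; cong; cong₂; subst; _≢_; isEquivalence; module ≡-Reasoning)
open import Algebra.Bundles using (CommutativeRing)
open import Algebra.Structures using (IsCommutativeRing)
import Algebra.Properties.CommutativeSemiring.Binomial as Binomial
import Algebra.Properties.Semiring.Exp as Exp
import Algebra.Properties.Monoid.Mult as Mult
import Algebra.Properties.Monoid.Sum as MSum
import Algebra.Solver.Ring
open import Algebra.Solver.Ring.AlmostCommutativeRing using (fromCommutativeRing; _-Raw-AlmostCommutative⟶_)

-- Finite sums

-- The modular input is seven convolution identities between divisor sums, proved by Liouville's
-- elementary method. They show that a (with a² = w), c = tB and the quasimodular series y generate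
-- a ring closed under θ, and that C = wB. Since C has weight 5, Bol's identity starts in weight -3
-- and takes four derivatives; four applications of q d/dq to q^(k - n) produce the factor (k - n)⁴,
-- and this is the source of p⁴. The obstacle is that the resulting recurrence compares only the
-- residues i belonging to one r and says nothing about U_p(C t^(-pr)) itself. The M_j form a
-- geometric progression in j, and this is the relation that links different r. Being quadratic, it
-- controls only second differences in r; the two eigenfunctions C and Ct supply exactly the two
-- values that a linear function of r needs. Since Ct belongs to r = -1, and the induction goes both
-- ways from there, r runs through the integers.

sum-cong : ∀ n {f g : ℕ → ℤ} → (∀ k → k < n → f k ≡ g k) → sumℤ n f ≡ sumℤ n g
sum-cong zero    h = refl
sum-cong (suc n) h = cong₂ _+_ (sum-cong n (λ k k<n → h k (ℕP.m<n⇒m<1+n k<n))) (h n ℕP.≤-refl)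

sum-cong′ : ∀ n {f g : ℕ → ℤ} → (∀ k → f k ≡ g k) → sumℤ n f ≡ sumℤ n g
sum-cong′ n h = sum-cong n (λ k _ → h k)

sum-zero : ∀ n {f : ℕ → ℤ} → (∀ k → k < n → f k ≡ + 0) → sumℤ n f ≡ + 0
sum-zero zero    h = refl
sum-zero (suc n) h = cong₂ _+_ (sum-zero n (λ k k<n → h k (ℕP.m<n⇒m<1+n k<n))) (h n ℕP.≤-refl)

sum-+ : ∀ n (f g : ℕ → ℤ) → sumℤ n (λ k → f k + g k) ≡ sumℤ n f + sumℤ n g
sum-+ zero    f g = refl
sum-+ (suc n) f g = trans (cong (_+ (f n + g n)) (sum-+ n f g))
  (solve 4 (λ a b c d → (a :+ b) :+ (c :+ d) := (a :+ c) :+ (b :+ d)) refl (sumℤ n f) (sumℤ n g) (f n) (g n))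
  where open ℤS

sum-*ˡ : ∀ n c (f : ℕ → ℤ) → sumℤ n (λ k → c * f k) ≡ c * sumℤ n f
sum-*ˡ zero    c f = sym (ℤP.*-zeroʳ c)
sum-*ˡ (suc n) c f = trans (cong (_+ c * f n) (sum-*ˡ n c f)) (sym (ℤP.*-distribˡ-+ c _ _))

sum-*ʳ : ∀ n c (f : ℕ → ℤ) → sumℤ n (λ k → f k * c) ≡ sumℤ n f * c
sum-*ʳ n c f = trans (sum-cong′ n (λ k → ℤP.*-comm (f k) c)) (trans (sum-*ˡ n c f) (ℤP.*-comm c _))

sum-neg : ∀ n (f : ℕ → ℤ) → sumℤ n (λ k → - f k) ≡ - sumℤ n f
sum-neg zero    f = refl
sum-neg (suc n) f = trans (cong (_+ - f n) (sum-neg n f)) (sym (ℤP.neg-distrib-+ (sumℤ n f) (f n)))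

sum-head : ∀ n (f : ℕ → ℤ) → sumℤ (suc n) f ≡ f 0 + sumℤ n (f ∘ suc)
sum-head zero    f = ℤP.+-comm (+ 0) (f 0)
sum-head (suc n) f = trans (cong (_+ f (suc n)) (sum-head n f)) (ℤP.+-assoc (f 0) _ _)

sum-split : ∀ m n (f : ℕ → ℤ) → sumℤ (m ℕ.+ n) f ≡ sumℤ m f + sumℤ n (λ k → f (m ℕ.+ k))
sum-split m zero    f = trans (cong (λ z → sumℤ z f) (ℕP.+-identityʳ m)) (sym (ℤP.+-identityʳ _))
sum-split m (suc n) f = trans (cong (λ z → sumℤ z f) (ℕP.+-suc m n))
  (trans (cong (_+ f (m ℕ.+ n)) (sum-split m n f)) (ℤP.+-assoc (sumℤ m f) _ _))

sum-extend : ∀ {m n} (f : ℕ → ℤ) → m ≤ n → (∀ k → m ≤ k → f k ≡ + 0) → sumℤ n f ≡ sumℤ m f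
sum-extend {m} {n} f m≤n h = trans (cong (λ z → sumℤ z f) (sym (ℕP.m+[n∸m]≡n m≤n)))
  (trans (sum-split m (n ∸ m) f)
  (trans (cong (_+_ (sumℤ m f)) (sum-zero (n ∸ m) (λ k _ → h (m ℕ.+ k) (ℕP.m≤m+n m k)))) (ℤP.+-identityʳ _)))

sum-swap : ∀ m n (f : ℕ → ℕ → ℤ) →
  sumℤ m (λ i → sumℤ n (λ j → f i j)) ≡ sumℤ n (λ j → sumℤ m (λ i → f i j))
sum-swap zero    n f = sym (sum-zero n (λ _ _ → refl))
sum-swap (suc m) n f = trans (cong (_+ sumℤ n (f m)) (sum-swap m n f))
  (sym (sum-+ n (λ j → sumℤ m (λ i → f i j)) (f m)))

-- Power series; products are analysed through f = f₀ + q · sh f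

sh : Series → Series
sh f n = f (suc n)

infix 4 _≐_
_≐_ : Series → Series → Set
f ≐ g = ∀ n → f n ≡ g n

infixl 6 _⊕ₚ_
_⊕ₚ_ : Series → Series → Series
(f ⊕ₚ g) n = f n + g n

const : ℤ → Series
const c zero    = c
const c (suc n) = + 0

scale : ℤ → Series → Series
scale c f n = c * f n

Xs : Series → Series
Xs f zero    = + 0
Xs f (suc n) = f n

mul-cong≐ : ∀ {f f′ g g′} → f ≐ f′ → g ≐ g′ → mul f g ≐ mul f′ g′
mul-cong≐ p q n = sum-cong′ (suc n) (λ k → cong₂ _*_ (p k) (q (n ∸ k)))

mul-local : ∀ n {f f′ g g′ : Series} → (∀ k → k ≤ n → f k ≡ f′ k) → (∀ k → k ≤ n → g k ≡ g′ k) →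
  mul f g n ≡ mul f′ g′ n
mul-local n p q = sum-cong (suc n) (λ { k (s≤s k≤n) → cong₂ _*_ (p k k≤n) (q (n ∸ k) (ℕP.m∸n≤m n k)) })

mul-zero : ∀ f g → mul f g 0 ≡ f 0 * g 0
mul-zero f g = ℤP.+-identityˡ _

mul-suc : ∀ f g n → mul f g (suc n) ≡ f 0 * g (suc n) + mul (sh f) g n
mul-suc f g n = sum-head (suc n) _

mul-sucʳ : ∀ f g n → mul f g (suc n) ≡ mul f (sh g) n + f (suc n) * g 0
mul-sucʳ f g n = cong₂ _+_
  (sum-cong (suc n) (λ { k (s≤s k≤n) → cong (λ z → f k * g z) (ℕP.+-∸-assoc 1 k≤n) }))
  (cong (λ z → f (suc n) * g z) (ℕP.n∸n≡0 (suc n)))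

mul-comm : ∀ f g → mul f g ≐ mul g f
mul-comm f g zero    = trans (mul-zero f g) (trans (ℤP.*-comm (f 0) (g 0)) (sym (mul-zero g f)))
mul-comm f g (suc n) = trans (mul-suc f g n) (trans (ℤP.+-comm (f 0 * g (suc n)) _)
  (trans (cong₂ _+_ (mul-comm (sh f) g n) (ℤP.*-comm (f 0) (g (suc n)))) (sym (mul-sucʳ g f n))))

mul-distribˡ : ∀ f g h → mul f (g ⊕ₚ h) ≐ (mul f g ⊕ₚ mul f h)
mul-distribˡ f g h n = trans (sum-cong′ (suc n) (λ k → ℤP.*-distribˡ-+ (f k) (g (n ∸ k)) (h (n ∸ k)))) (sum-+ (suc n) _ _)

mul-distribʳ : ∀ f g h → mul (g ⊕ₚ h) f ≐ (mul g f ⊕ₚ mul h f)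
mul-distribʳ f g h n = trans (mul-comm (g ⊕ₚ h) f n) (trans (mul-distribˡ f g h n) (cong₂ _+_ (mul-comm f g n) (mul-comm f h n)))

mul-scaleˡ : ∀ c f g → mul (scale c f) g ≐ scale c (mul f g)
mul-scaleˡ c f g n = trans (sum-cong′ (suc n) (λ k → ℤP.*-assoc c (f k) (g (n ∸ k)))) (sum-*ˡ (suc n) c _)

mul-assoc : ∀ f g h → mul (mul f g) h ≐ mul f (mul g h)
mul-assoc f g h zero = trans (mul-zero (mul f g) h) (trans (cong (_* h 0) (mul-zero f g))
  (trans (ℤP.*-assoc (f 0) (g 0) (h 0)) (sym (trans (mul-zero f (mul g h)) (cong (f 0 *_) (mul-zero g h))))))
mul-assoc f g h (suc n) = begin
  mul (mul f g) h (suc n)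
    ≡⟨ mul-suc (mul f g) h n ⟩
  mul f g 0 * h (suc n) + mul (sh (mul f g)) h n
    ≡⟨ cong₂ _+_ (cong (_* h (suc n)) (mul-zero f g)) (mul-cong≐ {g = h} (λ k → mul-suc f g k) (λ _ → refl) n) ⟩
  f 0 * g 0 * h (suc n) + mul (scale (f 0) (sh g) ⊕ₚ mul (sh f) g) h n
    ≡⟨ cong (λ z → f 0 * g 0 * h (suc n) + z) (trans (mul-distribʳ h (scale (f 0) (sh g)) (mul (sh f) g) n)
         (cong₂ _+_ (mul-scaleˡ (f 0) (sh g) h n) (mul-assoc (sh f) g h n))) ⟩
  f 0 * g 0 * h (suc n) + (f 0 * mul (sh g) h n + mul (sh f) (mul g h) n)
    ≡⟨ solve 5 (λ a b c d e → a :* b :* c :+ (a :* d :+ e) := a :* (b :* c :+ d) :+ e) refl (f 0) (g 0) (h (suc n)) (mul (sh g) h n) (mul (sh f) (mul g h) n) ⟩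
  f 0 * (g 0 * h (suc n) + mul (sh g) h n) + mul (sh f) (mul g h) n
    ≡⟨ cong (λ z → f 0 * z + mul (sh f) (mul g h) n) (sym (mul-suc g h n)) ⟩
  f 0 * mul g h (suc n) + mul (sh f) (mul g h) n
    ≡⟨ sym (mul-suc f (mul g h) n) ⟩
  mul f (mul g h) (suc n) ∎
  where open ≡-Reasoning
        open ℤS using (solve; _:+_; _:*_; _:=_)

mul-const : ∀ c f → mul (const c) f ≐ scale c f
mul-const c f zero    = mul-zero (const c) f
mul-const c f (suc n) = trans (mul-suc (const c) f n)
  (trans (cong (_+_ (c * f (suc n))) (sum-zero (suc n) (λ _ _ → refl))) (ℤP.+-identityʳ _))

one≐ : one ≐ const (+ 1)
one≐ zero    = refl
one≐ (suc n) = refl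

mul-one : ∀ f → mul one f ≐ f
mul-one f n = trans (mul-cong≐ {g = f} one≐ (λ _ → refl) n) (trans (mul-const (+ 1) f n) (ℤP.*-identityˡ (f n)))

mul-Xs : ∀ f g → mul (Xs f) g ≐ Xs (mul f g)
mul-Xs f g zero    = mul-zero (Xs f) g
mul-Xs f g (suc n) = trans (mul-suc (Xs f) g n) (ℤP.+-identityˡ _)

split : ∀ f → f ≐ (const (f 0) ⊕ₚ Xs (sh f))
split f zero    = sym (ℤP.+-identityʳ _)
split f (suc n) = sym (ℤP.+-identityˡ _)

-- Congruences of integers and the ring of power series over ℤ/N

opaque

  infixl 6 _⊕_
  infixl 7 _⊙_
  -- Sealed copies of the sum and the product: goals keep the shape of ring terms, and conversion
  -- does not unfold products into convolution sums.
  _⊕_ _⊙_ : Series → Series → Series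
  _⊕_ = _⊕ₚ_
  _⊙_ = mul

  neg : Series → Series
  neg f n = - f n

  ⊕-at : ∀ f g n → (f ⊕ g) n ≡ f n + g n
  ⊕-at f g n = refl

  neg-at : ∀ f n → neg f n ≡ - f n
  neg-at f n = refl

  ⊙-at : ∀ f g n → (f ⊙ g) n ≡ mul f g n
  ⊙-at f g n = refl

infixl 6 _⊖_
_⊖_ : Series → Series → Series
f ⊖ g = f ⊕ neg g

⊖-at : ∀ f g n → (f ⊖ g) n ≡ f n - g n
⊖-at f g n = trans (⊕-at f (neg g) n) (cong (_+_ (f n)) (neg-at g n))

-- Equality and congruence modulo N are treated at once: for each instance, `SeriesOver` yields a
-- commutative ring of power series together with its ring solver.
record Congruence : Set₁ where
  infix 4 _∼_
  field
    _∼_     : ℤ → ℤ → Set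
    ∼-equiv : IsEquivalence _∼_
    ∼-+     : ∀ {a b c d} → a ∼ b → c ∼ d → (a + c) ∼ (b + d)
    ∼-*     : ∀ {a b c d} → a ∼ b → c ∼ d → (a * c) ∼ (b * d)
    ∼-neg   : ∀ {a b} → a ∼ b → (- a) ∼ (- b)

module SeriesOver (congruence : Congruence) where

  open Congruence congruence
  private module Eq = IsEquivalence ∼-equiv

  infix 4 _≈_
  record _≈_ (f g : Series) : Set where
    constructor pw
    field at : ∀ n → f n ∼ g n
  open _≈_ public

  ≐⇒≈ : ∀ {f g} → f ≐ g → f ≈ g
  ≐⇒≈ h = pw (λ n → Eq.reflexive (h n))

  sum-∼ : ∀ n {f g : ℕ → ℤ} → (∀ k → k < n → f k ∼ g k) → sumℤ n f ∼ sumℤ n g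
  sum-∼ zero    h = Eq.refl
  sum-∼ (suc n) h = ∼-+ (sum-∼ n (λ k k<n → h k (ℕP.m<n⇒m<1+n k<n))) (h n ℕP.≤-refl)

  mul-cong : ∀ {f f′ g g′} → f ≈ f′ → g ≈ g′ → mul f g ≈ mul f′ g′
  mul-cong p q = pw (λ n → sum-∼ (suc n) (λ k _ → ∼-* (at p k) (at q (n ∸ k))))

  opaque
   unfolding _⊕_ _⊙_ neg
   isCommutativeRing : IsCommutativeRing _≈_ _⊕_ _⊙_ neg (const (+ 0)) one
   isCommutativeRing = record
     { isRing = record
       { +-isAbelianGroup = record
         { isGroup = record
           { isMonoid = record
             { isSemigroup = record
               { isMagma = record
                 { isEquivalence = record
                   { refl = pw (λ n → Eq.refl) ; sym = λ h → pw (λ n → Eq.sym (at h n)) ; trans = λ h k → pw (λ n → Eq.trans (at h n) (at k n)) }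
                 ; ∙-cong = λ h k → pw (λ n → ∼-+ (at h n) (at k n)) }
               ; assoc = λ f g h → pw (λ n → Eq.reflexive (ℤP.+-assoc (f n) (g n) (h n))) }
             ; identity = (λ f → pw (λ n → Eq.reflexive (zˡ f n))) , (λ f → pw (λ n → Eq.reflexive (trans (ℤP.+-comm (f n) (const (+ 0) n)) (zˡ f n)))) }
           ; inverse = (λ f → pw (λ n → Eq.reflexive (trans (ℤP.+-inverseˡ (f n)) (sym (c0 n))))) , (λ f → pw (λ n → Eq.reflexive (trans (ℤP.+-inverseʳ (f n)) (sym (c0 n)))))
           ; ⁻¹-cong = λ h → pw (λ n → ∼-neg (at h n)) }
         ; comm = λ f g → pw (λ n → Eq.reflexive (ℤP.+-comm (f n) (g n))) }
       ; *-cong = mul-cong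
       ; *-assoc = λ f g h → ≐⇒≈ (mul-assoc f g h)
       ; *-identity = (λ f → ≐⇒≈ (mul-one f)) , (λ f → ≐⇒≈ (λ n → trans (mul-comm f one n) (mul-one f n)))
       ; distrib = (λ f g h → ≐⇒≈ (mul-distribˡ f g h)) , (λ f g h → ≐⇒≈ (mul-distribʳ f g h))
       }
     ; *-comm = λ f g → ≐⇒≈ (mul-comm f g) }
     where
     c0 : ∀ (n : ℕ) → const (+ 0) n ≡ + 0
     c0 zero    = refl
     c0 (suc n) = refl
     zˡ : ∀ (f : Series) (n : ℕ) → const (+ 0) n + f n ≡ f n
     zˡ f n = trans (cong (_+ f n) (c0 n)) (ℤP.+-identityˡ (f n))

  ring : CommutativeRing 0ℓ 0ℓ
  ring = record { isCommutativeRing = isCommutativeRing }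

  opaque
    unfolding _⊕_ _⊙_ neg
    const-+ : ∀ a b → const (a + b) ≈ const a ⊕ const b
    const-+ a b = ≐⇒≈ (λ { zero → refl ; (suc n) → refl })

    const-* : ∀ a b → const (a * b) ≈ const a ⊙ const b
    const-* a b = ≐⇒≈ (λ n → trans (h a b n) (sym (mul-const a (const b) n)))
      where
      h : ∀ (a b : ℤ) → const (a * b) ≐ scale a (const b)
      h a b zero    = refl
      h a b (suc n) = sym (ℤP.*-zeroʳ a)

    const-neg : ∀ a → const (- a) ≈ neg (const a)
    const-neg a = ≐⇒≈ (λ { zero → refl ; (suc n) → refl })

  morphism : CommutativeRing.rawRing ℤP.+-*-commutativeRing -Raw-AlmostCommutative⟶ fromCommutativeRing ring
  morphism = record
    { ⟦_⟧ = const
    ; +-homo = const-+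
    ; *-homo = const-*
    ; -‿homo = const-neg
    ; 0-homo = ≐⇒≈ (λ n → refl)
    ; 1-homo = ≐⇒≈ (λ n → sym (one≐ n)) }

  private
    coeff≟ : ∀ (a b : ℤ) → Maybe (const a ≈ const b)
    coeff≟ a b with a ℤP.≟ b
    ... | yes refl = just (pw (λ n → Eq.refl))
    ... | no _ = nothing

  module Solver = Algebra.Solver.Ring (CommutativeRing.rawRing ℤP.+-*-commutativeRing)
    (fromCommutativeRing ring) morphism coeff≟

  open CommutativeRing ring public
    using (setoid; +-cong; *-cong; -‿cong)
    renaming (refl to ≈-refl; sym to ≈-sym; trans to ≈-trans; reflexive to ≈-reflexive)

equality : Congruence
equality = record { _∼_ = _≡_ ; ∼-equiv = isEquivalence ; ∼-+ = cong₂ _+_ ; ∼-* = cong₂ _*_ ; ∼-neg = cong (λ z → - z) }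

module Exact = SeriesOver equality

infix 4 _≡_⟨mod_⟩
-- A record and not an abbreviation: from the bare divisibility of `a - b`, unification could not
-- recover a and b.
record _≡_⟨mod_⟩ (a b : ℤ) (N : ℕ) : Set where
  constructor mod
  field divides-difference : + N ∣ˢ a - b
open _≡_⟨mod_⟩ public

module _ {N : ℕ} where

  ≡ₘ-refl : ∀ {a} → a ≡ a ⟨mod N ⟩
  ≡ₘ-refl {a} = mod (divides (+ 0) (ℤP.+-inverseʳ a))

  ≡ₘ-reflexive : ∀ {a b} → a ≡ b → a ≡ b ⟨mod N ⟩
  ≡ₘ-reflexive refl = ≡ₘ-refl

  ≡ₘ-sym : ∀ {a b} → a ≡ b ⟨mod N ⟩ → b ≡ a ⟨mod N ⟩
  ≡ₘ-sym {a} {b} (mod (divides q e)) = mod (divides (- q) (trans (solve 2 (λ a b → b :- a := :- (a :- b)) refl a b)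
    (trans (cong (λ z → - z) e) (ℤP.neg-distribˡ-* q (+ N)))))
    where open ℤS

  ≡ₘ-trans : ∀ {a b c} → a ≡ b ⟨mod N ⟩ → b ≡ c ⟨mod N ⟩ → a ≡ c ⟨mod N ⟩
  ≡ₘ-trans {a} {b} {c} (mod (divides q e)) (mod (divides r f)) = mod (divides (q + r)
    (trans (solve 3 (λ a b c → a :- c := (a :- b) :+ (b :- c)) refl a b c)
    (trans (cong₂ _+_ e f) (sym (ℤP.*-distribʳ-+ (+ N) q r)))))
    where open ℤS

  ≡ₘ-equiv : IsEquivalence (_≡_⟨mod N ⟩)
  ≡ₘ-equiv = record { refl = ≡ₘ-refl ; sym = ≡ₘ-sym ; trans = ≡ₘ-trans }

  ≡ₘ-+ : ∀ {a b c d} → a ≡ b ⟨mod N ⟩ → c ≡ d ⟨mod N ⟩ → a + c ≡ b + d ⟨mod N ⟩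
  ≡ₘ-+ {a} {b} {c} {d} (mod (divides q e)) (mod (divides r f)) = mod (divides (q + r)
    (trans (solve 4 (λ a b c d → (a :+ c) :- (b :+ d) := (a :- b) :+ (c :- d)) refl a b c d)
    (trans (cong₂ _+_ e f) (sym (ℤP.*-distribʳ-+ (+ N) q r)))))
    where open ℤS

  ≡ₘ-* : ∀ {a b c d} → a ≡ b ⟨mod N ⟩ → c ≡ d ⟨mod N ⟩ → a * c ≡ b * d ⟨mod N ⟩
  ≡ₘ-* {a} {b} {c} {d} (mod (divides q e)) (mod (divides r f)) = mod (divides (q * c + b * r)
    (trans (solve 4 (λ a b c d → (a :* c) :- (b :* d) := (a :- b) :* c :+ b :* (c :- d)) refl a b c d)
    (trans (cong₂ (λ x y → x * c + b * y) e f)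
    (solve 5 (λ q c b r n → q :* n :* c :+ b :* (r :* n) := (q :* c :+ b :* r) :* n) refl q c b r (+ N)))))
    where open ℤS

  ≡ₘ-neg : ∀ {a b} → a ≡ b ⟨mod N ⟩ → - a ≡ - b ⟨mod N ⟩
  ≡ₘ-neg {a} {b} (mod (divides q e)) = mod (divides (- q) (trans (sym (ℤP.neg-distrib-+ a (- b)))
    (trans (cong (λ z → - z) e) (ℤP.neg-distribˡ-* q (+ N)))))

modulo : ℕ → Congruence
modulo N = record { _∼_ = _≡_⟨mod N ⟩ ; ∼-equiv = ≡ₘ-equiv ; ∼-+ = ≡ₘ-+ ; ∼-* = ≡ₘ-* ; ∼-neg = ≡ₘ-neg }

module Mod (N : ℕ) = SeriesOver (modulo N)

-- Double sums over pairs of positive integers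

sum₂-+ : ∀ m n (f g : ℕ → ℕ → ℤ) →
  sumℤ m (λ a → sumℤ n (λ b → f a b + g a b)) ≡ sumℤ m (λ a → sumℤ n (f a)) + sumℤ m (λ a → sumℤ n (g a))
sum₂-+ m n f g = trans (sum-cong′ m (λ a → sum-+ n (f a) (g a))) (sum-+ m _ _)

sum-square : ∀ N (φ : ℕ → ℕ → ℤ) → sumℤ N (λ a → sumℤ N (φ a)) ≡
  sumℤ N (λ k → sumℤ k (λ i → φ i k)) + sumℤ N (λ k → sumℤ k (λ i → φ k i)) + sumℤ N (λ k → φ k k)
sum-square zero    φ = refl
sum-square (suc N) φ = trans (cong (_+ (sumℤ N (φ N) + φ N N))
    (trans (sum-+ N (λ a → sumℤ N (φ a)) (λ a → φ a N)) (cong (_+ sumℤ N (λ a → φ a N)) (sum-square N φ))))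
  (solve 6 (λ u v w x y z → (((u :+ v) :+ w) :+ x) :+ (y :+ z) := ((u :+ x) :+ (v :+ y)) :+ (w :+ z)) refl
    (sumℤ N (λ k → sumℤ k (λ i → φ i k))) (sumℤ N (λ k → sumℤ k (λ i → φ k i))) (sumℤ N (λ k → φ k k))
    (sumℤ N (λ a → φ a N)) (sumℤ N (φ N)) (φ N N))
  where open ℤS using (solve; _:+_; _:=_)

-- Pairs (a, b) are traded for pairs a < k by k = a + b + 1. The square also produces values k ≥ N,
-- and the vanishing hypothesis removes them.
sum-upper : ∀ N (φ : ℕ → ℕ → ℤ) → (∀ a k → N ≤ k → φ a k ≡ + 0) →
  sumℤ N (λ a → sumℤ N (λ b → φ a (suc (a ℕ.+ b)))) ≡ sumℤ N (λ k → sumℤ k (λ i → φ i k))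
sum-upper zero    φ h = refl
sum-upper (suc N) φ h = begin
  sumℤ (suc N) (λ a → sumℤ (suc N) (λ b → φ a (suc (a ℕ.+ b))))
    ≡⟨ sum-head N _ ⟩
  (sumℤ N (λ b → φ 0 (suc b)) + φ 0 (suc N)) + sumℤ N (λ a → sumℤ N (λ b → φ (suc a) (suc (suc a ℕ.+ b))) + φ (suc a) (suc (suc a ℕ.+ N)))
    ≡⟨ cong₂ _+_ (trans (cong (_+_ (sumℤ N (λ b → φ 0 (suc b)))) (h 0 (suc N) ℕP.≤-refl)) (ℤP.+-identityʳ (sumℤ N (λ b → φ 0 (suc b)))))
         (sum-cong′ N (λ a → trans (cong (_+_ (sumℤ N (λ b → φ (suc a) (suc (suc a ℕ.+ b))))) (h (suc a) (suc (suc a ℕ.+ N)) (s≤s (ℕP.m≤n⇒m≤1+n (ℕP.m≤n+m N a))))) (ℤP.+-identityʳ (sumℤ N (λ b → φ (suc a) (suc (suc a ℕ.+ b))))))) ⟩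
  sumℤ N (λ b → φ 0 (suc b)) + sumℤ N (λ a → sumℤ N (λ b → φ (suc a) (suc (suc a ℕ.+ b))))
    ≡⟨ cong (_+_ (sumℤ N (λ b → φ 0 (suc b)))) (sum-upper N (λ a k → φ (suc a) (suc k)) (λ a k le → h (suc a) (suc k) (s≤s le))) ⟩
  sumℤ N (λ b → φ 0 (suc b)) + sumℤ N (λ k → sumℤ k (λ i → φ (suc i) (suc k)))
    ≡⟨ sym (sum-+ N _ _) ⟩
  sumℤ N (λ k → φ 0 (suc k) + sumℤ k (λ i → φ (suc i) (suc k)))
    ≡⟨ sum-cong′ N (λ k → sym (sum-head k (λ i → φ i (suc k)))) ⟩
  sumℤ N (λ k → sumℤ (suc k) (λ i → φ i (suc k)))
    ≡⟨ sym (trans (sum-head N (λ k → sumℤ k (λ i → φ i k))) (ℤP.+-identityˡ _)) ⟩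
  sumℤ (suc N) (λ k → sumℤ k (λ i → φ i k)) ∎
  where open ≡-Reasoning

sum-shear : ∀ N (φ : ℕ → ℕ → ℤ) → (∀ a b → N ≤ a → φ a b ≡ + 0) → (∀ a b → N ≤ b → φ a b ≡ + 0) →
  sumℤ N (λ a → sumℤ N (φ a)) ≡
  sumℤ N (λ a → sumℤ N (λ b → φ a (suc (a ℕ.+ b)))) + sumℤ N (λ a → sumℤ N (λ b → φ (suc (a ℕ.+ b)) b)) + sumℤ N (λ k → φ k k)
sum-shear N φ h₁ h₂ = trans (sum-square N φ) (cong₂ _+_ (cong₂ _+_ (sym (sum-upper N φ h₂))
  (sym (trans (sum-swap N N (λ a b → φ (suc (a ℕ.+ b)) b))
    (trans (sum-cong′ N (λ b → sum-cong′ N (λ a → cong (λ z → φ (suc z) b) (ℕP.+-comm a b))))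
      (sum-upper N (λ a b → φ b a) (λ a k le → h₁ k a le)))))) refl)

δ : ℕ → ℕ → ℤ
δ zero    zero    = + 1
δ zero    (suc n) = + 0
δ (suc m) zero    = + 0
δ (suc m) (suc n) = δ m n

δ-≢ : ∀ m n → m ≢ n → δ m n ≡ + 0
δ-≢ zero    zero    h = ⊥-elim (h refl)
δ-≢ zero    (suc n) h = refl
δ-≢ (suc m) zero    h = refl
δ-≢ (suc m) (suc n) h = δ-≢ m n (h ∘ cong suc)

δ-refl : ∀ n → δ n n ≡ + 1
δ-refl zero    = refl
δ-refl (suc n) = δ-refl n

δ-> : ∀ {m n} → n < m → δ m n ≡ + 0
δ-> {m} {n} h = δ-≢ m n (λ e → ℕP.<⇒≢ h (sym e))

δ-subst : ∀ m n (f : ℕ → ℤ) → f m * δ m n ≡ f n * δ m n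
δ-subst m n f with m ℕ.≟ n
... | yes refl = refl
... | no h = trans (cong (f m *_) (δ-≢ m n h)) (trans (ℤP.*-zeroʳ (f m)) (sym (trans (cong (f n *_) (δ-≢ m n h)) (ℤP.*-zeroʳ (f n)))))

*0ʳ : ∀ x {y} → y ≡ + 0 → x * y ≡ + 0
*0ʳ x refl = ℤP.*-zeroʳ x

δ-conv : ∀ x y n → sumℤ (suc n) (λ k → δ x k * δ y (n ∸ k)) ≡ δ (x ℕ.+ y) n
δ-conv zero    y n       = trans (sum-head n _) (trans (cong₂ _+_ (ℤP.*-identityˡ (δ y n)) (sum-zero n (λ _ _ → refl))) (ℤP.+-identityʳ _))
δ-conv (suc x) y zero    = refl
δ-conv (suc x) y (suc n) = trans (sum-head (suc n) (λ k → δ (suc x) k * δ y (suc n ∸ k))) (trans (ℤP.+-identityˡ _) (δ-conv x y n))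

-- The Lambert series with f(m, d) at q^(md). Indices count from zero, so `suc a` is m and `suc i`
-- is d; the bound n suffices because md = n forces m, d ≤ n.
Lam : (ℕ → ℕ → ℤ) → Series
Lam f n = sumℤ n (λ i → sumℤ n (λ a → f (suc a) (suc i) * δ (suc a ℕ.* suc i) n))

-- Summation over m₁d₁ + m₂d₂ = n; the arguments of Φ come in the order m₁, d₁, m₂, d₂.
pairSum : ℕ → (ℕ → ℕ → ℕ → ℕ → ℤ) → ℤ
pairSum n Φ = sumℤ n (λ i → sumℤ n (λ j → sumℤ n (λ a → sumℤ n (λ b →
  Φ (suc a) (suc i) (suc b) (suc j) * δ (suc a ℕ.* suc i ℕ.+ suc b ℕ.* suc j) n))))

Lam-cong : ∀ (f g : ℕ → ℕ → ℤ) → (∀ m d → f (suc m) (suc d) ≡ g (suc m) (suc d)) → Lam f ≐ Lam g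
Lam-cong f g h n = sum-cong′ n (λ i → sum-cong′ n (λ a → cong (_* δ (suc a ℕ.* suc i) n) (h a i)))

Lam-+ : ∀ f g → Lam (λ m d → f m d + g m d) ≐ (Lam f ⊕ₚ Lam g)
Lam-+ f g n = trans (sum-cong′ n (λ i → sum-cong′ n (λ a → ℤP.*-distribʳ-+ (δ (suc a ℕ.* suc i) n) (f (suc a) (suc i)) (g (suc a) (suc i))))) (sum₂-+ n n _ _)

Lam-scale : ∀ c f → Lam (λ m d → c * f m d) ≐ scale c (Lam f)
Lam-scale c f n = trans (sum-cong′ n (λ i → trans (sum-cong′ n (λ a → ℤP.*-assoc c (f (suc a) (suc i)) _)) (sum-*ˡ n c _))) (sum-*ˡ n c _)

Lam-swap : ∀ f → Lam f ≐ Lam (λ m d → f d m)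
Lam-swap f n = trans (sum-swap n n _) (sum-cong′ n (λ a → sum-cong′ n (λ i → cong (λ z → f (suc a) (suc i) * δ z n) (ℕP.*-comm (suc a) (suc i)))))

Lam-extend : ∀ f {k n} → k ≤ n → Lam f k ≡ sumℤ n (λ i → sumℤ n (λ a → f (suc a) (suc i) * δ (suc a ℕ.* suc i) k))
Lam-extend f {k} {n} k≤n = sym (trans
  (sum-extend _ k≤n (λ i k≤i → sum-zero n (λ a _ → *0ʳ (f (suc a) (suc i)) (δ-> (ℕP.≤-trans (s≤s k≤i) (ℕP.m≤n*m (suc i) (suc a)))))))
  (sum-cong′ k (λ i → sum-extend _ k≤n (λ a k≤a → *0ʳ (f (suc a) (suc i)) (δ-> (ℕP.≤-trans (s≤s k≤a) (ℕP.m≤m*n (suc a) (suc i))))))))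

pairSum-+ : ∀ n Φ Ψ → pairSum n (λ m i k j → Φ m i k j + Ψ m i k j) ≡ pairSum n Φ + pairSum n Ψ
pairSum-+ n Φ Ψ = trans (sum-cong′ n (λ i → trans (sum-cong′ n (λ j → trans (sum-cong′ n (λ a → trans (sum-cong′ n (λ b →
   ℤP.*-distribʳ-+ _ (Φ (suc a) (suc i) (suc b) (suc j)) (Ψ (suc a) (suc i) (suc b) (suc j)))) (sum-+ n _ _))) (sum-+ n _ _))) (sum-+ n _ _))) (sum-+ n _ _)

pairSum-scale : ∀ n c Φ → pairSum n (λ m i k j → c * Φ m i k j) ≡ c * pairSum n Φ
pairSum-scale n c Φ = trans (sum-cong′ n (λ i → trans (sum-cong′ n (λ j → trans (sum-cong′ n (λ a → trans (sum-cong′ n (λ b →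
   ℤP.*-assoc c (Φ (suc a) (suc i) (suc b) (suc j)) _)) (sum-*ˡ n c _))) (sum-*ˡ n c _))) (sum-*ˡ n c _))) (sum-*ˡ n c _)

pairSum-cong : ∀ n {Φ Ψ} → (∀ m i k j → Φ m i k j ≡ Ψ m i k j) → pairSum n Φ ≡ pairSum n Ψ
pairSum-cong n h = sum-cong′ n (λ i → sum-cong′ n (λ j → sum-cong′ n (λ a → sum-cong′ n (λ b → cong (_* δ (suc a ℕ.* suc i ℕ.+ suc b ℕ.* suc j) n) (h (suc a) (suc i) (suc b) (suc j))))))

sum-prod : ∀ m n (f g : ℕ → ℤ) → sumℤ m f * sumℤ n g ≡ sumℤ m (λ i → sumℤ n (λ j → f i * g j))
sum-prod m n f g = trans (sym (sum-*ʳ m (sumℤ n g) f)) (sum-cong′ m (λ i → sym (sum-*ˡ n (f i) g)))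

pairSum-product : ∀ f g n → pairSum n (λ m i k j → f m i * g k j) ≡ mul (Lam f) (Lam g) n
pairSum-product f g n = sym (begin
  sumℤ (suc n) (λ k → Lam f k * Lam g (n ∸ k))
    ≡⟨ sum-cong (suc n) (λ { k (s≤s k≤n) → trans (cong₂ _*_ (Lam-extend f k≤n) (Lam-extend g (ℕP.m∸n≤m n k)))
         (trans (sum-prod n n _ _) (sum-cong′ n (λ i → sum-cong′ n (λ j → sum-prod n n _ _)))) }) ⟩
  sumℤ (suc n) (λ k → sumℤ n (λ i → sumℤ n (λ j → sumℤ n (λ a → sumℤ n (λ b →
    (f (suc a) (suc i) * δ (suc a ℕ.* suc i) k) * (g (suc b) (suc j) * δ (suc b ℕ.* suc j) (n ∸ k)))))))
    ≡⟨ trans (sum-swap (suc n) n _) (sum-cong′ n (λ i → trans (sum-swap (suc n) n _) (sum-cong′ n (λ j →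
       trans (sum-swap (suc n) n _) (sum-cong′ n (λ a → trans (sum-swap (suc n) n _) (sum-cong′ n (λ b →
       trans (sum-cong′ (suc n) (λ k → solve 4 (λ x y z w → (x :* y) :* (z :* w) := (x :* z) :* (y :* w)) refl (f (suc a) (suc i)) (δ (suc a ℕ.* suc i) k) (g (suc b) (suc j)) (δ (suc b ℕ.* suc j) (n ∸ k))))
       (trans (sum-*ˡ (suc n) (f (suc a) (suc i) * g (suc b) (suc j)) (λ k → δ (suc a ℕ.* suc i) k * δ (suc b ℕ.* suc j) (n ∸ k))) (cong (_*_ (f (suc a) (suc i) * g (suc b) (suc j))) (δ-conv (suc a ℕ.* suc i) (suc b ℕ.* suc j) n)))))))))))  ⟩
  pairSum n (λ m i k j → f m i * g k j) ∎)
  where open ≡-Reasoning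
        open ℤS using (solve; _:*_; _:=_)

-- The shear (m₁,m₂;d₁,d₂) ↦ (m₁-m₂,m₂;d₁,d₁+d₂) preserves m₁d₁+m₂d₂.  Applied once on the m's and once on
-- the d's it turns the sum of A into the sum of B, up to the diagonal terms m₁ = m₂ and d₁ = d₂.
module _ (A B : ℕ → ℕ → ℕ → ℕ → ℤ)
  (A-sym : ∀ m i k j → A m i k j ≡ A k j m i)
  (B-sym : ∀ m i k j → B m i k j ≡ B k j m i)
  (rot : ∀ m i k j → A (m ℕ.+ k) i k j ≡ B m i k (i ℕ.+ j)) where

  -- For m₁ = m₂ = m the exponent is m(d₁ + d₂), so this diagonal is again a Lambert series, in m
  -- and d = d₁ + d₂. For d₁ = d₂ the roles of m and d are exchanged.
  diagA diagB : ℕ → ℕ → ℤ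
  diagA m d = sumℤ (d ∸ 1) (λ i → A m (suc i) m (d ∸ suc i))
  diagB m d = sumℤ (m ∸ 1) (λ b → B (m ∸ suc b) d (suc b) d)

  private module Level (n : ℕ) where

    tA tB : ℕ → ℕ → ℕ → ℕ → ℤ
    tA a i b j = A (suc a) (suc i) (suc b) (suc j) * δ (suc a ℕ.* suc i ℕ.+ suc b ℕ.* suc j) n
    tB a i b j = B (suc a) (suc i) (suc b) (suc j) * δ (suc a ℕ.* suc i ℕ.+ suc b ℕ.* suc j) n

    big₁ : ∀ x y z → n ≤ x → δ (suc x ℕ.* suc y ℕ.+ z) n ≡ + 0
    big₁ x y z h = δ-> (ℕP.≤-trans (s≤s h) (ℕP.≤-trans (ℕP.m≤m*n (suc x) (suc y)) (ℕP.m≤m+n _ z)))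
    big₁′ : ∀ x y z → n ≤ y → δ (suc x ℕ.* suc y ℕ.+ z) n ≡ + 0
    big₁′ x y z h = δ-> (ℕP.≤-trans (s≤s h) (ℕP.≤-trans (ℕP.m≤n*m (suc y) (suc x)) (ℕP.m≤m+n _ z)))
    big₂ : ∀ x y z → n ≤ x → δ (z ℕ.+ suc x ℕ.* suc y) n ≡ + 0
    big₂ x y z h = trans (cong (λ t → δ t n) (ℕP.+-comm z _)) (big₁ x y z h)
    big₂′ : ∀ x y z → n ≤ y → δ (z ℕ.+ suc x ℕ.* suc y) n ≡ + 0
    big₂′ x y z h = trans (cong (λ t → δ t n) (ℕP.+-comm z _)) (big₁′ x y z h)

    ψ : ℕ → ℕ → ℤ
    ψ i k = sumℤ n (λ a → sumℤ n (λ b → tB a i b k))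

    dA : ℕ → ℕ → ℤ
    dA i j = sumℤ n (λ a → tA a i a j)

    ss : ∀ a b → suc (suc (a ℕ.+ b)) ≡ suc a ℕ.+ suc b
    ss a b = cong suc (sym (ℕP.+-suc a b))

    upper-term : ∀ i j a b → tA (suc (a ℕ.+ b)) i b j ≡ tB a i b (suc (i ℕ.+ j))
    upper-term i j a b = cong₂ _*_
      (trans (cong (λ z → A z (suc i) (suc b) (suc j)) (ss a b))
        (trans (rot (suc a) (suc i) (suc b) (suc j)) (cong (B (suc a) (suc i) (suc b)) (sym (ss i j)))))
      (cong (λ z → δ z n) (solve 4 (λ a b i j → (con 2 :+ (a :+ b)) :* (con 1 :+ i) :+ (con 1 :+ b) :* (con 1 :+ j)
        := (con 1 :+ a) :* (con 1 :+ i) :+ (con 1 :+ b) :* (con 2 :+ (i :+ j))) refl a b i j))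
      where open ℕS

    -- The region m₁ < m₂ is reduced to m₁ > m₂ by the symmetry of `A`; the symmetry of `B` then
    -- restores the order of the two pairs.
    lower-term : ∀ i j a b → tA a i (suc (a ℕ.+ b)) j ≡ tB a (suc (i ℕ.+ j)) b j
    lower-term i j a b = trans (cong₂ _*_ (A-sym (suc a) (suc i) (suc (suc (a ℕ.+ b))) (suc j)) refl)
      (trans (cong (λ z → A (suc (suc z)) (suc j) (suc a) (suc i) * δ (suc a ℕ.* suc i ℕ.+ suc (suc z) ℕ.* suc j) n) (ℕP.+-comm a b))
      (trans (cong (λ z → A (suc (suc (b ℕ.+ a))) (suc j) (suc a) (suc i) * δ z n) (ℕP.+-comm (suc a ℕ.* suc i) _))
      (trans (upper-term j i b a)
      (cong₂ _*_ (trans (B-sym (suc b) (suc j) (suc a) (suc (suc (j ℕ.+ i)))) (cong (λ z → B (suc a) (suc (suc z)) (suc b) (suc j)) (ℕP.+-comm j i)))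
        (cong (λ z → δ z n) (trans (ℕP.+-comm (suc b ℕ.* suc j) _) (cong (λ z → suc a ℕ.* suc (suc z) ℕ.+ suc b ℕ.* suc j) (ℕP.+-comm j i))))))))

    shear-m : ∀ i j → sumℤ n (λ a → sumℤ n (λ b → tA a i b j)) ≡ ψ (suc (i ℕ.+ j)) j + ψ i (suc (i ℕ.+ j)) + dA i j
    shear-m i j = trans (sum-shear n (λ a b → tA a i b j)
        (λ a b h → *0ʳ (A (suc a) (suc i) (suc b) (suc j)) (big₁ a i (suc b ℕ.* suc j) h)) (λ a b h → *0ʳ (A (suc a) (suc i) (suc b) (suc j)) (big₂ b j (suc a ℕ.* suc i) h)))
      (cong (_+ dA i j) (cong₂ _+_ (sum-cong′ n (λ a → sum-cong′ n (λ b → lower-term i j a b)))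
        (sum-cong′ n (λ a → sum-cong′ n (λ b → upper-term i j a b)))))

    shear-d : pairSum n B ≡ sumℤ n (λ i → sumℤ n (λ j → ψ i (suc (i ℕ.+ j)))) + sumℤ n (λ i → sumℤ n (λ j → ψ (suc (i ℕ.+ j)) j)) + sumℤ n (λ i → ψ i i)
    shear-d = sum-shear n ψ (λ i k h → sum-zero n (λ a _ → sum-zero n (λ b _ → *0ʳ (B (suc a) (suc i) (suc b) (suc k)) (big₁′ a i (suc b ℕ.* suc k) h))))
      (λ i k h → sum-zero n (λ a _ → sum-zero n (λ b _ → *0ʳ (B (suc a) (suc i) (suc b) (suc k)) (big₂′ b k (suc a ℕ.* suc i) h))))

    diagA-sum : sumℤ n (λ i → sumℤ n (dA i)) ≡ Lam diagA n
    diagA-sum = trans (sum-cong′ n (λ i → sum-cong′ n (λ j → sum-cong′ n (λ a → cong₂ _*_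
        (cong (A (suc a) (suc i) (suc a)) (sym (trans (cong (_∸ i) (sym (ℕP.+-suc i j))) (ℕP.m+n∸m≡n i (suc j)))))
        (cong (λ z → δ z n) (trans (sym (ℕP.*-distribˡ-+ (suc a) (suc i) (suc j))) (cong (suc a ℕ.*_) (sym (ss i j)))))))))
      (trans (sum-upper n (λ i k → sumℤ n (λ a → A (suc a) (suc i) (suc a) (k ∸ i) * δ (suc a ℕ.* suc k) n))
        (λ i k h → sum-zero n (λ a _ → *0ʳ (A (suc a) (suc i) (suc a) (k ∸ i)) (δ-> (ℕP.≤-trans (s≤s h) (ℕP.m≤n*m (suc k) (suc a)))))))
      (sum-cong′ n (λ k → trans (sum-swap k n _) (sum-cong′ n (λ a → sum-*ʳ k (δ (suc a ℕ.* suc k) n) (λ i → A (suc a) (suc i) (suc a) (k ∸ i)))))))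

    diagB-sum : sumℤ n (λ i → ψ i i) ≡ Lam diagB n
    diagB-sum = sum-cong′ n (λ i → trans (sum-swap n n _) (trans (sum-cong′ n (λ b → sum-cong′ n (λ a → cong₂ _*_
        (cong (λ z → B z (suc i) (suc b) (suc i)) (sym (trans (cong (_∸ b) (sym (ℕP.+-suc b a))) (ℕP.m+n∸m≡n b (suc a)))))
        (cong (λ z → δ z n) (trans (ℕP.+-comm (suc a ℕ.* suc i) _) (trans (sym (ℕP.*-distribʳ-+ (suc i) (suc b) (suc a))) (cong (ℕ._* suc i) (sym (ss b a)))))))))
      (trans (sum-upper n (λ b m → B (m ∸ b) (suc i) (suc b) (suc i) * δ (suc m ℕ.* suc i) n)
        (λ b m h → *0ʳ (B (m ∸ b) (suc i) (suc b) (suc i)) (δ-> (ℕP.≤-trans (s≤s h) (ℕP.m≤m*n (suc m) (suc i))))))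
      (sum-cong′ n (λ m → sum-*ʳ m (δ (suc m ℕ.* suc i) n) (λ b → B (m ∸ b) (suc i) (suc b) (suc i)))))))

    -- In both pair sums the off-diagonal part consists of the sums of `ψ` over d₁ < d₂ and over d₁
    -- > d₂. These cancel and leave the two diagonals.
    result : pairSum n A - pairSum n B ≡ Lam diagA n - Lam diagB n
    result = trans (cong₂ _-_ (trans (sum-cong′ n (λ i → trans (sum-cong′ n (shear-m i)) (trans (sum-+ n _ _) (cong (_+ sumℤ n (dA i)) (sum-+ n _ _)))))
        (trans (sum-+ n _ _) (cong₂ _+_ (sum-+ n _ _) diagA-sum))) (trans shear-d (cong (_+_ (sumℤ n (λ i → sumℤ n (λ j → ψ i (suc (i ℕ.+ j)))) + sumℤ n (λ i → sumℤ n (λ j → ψ (suc (i ℕ.+ j)) j)))) diagB-sum)))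
      (solve 4 (λ x y d e → ((x :+ y) :+ d) :- ((y :+ x) :+ e) := d :- e) refl
        (sumℤ n (λ i → sumℤ n (λ j → ψ (suc (i ℕ.+ j)) j))) (sumℤ n (λ i → sumℤ n (λ j → ψ i (suc (i ℕ.+ j))))) (Lam diagA n) (Lam diagB n))
      where open ℤS using (solve; _:+_; _:-_; _:=_)

  pairSum-shear : ∀ n → pairSum n A - pairSum n B ≡ Lam diagA n - Lam diagB n
  pairSum-shear = Level.result

-- Residues modulo 3

data T3 : Set where
  t0 t1 t2 : T3

succ : T3 → T3
succ t0 = t1
succ t1 = t2
succ t2 = t0

infixl 6 _⊞_
_⊞_ : T3 → T3 → T3
t0 ⊞ t = t
t1 ⊞ t = succ t
t2 ⊞ t = succ (succ t)

⌊_⌋ : T3 → ℤ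
⌊ t0 ⌋ = + 0
⌊ t1 ⌋ = + 1
⌊ t2 ⌋ = - (+ 1)

-- Reduction modulo 3 with values in a three-element type: each character identity becomes a short
-- list of closed cases decided by computation.
cl : ℕ → T3
cl zero    = t0
cl (suc n) = succ (cl n)

cl-+ : ∀ m n → cl (m ℕ.+ n) ≡ cl m ⊞ cl n
cl-+ zero    n = refl
cl-+ (suc m) n = trans (cong succ (cl-+ m n)) (h (cl m) (cl n))
  where
  h : ∀ s t → succ (s ⊞ t) ≡ succ s ⊞ t
  h t0 t  = refl
  h t1 t  = refl
  h t2 t0 = refl
  h t2 t1 = refl
  h t2 t2 = refl

χ : ℕ → ℤ
χ n = ⌊ cl n ⌋

-- The principal character modulo 3.
e : ℕ → ℤ
e n = χ n * χ n

χ₃-+3 : ∀ n → χ₃ (3 ℕ.+ n) ≡ χ₃ n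
χ₃-+3 n with n % 3
... | 0 = refl
... | 1 = refl
... | suc (suc k) = refl

χ₃≡χ : ∀ n → χ₃ n ≡ χ n
χ₃≡χ 0 = refl
χ₃≡χ 1 = refl
χ₃≡χ 2 = refl
χ₃≡χ (suc (suc (suc n))) = trans (χ₃-+3 n) (trans (χ₃≡χ n) (cong ⌊_⌋ (sym (h (cl n)))))
  where
  h : ∀ t → succ (succ (succ t)) ≡ t
  h t0 = refl
  h t1 = refl
  h t2 = refl

χ-twice : ∀ m n → χ (m ℕ.+ n ℕ.+ n) ≡ χ (m ℕ.+ (n ℕ.+ n))
χ-twice m n = cong χ (ℕP.+-assoc m n n)

-- Modulo 3 the number m + 2n stands for m - n, so this is (m + n) - n = m written without
-- subtraction.
χ-thrice : ∀ m n → χ (m ℕ.+ n ℕ.+ (n ℕ.+ n)) ≡ χ m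
χ-thrice m n rewrite cl-+ (m ℕ.+ n) (n ℕ.+ n) | cl-+ m n | cl-+ n n = h (cl m) (cl n)
  where
  h : ∀ s t → ⌊ (s ⊞ t) ⊞ (t ⊞ t) ⌋ ≡ ⌊ s ⌋
  h t0 t0 = refl
  h t0 t1 = refl
  h t0 t2 = refl
  h t1 t0 = refl
  h t1 t1 = refl
  h t1 t2 = refl
  h t2 t0 = refl
  h t2 t1 = refl
  h t2 t2 = refl

χ-anti : ∀ m n → χ (m ℕ.+ (n ℕ.+ n)) ≡ - χ (n ℕ.+ (m ℕ.+ m))
χ-anti m n rewrite cl-+ m (n ℕ.+ n) | cl-+ n n | cl-+ n (m ℕ.+ m) | cl-+ m m = h (cl m) (cl n)
  where
  h : ∀ s t → ⌊ s ⊞ (t ⊞ t) ⌋ ≡ - ⌊ t ⊞ (s ⊞ s) ⌋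
  h t0 t0 = refl
  h t0 t1 = refl
  h t0 t2 = refl
  h t1 t0 = refl
  h t1 t1 = refl
  h t1 t2 = refl
  h t2 t0 = refl
  h t2 t1 = refl
  h t2 t2 = refl

-- The addition formula of the sine: `χ` is proportional to sin(2πn/3), and 2 - 3 `e` is 2
-- cos(2πn/3). `χ-diff` is the corresponding subtraction formula.
χ-sum : ∀ m n → + 2 * χ (m ℕ.+ n) ≡ χ m * (+ 2 - + 3 * e n) + (+ 2 - + 3 * e m) * χ n
χ-sum m n rewrite cl-+ m n = h (cl m) (cl n)
  where
  h : ∀ s t → + 2 * ⌊ s ⊞ t ⌋ ≡ ⌊ s ⌋ * (+ 2 - + 3 * (⌊ t ⌋ * ⌊ t ⌋)) + (+ 2 - + 3 * (⌊ s ⌋ * ⌊ s ⌋)) * ⌊ t ⌋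
  h t0 t0 = refl
  h t0 t1 = refl
  h t0 t2 = refl
  h t1 t0 = refl
  h t1 t1 = refl
  h t1 t2 = refl
  h t2 t0 = refl
  h t2 t1 = refl
  h t2 t2 = refl

χ-diff : ∀ m n → + 2 * χ (m ℕ.+ (n ℕ.+ n)) ≡ χ m * (+ 2 - + 3 * e n) - (+ 2 - + 3 * e m) * χ n
χ-diff m n rewrite cl-+ m (n ℕ.+ n) | cl-+ n n = h (cl m) (cl n)
  where
  h : ∀ s t → + 2 * ⌊ s ⊞ (t ⊞ t) ⌋ ≡ ⌊ s ⌋ * (+ 2 - + 3 * (⌊ t ⌋ * ⌊ t ⌋)) - (+ 2 - + 3 * (⌊ s ⌋ * ⌊ s ⌋)) * ⌊ t ⌋
  h t0 t0 = refl
  h t0 t1 = refl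
  h t0 t2 = refl
  h t1 t0 = refl
  h t1 t1 = refl
  h t1 t2 = refl
  h t2 t0 = refl
  h t2 t1 = refl
  h t2 t2 = refl

-- For x + b = M: twice the indicator of x ≡ b ≢ 0.
ee+χχ : ∀ x b → e x * e b + χ x * χ b ≡ e (x ℕ.+ b) * e b - χ (x ℕ.+ b) * χ b
ee+χχ x b rewrite cl-+ x b = h (cl x) (cl b)
  where
  h : ∀ s t → ⌊ s ⌋ * ⌊ s ⌋ * (⌊ t ⌋ * ⌊ t ⌋) + ⌊ s ⌋ * ⌊ t ⌋ ≡ ⌊ s ⊞ t ⌋ * ⌊ s ⊞ t ⌋ * (⌊ t ⌋ * ⌊ t ⌋) - ⌊ s ⊞ t ⌋ * ⌊ t ⌋
  h t0 t0 = refl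
  h t0 t1 = refl
  h t0 t2 = refl
  h t1 t0 = refl
  h t1 t1 = refl
  h t1 t2 = refl
  h t2 t0 = refl
  h t2 t1 = refl
  h t2 t2 = refl

ee-χχ : ∀ m n → e (m ℕ.+ n) * e n - χ (m ℕ.+ n) * χ n ≡ e m * e n + χ m * χ n
ee-χχ m n = sym (ee+χχ m n)

-- The right side involves only x and the total x + y, so for a fixed total the sum over x reduces
-- to moments of `χ` and `e`.
χχχ : ∀ x y → + 2 * (χ x * χ y * χ (x ℕ.+ y)) ≡ χ (x ℕ.+ y) * e x - e (x ℕ.+ y) * χ x
χχχ x y rewrite cl-+ x y = h (cl x) (cl y)
  where
  h : ∀ s t → + 2 * (⌊ s ⌋ * ⌊ t ⌋ * ⌊ s ⊞ t ⌋) ≡ ⌊ s ⊞ t ⌋ * (⌊ s ⌋ * ⌊ s ⌋) - ⌊ s ⊞ t ⌋ * ⌊ s ⊞ t ⌋ * ⌊ s ⌋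
  h t0 t0 = refl
  h t0 t1 = refl
  h t0 t2 = refl
  h t1 t0 = refl
  h t1 t1 = refl
  h t1 t2 = refl
  h t2 t0 = refl
  h t2 t1 = refl
  h t2 t2 = refl

χχχ-sum : ∀ x y → + 2 * (χ x * χ y * χ (x ℕ.+ y)) ≡ - (χ x * e y + e x * χ y)
χχχ-sum x y rewrite cl-+ x y = h (cl x) (cl y)
  where
  h : ∀ s t → + 2 * (⌊ s ⌋ * ⌊ t ⌋ * ⌊ s ⊞ t ⌋) ≡ - (⌊ s ⌋ * (⌊ t ⌋ * ⌊ t ⌋) + ⌊ s ⌋ * ⌊ s ⌋ * ⌊ t ⌋)
  h t0 t0 = refl
  h t0 t1 = refl
  h t0 t2 = refl
  h t1 t0 = refl
  h t1 t1 = refl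
  h t1 t2 = refl
  h t2 t0 = refl
  h t2 t1 = refl
  h t2 t2 = refl

χχχ-diff : ∀ x y → + 2 * (χ x * χ y * χ (y ℕ.+ (x ℕ.+ x))) ≡ - (χ x * e y - e x * χ y)
χχχ-diff x y rewrite cl-+ y (x ℕ.+ x) | cl-+ x x = h (cl x) (cl y)
  where
  h : ∀ s t → + 2 * (⌊ s ⌋ * ⌊ t ⌋ * ⌊ t ⊞ (s ⊞ s) ⌋) ≡ - (⌊ s ⌋ * (⌊ t ⌋ * ⌊ t ⌋) - ⌊ s ⌋ * ⌊ s ⌋ * ⌊ t ⌋)
  h t0 t0 = refl
  h t0 t1 = refl
  h t0 t2 = refl
  h t1 t0 = refl
  h t1 t1 = refl
  h t1 t2 = refl
  h t2 t0 = refl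
  h t2 t1 = refl
  h t2 t2 = refl

-- Closed forms of sums over 0 < x < K

closed : ∀ c (f P : ℕ → ℤ) → P 1 ≡ + 0 → (∀ K → P (suc K) ≡ P K + c * f K) → ∀ m → c * sumℤ m (f ∘ suc) ≡ P (suc m)
closed c f P base step zero    = trans (ℤP.*-zeroʳ c) (sym base)
closed c f P base step (suc m) = trans (ℤP.*-distribˡ-+ c (sumℤ m (f ∘ suc)) (f (suc m)))
  (trans (cong (_+ c * f (suc m)) (closed c f P base step m)) (sym (step (suc m))))

Σχ : ∀ m → + 2 * sumℤ m (λ b → χ (suc b)) ≡ χ (suc m) * χ (suc m) - χ (suc m)
Σχ = closed (+ 2) (λ n → χ n) (λ n → χ n * χ n - χ n) refl (λ n → h (+ n) (cl n))
  where
  h : ∀ (k : ℤ) s → ⌊ succ s ⌋ * ⌊ succ s ⌋ - ⌊ succ s ⌋ ≡ ⌊ s ⌋ * ⌊ s ⌋ - ⌊ s ⌋ + + 2 * (⌊ s ⌋)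
  h k t0 = RingSolver.solve (k ∷ [])
  h k t1 = RingSolver.solve (k ∷ [])
  h k t2 = RingSolver.solve (k ∷ [])

Σe : ∀ m → + 6 * sumℤ m (λ b → χ (suc b) * χ (suc b)) ≡ + 4 * + suc m - + 3 * (χ (suc m) * χ (suc m)) - χ (suc m)
Σe = closed (+ 6) (λ n → χ n * χ n) (λ n → + 4 * + n - + 3 * (χ n * χ n) - χ n) refl (λ n → h (+ n) (cl n))
  where
  h : ∀ (k : ℤ) s → + 4 * (+ 1 + k) - + 3 * (⌊ succ s ⌋ * ⌊ succ s ⌋) - ⌊ succ s ⌋ ≡ + 4 * k - + 3 * (⌊ s ⌋ * ⌊ s ⌋) - ⌊ s ⌋ + + 6 * (⌊ s ⌋ * ⌊ s ⌋)
  h k t0 = RingSolver.solve (k ∷ [])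
  h k t1 = RingSolver.solve (k ∷ [])
  h k t2 = RingSolver.solve (k ∷ [])

Σxχ : ∀ m → + 6 * sumℤ m (λ b → + suc b * χ (suc b)) ≡ + 3 * + suc m * (χ (suc m) * χ (suc m)) - + 2 * + suc m + (+ 2 - + 3 * + suc m) * χ (suc m)
Σxχ = closed (+ 6) (λ n → + n * χ n) (λ n → + 3 * + n * (χ n * χ n) - + 2 * + n + (+ 2 - + 3 * + n) * χ n) refl (λ n → h (+ n) (cl n))
  where
  h : ∀ (k : ℤ) s → + 3 * (+ 1 + k) * (⌊ succ s ⌋ * ⌊ succ s ⌋) - + 2 * (+ 1 + k) + (+ 2 - + 3 * (+ 1 + k)) * ⌊ succ s ⌋ ≡ + 3 * k * (⌊ s ⌋ * ⌊ s ⌋) - + 2 * k + (+ 2 - + 3 * k) * ⌊ s ⌋ + + 6 * (k * ⌊ s ⌋)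
  h k t0 = RingSolver.solve (k ∷ [])
  h k t1 = RingSolver.solve (k ∷ [])
  h k t2 = RingSolver.solve (k ∷ [])

Σxe : ∀ m → + 6 * sumℤ m (λ b → + suc b * (χ (suc b) * χ (suc b))) ≡ + 2 * + suc m * + suc m + (+ 2 - + 3 * + suc m) * (χ (suc m) * χ (suc m)) - + suc m * χ (suc m)
Σxe = closed (+ 6) (λ n → + n * (χ n * χ n)) (λ n → + 2 * + n * + n + (+ 2 - + 3 * + n) * (χ n * χ n) - + n * χ n) refl (λ n → h (+ n) (cl n))
  where
  h : ∀ (k : ℤ) s → + 2 * (+ 1 + k) * (+ 1 + k) + (+ 2 - + 3 * (+ 1 + k)) * (⌊ succ s ⌋ * ⌊ succ s ⌋) - (+ 1 + k) * ⌊ succ s ⌋ ≡ + 2 * k * k + (+ 2 - + 3 * k) * (⌊ s ⌋ * ⌊ s ⌋) - k * ⌊ s ⌋ + + 6 * (k * (⌊ s ⌋ * ⌊ s ⌋))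
  h k t0 = RingSolver.solve (k ∷ [])
  h k t1 = RingSolver.solve (k ∷ [])
  h k t2 = RingSolver.solve (k ∷ [])

Σx²χ : ∀ m → + 6 * sumℤ m (λ b → + suc b * + suc b * χ (suc b)) ≡ (+ 3 * + suc m * + suc m - + 2) * (χ (suc m) * χ (suc m)) - + 2 * + suc m * + suc m + (+ 4 * + suc m - + 3 * + suc m * + suc m) * χ (suc m)
Σx²χ = closed (+ 6) (λ n → + n * + n * χ n) (λ n → (+ 3 * + n * + n - + 2) * (χ n * χ n) - + 2 * + n * + n + (+ 4 * + n - + 3 * + n * + n) * χ n) refl (λ n → h (+ n) (cl n))
  where
  h : ∀ (k : ℤ) s → (+ 3 * (+ 1 + k) * (+ 1 + k) - + 2) * (⌊ succ s ⌋ * ⌊ succ s ⌋) - + 2 * (+ 1 + k) * (+ 1 + k) + (+ 4 * (+ 1 + k) - + 3 * (+ 1 + k) * (+ 1 + k)) * ⌊ succ s ⌋ ≡ (+ 3 * k * k - + 2) * (⌊ s ⌋ * ⌊ s ⌋) - + 2 * k * k + (+ 4 * k - + 3 * k * k) * ⌊ s ⌋ + + 6 * (k * k * ⌊ s ⌋)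
  h k t0 = RingSolver.solve (k ∷ [])
  h k t1 = RingSolver.solve (k ∷ [])
  h k t2 = RingSolver.solve (k ∷ [])

Σx²e : ∀ m → + 18 * sumℤ m (λ b → + suc b * + suc b * (χ (suc b) * χ (suc b))) ≡ + 4 * + suc m * + suc m * + suc m - + 6 * + suc m + (+ 12 * + suc m - + 9 * + suc m * + suc m) * (χ (suc m) * χ (suc m)) + (+ 2 - + 3 * + suc m * + suc m) * χ (suc m)
Σx²e = closed (+ 18) (λ n → + n * + n * (χ n * χ n)) (λ n → + 4 * + n * + n * + n - + 6 * + n + (+ 12 * + n - + 9 * + n * + n) * (χ n * χ n) + (+ 2 - + 3 * + n * + n) * χ n) refl (λ n → h (+ n) (cl n))
  where
  h : ∀ (k : ℤ) s → + 4 * (+ 1 + k) * (+ 1 + k) * (+ 1 + k) - + 6 * (+ 1 + k) + (+ 12 * (+ 1 + k) - + 9 * (+ 1 + k) * (+ 1 + k)) * (⌊ succ s ⌋ * ⌊ succ s ⌋) + (+ 2 - + 3 * (+ 1 + k) * (+ 1 + k)) * ⌊ succ s ⌋ ≡ + 4 * k * k * k - + 6 * k + (+ 12 * k - + 9 * k * k) * (⌊ s ⌋ * ⌊ s ⌋) + (+ 2 - + 3 * k * k) * ⌊ s ⌋ + + 18 * (k * k * (⌊ s ⌋ * ⌊ s ⌋))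
  h k t0 = RingSolver.solve (k ∷ [])
  h k t1 = RingSolver.solve (k ∷ [])
  h k t2 = RingSolver.solve (k ∷ [])

Σx : ∀ m → + 2 * sumℤ m (λ b → + suc b) ≡ + suc m * + suc m - + suc m
Σx = closed (+ 2) (λ n → + n) (λ n → + n * + n - + n) refl (λ n → h (+ n))
  where
  h : ∀ k → (+ 1 + k) * (+ 1 + k) - (+ 1 + k) ≡ k * k - k + + 2 * k
  h = solve-∀

Σx² : ∀ m → + 6 * sumℤ m (λ b → + suc b * + suc b) ≡ + 2 * + suc m * + suc m * + suc m - + 3 * + suc m * + suc m + + suc m
Σx² = closed (+ 6) (λ n → + n * + n) (λ n → + 2 * + n * + n * + n - + 3 * + n * + n + + n) refl (λ n → h (+ n))
  where
  h : ∀ k → + 2 * (+ 1 + k) * (+ 1 + k) * (+ 1 + k) - + 3 * (+ 1 + k) * (+ 1 + k) + (+ 1 + k) ≡ + 2 * k * k * k - + 3 * k * k + k + + 6 * (k * k)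
  h = solve-∀

Σ1 : ∀ m c → sumℤ m (λ _ → c) ≡ + m * c
Σ1 zero    c = refl
Σ1 (suc m) c = trans (cong (_+ c) (Σ1 m c)) (h (+ m) c)
  where
  h : ∀ k c → k * c + c ≡ (+ 1 + k) * c
  h = solve-∀

sum-reverse : ∀ k (f : ℕ → ℤ) → sumℤ k (λ i → f (k ∸ i)) ≡ sumℤ k (λ i → f (suc i))
sum-reverse zero    f = refl
sum-reverse (suc k) f = trans (sum-head k _) (trans (ℤP.+-comm (f (suc k)) _) (cong (_+ f (suc k)) (sum-reverse k f)))

-- Quadratic relations between Eisenstein series of level 3, by Liouville's method.

θ : Series → Series
θ f n = + n * f n

θ-Lam : ∀ f → θ (Lam f) ≐ Lam (λ m d → + m * + d * f m d)
θ-Lam f n = trans (sym (sum-*ˡ n (+ n) _)) (sum-cong′ n (λ i → trans (sym (sum-*ˡ n (+ n) _)) (sum-cong′ n (λ a →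
  trans (h (+ n) (f (suc a) (suc i)) (δ (suc a ℕ.* suc i) n))
  (trans (sym (δ-subst (suc a ℕ.* suc i) n (λ k → + k * f (suc a) (suc i))))
    (cong (λ z → z * f (suc a) (suc i) * δ (suc a ℕ.* suc i) n) (ℤP.pos-* (suc a) (suc i))))))))
  where
  h : ∀ n x y → n * (x * y) ≡ n * x * y
  h = solve-∀

Lam-lin : ∀ a b f g n → Lam (λ m d → a * f m d + b * g m d) n ≡ a * Lam f n + b * Lam g n
Lam-lin a b f g n = trans (Lam-+ (λ m d → a * f m d) (λ m d → b * g m d) n) (cong₂ _+_ (Lam-scale a f n) (Lam-scale b g n))

pairSum-lin : ∀ a b f g f′ g′ n → pairSum n (λ m i k j → a * (f m i * g k j) + b * (f′ m i * g′ k j)) ≡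
  a * mul (Lam f) (Lam g) n + b * mul (Lam f′) (Lam g′) n
pairSum-lin a b f g f′ g′ n = trans (pairSum-+ n (λ m i k j → a * (f m i * g k j)) (λ m i k j → b * (f′ m i * g′ k j)))
  (cong₂ _+_ (trans (pairSum-scale n a (λ m i k j → f m i * g k j)) (cong (a *_) (pairSum-product f g n)))
             (trans (pairSum-scale n b (λ m i k j → f′ m i * g′ k j)) (cong (b *_) (pairSum-product f′ g′ n))))

-- For the left side to become products of series, `κ` has to split into functions of the single
-- pairs (m₁, d₁) and (m₂, d₂). The constant `c₁` clears the denominators of the character formulas,
-- `c₂` those of the diagonal sums.
module Instance (A B : ℕ → ℕ → ℕ → ℕ → ℤ)
  (A-sym : ∀ m i k j → A m i k j ≡ A k j m i)
  (B-sym : ∀ m i k j → B m i k j ≡ B k j m i)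
  (rot : ∀ m i k j → A (m ℕ.+ k) i k j ≡ B m i k (i ℕ.+ j))
  (c₁ c₂ : ℤ) (κ : ℕ → ℕ → ℕ → ℕ → ℤ) (h : ℕ → ℕ → ℤ)
  (kernel : ∀ m i k j → c₁ * (A m i k j - B m i k j) ≡ κ m i k j)
  (diagonal : ∀ m d → c₂ * (sumℤ d (λ i → A (suc m) (suc i) (suc m) (d ∸ i)) - sumℤ m (λ b → B (m ∸ b) (suc d) (suc b) (suc d))) ≡ h (suc m) (suc d))
  where

  private
    dA = diagA A B A-sym B-sym rot
    dB = diagB A B A-sym B-sym rot

  identity : ∀ n → c₂ * pairSum n κ ≡ c₁ * Lam h n
  identity n = begin
    c₂ * pairSum n κ
      ≡⟨ cong (c₂ *_) (pairSum-cong n (λ m i k j → trans (sym (kernel m i k j)) (h₀ c₁ (A m i k j) (B m i k j)))) ⟩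
    c₂ * pairSum n (λ m i k j → c₁ * A m i k j + (- c₁) * B m i k j)
      ≡⟨ cong (c₂ *_) (trans (pairSum-+ n (λ m i k j → c₁ * A m i k j) (λ m i k j → - c₁ * B m i k j))
           (cong₂ _+_ (pairSum-scale n c₁ A) (pairSum-scale n (- c₁) B))) ⟩
    c₂ * (c₁ * pairSum n A + (- c₁) * pairSum n B)
      ≡⟨ h₁ c₂ c₁ (pairSum n A) (pairSum n B) ⟩
    c₁ * (c₂ * (pairSum n A - pairSum n B))
      ≡⟨ cong (λ z → c₁ * (c₂ * z)) (pairSum-shear A B A-sym B-sym rot n) ⟩
    c₁ * (c₂ * (Lam dA n - Lam dB n))
      ≡⟨ cong (c₁ *_) (trans (h₂ c₂ (Lam dA n) (Lam dB n)) (trans (sym (Lam-lin c₂ (- c₂) dA dB n))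
           (Lam-cong (λ m d → c₂ * dA m d + (- c₂) * dB m d) h (λ m d → trans (sym (h₂ c₂ (dA (suc m) (suc d)) (dB (suc m) (suc d)))) (diagonal m d)) n))) ⟩
    c₁ * Lam h n ∎
    where
    open ≡-Reasoning
    h₀ : ∀ c a b → c * (a - b) ≡ c * a + (- c) * b
    h₀ = solve-∀
    h₁ : ∀ d c a b → d * (c * a + (- c) * b) ≡ c * (d * (a - b))
    h₁ = solve-∀
    h₂ : ∀ c a b → c * (a - b) ≡ c * a + (- c) * b
    h₂ = solve-∀

compl : ∀ {i k} → i < k → suc i ℕ.+ (k ∸ i) ≡ suc k
compl i<k = cong suc (ℕP.m+[n∸m]≡n (ℕP.<⇒≤ i<k))

compl′ : ∀ {i k} → i < k → (k ∸ i) ℕ.+ suc i ≡ suc k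
compl′ {i} {k} i<k = trans (ℕP.+-comm (k ∸ i) (suc i)) (compl i<k)

complℤ : ∀ {i k} → i < k → + (k ∸ i) ≡ + suc k - + suc i
complℤ {i} {k} i<k = trans (h (+ suc i) (+ (k ∸ i))) (cong (λ z → + z - + suc i) (compl i<k))
  where
  h : ∀ x y → y ≡ (x + y) - x
  h = solve-∀

-- Summands of Eisenstein series of level 3: weight 1 (`lα`, with `lα′` giving the same series after
-- exchanging m and d), weight 2 (`lE`, `lY`, `lS`), weight 3 (`lc`, `lA₃`) and weight 5 (`lC`,
-- `lA₅`).
lα lα′ lE lY lS lc lC lA₃ lA₅ : ℕ → ℕ → ℤ
lα  m d = χ m
lα′ m d = χ d
lE  m d = e d * + d
lY  m d = e m * + d
lS  m d = + d
lc  m d = χ m * (+ d * + d)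
lC  m d = χ m * (+ d * + d * + d * + d)
lA₃ m d = χ d * (+ d * + d)
lA₅ m d = χ d * (+ d * + d * + d * + d)

-- With M = m + 1 = x + b, the summand is 2 when x ≡ b and both are prime to 3, and 0 otherwise.
-- This fixes the class of b as that of -M, so the sum counts a residue class below M.
indicator-sum : ∀ m → + 6 * sumℤ m (λ b → e (m ∸ b) * e (suc b) + χ (m ∸ b) * χ (suc b)) ≡ + 4 * (+ suc m * e (suc m)) - + 4 * χ (suc m)
indicator-sum m = begin
  + 6 * sumℤ m (λ b → e (m ∸ b) * e (suc b) + χ (m ∸ b) * χ (suc b))
    ≡⟨ cong (+ 6 *_) (sum-cong m (λ b b<m → trans (ee+χχ (m ∸ b) (suc b)) (cong (λ z → e z * e (suc b) - χ z * χ (suc b)) (compl′ b<m)))) ⟩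
  + 6 * sumℤ m (λ b → e M * e (suc b) - χ M * χ (suc b))
    ≡⟨ cong (+ 6 *_) (trans (sum-+ m (λ b → e M * e (suc b)) (λ b → - (χ M * χ (suc b)))) (cong₂ _+_ (sum-*ˡ m (e M) (λ b → e (suc b))) (trans (sum-neg m (λ b → χ M * χ (suc b))) (cong (λ z → - z) (sum-*ˡ m (χ M) (λ b → χ (suc b))))))) ⟩
  + 6 * (e M * sumℤ m (λ b → e (suc b)) - χ M * sumℤ m (λ b → χ (suc b)))
    ≡⟨ h₁ (χ M) (sumℤ m (λ b → e (suc b))) (sumℤ m (λ b → χ (suc b))) ⟩
  e M * (+ 6 * sumℤ m (λ b → e (suc b))) - + 3 * χ M * (+ 2 * sumℤ m (λ b → χ (suc b)))
    ≡⟨ cong₂ (λ u v → e M * u - + 3 * χ M * v) (Σe m) (Σχ m) ⟩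
  e M * (+ 4 * + M - + 3 * (χ M * χ M) - χ M) - + 3 * χ M * (χ M * χ M - χ M)
    ≡⟨ h₂ (+ M) (cl M) ⟩
  + 4 * (+ M * e M) - + 4 * χ M ∎
  where
  open ≡-Reasoning
  M = suc m
  h₁ : ∀ x u v → + 6 * (x * x * u - x * v) ≡ x * x * (+ 6 * u) - + 3 * x * (+ 2 * v)
  h₁ = solve-∀
  h₂ : ∀ k s → ⌊ s ⌋ * ⌊ s ⌋ * (+ 4 * k - + 3 * (⌊ s ⌋ * ⌊ s ⌋) - ⌊ s ⌋) - + 3 * ⌊ s ⌋ * (⌊ s ⌋ * ⌊ s ⌋ - ⌊ s ⌋) ≡ + 4 * (k * (⌊ s ⌋ * ⌊ s ⌋)) - + 4 * ⌊ s ⌋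
  h₂ k t0 = RingSolver.solve (k ∷ [])
  h₂ k t1 = RingSolver.solve (k ∷ [])
  h₂ k t2 = RingSolver.solve (k ∷ [])

ee-χχ-diag : ∀ m → e m * e m - χ m * χ m ≡ + 0
ee-χχ-diag m with cl m
... | t0 = refl
... | t1 = refl
... | t2 = refl

-- The relation a² = w. Up to the factor 2, `A` detects m ≡ -k and `B` detects m ≡ k, both off the
-- multiples of 3; replacing m by m + k carries the first condition into the second.
square-identity : ∀ n → + 12 * mul (Lam lα) (Lam lα) n ≡ + 4 * Lam lE n - + 4 * Lam lα n
square-identity n = begin
  + 12 * mul (Lam lα) (Lam lα) n
    ≡⟨ trans (h₃ (mul (Lam lα) (Lam lα) n)) (cong (λ z → - (+ 6 * z)) (sym (pairSum-lin (- + 1) (- + 1) lα lα lα lα n))) ⟩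
  - (+ 6 * pairSum n κ)
    ≡⟨ cong (λ z → - z) (I.identity n) ⟩
  - (+ 1 * Lam (λ m d → - + 4 * (+ m * e m) + + 4 * χ m) n)
    ≡⟨ cong (λ z → - (+ 1 * z)) (trans (Lam-lin (- + 4) (+ 4) (λ m d → + m * e m) lα n)
         (cong (λ z → - + 4 * z + + 4 * Lam lα n) (trans (Lam-swap (λ m d → + m * e m) n) (Lam-cong (λ m d → + d * e d) lE (λ m d → ℤP.*-comm (+ suc d) (e (suc d))) n)))) ⟩
  - (+ 1 * (- + 4 * Lam lE n + + 4 * Lam lα n))
    ≡⟨ h₄ (Lam lE n) (Lam lα n) ⟩
  + 4 * Lam lE n - + 4 * Lam lα n ∎
  where
  open ≡-Reasoning
  A B κ : ℕ → ℕ → ℕ → ℕ → ℤ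
  A m i k j = e m * e k - χ m * χ k
  B m i k j = e m * e k + χ m * χ k
  κ m i k j = - + 1 * (χ m * χ k) + - + 1 * (χ m * χ k)
  h₁ : ∀ x y → x * x * (y * y) - x * y ≡ y * y * (x * x) - y * x
  h₁ = solve-∀
  h₁′ : ∀ x y → x * x * (y * y) + x * y ≡ y * y * (x * x) + y * x
  h₁′ = solve-∀
  h₂ : ∀ x y → + 1 * ((x * x * (y * y) - x * y) - (x * x * (y * y) + x * y)) ≡ - + 1 * (x * y) + - + 1 * (x * y)
  h₂ = solve-∀
  h₃ : ∀ z → + 12 * z ≡ - (+ 6 * (- + 1 * z + - + 1 * z))
  h₃ = solve-∀
  h₄ : ∀ x y → - (+ 1 * (- + 4 * x + + 4 * y)) ≡ + 4 * x - + 4 * y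
  h₄ = solve-∀
  h₅ : ∀ s x y → + 6 * s ≡ + 4 * x - + 4 * y → + 6 * (+ 0 - s) ≡ - + 4 * x + + 4 * y
  h₅ s x y h = trans (h₆ s) (trans (cong (λ z → - z) h) (h₇ x y))
    where
    h₆ : ∀ s → + 6 * (+ 0 - s) ≡ - (+ 6 * s)
    h₆ = solve-∀
    h₇ : ∀ x y → - (+ 4 * x - + 4 * y) ≡ - + 4 * x + + 4 * y
    h₇ = solve-∀
  module I = Instance A B (λ m _ k _ → h₁ (χ m) (χ k)) (λ m _ k _ → h₁′ (χ m) (χ k)) (λ m _ k _ → ee-χχ m k)
    (+ 1) (+ 6) κ (λ m d → - + 4 * (+ m * e m) + + 4 * χ m) (λ m _ k _ → h₂ (χ m) (χ k))
    (λ m d → trans (cong (λ z → + 6 * (z - sumℤ m (λ b → B (m ∸ b) (suc d) (suc b) (suc d)))) (sum-zero d (λ _ _ → ee-χχ-diag (suc m))))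
      (h₅ _ (+ suc m * e (suc m)) (χ (suc m)) (indicator-sum m)))

-- The kernels of `square-identity` are multiplied by the form i² + ij + j², which equals i² - ij' +
-- j'² for j' = i + j. The diagonal d₁ = d₂ then acquires the factor d² that produces θY.
y-identity : ∀ n → + 12 * mul (Lam lY) (Lam lY) n - + 12 * mul (Lam lc) (Lam lα) n - + 12 * mul (Lam lα) (Lam lc) n
  ≡ + 4 * Lam lc n - + 4 * θ (Lam lY) n
y-identity n = begin
  + 12 * YY - + 12 * cα - + 12 * αc
    ≡⟨ trans (h₃ YY cα αc) (cong (+ 6 *_) (sym (trans (pairSum-+ n (λ m i k j → + 2 * (lY m i * lY k j) + - + 2 * (lc m i * lα k j)) (λ m i k j → - + 2 * (lα m i * lc k j)))
        (cong₂ _+_ (pairSum-lin (+ 2) (- + 2) lY lY lc lα n)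
          (trans (pairSum-scale n (- + 2) (λ m i k j → lα m i * lc k j)) (cong (- + 2 *_) (pairSum-product lα lc n))))))) ⟩
  + 6 * pairSum n κ
    ≡⟨ I.identity n ⟩
  + 1 * Lam (λ m d → + 4 * lc m d + - + 4 * (+ m * + d * lY m d)) n
    ≡⟨ cong (+ 1 *_) (trans (Lam-lin (+ 4) (- + 4) lc (λ m d → + m * + d * lY m d) n) (cong (λ z → + 4 * Lam lc n + - + 4 * z) (sym (θ-Lam lY n)))) ⟩
  + 1 * (+ 4 * Lam lc n + - + 4 * θ (Lam lY) n)
    ≡⟨ h₄ (Lam lc n) (θ (Lam lY) n) ⟩
  + 4 * Lam lc n - + 4 * θ (Lam lY) n ∎
  where
  open ≡-Reasoning
  YY = mul (Lam lY) (Lam lY) n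
  cα = mul (Lam lc) (Lam lα) n
  αc = mul (Lam lα) (Lam lc) n
  A B κ : ℕ → ℕ → ℕ → ℕ → ℤ
  A m i k j = (+ i * + i + + i * + j + + j * + j) * (e m * e k - χ m * χ k)
  B m i k j = (+ i * + i - + i * + j + + j * + j) * (e m * e k + χ m * χ k)
  κ m i k j = + 2 * (lY m i * lY k j) + - + 2 * (lc m i * lα k j) + - + 2 * (lα m i * lc k j)
  h₁ : ∀ x y i j → (i * i + i * j + j * j) * (x * x * (y * y) - x * y) ≡ (j * j + j * i + i * i) * (y * y * (x * x) - y * x)
  h₁ = solve-∀
  h₁′ : ∀ x y i j → (i * i - i * j + j * j) * (x * x * (y * y) + x * y) ≡ (j * j - j * i + i * i) * (y * y * (x * x) + y * x)
  h₁′ = solve-∀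
  hr : ∀ i j u v → u ≡ v → (i * i + i * j + j * j) * u ≡ (i * i - i * (i + j) + (i + j) * (i + j)) * v
  hr i j u .u refl = hr′ i j u
    where
    hr′ : ∀ i j u → (i * i + i * j + j * j) * u ≡ (i * i - i * (i + j) + (i + j) * (i + j)) * u
    hr′ = solve-∀
  h₂ : ∀ x y i j → + 1 * ((i * i + i * j + j * j) * (x * x * (y * y) - x * y) - (i * i - i * j + j * j) * (x * x * (y * y) + x * y))
    ≡ + 2 * (x * x * i * (y * y * j)) + - + 2 * (x * (i * i) * y) + - + 2 * (x * (y * (j * j)))
  h₂ = solve-∀
  h₃ : ∀ u v w → + 12 * u - + 12 * v - + 12 * w ≡ + 6 * (+ 2 * u + - + 2 * v + - + 2 * w)
  h₃ = solve-∀
  h₄ : ∀ x y → + 1 * (+ 4 * x + - + 4 * y) ≡ + 4 * x - + 4 * y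
  h₄ = solve-∀
  h₅ : ∀ d s M x → + 6 * s ≡ + 4 * (M * (x * x)) - + 4 * x →
    + 6 * (+ 0 - (d * d - d * d + d * d) * s) ≡ + 4 * (x * (d * d)) + - + 4 * (M * d * (x * x * d))
  h₅ d s M x h = trans (h₆ d s) (trans (cong (λ z → - (d * d * z)) h) (h₇ d M x))
    where
    h₆ : ∀ d s → + 6 * (+ 0 - (d * d - d * d + d * d) * s) ≡ - (d * d * (+ 6 * s))
    h₆ = solve-∀
    h₇ : ∀ d M x → - (d * d * (+ 4 * (M * (x * x)) - + 4 * x)) ≡ + 4 * (x * (d * d)) + - + 4 * (M * d * (x * x * d))
    h₇ = solve-∀
  module I = Instance A B (λ m i k j → h₁ (χ m) (χ k) (+ i) (+ j)) (λ m i k j → h₁′ (χ m) (χ k) (+ i) (+ j))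
    (λ m i k j → hr (+ i) (+ j) _ _ (ee-χχ m k))
    (+ 1) (+ 6) κ (λ m d → + 4 * lc m d + - + 4 * (+ m * + d * lY m d)) (λ m i k j → h₂ (χ m) (χ k) (+ i) (+ j))
    (λ m d → trans (cong₂ (λ u v → + 6 * (u - v)) (sum-zero d (λ i _ → *0ʳ (+ suc i * + suc i + + suc i * + (d ∸ i) + + (d ∸ i) * + (d ∸ i)) (ee-χχ-diag (suc m))))
        (sum-*ˡ m (+ suc d * + suc d - + suc d * + suc d + + suc d * + suc d) (λ b → e (m ∸ b) * e (suc b) + χ (m ∸ b) * χ (suc b))))
      (h₅ (+ suc d) (sumℤ m (λ b → e (m ∸ b) * e (suc b) + χ (m ∸ b) * χ (suc b))) (+ suc m) (χ (suc m)) (indicator-sum m)))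

lK : ℕ → ℕ → ℤ
lK m d = (+ 2 - + 3 * e m) * + d

halve : ∀ n κ h → + 2 * pairSum n (λ m i k j → + 2 * κ m i k j) ≡ + 2 * Lam (λ m d → + 2 * h m d) n → pairSum n κ ≡ Lam h n
halve n κ h eq = ℤP.*-cancelˡ-≡ (+ 2) _ _ (trans (sym (pairSum-scale n (+ 2) κ)) (trans (ℤP.*-cancelˡ-≡ (+ 2) _ _ eq) (Lam-scale (+ 2) h n)))

-- In this instance and the next ones the reflection of m₂ is χ(m - k) = χ(m + 2k).
a-identity : ∀ n → + 3 * mul (Lam lα) (Lam lY) n + + 3 * mul (Lam lY) (Lam lα) n ≡ + 3 * Lam lc n - Lam lY n - + 2 * θ (Lam lα) n
a-identity n = begin
  + 3 * mul (Lam lα) (Lam lY) n + + 3 * mul (Lam lY) (Lam lα) n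
    ≡⟨ sym (pairSum-lin (+ 3) (+ 3) lα lY lY lα n) ⟩
  pairSum n κ
    ≡⟨ halve n κ h (I.identity n) ⟩
  Lam h n
    ≡⟨ trans (Lam-+ (λ m d → + 3 * lc m d + - + 1 * lY m d) (λ m d → - + 2 * (+ m * + d * lα m d)) n)
         (cong₂ _+_ (Lam-lin (+ 3) (- + 1) lc lY n) (trans (Lam-scale (- + 2) (λ m d → + m * + d * lα m d) n) (cong (- + 2 *_) (sym (θ-Lam lα n))))) ⟩
  (+ 3 * Lam lc n + - + 1 * Lam lY n) + - + 2 * θ (Lam lα) n
    ≡⟨ h₁ (Lam lc n) (Lam lY n) (θ (Lam lα) n) ⟩
  + 3 * Lam lc n - Lam lY n - + 2 * θ (Lam lα) n ∎
  where
  open ≡-Reasoning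
  A B κ : ℕ → ℕ → ℕ → ℕ → ℤ
  -- Each character value keeps its linear form under the shear: with j' = i + j one has i + j' = 2i
  -- + j, 2i - j' = i - j and i - 2j' = -(i + 2j).
  A m i k j = (+ i - + j) * χ (m ℕ.+ (k ℕ.+ k)) + (+ 2 * + i + + j) * χ m + (+ i + + 2 * + j) * χ k
  B m i k j = (+ i + + j) * χ (m ℕ.+ k) + (+ 2 * + i - + j) * χ m - (+ i - + 2 * + j) * χ k
  κ m i k j = + 3 * (lα m i * lY k j) + + 3 * (lY m i * lα k j)
  h : ℕ → ℕ → ℤ
  h m d = (+ 3 * lc m d + - + 1 * lY m d) + - + 2 * (+ m * + d * lα m d)
  h₁ : ∀ x y z → (+ 3 * x + - + 1 * y) + - + 2 * z ≡ + 3 * x - y - + 2 * z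
  h₁ = solve-∀
  A-sym : ∀ m i k j → A m i k j ≡ A k j m i
  A-sym m i k j = trans (cong (λ z → (+ i - + j) * z + (+ 2 * + i + + j) * χ m + (+ i + + 2 * + j) * χ k) (χ-anti m k)) (g (+ i) (+ j) (χ (k ℕ.+ (m ℕ.+ m))) (χ m) (χ k))
    where
    g : ∀ i j u x y → (i - j) * (- u) + (+ 2 * i + j) * x + (i + + 2 * j) * y ≡ (j - i) * u + (+ 2 * j + i) * y + (j + + 2 * i) * x
    g = solve-∀
  B-sym : ∀ m i k j → B m i k j ≡ B k j m i
  B-sym m i k j = trans (cong (λ z → (+ i + + j) * χ z + (+ 2 * + i - + j) * χ m - (+ i - + 2 * + j) * χ k) (ℕP.+-comm m k)) (g (+ i) (+ j) (χ (k ℕ.+ m)) (χ m) (χ k))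
    where
    g : ∀ i j u x y → (i + j) * u + (+ 2 * i - j) * x - (i - + 2 * j) * y ≡ (j + i) * u + (+ 2 * j - i) * y - (j - + 2 * i) * x
    g = solve-∀
  rot : ∀ m i k j → A (m ℕ.+ k) i k j ≡ B m i k (i ℕ.+ j)
  rot m i k j = trans (cong (λ z → (+ i - + j) * z + (+ 2 * + i + + j) * χ (m ℕ.+ k) + (+ i + + 2 * + j) * χ k) (χ-thrice m k)) (g (+ i) (+ j) (χ (m ℕ.+ k)) (χ m) (χ k))
    where
    g : ∀ i j u x y → (i - j) * x + (+ 2 * i + j) * u + (i + + 2 * j) * y ≡ (i + (i + j)) * u + (+ 2 * i - (i + j)) * x - (i - + 2 * (i + j)) * y
    g = solve-∀
  kernel : ∀ m i k j → + 2 * (A m i k j - B m i k j) ≡ + 2 * κ m i k j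
  kernel m i k j = trans (g₁ (+ i) (+ j) (χ (m ℕ.+ (k ℕ.+ k))) (χ (m ℕ.+ k)) (χ m) (χ k))
    (trans (cong₂ (λ u v → (+ i - + j) * u - (+ i + + j) * v + + 4 * + j * χ m + + 4 * + i * χ k) (χ-diff m k) (χ-sum m k)) (g₂ (+ i) (+ j) (χ m) (χ k)))
    where
    g₁ : ∀ i j u v x y → + 2 * (((i - j) * u + (+ 2 * i + j) * x + (i + + 2 * j) * y) - ((i + j) * v + (+ 2 * i - j) * x - (i - + 2 * j) * y))
      ≡ (i - j) * (+ 2 * u) - (i + j) * (+ 2 * v) + + 4 * j * x + + 4 * i * y
    g₁ = solve-∀
    g₂ : ∀ i j x y → (i - j) * (x * (+ 2 - + 3 * (y * y)) - (+ 2 - + 3 * (x * x)) * y) - (i + j) * (x * (+ 2 - + 3 * (y * y)) + (+ 2 - + 3 * (x * x)) * y) + + 4 * j * x + + 4 * i * y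
      ≡ + 2 * (+ 3 * (x * (y * y * j)) + + 3 * (x * x * i * y))
    g₂ = solve-∀
  diagonal : ∀ m d → + 2 * (sumℤ d (λ i → A (suc m) (suc i) (suc m) (d ∸ i)) - sumℤ m (λ b → B (m ∸ b) (suc d) (suc b) (suc d))) ≡ + 2 * h (suc m) (suc d)
  diagonal m d = trans (cong₂ (λ u v → + 2 * (u - v)) sA sB) (trans (g₁ (+ d) (+ suc d) (+ m) (χ (suc m)) (sumℤ m (λ b → χ (suc b))))
      (trans (cong (λ z → + 6 * (+ d * (+ suc d * χ (suc m))) - + 4 * (+ m * (+ suc d * χ (suc m))) - + 2 * (+ suc d * z)) (Σχ m)) (g₂ (+ d) (+ m) (χ (suc m)))))
    where
    g₁ : ∀ k K M x s → + 2 * (k * (+ 3 * K * x) - (M * (+ 2 * K * x) + (K * s + K * s))) ≡ + 6 * (k * (K * x)) - + 4 * (M * (K * x)) - + 2 * (K * (+ 2 * s))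
    g₁ = solve-∀
    g₂ : ∀ k M x → + 6 * (k * ((+ 1 + k) * x)) - + 4 * (M * ((+ 1 + k) * x)) - + 2 * ((+ 1 + k) * (x * x - x))
      ≡ + 2 * ((+ 3 * (x * ((+ 1 + k) * (+ 1 + k))) + - + 1 * (x * x * (+ 1 + k))) + - + 2 * ((+ 1 + M) * (+ 1 + k) * x))
    g₂ = solve-∀
    t : ∀ i j u x → u ≡ + 0 → (i - j) * u + (+ 2 * i + j) * x + (i + + 2 * j) * x ≡ + 3 * (i + j) * x
    t i j .(+ 0) x refl = t′ i j x
      where
      t′ : ∀ i j x → (i - j) * + 0 + (+ 2 * i + j) * x + (i + + 2 * j) * x ≡ + 3 * (i + j) * x
      t′ = solve-∀
    χ3 : χ (suc m ℕ.+ (suc m ℕ.+ suc m)) ≡ + 0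
    χ3 = χ-thrice 0 (suc m)
    sA : sumℤ d (λ i → A (suc m) (suc i) (suc m) (d ∸ i)) ≡ + d * (+ 3 * + suc d * χ (suc m))
    sA = trans (sum-cong d (λ i i<d → trans (t (+ suc i) (+ (d ∸ i)) (χ (suc m ℕ.+ (suc m ℕ.+ suc m))) (χ (suc m)) χ3)
      (cong (λ z → + 3 * + z * χ (suc m)) (compl i<d)))) (Σ1 d _)
    t₂ : ∀ D u x y → (D + D) * u + (+ 2 * D - D) * x - (D - + 2 * D) * y ≡ + 2 * D * u + (D * x + D * y)
    t₂ = solve-∀
    sB : sumℤ m (λ b → B (m ∸ b) (suc d) (suc b) (suc d)) ≡ + m * (+ 2 * + suc d * χ (suc m)) + (+ suc d * sumℤ m (λ b → χ (suc b)) + + suc d * sumℤ m (λ b → χ (suc b)))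
    sB = trans (sum-cong m (λ b b<m → trans (t₂ (+ suc d) (χ (m ∸ b ℕ.+ suc b)) (χ (m ∸ b)) (χ (suc b))) (cong (λ z → + 2 * + suc d * χ z + (+ suc d * χ (m ∸ b) + + suc d * χ (suc b))) (compl′ b<m))))
      (trans (sum-+ m (λ _ → + 2 * + suc d * χ (suc m)) (λ b → + suc d * χ (m ∸ b) + + suc d * χ (suc b))) (cong₂ _+_ (Σ1 m _)
        (trans (sum-+ m (λ b → + suc d * χ (m ∸ b)) (λ b → + suc d * χ (suc b))) (cong₂ _+_ (trans (sum-*ˡ m (+ suc d) (λ b → χ (m ∸ b))) (cong (+ suc d *_) (sum-reverse m χ))) (sum-*ˡ m (+ suc d) (λ b → χ (suc b)))))))
  module I = Instance A B A-sym B-sym rot (+ 2) (+ 2) (λ m i k j → + 2 * κ m i k j) (λ m d → + 2 * h m d) kernel diagonal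

sum-poly₂ : ∀ m c₀ c₁ c₂ → sumℤ m (λ i → c₀ + c₁ * + suc i + c₂ * (+ suc i * + suc i)) ≡
  + m * c₀ + c₁ * sumℤ m (λ i → + suc i) + c₂ * sumℤ m (λ i → + suc i * + suc i)
sum-poly₂ m c₀ c₁ c₂ = trans (sum-+ m (λ i → c₀ + c₁ * + suc i) (λ i → c₂ * (+ suc i * + suc i)))
  (cong₂ _+_ (trans (sum-+ m (λ _ → c₀) (λ i → c₁ * + suc i)) (cong₂ _+_ (Σ1 m c₀) (sum-*ˡ m c₁ (λ i → + suc i))))
    (sum-*ˡ m c₂ (λ i → + suc i * + suc i)))

-- This becomes Ct = wc, because the series of `lK` is -E. The factor j - i of `B` vanishes for d₁ =
-- d₂, so only the diagonal m₁ = m₂ contributes, with χ(2m) = -χ(m).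
C*-identity : ∀ n → + 6 * mul (Lam lc) (Lam lK) n + + 6 * mul (Lam lK) (Lam lc) n ≡ Lam lc n - Lam lC n
C*-identity n = begin
  + 6 * mul (Lam lc) (Lam lK) n + + 6 * mul (Lam lK) (Lam lc) n
    ≡⟨ sym (pairSum-lin (+ 6) (+ 6) lc lK lK lc n) ⟩
  pairSum n κ
    ≡⟨ halve n κ h (I.identity n) ⟩
  Lam h n
    ≡⟨ trans (Lam-lin (+ 1) (- + 1) lc lC n) (h₁ (Lam lc n) (Lam lC n)) ⟩
  Lam lc n - Lam lC n ∎
  where
  open ≡-Reasoning
  A B κ : ℕ → ℕ → ℕ → ℕ → ℤ
  A m i k j = + 6 * (+ i * + j * (+ i + + j) * χ (m ℕ.+ k))
  B m i k j = + 6 * (+ i * + j * (+ j - + i) * χ (m ℕ.+ (k ℕ.+ k)))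
  κ m i k j = + 6 * (lc m i * lK k j) + + 6 * (lK m i * lc k j)
  h : ℕ → ℕ → ℤ
  h m d = + 1 * lc m d + - + 1 * lC m d
  h₁ : ∀ x y → + 1 * x + - + 1 * y ≡ x - y
  h₁ = solve-∀
  A-sym : ∀ m i k j → A m i k j ≡ A k j m i
  A-sym m i k j = trans (cong (λ z → + 6 * (+ i * + j * (+ i + + j) * χ z)) (ℕP.+-comm m k)) (g (+ i) (+ j) (χ (k ℕ.+ m)))
    where
    g : ∀ i j u → + 6 * (i * j * (i + j) * u) ≡ + 6 * (j * i * (j + i) * u)
    g = solve-∀
  B-sym : ∀ m i k j → B m i k j ≡ B k j m i
  B-sym m i k j = trans (cong (λ z → + 6 * (+ i * + j * (+ j - + i) * z)) (χ-anti m k)) (g (+ i) (+ j) (χ (k ℕ.+ (m ℕ.+ m))))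
    where
    g : ∀ i j u → + 6 * (i * j * (j - i) * (- u)) ≡ + 6 * (j * i * (i - j) * u)
    g = solve-∀
  rot : ∀ m i k j → A (m ℕ.+ k) i k j ≡ B m i k (i ℕ.+ j)
  rot m i k j = trans (cong (λ z → + 6 * (+ i * + j * (+ i + + j) * z)) (χ-twice m k)) (g (+ i) (+ j) (χ (m ℕ.+ (k ℕ.+ k))))
    where
    g : ∀ i j u → + 6 * (i * j * (i + j) * u) ≡ + 6 * (i * (i + j) * ((i + j) - i) * u)
    g = solve-∀
  kernel : ∀ m i k j → + 2 * (A m i k j - B m i k j) ≡ + 2 * κ m i k j
  kernel m i k j = trans (g₁ (+ i) (+ j) (χ (m ℕ.+ k)) (χ (m ℕ.+ (k ℕ.+ k))))
    (trans (cong₂ (λ u v → + 6 * (+ i * + j * (+ i + + j) * u - + i * + j * (+ j - + i) * v)) (χ-sum m k) (χ-diff m k)) (g₂ (+ i) (+ j) (χ m) (χ k)))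
    where
    g₁ : ∀ i j u v → + 2 * (+ 6 * (i * j * (i + j) * u) - + 6 * (i * j * (j - i) * v)) ≡ + 6 * (i * j * (i + j) * (+ 2 * u) - i * j * (j - i) * (+ 2 * v))
    g₁ = solve-∀
    g₂ : ∀ i j x y → + 6 * (i * j * (i + j) * (x * (+ 2 - + 3 * (y * y)) + (+ 2 - + 3 * (x * x)) * y) - i * j * (j - i) * (x * (+ 2 - + 3 * (y * y)) - (+ 2 - + 3 * (x * x)) * y))
      ≡ + 2 * (+ 6 * (x * (i * i) * ((+ 2 - + 3 * (y * y)) * j)) + + 6 * ((+ 2 - + 3 * (x * x)) * i * (y * (j * j))))
    g₂ = solve-∀
  χ2 : ∀ m → χ (m ℕ.+ m) ≡ - χ m
  χ2 m = trans (χ-anti 0 m) (cong (λ z → - χ z) (ℕP.+-identityʳ m))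
  diagonal : ∀ m d → + 2 * (sumℤ d (λ i → A (suc m) (suc i) (suc m) (d ∸ i)) - sumℤ m (λ b → B (m ∸ b) (suc d) (suc b) (suc d))) ≡ + 2 * h (suc m) (suc d)
  diagonal m d = trans (cong₂ (λ u v → + 2 * (u - v)) sA (sum-zero m (λ b _ → t₂ (+ suc d) (χ (m ∸ b ℕ.+ (suc b ℕ.+ suc b))))))
     (trans (g₁ (+ d) (+ suc d) (χ (suc m)) (sumℤ d (λ i → + suc i)) (sumℤ d (λ i → + suc i * + suc i)))
     (trans (cong₂ (λ u v → - (+ 6 * (+ suc d * (+ suc d * χ (suc m)) * u)) + + 2 * (+ suc d * χ (suc m) * v)) (Σx d) (Σx² d)) (g₂ (+ d) (χ (suc m)))))
    where
    t₂ : ∀ D u → + 6 * (D * D * (D - D) * u) ≡ + 0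
    t₂ = solve-∀
    t : ∀ i K u → + 6 * (i * (K - i) * K * (- u)) ≡ + 0 + (- + 6 * K * K * u) * i + (+ 6 * K * u) * (i * i)
    t = solve-∀
    sA : sumℤ d (λ i → A (suc m) (suc i) (suc m) (d ∸ i)) ≡ + d * + 0 + (- + 6 * + suc d * + suc d * χ (suc m)) * sumℤ d (λ i → + suc i) + (+ 6 * + suc d * χ (suc m)) * sumℤ d (λ i → + suc i * + suc i)
    sA = trans (sum-cong d (λ i i<d → trans (cong (λ z → + 6 * (+ suc i * + (d ∸ i) * (+ z) * χ (suc m ℕ.+ suc m))) (compl i<d))
       (trans (cong₂ (λ u v → + 6 * (+ suc i * u * + suc d * v)) (complℤ i<d) (χ2 (suc m))) (t (+ suc i) (+ suc d) (χ (suc m)))))) (sum-poly₂ d (+ 0) (- + 6 * + suc d * + suc d * χ (suc m)) (+ 6 * + suc d * χ (suc m)))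
    g₁ : ∀ k K x s r → + 2 * ((k * + 0 + (- + 6 * K * K * x) * s + (+ 6 * K * x) * r) - + 0) ≡ - (+ 6 * (K * (K * x) * (+ 2 * s))) + + 2 * (K * x * (+ 6 * r))
    g₁ = solve-∀
    g₂ : ∀ k x → - (+ 6 * ((+ 1 + k) * ((+ 1 + k) * x) * ((+ 1 + k) * (+ 1 + k) - (+ 1 + k)))) + + 2 * ((+ 1 + k) * x * (+ 2 * (+ 1 + k) * (+ 1 + k) * (+ 1 + k) - + 3 * (+ 1 + k) * (+ 1 + k) + (+ 1 + k)))
      ≡ + 2 * (+ 1 * (x * ((+ 1 + k) * (+ 1 + k))) + - + 1 * (x * ((+ 1 + k) * (+ 1 + k) * (+ 1 + k) * (+ 1 + k))))
    g₂ = solve-∀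
  module I = Instance A B A-sym B-sym rot (+ 2) (+ 2) (λ m i k j → + 2 * κ m i k j) (λ m d → + 2 * h m d) kernel diagonal

lM : ℕ → ℕ → ℤ
lM m d = (+ 36 + + 27 * e m) * + d

-- The cubic analogue of `a-identity`, from which the formula for θc is obtained.
c-identity : ∀ n → mul (Lam lc) (Lam lM) n + mul (Lam lM) (Lam lc) n ≡ + 15 * Lam lC n + + 3 * Lam lc n - + 18 * θ (Lam lc) n
c-identity n = begin
  mul (Lam lc) (Lam lM) n + mul (Lam lM) (Lam lc) n
    ≡⟨ sym (trans (pairSum-lin (+ 1) (+ 1) lc lM lM lc n) (cong₂ _+_ (ℤP.*-identityˡ (mul (Lam lc) (Lam lM) n)) (ℤP.*-identityˡ (mul (Lam lM) (Lam lc) n)))) ⟩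
  pairSum n κ
    ≡⟨ halve n κ h (I.identity n) ⟩
  Lam h n
    ≡⟨ trans (Lam-+ (λ m d → + 15 * lC m d + + 3 * lc m d) (λ m d → - + 18 * (+ m * + d * lc m d)) n)
         (cong₂ _+_ (Lam-lin (+ 15) (+ 3) lC lc n) (trans (Lam-scale (- + 18) (λ m d → + m * + d * lc m d) n) (cong (- + 18 *_) (sym (θ-Lam lc n))))) ⟩
  (+ 15 * Lam lC n + + 3 * Lam lc n) + - + 18 * θ (Lam lc) n
    ≡⟨ h₁ (Lam lC n) (Lam lc n) (θ (Lam lc) n) ⟩
  + 15 * Lam lC n + + 3 * Lam lc n - + 18 * θ (Lam lc) n ∎
  where
  open ≡-Reasoning
  P₁₂ P₁ P₂ : ℤ → ℤ → ℤ
  -- The cubes and the product of the forms i - j, 2i + j, i + 2j both follow the shear. The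
  -- coefficient 2 makes i³ and j³ cancel here, leaving -9ij(i - j), so the kernel splits into terms
  -- i² · j and i · j².
  P₁₂ i j = + 2 * ((i - j) * (i - j) * (i - j)) - (i - j) * (+ 2 * i + j) * (i + + 2 * j)
  P₁  i j = + 2 * ((+ 2 * i + j) * (+ 2 * i + j) * (+ 2 * i + j)) + (i - j) * (+ 2 * i + j) * (i + + 2 * j)
  P₂  i j = + 2 * ((i + + 2 * j) * (i + + 2 * j) * (i + + 2 * j)) - (i - j) * (+ 2 * i + j) * (i + + 2 * j)
  A B κ : ℕ → ℕ → ℕ → ℕ → ℤ
  A m i k j = P₁₂ (+ i) (+ j) * χ (m ℕ.+ (k ℕ.+ k)) + P₁ (+ i) (+ j) * χ m + P₂ (+ i) (+ j) * χ k
  B m i k j = P₁₂ (+ i) (- + j) * χ (m ℕ.+ k) + P₁ (+ i) (- + j) * χ m - P₂ (+ i) (- + j) * χ k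
  κ m i k j = + 1 * (lc m i * lM k j) + + 1 * (lM m i * lc k j)
  h : ℕ → ℕ → ℤ
  h m d = (+ 15 * lC m d + + 3 * lc m d) + - + 18 * (+ m * + d * lc m d)
  h₁ : ∀ x y z → (+ 15 * x + + 3 * y) + - + 18 * z ≡ + 15 * x + + 3 * y - + 18 * z
  h₁ = solve-∀
  flip₁₂ : ∀ i j → P₁₂ i j ≡ - P₁₂ j i
  flip₁₂ = g
    where
    g : ∀ i j → + 2 * ((i - j) * (i - j) * (i - j)) - (i - j) * (+ 2 * i + j) * (i + + 2 * j) ≡ - (+ 2 * ((j - i) * (j - i) * (j - i)) - (j - i) * (+ 2 * j + i) * (j + + 2 * i))
    g = solve-∀
  flip₁ : ∀ i j → P₁ i j ≡ P₂ j i
  flip₁ = g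
    where
    g : ∀ i j → + 2 * ((+ 2 * i + j) * (+ 2 * i + j) * (+ 2 * i + j)) + (i - j) * (+ 2 * i + j) * (i + + 2 * j) ≡ + 2 * ((j + + 2 * i) * (j + + 2 * i) * (j + + 2 * i)) - (j - i) * (+ 2 * j + i) * (j + + 2 * i)
    g = solve-∀
  flip-₁₂ : ∀ i j → P₁₂ i (- j) ≡ P₁₂ j (- i)
  flip-₁₂ = g
    where
    g : ∀ i j → + 2 * ((i - (- j)) * (i - (- j)) * (i - (- j))) - (i - (- j)) * (+ 2 * i + (- j)) * (i + + 2 * (- j)) ≡ + 2 * ((j - (- i)) * (j - (- i)) * (j - (- i))) - (j - (- i)) * (+ 2 * j + (- i)) * (j + + 2 * (- i))
    g = solve-∀
  flip-₁ : ∀ i j → P₁ i (- j) ≡ - P₂ j (- i)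
  flip-₁ = g
    where
    g : ∀ i j → + 2 * ((+ 2 * i + (- j)) * (+ 2 * i + (- j)) * (+ 2 * i + (- j))) + (i - (- j)) * (+ 2 * i + (- j)) * (i + + 2 * (- j)) ≡ - (+ 2 * ((j + + 2 * (- i)) * (j + + 2 * (- i)) * (j + + 2 * (- i))) - (j - (- i)) * (+ 2 * j + (- i)) * (j + + 2 * (- i)))
    g = solve-∀
  A-sym : ∀ m i k j → A m i k j ≡ A k j m i
  A-sym m i k j = trans (cong₂ _+_ (cong₂ _+_ (cong₂ _*_ (flip₁₂ (+ i) (+ j)) (χ-anti m k)) (cong (_* χ m) (flip₁ (+ i) (+ j)))) (cong (_* χ k) (sym (flip₁ (+ j) (+ i)))))
    (g (P₁₂ (+ j) (+ i)) (P₁ (+ j) (+ i)) (P₂ (+ j) (+ i)) (χ (k ℕ.+ (m ℕ.+ m))) (χ m) (χ k))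
    where
    g : ∀ p q r u x y → (- p) * (- u) + r * x + q * y ≡ p * u + q * y + r * x
    g = solve-∀
  B-sym : ∀ m i k j → B m i k j ≡ B k j m i
  B-sym m i k j = trans (cong₂ _-_ (cong₂ _+_ (cong₂ _*_ (flip-₁₂ (+ i) (+ j)) (cong χ (ℕP.+-comm m k))) (cong (_* χ m) (flip-₁ (+ i) (+ j)))) (refl {x = P₂ (+ i) (- + j) * χ k}))
    (trans (g (P₁₂ (+ j) (- + i)) (P₂ (+ j) (- + i)) (P₂ (+ i) (- + j)) (χ (k ℕ.+ m)) (χ m) (χ k))
      (cong (λ z → P₁₂ (+ j) (- + i) * χ (k ℕ.+ m) + z * χ k - P₂ (+ j) (- + i) * χ m) (sym (flip-₁ (+ j) (+ i)))))
    where
    g : ∀ p q r u x y → p * u + (- q) * x - r * y ≡ p * u + (- r) * y - q * x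
    g = solve-∀
  rot : ∀ m i k j → A (m ℕ.+ k) i k j ≡ B m i k (i ℕ.+ j)
  rot m i k j = trans (cong (λ z → P₁₂ (+ i) (+ j) * z + P₁ (+ i) (+ j) * χ (m ℕ.+ k) + P₂ (+ i) (+ j) * χ k) (χ-thrice m k)) (g (+ i) (+ j) (χ (m ℕ.+ k)) (χ m) (χ k))
    where
    g : ∀ i j u x y → (+ 2 * ((i - j) * (i - j) * (i - j)) - (i - j) * (+ 2 * i + j) * (i + + 2 * j)) * x
        + (+ 2 * ((+ 2 * i + j) * (+ 2 * i + j) * (+ 2 * i + j)) + (i - j) * (+ 2 * i + j) * (i + + 2 * j)) * u
        + (+ 2 * ((i + + 2 * j) * (i + + 2 * j) * (i + + 2 * j)) - (i - j) * (+ 2 * i + j) * (i + + 2 * j)) * y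
      ≡ (+ 2 * ((i - (- (i + j))) * (i - (- (i + j))) * (i - (- (i + j)))) - (i - (- (i + j))) * (+ 2 * i + (- (i + j))) * (i + + 2 * (- (i + j)))) * u
        + (+ 2 * ((+ 2 * i + (- (i + j))) * (+ 2 * i + (- (i + j))) * (+ 2 * i + (- (i + j)))) + (i - (- (i + j))) * (+ 2 * i + (- (i + j))) * (i + + 2 * (- (i + j)))) * x
        - (+ 2 * ((i + + 2 * (- (i + j))) * (i + + 2 * (- (i + j))) * (i + + 2 * (- (i + j)))) - (i - (- (i + j))) * (+ 2 * i + (- (i + j))) * (i + + 2 * (- (i + j)))) * y
    g = solve-∀
  kernel : ∀ m i k j → + 2 * (A m i k j - B m i k j) ≡ + 2 * κ m i k j
  kernel m i k j = trans (g₁ (P₁₂ (+ i) (+ j)) (P₁₂ (+ i) (- + j)) (P₁ (+ i) (+ j)) (P₁ (+ i) (- + j)) (P₂ (+ i) (+ j)) (P₂ (+ i) (- + j)) (χ (m ℕ.+ (k ℕ.+ k))) (χ (m ℕ.+ k)) (χ m) (χ k))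
    (trans (cong₂ (λ u v → P₁₂ (+ i) (+ j) * u - P₁₂ (+ i) (- + j) * v + + 2 * ((P₁ (+ i) (+ j) - P₁ (+ i) (- + j)) * χ m) + + 2 * ((P₂ (+ i) (+ j) + P₂ (+ i) (- + j)) * χ k)) (χ-diff m k) (χ-sum m k)) (g₂ (+ i) (+ j) (χ m) (χ k)))
    where
    g₁ : ∀ p p′ q q′ r r′ u v x y → + 2 * ((p * u + q * x + r * y) - (p′ * v + q′ * x - r′ * y)) ≡ p * (+ 2 * u) - p′ * (+ 2 * v) + + 2 * ((q - q′) * x) + + 2 * ((r + r′) * y)
    g₁ = solve-∀
    g₂ : ∀ i j x y → (+ 2 * ((i - j) * (i - j) * (i - j)) - (i - j) * (+ 2 * i + j) * (i + + 2 * j)) * (x * (+ 2 - + 3 * (y * y)) - (+ 2 - + 3 * (x * x)) * y)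
       - (+ 2 * ((i - (- j)) * (i - (- j)) * (i - (- j))) - (i - (- j)) * (+ 2 * i + (- j)) * (i + + 2 * (- j))) * (x * (+ 2 - + 3 * (y * y)) + (+ 2 - + 3 * (x * x)) * y)
       + + 2 * (((+ 2 * ((+ 2 * i + j) * (+ 2 * i + j) * (+ 2 * i + j)) + (i - j) * (+ 2 * i + j) * (i + + 2 * j)) - (+ 2 * ((+ 2 * i + (- j)) * (+ 2 * i + (- j)) * (+ 2 * i + (- j))) + (i - (- j)) * (+ 2 * i + (- j)) * (i + + 2 * (- j)))) * x)
       + + 2 * (((+ 2 * ((i + + 2 * j) * (i + + 2 * j) * (i + + 2 * j)) - (i - j) * (+ 2 * i + j) * (i + + 2 * j)) + (+ 2 * ((i + + 2 * (- j)) * (i + + 2 * (- j)) * (i + + 2 * (- j))) - (i - (- j)) * (+ 2 * i + (- j)) * (i + + 2 * (- j)))) * y)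
       ≡ + 2 * (+ 1 * (x * (i * i) * ((+ 36 + + 27 * (y * y)) * j)) + + 1 * ((+ 36 + + 27 * (x * x)) * i * (y * (j * j))))
    g₂ = solve-∀
  diagonal : ∀ m d → + 2 * (sumℤ d (λ i → A (suc m) (suc i) (suc m) (d ∸ i)) - sumℤ m (λ b → B (m ∸ b) (suc d) (suc b) (suc d))) ≡ + 2 * h (suc m) (suc d)
  diagonal m d = trans (cong₂ (λ u v → + 2 * (u - v)) sA sB)
     (trans (g₁ (+ d) (+ suc d) (+ m) (χ (suc m)) (sumℤ d (λ i → + suc i)) (sumℤ d (λ i → + suc i * + suc i)))
     (trans (cong₂ (λ u v → + 36 * (+ d * (+ suc d * + suc d * + suc d * χ (suc m))) - + 18 * (+ suc d * + suc d * χ (suc m) * u) + + 6 * (+ suc d * χ (suc m) * v) - + 36 * (+ m * (+ suc d * + suc d * + suc d * χ (suc m)))) (Σx d) (Σx² d)) (g₂ (+ d) (+ m) (χ (suc m)))))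
    where
    t : ∀ i K u x → u ≡ + 0 → P₁₂ i (K - i) * u + P₁ i (K - i) * x + P₂ i (K - i) * x ≡ + 18 * (K * K * K * x) + (- + 18 * (K * K * x)) * i + (+ 18 * (K * x)) * (i * i)
    t i K .(+ 0) x refl = t′ i K x
      where
      t′ : ∀ i K x → (+ 2 * ((i - (K - i)) * (i - (K - i)) * (i - (K - i))) - (i - (K - i)) * (+ 2 * i + (K - i)) * (i + + 2 * (K - i))) * + 0
        + (+ 2 * ((+ 2 * i + (K - i)) * (+ 2 * i + (K - i)) * (+ 2 * i + (K - i))) + (i - (K - i)) * (+ 2 * i + (K - i)) * (i + + 2 * (K - i))) * x
        + (+ 2 * ((i + + 2 * (K - i)) * (i + + 2 * (K - i)) * (i + + 2 * (K - i))) - (i - (K - i)) * (+ 2 * i + (K - i)) * (i + + 2 * (K - i))) * x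
        ≡ + 18 * (K * K * K * x) + (- + 18 * (K * K * x)) * i + (+ 18 * (K * x)) * (i * i)
      t′ = solve-∀
    sA : sumℤ d (λ i → A (suc m) (suc i) (suc m) (d ∸ i)) ≡ + d * (+ 18 * (+ suc d * + suc d * + suc d * χ (suc m))) + (- + 18 * (+ suc d * + suc d * χ (suc m))) * sumℤ d (λ i → + suc i) + (+ 18 * (+ suc d * χ (suc m))) * sumℤ d (λ i → + suc i * + suc i)
    sA = trans (sum-cong d (λ i i<d → trans (cong (λ z → P₁₂ (+ suc i) z * χ (suc m ℕ.+ (suc m ℕ.+ suc m)) + P₁ (+ suc i) z * χ (suc m) + P₂ (+ suc i) z * χ (suc m)) (complℤ i<d))
       (t (+ suc i) (+ suc d) (χ (suc m ℕ.+ (suc m ℕ.+ suc m))) (χ (suc m)) (χ-thrice 0 (suc m)))))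
       (sum-poly₂ d (+ 18 * (+ suc d * + suc d * + suc d * χ (suc m))) (- + 18 * (+ suc d * + suc d * χ (suc m))) (+ 18 * (+ suc d * χ (suc m))))
    t₂ : ∀ D u x y → P₁₂ D (- D) * u + P₁ D (- D) * x - P₂ D (- D) * y ≡ + 18 * (D * D * D * u)
    t₂ = t₂′
      where
      t₂′ : ∀ D u x y → (+ 2 * ((D - (- D)) * (D - (- D)) * (D - (- D))) - (D - (- D)) * (+ 2 * D + (- D)) * (D + + 2 * (- D))) * u
        + (+ 2 * ((+ 2 * D + (- D)) * (+ 2 * D + (- D)) * (+ 2 * D + (- D))) + (D - (- D)) * (+ 2 * D + (- D)) * (D + + 2 * (- D))) * x
        - (+ 2 * ((D + + 2 * (- D)) * (D + + 2 * (- D)) * (D + + 2 * (- D))) - (D - (- D)) * (+ 2 * D + (- D)) * (D + + 2 * (- D))) * y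
        ≡ + 18 * (D * D * D * u)
      t₂′ = solve-∀
    sB : sumℤ m (λ b → B (m ∸ b) (suc d) (suc b) (suc d)) ≡ + m * (+ 18 * (+ suc d * + suc d * + suc d * χ (suc m)))
    sB = trans (sum-cong m (λ b b<m → trans (t₂ (+ suc d) (χ (m ∸ b ℕ.+ suc b)) (χ (m ∸ b)) (χ (suc b))) (cong (λ z → + 18 * (+ suc d * + suc d * + suc d * χ z)) (compl′ b<m)))) (Σ1 m _)
    g₁ : ∀ k K M x s r → + 2 * ((k * (+ 18 * (K * K * K * x)) + (- + 18 * (K * K * x)) * s + (+ 18 * (K * x)) * r) - M * (+ 18 * (K * K * K * x)))
      ≡ + 36 * (k * (K * K * K * x)) - + 18 * (K * K * x * (+ 2 * s)) + + 6 * (K * x * (+ 6 * r)) - + 36 * (M * (K * K * K * x))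
    g₁ = solve-∀
    g₂ : ∀ k M x → + 36 * (k * ((+ 1 + k) * (+ 1 + k) * (+ 1 + k) * x)) - + 18 * ((+ 1 + k) * (+ 1 + k) * x * ((+ 1 + k) * (+ 1 + k) - (+ 1 + k)))
      + + 6 * ((+ 1 + k) * x * (+ 2 * (+ 1 + k) * (+ 1 + k) * (+ 1 + k) - + 3 * (+ 1 + k) * (+ 1 + k) + (+ 1 + k))) - + 36 * (M * ((+ 1 + k) * (+ 1 + k) * (+ 1 + k) * x))
      ≡ + 2 * ((+ 15 * (x * ((+ 1 + k) * (+ 1 + k) * (+ 1 + k) * (+ 1 + k))) + + 3 * (x * ((+ 1 + k) * (+ 1 + k)))) + - + 18 * ((+ 1 + M) * (+ 1 + k) * (x * ((+ 1 + k) * (+ 1 + k)))))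
    g₂ = solve-∀
  module I = Instance A B A-sym B-sym rot (+ 2) (+ 2) (λ m i k j → + 2 * κ m i k j) (λ m d → + 2 * h m d) kernel diagonal

lK′ : ℕ → ℕ → ℤ
lK′ m d = (+ 2 - + 3 * e d) * + d

-- With the characters on the d's, the weight 3 series of `lA₃` enters. Together with `a-identity`
-- this eliminates θα and leaves a relation between B, a³ and c.
a-identity′ : ∀ n → + 6 * mul (Lam lK′) (Lam lα′) n + + 6 * mul (Lam lα′) (Lam lK′) n ≡
  + 6 * Lam lE n - + 4 * Lam lS n + + 4 * Lam lα′ n + + 6 * Lam lA₃ n - + 12 * θ (Lam lα′) n
a-identity′ n = begin
  + 6 * mul (Lam lK′) (Lam lα′) n + + 6 * mul (Lam lα′) (Lam lK′) n
    ≡⟨ trans (h₀ (mul (Lam lK′) (Lam lα′) n) (mul (Lam lα′) (Lam lK′) n)) (cong (+ 3 *_) (sym (pairSum-lin (+ 2) (+ 2) lK′ lα′ lα′ lK′ n))) ⟩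
  + 3 * pairSum n κ
    ≡⟨ I.identity n ⟩
  + 2 * Lam h n
    ≡⟨ cong (+ 2 *_) (trans (Lam-+ (λ m d → (+ 3 * lE m d + - + 2 * lS m d) + (+ 2 * lα′ m d + + 3 * lA₃ m d)) (λ m d → - + 6 * (+ m * + d * lα′ m d)) n)
         (cong₂ _+_ (trans (Lam-+ (λ m d → + 3 * lE m d + - + 2 * lS m d) (λ m d → + 2 * lα′ m d + + 3 * lA₃ m d) n) (cong₂ _+_ (Lam-lin (+ 3) (- + 2) lE lS n) (Lam-lin (+ 2) (+ 3) lα′ lA₃ n)))
            (trans (Lam-scale (- + 6) (λ m d → + m * + d * lα′ m d) n) (cong (- + 6 *_) (sym (θ-Lam lα′ n)))))) ⟩
  + 2 * (((+ 3 * Lam lE n + - + 2 * Lam lS n) + (+ 2 * Lam lα′ n + + 3 * Lam lA₃ n)) + - + 6 * θ (Lam lα′) n)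
    ≡⟨ h₁ (Lam lE n) (Lam lS n) (Lam lα′ n) (Lam lA₃ n) (θ (Lam lα′) n) ⟩
  + 6 * Lam lE n - + 4 * Lam lS n + + 4 * Lam lα′ n + + 6 * Lam lA₃ n - + 12 * θ (Lam lα′) n ∎
  where
  open ≡-Reasoning
  A B κ : ℕ → ℕ → ℕ → ℕ → ℤ
  A m i k j = + i * χ i + + j * χ j + (+ i + + j) * χ (i ℕ.+ j)
  B m i k j = + i * χ i + + j * χ j + (+ j - + i) * χ (j ℕ.+ (i ℕ.+ i))
  κ m i k j = + 2 * (lK′ m i * lα′ k j) + + 2 * (lα′ m i * lK′ k j)
  h : ℕ → ℕ → ℤ
  h m d = ((+ 3 * lE m d + - + 2 * lS m d) + (+ 2 * lα′ m d + + 3 * lA₃ m d)) + - + 6 * (+ m * + d * lα′ m d)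
  h₀ : ∀ x y → + 6 * x + + 6 * y ≡ + 3 * (+ 2 * x + + 2 * y)
  h₀ = solve-∀
  h₁ : ∀ a b c d t → + 2 * (((+ 3 * a + - + 2 * b) + (+ 2 * c + + 3 * d)) + - + 6 * t) ≡ + 6 * a - + 4 * b + + 4 * c + + 6 * d - + 12 * t
  h₁ = solve-∀
  A-sym : ∀ m i k j → A m i k j ≡ A k j m i
  A-sym m i k j = trans (cong (λ z → + i * χ i + + j * χ j + (+ i + + j) * χ z) (ℕP.+-comm i j)) (g (+ i) (+ j) (χ (j ℕ.+ i)) (χ i) (χ j))
    where
    g : ∀ i j u x y → i * x + j * y + (i + j) * u ≡ j * y + i * x + (j + i) * u
    g = solve-∀
  B-sym : ∀ m i k j → B m i k j ≡ B k j m i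
  B-sym m i k j = trans (cong (λ z → + i * χ i + + j * χ j + (+ j - + i) * z) (χ-anti j i)) (g (+ i) (+ j) (χ (i ℕ.+ (j ℕ.+ j))) (χ i) (χ j))
    where
    g : ∀ i j u x y → i * x + j * y + (j - i) * (- u) ≡ j * y + i * x + (i - j) * u
    g = solve-∀
  rot : ∀ m i k j → A (m ℕ.+ k) i k j ≡ B m i k (i ℕ.+ j)
  rot m i k j = trans (cong (λ z → + i * χ i + + j * z + (+ i + + j) * χ (i ℕ.+ j)) (sym (trans (cong (λ z → χ (z ℕ.+ (i ℕ.+ i))) (ℕP.+-comm i j)) (χ-thrice j i))))
    (g (+ i) (+ j) (χ (i ℕ.+ j)) (χ i) (χ (i ℕ.+ j ℕ.+ (i ℕ.+ i))))
    where
    g : ∀ i j u x y → i * x + j * y + (i + j) * u ≡ i * x + (i + j) * u + ((i + j) - i) * y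
    g = solve-∀
  kernel : ∀ m i k j → + 2 * (A m i k j - B m i k j) ≡ κ m i k j
  kernel m i k j = trans (g₁ (+ i) (+ j) (χ (i ℕ.+ j)) (χ (j ℕ.+ (i ℕ.+ i))) (χ i) (χ j))
    (trans (cong₂ (λ u v → (+ i + + j) * u - (+ j - + i) * v) (χ-sum i j) (χ-diff j i)) (g₂ (+ i) (+ j) (χ i) (χ j)))
    where
    g₁ : ∀ i j u v x y → + 2 * ((i * x + j * y + (i + j) * u) - (i * x + j * y + (j - i) * v)) ≡ (i + j) * (+ 2 * u) - (j - i) * (+ 2 * v)
    g₁ = solve-∀
    g₂ : ∀ i j x y → (i + j) * (x * (+ 2 - + 3 * (y * y)) + (+ 2 - + 3 * (x * x)) * y) - (j - i) * (y * (+ 2 - + 3 * (x * x)) - (+ 2 - + 3 * (y * y)) * x)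
      ≡ + 2 * ((+ 2 - + 3 * (x * x)) * i * y) + + 2 * (x * ((+ 2 - + 3 * (y * y)) * j))
    g₂ = solve-∀
  diagonal : ∀ m d → + 3 * (sumℤ d (λ i → A (suc m) (suc i) (suc m) (d ∸ i)) - sumℤ m (λ b → B (m ∸ b) (suc d) (suc b) (suc d))) ≡ h (suc m) (suc d)
  diagonal m d = trans (cong₂ (λ u v → + 3 * (u - v)) sA sB)
     (trans (g₁ (+ d) (+ suc d) (+ m) (χ (suc d)) (sumℤ d (λ i → + suc i * χ (suc i))))
     (trans (cong (λ u → u + + 3 * (+ d * (+ suc d * χ (suc d))) - + 6 * (+ m * (+ suc d * χ (suc d)))) (Σxχ d)) (g₂ (+ d) (+ m) (χ (suc d)))))
    where
    sA : sumℤ d (λ i → A (suc m) (suc i) (suc m) (d ∸ i)) ≡ sumℤ d (λ i → + suc i * χ (suc i)) + sumℤ d (λ i → + suc i * χ (suc i)) + + d * (+ suc d * χ (suc d))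
    sA = trans (sum-cong d (λ i i<d → cong (λ z → + suc i * χ (suc i) + + (d ∸ i) * χ (d ∸ i) + + z * χ z) (compl i<d)))
       (trans (sum-+ d (λ i → + suc i * χ (suc i) + + (d ∸ i) * χ (d ∸ i)) (λ _ → + suc d * χ (suc d))) (cong₂ _+_
         (trans (sum-+ d (λ i → + suc i * χ (suc i)) (λ i → + (d ∸ i) * χ (d ∸ i))) (cong (_+_ (sumℤ d (λ i → + suc i * χ (suc i)))) (sum-reverse d (λ i → + i * χ i)))) (Σ1 d _)))
    t₂ : ∀ D u x → D * x + D * x + (D - D) * u ≡ + 2 * (D * x)
    t₂ = solve-∀
    sB : sumℤ m (λ b → B (m ∸ b) (suc d) (suc b) (suc d)) ≡ + m * (+ 2 * (+ suc d * χ (suc d)))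
    sB = trans (sum-cong′ m (λ b → t₂ (+ suc d) (χ (suc d ℕ.+ (suc d ℕ.+ suc d))) (χ (suc d)))) (Σ1 m _)
    g₁ : ∀ k K M x s → + 3 * ((s + s + k * (K * x)) - M * (+ 2 * (K * x))) ≡ + 6 * s + + 3 * (k * (K * x)) - + 6 * (M * (K * x))
    g₁ = solve-∀
    g₂ : ∀ k M x → (+ 3 * (+ 1 + k) * (x * x) - + 2 * (+ 1 + k) + (+ 2 - + 3 * (+ 1 + k)) * x) + + 3 * (k * ((+ 1 + k) * x)) - + 6 * (M * ((+ 1 + k) * x))
      ≡ ((+ 3 * (x * x * (+ 1 + k)) + - + 2 * (+ 1 + k)) + (+ 2 * x + + 3 * (x * ((+ 1 + k) * (+ 1 + k))))) + - + 6 * ((+ 1 + M) * (+ 1 + k) * x)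
    g₂ = solve-∀
  module I = Instance A B A-sym B-sym rot (+ 2) (+ 3) κ h kernel diagonal

-- The convolution behind C = wB. As in `C*-identity`, the sheared kernel has a factor j - i that
-- kills the diagonal d₁ = d₂.
C-identity : ∀ n → - + 72 * mul (Lam lA₃) (Lam lE) n + - + 72 * mul (Lam lE) (Lam lA₃) n ≡ + 4 * Lam lA₅ n + + 12 * Lam lA₃ n - + 16 * Lam lE n
C-identity n = begin
  - + 72 * mul (Lam lA₃) (Lam lE) n + - + 72 * mul (Lam lE) (Lam lA₃) n
    ≡⟨ trans (h₀ (mul (Lam lA₃) (Lam lE) n) (mul (Lam lE) (Lam lA₃) n)) (cong (+ 36 *_) (sym (pairSum-lin (- + 2) (- + 2) lA₃ lE lE lA₃ n))) ⟩
  + 36 * pairSum n κ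
    ≡⟨ I.identity n ⟩
  + 2 * Lam h n
    ≡⟨ cong (+ 2 *_) (trans (Lam-+ (λ m d → + 2 * lA₅ m d + + 6 * lA₃ m d) (λ m d → - + 8 * lE m d) n)
         (cong₂ _+_ (Lam-lin (+ 2) (+ 6) lA₅ lA₃ n) (Lam-scale (- + 8) lE n))) ⟩
  + 2 * ((+ 2 * Lam lA₅ n + + 6 * Lam lA₃ n) + - + 8 * Lam lE n)
    ≡⟨ h₁ (Lam lA₅ n) (Lam lA₃ n) (Lam lE n) ⟩
  + 4 * Lam lA₅ n + + 12 * Lam lA₃ n - + 16 * Lam lE n ∎
  where
  open ≡-Reasoning
  A B κ : ℕ → ℕ → ℕ → ℕ → ℤ
  A m i k j = + i * + j * (+ i + + j) * (χ i * χ j * χ (i ℕ.+ j))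
  B m i k j = + i * + j * (+ j - + i) * (χ i * χ j * χ (j ℕ.+ (i ℕ.+ i)))
  κ m i k j = - + 2 * (lA₃ m i * lE k j) + - + 2 * (lE m i * lA₃ k j)
  h : ℕ → ℕ → ℤ
  h m d = (+ 2 * lA₅ m d + + 6 * lA₃ m d) + - + 8 * lE m d
  h₀ : ∀ x y → - + 72 * x + - + 72 * y ≡ + 36 * (- + 2 * x + - + 2 * y)
  h₀ = solve-∀
  h₁ : ∀ a b c → + 2 * ((+ 2 * a + + 6 * b) + - + 8 * c) ≡ + 4 * a + + 12 * b - + 16 * c
  h₁ = solve-∀
  A-sym : ∀ m i k j → A m i k j ≡ A k j m i
  A-sym m i k j = trans (cong (λ z → + i * + j * (+ i + + j) * (χ i * χ j * χ z)) (ℕP.+-comm i j)) (g (+ i) (+ j) (χ (j ℕ.+ i)) (χ i) (χ j))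
    where
    g : ∀ i j u x y → i * j * (i + j) * (x * y * u) ≡ j * i * (j + i) * (y * x * u)
    g = solve-∀
  B-sym : ∀ m i k j → B m i k j ≡ B k j m i
  B-sym m i k j = trans (cong (λ z → + i * + j * (+ j - + i) * (χ i * χ j * z)) (χ-anti j i)) (g (+ i) (+ j) (χ (i ℕ.+ (j ℕ.+ j))) (χ i) (χ j))
    where
    g : ∀ i j u x y → i * j * (j - i) * (x * y * (- u)) ≡ j * i * (i - j) * (y * x * u)
    g = solve-∀
  rot : ∀ m i k j → A (m ℕ.+ k) i k j ≡ B m i k (i ℕ.+ j)
  rot m i k j = trans (cong (λ z → + i * + j * (+ i + + j) * (χ i * z * χ (i ℕ.+ j))) (sym (trans (cong (λ z → χ (z ℕ.+ (i ℕ.+ i))) (ℕP.+-comm i j)) (χ-thrice j i))))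
    (g (+ i) (+ j) (χ (i ℕ.+ j)) (χ i) (χ (i ℕ.+ j ℕ.+ (i ℕ.+ i))))
    where
    g : ∀ i j u x y → i * j * (i + j) * (x * y * u) ≡ i * (i + j) * ((i + j) - i) * (x * u * y)
    g = solve-∀
  kernel : ∀ m i k j → + 2 * (A m i k j - B m i k j) ≡ κ m i k j
  kernel m i k j = trans (g₁ (+ i) (+ j) (χ i * χ j * χ (i ℕ.+ j)) (χ i * χ j * χ (j ℕ.+ (i ℕ.+ i))))
    (trans (cong₂ (λ u v → + i * + j * (+ i + + j) * u - + i * + j * (+ j - + i) * v) (χχχ-sum i j) (χχχ-diff i j)) (g₂ (+ i) (+ j) (χ i) (χ j)))
    where
    g₁ : ∀ i j u v → + 2 * (i * j * (i + j) * u - i * j * (j - i) * v) ≡ i * j * (i + j) * (+ 2 * u) - i * j * (j - i) * (+ 2 * v)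
    g₁ = solve-∀
    g₂ : ∀ i j x y → i * j * (i + j) * (- (x * (y * y) + x * x * y)) - i * j * (j - i) * (- (x * (y * y) - x * x * y))
      ≡ - + 2 * (x * (i * i) * (y * y * j)) + - + 2 * (x * x * i * (y * (j * j)))
    g₂ = solve-∀
  diagonal : ∀ m d → + 36 * (sumℤ d (λ i → A (suc m) (suc i) (suc m) (d ∸ i)) - sumℤ m (λ b → B (m ∸ b) (suc d) (suc b) (suc d))) ≡ h (suc m) (suc d)
  diagonal m d = trans (cong (λ v → + 36 * (sumℤ d (λ i → A (suc m) (suc i) (suc m) (d ∸ i)) - v)) (sum-zero m (λ b _ → t₂ (+ suc d) (χ (suc d) * χ (suc d) * χ (suc d ℕ.+ (suc d ℕ.+ suc d))))))
     (trans (g₀ (sumℤ d (λ i → A (suc m) (suc i) (suc m) (d ∸ i)))) (trans (cong (+ 18 *_) sA)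
     (trans (g₁ (+ suc d) X (sumℤ d (λ i → + suc i * (χ (suc i) * χ (suc i)))) (sumℤ d (λ i → + suc i * + suc i * (χ (suc i) * χ (suc i)))) (sumℤ d (λ i → + suc i * χ (suc i))) (sumℤ d (λ i → + suc i * + suc i * χ (suc i))))
     (trans (cong₂ (λ u v → u - v) (cong₂ (λ u v → + 3 * (+ suc d * + suc d * X * u) - + suc d * X * v) (Σxe d) (Σx²e d)) (cong₂ (λ u v → + 3 * (+ suc d * + suc d * (X * X) * u) - + 3 * (+ suc d * (X * X) * v)) (Σxχ d) (Σx²χ d)))
       (g₂ (+ suc d) (cl (suc d)))))))
    where
    X = χ (suc d)
    t₂ : ∀ D u → D * D * (D - D) * u ≡ + 0
    t₂ = solve-∀
    g₀ : ∀ x → + 36 * (x - + 0) ≡ + 18 * (+ 2 * x)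
    g₀ = solve-∀
    t : ∀ i K u x y → + 2 * u ≡ x * (y * y) - x * x * y → + 2 * (i * (K - i) * K * u) ≡ K * (K * x * (i * (y * y)) - x * (i * i * (y * y)) - (K * (x * x) * (i * y) - x * x * (i * i * y)))
    t i K u x y h = trans (t₁ i K u) (trans (cong (i * (K - i) * K *_) h) (t₃ i K x y))
      where
      t₁ : ∀ i K u → + 2 * (i * (K - i) * K * u) ≡ i * (K - i) * K * (+ 2 * u)
      t₁ = solve-∀
      t₃ : ∀ i K x y → i * (K - i) * K * (x * (y * y) - x * x * y) ≡ K * (K * x * (i * (y * y)) - x * (i * i * (y * y)) - (K * (x * x) * (i * y) - x * x * (i * i * y)))
      t₃ = solve-∀
    sum-- : ∀ n (f g : ℕ → ℤ) → sumℤ n (λ k → f k - g k) ≡ sumℤ n f - sumℤ n g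
    sum-- n f g = trans (sum-+ n f (λ k → - g k)) (cong (_+_ (sumℤ n f)) (sum-neg n g))
    sA : + 2 * sumℤ d (λ i → A (suc m) (suc i) (suc m) (d ∸ i)) ≡ + suc d *
      (+ suc d * X * sumℤ d (λ i → + suc i * (χ (suc i) * χ (suc i))) - X * sumℤ d (λ i → + suc i * + suc i * (χ (suc i) * χ (suc i)))
      - (+ suc d * (X * X) * sumℤ d (λ i → + suc i * χ (suc i)) - X * X * sumℤ d (λ i → + suc i * + suc i * χ (suc i))))
    sA = trans (sym (sum-*ˡ d (+ 2) (λ i → A (suc m) (suc i) (suc m) (d ∸ i)))) (trans (sum-cong d (λ i i<d →
        trans (cong₂ (λ u v → + 2 * (+ suc i * u * + v * (χ (suc i) * χ (d ∸ i) * χ v))) (complℤ i<d) (compl i<d))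
          (t (+ suc i) (+ suc d) (χ (suc i) * χ (d ∸ i) * X) X (χ (suc i)) (subst (λ z → + 2 * (χ (suc i) * χ (d ∸ i) * χ z) ≡ χ z * e (suc i) - e z * χ (suc i)) (compl i<d) (χχχ (suc i) (d ∸ i))))))
      (trans (sum-*ˡ d (+ suc d) _) (cong (+ suc d *_) (trans (sum-- d _ _) (cong₂ _-_
        (trans (sum-- d _ _) (cong₂ _-_ (sum-*ˡ d (+ suc d * X) (λ i → + suc i * (χ (suc i) * χ (suc i)))) (sum-*ˡ d X (λ i → + suc i * + suc i * (χ (suc i) * χ (suc i))))))
        (trans (sum-- d _ _) (cong₂ _-_ (sum-*ˡ d (+ suc d * (X * X)) (λ i → + suc i * χ (suc i))) (sum-*ˡ d (X * X) (λ i → + suc i * + suc i * χ (suc i))))))))))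
    g₁ : ∀ K x s₁ s₂ s₃ s₄ → + 18 * (K * (K * x * s₁ - x * s₂ - (K * (x * x) * s₃ - x * x * s₄)))
      ≡ (+ 3 * (K * K * x * (+ 6 * s₁)) - K * x * (+ 18 * s₂)) - (+ 3 * (K * K * (x * x) * (+ 6 * s₃)) - + 3 * (K * (x * x) * (+ 6 * s₄)))
    g₁ = solve-∀
    Exp : ℤ → ℤ → ℤ
    Exp k x = (+ 3 * (k * k * x * (+ 2 * k * k + (+ 2 - + 3 * k) * (x * x) - k * x))
       - k * x * (+ 4 * k * k * k - + 6 * k + (+ 12 * k - + 9 * k * k) * (x * x) + (+ 2 - + 3 * k * k) * x))
       - (+ 3 * (k * k * (x * x) * (+ 3 * k * (x * x) - + 2 * k + (+ 2 - + 3 * k) * x))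
       - + 3 * (k * (x * x) * ((+ 3 * k * k - + 2) * (x * x) - + 2 * k * k + (+ 4 * k - + 3 * k * k) * x)))
    g₂ : ∀ k s → Exp k ⌊ s ⌋ ≡ (+ 2 * (⌊ s ⌋ * (k * k * k * k)) + + 6 * (⌊ s ⌋ * (k * k))) + - + 8 * (⌊ s ⌋ * ⌊ s ⌋ * k)
    g₂ k t0 = c k
      where
      c : ∀ k → (+ 3 * (k * k * + 0 * (+ 2 * k * k + (+ 2 - + 3 * k) * (+ 0 * + 0) - k * + 0))
       - k * + 0 * (+ 4 * k * k * k - + 6 * k + (+ 12 * k - + 9 * k * k) * (+ 0 * + 0) + (+ 2 - + 3 * k * k) * + 0))
       - (+ 3 * (k * k * (+ 0 * + 0) * (+ 3 * k * (+ 0 * + 0) - + 2 * k + (+ 2 - + 3 * k) * + 0))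
       - + 3 * (k * (+ 0 * + 0) * ((+ 3 * k * k - + 2) * (+ 0 * + 0) - + 2 * k * k + (+ 4 * k - + 3 * k * k) * + 0)))
       ≡ (+ 2 * (+ 0 * (k * k * k * k)) + + 6 * (+ 0 * (k * k))) + - + 8 * (+ 0 * + 0 * k)
      c = solve-∀
    g₂ k t1 = c k
      where
      c : ∀ k → (+ 3 * (k * k * + 1 * (+ 2 * k * k + (+ 2 - + 3 * k) * (+ 1 * + 1) - k * + 1))
       - k * + 1 * (+ 4 * k * k * k - + 6 * k + (+ 12 * k - + 9 * k * k) * (+ 1 * + 1) + (+ 2 - + 3 * k * k) * + 1))
       - (+ 3 * (k * k * (+ 1 * + 1) * (+ 3 * k * (+ 1 * + 1) - + 2 * k + (+ 2 - + 3 * k) * + 1))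
       - + 3 * (k * (+ 1 * + 1) * ((+ 3 * k * k - + 2) * (+ 1 * + 1) - + 2 * k * k + (+ 4 * k - + 3 * k * k) * + 1)))
       ≡ (+ 2 * (+ 1 * (k * k * k * k)) + + 6 * (+ 1 * (k * k))) + - + 8 * (+ 1 * + 1 * k)
      c = solve-∀
    g₂ k t2 = c k
      where
      c : ∀ k → (+ 3 * (k * k * (- + 1) * (+ 2 * k * k + (+ 2 - + 3 * k) * ((- + 1) * (- + 1)) - k * (- + 1)))
       - k * (- + 1) * (+ 4 * k * k * k - + 6 * k + (+ 12 * k - + 9 * k * k) * ((- + 1) * (- + 1)) + (+ 2 - + 3 * k * k) * (- + 1)))
       - (+ 3 * (k * k * ((- + 1) * (- + 1)) * (+ 3 * k * ((- + 1) * (- + 1)) - + 2 * k + (+ 2 - + 3 * k) * (- + 1)))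
       - + 3 * (k * ((- + 1) * (- + 1)) * ((+ 3 * k * k - + 2) * ((- + 1) * (- + 1)) - + 2 * k * k + (+ 4 * k - + 3 * k * k) * (- + 1))))
       ≡ (+ 2 * ((- + 1) * (k * k * k * k)) + + 6 * ((- + 1) * (k * k))) + - + 8 * ((- + 1) * (- + 1) * k)
      c = solve-∀
  module I = Instance A B A-sym B-sym rot (+ 2) (+ 36) κ h kernel diagonal

-- Sums over multiples of p

sum-multiples : ∀ p k (φ : ℕ → ℤ) → (∀ x → ¬ (suc p ∣ₙ x) → φ x ≡ + 0) →
  sumℤ (k ℕ.* suc p) (λ i → φ (suc i)) ≡ sumℤ k (λ i → φ (suc i ℕ.* suc p))
sum-multiples p zero    φ h = refl
sum-multiples p (suc k) φ h = trans (cong (λ z → sumℤ z (λ i → φ (suc i))) (ℕP.+-comm (suc p) (k ℕ.* suc p)))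
  (trans (sum-split (k ℕ.* suc p) (suc p) (λ i → φ (suc i)))
  (cong₂ _+_ (sum-multiples p k φ h)
    (trans (cong₂ _+_ (sum-zero p (λ j j<p → h (suc (k ℕ.* suc p ℕ.+ j)) (λ d → ℕP.<⇒≱ (s≤s j<p) (ℕD.∣⇒≤ (ℕD.∣m+n∣m⇒∣n (subst (suc p ∣ₙ_) (sym (ℕP.+-suc (k ℕ.* suc p) j)) d) (ℕD.n∣m*n k)))))) refl)
      (trans (ℤP.+-identityˡ _) (cong φ (trans (cong suc (ℕP.+-comm (k ℕ.* suc p) p)) refl))))))

three∤ : ∀ x → ¬ (3 ∣ₙ x) → + 1 - e x ≡ + 0
three∤ 0 h = Data.Empty.⊥-elim (h (3 ℕD.∣0))
  where import Data.Empty
three∤ 1 h = refl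
three∤ 2 h = refl
three∤ (suc (suc (suc x))) h = trans (g (cl x)) (three∤ x (λ d → h (ℕD.∣m∣n⇒∣m+n (ℕD.∣-refl {3}) d)))
  where
  g : ∀ s → + 1 - ⌊ succ (succ (succ s)) ⌋ * ⌊ succ (succ (succ s)) ⌋ ≡ + 1 - ⌊ s ⌋ * ⌊ s ⌋
  g t0 = refl
  g t1 = refl
  g t2 = refl

three∣ : ∀ x → + 1 - e (x ℕ.* 3) ≡ + 1
three∣ zero    = refl
three∣ (suc x) = trans (g (cl (x ℕ.* 3))) (three∣ x)
  where
  g : ∀ s → + 1 - ⌊ succ (succ (succ s)) ⌋ * ⌊ succ (succ (succ s)) ⌋ ≡ + 1 - ⌊ s ⌋ * ⌊ s ⌋
  g t0 = refl
  g t1 = refl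
  g t2 = refl

sum-three : ∀ n (φ : ℕ → ℤ) → (∀ x → n < x → φ x ≡ + 0) →
  sumℤ n (λ i → (+ 1 - e (suc i)) * φ (suc i)) ≡ sumℤ n (λ i → φ (suc i ℕ.* 3))
sum-three n φ h = trans (sym (sum-extend (λ i → (+ 1 - e (suc i)) * φ (suc i)) (ℕP.m≤m*n n 3) (λ k n≤k → *0ʳ (+ 1 - e (suc k)) (h (suc k) (s≤s n≤k)))))
  (trans (sum-multiples 2 n (λ x → (+ 1 - e x) * φ x) (λ x n∤ → cong (_* φ x) (three∤ x n∤)))
  (sum-cong′ n (λ i → trans (cong (_* φ (suc i ℕ.* 3)) (three∣ (suc i))) (ℤP.*-identityˡ _))))

-- 3 | d and 3 | m select the same terms m (3d) = (3m) d.
three-shift : ∀ n → Lam (λ m d → (+ 1 - e d) * + d) n ≡ + 3 * Lam (λ m d → (+ 1 - e m) * + d) n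
three-shift n = trans (sum-swap n n _) (trans (sum-cong′ n (λ a → trans (sum-cong′ n (λ i → ℤP.*-assoc (+ 1 - e (suc i)) (+ suc i) (δ (suc a ℕ.* suc i) n)))
   (sum-three n (λ x → + x * δ (suc a ℕ.* x) n) (λ x n<x → *0ʳ (+ x) (δ-> (ℕP.≤-trans n<x (ℕP.m≤n*m x (suc a))))))))
  (trans (trans (sum-swap n n _) (sum-cong′ n (λ i → trans (sum-cong′ n (λ a → g a i)) (trans (sum-*ˡ n (+ 3) _) (cong (+ 3 *_) (sym
     (trans (sum-cong′ n (λ a → ℤP.*-assoc (+ 1 - e (suc a)) (+ suc i) (δ (suc a ℕ.* suc i) n))) (sum-three n (λ x → + suc i * δ (x ℕ.* suc i) n) (λ x n<x → *0ʳ (+ suc i) (δ-> (ℕP.≤-trans n<x (ℕP.m≤m*n x (suc i)))))))))))))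
   (sum-*ˡ n (+ 3) _)))
  where
  g : ∀ a i → + (suc i ℕ.* 3) * δ (suc a ℕ.* (suc i ℕ.* 3)) n ≡ + 3 * (+ suc i * δ (suc a ℕ.* 3 ℕ.* suc i) n)
  g a i = trans (cong₂ (λ u v → u * δ v n) (ℤP.pos-* (suc i) 3) (solve₃ (suc a) (suc i))) (g′ (+ suc i) (δ (suc a ℕ.* 3 ℕ.* suc i) n))
    where
    g′ : ∀ x y → x * + 3 * y ≡ + 3 * (x * y)
    g′ = solve-∀
    solve₃ : ∀ x y → x ℕ.* (y ℕ.* 3) ≡ x ℕ.* 3 ℕ.* y
    solve₃ = ℕS.solve 2 (λ x y → x ℕS.:* (y ℕS.:* ℕS.con 3) ℕS.:= x ℕS.:* ℕS.con 3 ℕS.:* y) refl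

open Exact using (_≈_; pw; at; ≐⇒≈; ≈-refl; ≈-sym; ≈-trans; ≈-reflexive; +-cong; *-cong; -‿cong; setoid)

module _ where

  open import Relation.Binary.Reasoning.Setoid setoid
  open Exact.Solver using (solve; con; _:+_; _:*_; _:-_; :-_; _:=_; Polynomial; var; ⟦_⟧; prove)

  K : ℤ → Series
  K = const

  K⊙ : ∀ c f → K c ⊙ f ≈ scale c f
  K⊙ c f = pw (λ n → trans (⊙-at (K c) f n) (mul-const c f n))

  θ-cong : ∀ {f g} → f ≈ g → θ f ≈ θ g
  θ-cong h = pw (λ n → cong (+ n *_) (at h n))

  opaque
    unfolding _⊕_ _⊙_ neg
    θ-+ : ∀ f g → θ (f ⊕ g) ≈ θ f ⊕ θ g
    θ-+ f g = pw (λ n → ℤP.*-distribˡ-+ (+ n) (f n) (g n))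

    θ-neg : ∀ f → θ (neg f) ≈ neg (θ f)
    θ-neg f = pw (λ n → sym (ℤP.neg-distribʳ-* (+ n) (f n)))

  θ-K : ∀ c → θ (K c) ≈ K (+ 0)
  θ-K c = pw λ { zero → refl ; (suc n) → ℤP.*-zeroʳ (+ suc n) }

  opaque
    unfolding _⊕_ _⊙_ neg
    θ-* : ∀ f g → θ (f ⊙ g) ≈ θ f ⊙ g ⊕ f ⊙ θ g
    θ-* f g = pw λ n → trans (sym (sum-*ˡ (suc n) (+ n) (λ k → f k * g (n ∸ k)))) (trans (sum-cong (suc n) (λ { k (s≤s k≤n) →
        trans (cong (λ z → + z * (f k * g (n ∸ k))) (sym (ℕP.m+[n∸m]≡n k≤n))) (h (+ k) (+ (n ∸ k)) (f k) (g (n ∸ k))) }))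
      (sum-+ (suc n) (λ k → + k * f k * g (n ∸ k)) (λ k → f k * (+ (n ∸ k) * g (n ∸ k)))))
      where
      h : ∀ k l x y → (k + l) * (x * y) ≡ k * x * y + x * (l * y)
      h = solve-∀

  θ-K* : ∀ c f → θ (K c ⊙ f) ≈ K c ⊙ θ f
  θ-K* c f = begin
    θ (K c ⊙ f)               ≈⟨ θ-* (K c) f ⟩
    θ (K c) ⊙ f ⊕ K c ⊙ θ f   ≈⟨ +-cong (*-cong (θ-K c) ≈-refl) ≈-refl ⟩
    K (+ 0) ⊙ f ⊕ K c ⊙ θ f   ≈⟨ solve 2 (λ f g → con (+ 0) :* f :+ g := g) ≈-refl f (K c ⊙ θ f) ⟩
    K c ⊙ θ f                 ∎

  K-cancel : ∀ c .{{_ : ℤ.NonZero c}} {f g} → K c ⊙ f ≈ K c ⊙ g → f ≈ g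
  K-cancel c {f} {g} h = pw (λ n → ℤP.*-cancelˡ-≡ c (f n) (g n) (trans (sym (at (K⊙ c f) n)) (trans (at h n) (at (K⊙ c g) n))))

  -- The differential ring generated by Eisenstein series of level 3

  αₛ Eₛ Yₛ Sₛ cₛ C*ₛ A₃ₛ A₅ₛ : Series
  αₛ  = Lam lα
  Eₛ  = Lam lE
  Yₛ  = Lam lY
  Sₛ  = Lam lS
  cₛ  = Lam lc
  C*ₛ = Lam lC
  A₃ₛ = Lam lA₃
  A₅ₛ = Lam lA₅

  -- In the notation of the Borweins, `aₛ` is the cubic theta function a(q), `Bₛ` is b(q)³ and `cₛ`
  -- is c(q)³/27. The quasimodular `yₛ` is (E₂(q) - E₂(q³))/8, one third of the logarithmic
  -- derivative of `Bₛ`.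
  aₛ wₛ yₛ Bₛ : Series
  aₛ = K (+ 1) ⊕ K (+ 6) ⊙ αₛ
  wₛ = K (+ 1) ⊕ K (+ 12) ⊙ Eₛ
  yₛ = K (- + 3) ⊙ Yₛ
  Bₛ = K (+ 1) ⊖ K (+ 9) ⊙ A₃ₛ

  private
    opaque
     unfolding _⊕_ _⊙_ neg

     sq : K (+ 12) ⊙ (αₛ ⊙ αₛ) ≈ K (+ 4) ⊙ Eₛ ⊖ K (+ 4) ⊙ αₛ
     sq = pw λ n → trans (mul-const (+ 12) (mul αₛ αₛ) n) (trans (square-identity n) (sym (cong₂ _-_ (mul-const (+ 4) Eₛ n) (mul-const (+ 4) αₛ n))))

     yi : K (+ 12) ⊙ (Yₛ ⊙ Yₛ) ⊖ K (+ 12) ⊙ (cₛ ⊙ αₛ) ⊖ K (+ 12) ⊙ (αₛ ⊙ cₛ) ≈ K (+ 4) ⊙ cₛ ⊖ K (+ 4) ⊙ θ Yₛ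
     yi = pw λ n → trans (cong₂ _-_ (cong₂ _-_ (mul-const (+ 12) (mul Yₛ Yₛ) n) (mul-const (+ 12) (mul cₛ αₛ) n)) (mul-const (+ 12) (mul αₛ cₛ) n)) (trans (y-identity n) (sym (cong₂ _-_ (mul-const (+ 4) cₛ n) (mul-const (+ 4) (θ Yₛ) n))))

     ai : K (+ 3) ⊙ (αₛ ⊙ Yₛ) ⊕ K (+ 3) ⊙ (Yₛ ⊙ αₛ) ≈ K (+ 3) ⊙ cₛ ⊖ Yₛ ⊖ K (+ 2) ⊙ θ αₛ
     ai = pw λ n → trans (cong₂ _+_ (mul-const (+ 3) (mul αₛ Yₛ) n) (mul-const (+ 3) (mul Yₛ αₛ) n)) (trans (a-identity n) (sym (cong₂ _-_ (cong₂ _-_ (mul-const (+ 3) cₛ n) (refl {x = Yₛ n})) (mul-const (+ 2) (θ αₛ) n))))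

     shift : Sₛ ⊖ Eₛ ≈ K (+ 3) ⊙ (Sₛ ⊖ Yₛ)
     shift = pw λ n → trans (sym (trans (Lam-cong (λ m d → (+ 1 - e d) * + d) (λ m d → + 1 * lS m d + - + 1 * lE m d) (λ m d → h₁ (+ suc d) (e (suc d))) n)
         (trans (Lam-lin (+ 1) (- + 1) lS lE n) (h₂ (Sₛ n) (Eₛ n)))))
       (trans (three-shift n) (sym (trans (mul-const (+ 3) (Sₛ ⊖ Yₛ) n) (cong (+ 3 *_) (sym (trans (Lam-cong (λ m d → (+ 1 - e m) * + d) (λ m d → + 1 * lS m d + - + 1 * lY m d) (λ m d → h₁ (+ suc d) (e (suc m))) n)
         (trans (Lam-lin (+ 1) (- + 1) lS lY n) (h₂ (Sₛ n) (Yₛ n)))))))))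
       where
       h₁ : ∀ d x → (+ 1 - x) * d ≡ + 1 * d + - + 1 * (x * d)
       h₁ = solve-∀
       h₂ : ∀ x y → + 1 * x + - + 1 * y ≡ x - y
       h₂ = solve-∀

     lin : ∀ p q (f g h : ℕ → ℕ → ℤ) → (∀ m d → f m d ≡ p * g m d + q * h m d) → Lam f ≈ K p ⊙ Lam g ⊕ K q ⊙ Lam h
     lin p q f g h eq = pw λ n → trans (Lam-cong f (λ m d → p * g m d + q * h m d) (λ m d → eq (suc m) (suc d)) n)
       (trans (Lam-lin p q g h n) (sym (cong₂ _+_ (mul-const p (Lam g) n) (mul-const q (Lam h) n))))

    Kₛ≈ : Lam lK ≈ neg Eₛ
    Kₛ≈ = begin
      Lam lK ≈⟨ lin (+ 2) (- + 3) lK lS lY (λ m d → h (+ d) (e m)) ⟩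
      K (+ 2) ⊙ Sₛ ⊕ K (- + 3) ⊙ Yₛ
        ≈⟨ solve 2 (λ S Y → con (+ 2) :* S :+ con (- + 3) :* Y := con (+ 3) :* (S :- Y) :- S) ≈-refl Sₛ Yₛ ⟩
      K (+ 3) ⊙ (Sₛ ⊖ Yₛ) ⊖ Sₛ ≈⟨ +-cong (≈-sym shift) ≈-refl ⟩
      Sₛ ⊖ Eₛ ⊖ Sₛ ≈⟨ solve 2 (λ S E → S :- E :- S := :- E) ≈-refl Sₛ Eₛ ⟩
      neg Eₛ ∎
      where
      h : ∀ d x → (+ 2 - + 3 * x) * d ≡ + 2 * d + - + 3 * (x * d)
      h = solve-∀

    2S : K (+ 2) ⊙ Sₛ ≈ K (+ 3) ⊙ Yₛ ⊖ Eₛ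
    2S = begin
      K (+ 2) ⊙ Sₛ ≈⟨ solve 2 (λ S Y → con (+ 2) :* S := con (+ 3) :* (S :- Y) :- S :+ con (+ 3) :* Y) ≈-refl Sₛ Yₛ ⟩
      K (+ 3) ⊙ (Sₛ ⊖ Yₛ) ⊖ Sₛ ⊕ K (+ 3) ⊙ Yₛ ≈⟨ +-cong (+-cong (≈-sym shift) ≈-refl) ≈-refl ⟩
      Sₛ ⊖ Eₛ ⊖ Sₛ ⊕ K (+ 3) ⊙ Yₛ ≈⟨ solve 3 (λ S E Y → S :- E :- S :+ con (+ 3) :* Y := con (+ 3) :* Y :- E) ≈-refl Sₛ Eₛ Yₛ ⟩
      K (+ 3) ⊙ Yₛ ⊖ Eₛ ∎

  a²≈w : aₛ ⊙ aₛ ≈ wₛ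
  a²≈w = begin
    aₛ ⊙ aₛ ≈⟨ solve 1 (λ α → (con (+ 1) :+ con (+ 6) :* α) :* (con (+ 1) :+ con (+ 6) :* α) := con (+ 1) :+ con (+ 12) :* α :+ con (+ 3) :* (con (+ 12) :* (α :* α))) ≈-refl αₛ ⟩
    K (+ 1) ⊕ K (+ 12) ⊙ αₛ ⊕ K (+ 3) ⊙ (K (+ 12) ⊙ (αₛ ⊙ αₛ)) ≈⟨ +-cong ≈-refl (*-cong ≈-refl sq) ⟩
    K (+ 1) ⊕ K (+ 12) ⊙ αₛ ⊕ K (+ 3) ⊙ (K (+ 4) ⊙ Eₛ ⊖ K (+ 4) ⊙ αₛ)
      ≈⟨ solve 2 (λ α E → con (+ 1) :+ con (+ 12) :* α :+ con (+ 3) :* (con (+ 4) :* E :- con (+ 4) :* α) := con (+ 1) :+ con (+ 12) :* E) ≈-refl αₛ Eₛ ⟩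
    wₛ ∎

  θa : θ aₛ ≈ aₛ ⊙ yₛ ⊕ K (+ 9) ⊙ cₛ
  θa = begin
    θ aₛ ≈⟨ ≈-trans (θ-+ (K (+ 1)) (K (+ 6) ⊙ αₛ)) (+-cong (θ-K (+ 1)) (θ-K* (+ 6) αₛ)) ⟩
    K (+ 0) ⊕ K (+ 6) ⊙ θ αₛ
      ≈⟨ solve 4 (λ t α Y c → con (+ 0) :+ con (+ 6) :* t := con (+ 9) :* c :- con (+ 3) :* Y :- con (+ 3) :* (con (+ 3) :* c :- Y :- con (+ 2) :* t)) ≈-refl (θ αₛ) αₛ Yₛ cₛ ⟩
    K (+ 9) ⊙ cₛ ⊖ K (+ 3) ⊙ Yₛ ⊖ K (+ 3) ⊙ (K (+ 3) ⊙ cₛ ⊖ Yₛ ⊖ K (+ 2) ⊙ θ αₛ)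
      ≈⟨ +-cong ≈-refl (-‿cong (*-cong ≈-refl (≈-sym ai))) ⟩
    K (+ 9) ⊙ cₛ ⊖ K (+ 3) ⊙ Yₛ ⊖ K (+ 3) ⊙ (K (+ 3) ⊙ (αₛ ⊙ Yₛ) ⊕ K (+ 3) ⊙ (Yₛ ⊙ αₛ))
      ≈⟨ solve 3 (λ α Y c → con (+ 9) :* c :- con (+ 3) :* Y :- con (+ 3) :* (con (+ 3) :* (α :* Y) :+ con (+ 3) :* (Y :* α))
           := (con (+ 1) :+ con (+ 6) :* α) :* (con (- + 3) :* Y) :+ con (+ 9) :* c) ≈-refl αₛ Yₛ cₛ ⟩
    aₛ ⊙ yₛ ⊕ K (+ 9) ⊙ cₛ ∎

  θy : θ yₛ ≈ yₛ ⊙ yₛ ⊖ K (+ 3) ⊙ (aₛ ⊙ cₛ)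
  θy = K-cancel (+ 4) (begin
    K (+ 4) ⊙ θ yₛ ≈⟨ *-cong ≈-refl (θ-K* (- + 3) Yₛ) ⟩
    K (+ 4) ⊙ (K (- + 3) ⊙ θ Yₛ)
      ≈⟨ solve 2 (λ t c → con (+ 4) :* (con (- + 3) :* t) := con (+ 3) :* (con (+ 4) :* c :- con (+ 4) :* t) :- con (+ 12) :* c) ≈-refl (θ Yₛ) cₛ ⟩
    K (+ 3) ⊙ (K (+ 4) ⊙ cₛ ⊖ K (+ 4) ⊙ θ Yₛ) ⊖ K (+ 12) ⊙ cₛ ≈⟨ +-cong (*-cong ≈-refl (≈-sym yi)) ≈-refl ⟩
    K (+ 3) ⊙ (K (+ 12) ⊙ (Yₛ ⊙ Yₛ) ⊖ K (+ 12) ⊙ (cₛ ⊙ αₛ) ⊖ K (+ 12) ⊙ (αₛ ⊙ cₛ)) ⊖ K (+ 12) ⊙ cₛ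
      ≈⟨ solve 3 (λ α Y c → con (+ 3) :* (con (+ 12) :* (Y :* Y) :- con (+ 12) :* (c :* α) :- con (+ 12) :* (α :* c)) :- con (+ 12) :* c
           := con (+ 4) :* ((con (- + 3) :* Y) :* (con (- + 3) :* Y) :- con (+ 3) :* ((con (+ 1) :+ con (+ 6) :* α) :* c))) ≈-refl αₛ Yₛ cₛ ⟩
    K (+ 4) ⊙ (yₛ ⊙ yₛ ⊖ K (+ 3) ⊙ (aₛ ⊙ cₛ)) ∎)

  C*≈wc : C*ₛ ≈ wₛ ⊙ cₛ
  C*≈wc = begin
    C*ₛ ≈⟨ solve 2 (λ C c → C := c :- (c :- C)) ≈-refl C*ₛ cₛ ⟩
    cₛ ⊖ (cₛ ⊖ C*ₛ) ≈⟨ +-cong ≈-refl (-‿cong (≈-sym eq)) ⟩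
    cₛ ⊖ (K (+ 6) ⊙ (cₛ ⊙ Lam lK) ⊕ K (+ 6) ⊙ (Lam lK ⊙ cₛ))
      ≈⟨ +-cong ≈-refl (-‿cong (+-cong (*-cong ≈-refl (*-cong ≈-refl Kₛ≈)) (*-cong ≈-refl (*-cong Kₛ≈ ≈-refl)))) ⟩
    cₛ ⊖ (K (+ 6) ⊙ (cₛ ⊙ neg Eₛ) ⊕ K (+ 6) ⊙ (neg Eₛ ⊙ cₛ))
      ≈⟨ solve 2 (λ E c → c :- (con (+ 6) :* (c :* (:- E)) :+ con (+ 6) :* ((:- E) :* c)) := (con (+ 1) :+ con (+ 12) :* E) :* c) ≈-refl Eₛ cₛ ⟩
    wₛ ⊙ cₛ ∎
    where
    opaque
     unfolding _⊕_ _⊙_ neg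
     eq : K (+ 6) ⊙ (cₛ ⊙ Lam lK) ⊕ K (+ 6) ⊙ (Lam lK ⊙ cₛ) ≈ cₛ ⊖ C*ₛ
     eq = pw λ n → trans (cong₂ _+_ (mul-const (+ 6) (mul cₛ (Lam lK)) n) (mul-const (+ 6) (mul (Lam lK) cₛ) n)) (C*-identity n)

  θc : θ cₛ ≈ cₛ ⊙ (K (+ 3) ⊙ yₛ ⊕ wₛ)
  θc = K-cancel (+ 18) (begin
    K (+ 18) ⊙ θ cₛ
      ≈⟨ solve 3 (λ t C c → con (+ 18) :* t := con (+ 15) :* C :+ con (+ 3) :* c :- (con (+ 15) :* C :+ con (+ 3) :* c :- con (+ 18) :* t)) ≈-refl (θ cₛ) C*ₛ cₛ ⟩
    K (+ 15) ⊙ C*ₛ ⊕ K (+ 3) ⊙ cₛ ⊖ (K (+ 15) ⊙ C*ₛ ⊕ K (+ 3) ⊙ cₛ ⊖ K (+ 18) ⊙ θ cₛ)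
      ≈⟨ +-cong (+-cong (*-cong ≈-refl C*≈wc) ≈-refl) (-‿cong (≈-trans (≈-sym eq) (+-cong (*-cong ≈-refl Mₛ≈) (*-cong Mₛ≈ ≈-refl)))) ⟩
    K (+ 15) ⊙ (wₛ ⊙ cₛ) ⊕ K (+ 3) ⊙ cₛ ⊖ (cₛ ⊙ (K (+ 81) ⊙ Yₛ ⊖ K (+ 18) ⊙ Eₛ) ⊕ (K (+ 81) ⊙ Yₛ ⊖ K (+ 18) ⊙ Eₛ) ⊙ cₛ)
      ≈⟨ solve 3 (λ E Y c → con (+ 15) :* ((con (+ 1) :+ con (+ 12) :* E) :* c) :+ con (+ 3) :* c :- (c :* (con (+ 81) :* Y :- con (+ 18) :* E) :+ (con (+ 81) :* Y :- con (+ 18) :* E) :* c)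
           := con (+ 18) :* (c :* (con (+ 3) :* (con (- + 3) :* Y) :+ (con (+ 1) :+ con (+ 12) :* E)))) ≈-refl Eₛ Yₛ cₛ ⟩
    K (+ 18) ⊙ (cₛ ⊙ (K (+ 3) ⊙ yₛ ⊕ wₛ)) ∎)
    where
    opaque
     unfolding _⊕_ _⊙_ neg
     eq : cₛ ⊙ Lam lM ⊕ Lam lM ⊙ cₛ ≈ K (+ 15) ⊙ C*ₛ ⊕ K (+ 3) ⊙ cₛ ⊖ K (+ 18) ⊙ θ cₛ
     eq = pw λ n → trans (c-identity n) (sym (cong₂ _-_ (cong₂ _+_ (mul-const (+ 15) C*ₛ n) (mul-const (+ 3) cₛ n)) (mul-const (+ 18) (θ cₛ) n)))
    h : ∀ d x → (+ 36 + + 27 * x) * d ≡ + 36 * d + + 27 * (x * d)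
    h = solve-∀
    Mₛ≈ : Lam lM ≈ K (+ 81) ⊙ Yₛ ⊖ K (+ 18) ⊙ Eₛ
    Mₛ≈ = begin
      Lam lM ≈⟨ lin (+ 36) (+ 27) lM lS lY (λ m d → h (+ d) (e m)) ⟩
      K (+ 36) ⊙ Sₛ ⊕ K (+ 27) ⊙ Yₛ ≈⟨ solve 2 (λ S Y → con (+ 36) :* S :+ con (+ 27) :* Y := con (+ 18) :* (con (+ 2) :* S) :+ con (+ 27) :* Y) ≈-refl Sₛ Yₛ ⟩
      K (+ 18) ⊙ (K (+ 2) ⊙ Sₛ) ⊕ K (+ 27) ⊙ Yₛ ≈⟨ +-cong (*-cong ≈-refl 2S) ≈-refl ⟩
      K (+ 18) ⊙ (K (+ 3) ⊙ Yₛ ⊖ Eₛ) ⊕ K (+ 27) ⊙ Yₛ ≈⟨ solve 2 (λ E Y → con (+ 18) :* (con (+ 3) :* Y :- E) :+ con (+ 27) :* Y := con (+ 81) :* Y :- con (+ 18) :* E) ≈-refl Eₛ Yₛ ⟩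
      K (+ 81) ⊙ Yₛ ⊖ K (+ 18) ⊙ Eₛ ∎

  -- The Borwein identity a³ = b³ + c³. It comes from two expressions for θα, one with the
  -- characters on m and one with the characters on d.
  B≈a³-27c : Bₛ ≈ aₛ ⊙ aₛ ⊙ aₛ ⊖ K (+ 27) ⊙ cₛ
  B≈a³-27c = K-cancel (+ 2) (begin
    K (+ 2) ⊙ Bₛ
      ≈⟨ solve 5 (λ A α E S t → con (+ 2) :* (con (+ 1) :- con (+ 9) :* A) := con (+ 2) :+ con (+ 18) :* E :- con (+ 6) :* (con (+ 2) :* S) :+ con (+ 12) :* α :- con (+ 36) :* t
            :- con (+ 3) :* (con (+ 6) :* E :- con (+ 4) :* S :+ con (+ 4) :* α :+ con (+ 6) :* A :- con (+ 12) :* t)) ≈-refl A₃ₛ αₛ Eₛ Sₛ (θ αₛ) ⟩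
    K (+ 2) ⊕ K (+ 18) ⊙ Eₛ ⊖ K (+ 6) ⊙ (K (+ 2) ⊙ Sₛ) ⊕ K (+ 12) ⊙ αₛ ⊖ K (+ 36) ⊙ θ αₛ
      ⊖ K (+ 3) ⊙ (K (+ 6) ⊙ Eₛ ⊖ K (+ 4) ⊙ Sₛ ⊕ K (+ 4) ⊙ αₛ ⊕ K (+ 6) ⊙ A₃ₛ ⊖ K (+ 12) ⊙ θ αₛ)
      ≈⟨ +-cong ≈-refl (-‿cong (*-cong ≈-refl (≈-trans (≈-sym eq) (+-cong (*-cong ≈-refl (*-cong K′≈ (≈-sym α≈))) (*-cong ≈-refl (*-cong (≈-sym α≈) K′≈)))))) ⟩
    K (+ 2) ⊕ K (+ 18) ⊙ Eₛ ⊖ K (+ 6) ⊙ (K (+ 2) ⊙ Sₛ) ⊕ K (+ 12) ⊙ αₛ ⊖ K (+ 36) ⊙ θ αₛ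
      ⊖ K (+ 3) ⊙ (K (+ 6) ⊙ ((K (+ 2) ⊙ Sₛ ⊖ K (+ 3) ⊙ Eₛ) ⊙ αₛ) ⊕ K (+ 6) ⊙ (αₛ ⊙ (K (+ 2) ⊙ Sₛ ⊖ K (+ 3) ⊙ Eₛ)))
      ≈⟨ +-cong (+-cong (+-cong (+-cong ≈-refl (-‿cong (*-cong ≈-refl 2S))) ≈-refl) ≈-refl)
           (-‿cong (*-cong ≈-refl (+-cong (*-cong ≈-refl (*-cong (+-cong 2S ≈-refl) ≈-refl)) (*-cong ≈-refl (*-cong ≈-refl (+-cong 2S ≈-refl)))))) ⟩
    K (+ 2) ⊕ K (+ 18) ⊙ Eₛ ⊖ K (+ 6) ⊙ (K (+ 3) ⊙ Yₛ ⊖ Eₛ) ⊕ K (+ 12) ⊙ αₛ ⊖ K (+ 36) ⊙ θ αₛ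
      ⊖ K (+ 3) ⊙ (K (+ 6) ⊙ ((K (+ 3) ⊙ Yₛ ⊖ Eₛ ⊖ K (+ 3) ⊙ Eₛ) ⊙ αₛ) ⊕ K (+ 6) ⊙ (αₛ ⊙ (K (+ 3) ⊙ Yₛ ⊖ Eₛ ⊖ K (+ 3) ⊙ Eₛ)))
      ≈⟨ solve 5 (λ α E Y t c → con (+ 2) :+ con (+ 18) :* E :- con (+ 6) :* (con (+ 3) :* Y :- E) :+ con (+ 12) :* α :- con (+ 36) :* t
          :- con (+ 3) :* (con (+ 6) :* ((con (+ 3) :* Y :- E :- con (+ 3) :* E) :* α) :+ con (+ 6) :* (α :* (con (+ 3) :* Y :- E :- con (+ 3) :* E)))
          := con (+ 2) :* ((con (+ 1) :+ con (+ 12) :* E) :* (con (+ 1) :+ con (+ 6) :* α) :- con (+ 27) :* c) :+ con (+ 18) :* (con (+ 3) :* c :- Y :- con (+ 2) :* t) :- con (+ 18) :* (con (+ 3) :* (α :* Y) :+ con (+ 3) :* (Y :* α))) ≈-refl αₛ Eₛ Yₛ (θ αₛ) cₛ ⟩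
    K (+ 2) ⊙ (wₛ ⊙ aₛ ⊖ K (+ 27) ⊙ cₛ) ⊕ K (+ 18) ⊙ (K (+ 3) ⊙ cₛ ⊖ Yₛ ⊖ K (+ 2) ⊙ θ αₛ) ⊖ K (+ 18) ⊙ (K (+ 3) ⊙ (αₛ ⊙ Yₛ) ⊕ K (+ 3) ⊙ (Yₛ ⊙ αₛ))
      ≈⟨ +-cong (+-cong (*-cong ≈-refl (+-cong (*-cong (≈-sym a²≈w) ≈-refl) ≈-refl)) (*-cong ≈-refl (≈-sym ai))) ≈-refl ⟩
    K (+ 2) ⊙ (aₛ ⊙ aₛ ⊙ aₛ ⊖ K (+ 27) ⊙ cₛ) ⊕ K (+ 18) ⊙ (K (+ 3) ⊙ (αₛ ⊙ Yₛ) ⊕ K (+ 3) ⊙ (Yₛ ⊙ αₛ)) ⊖ K (+ 18) ⊙ (K (+ 3) ⊙ (αₛ ⊙ Yₛ) ⊕ K (+ 3) ⊙ (Yₛ ⊙ αₛ))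
      ≈⟨ solve 2 (λ u v → u :+ v :- v := u) ≈-refl (K (+ 2) ⊙ (aₛ ⊙ aₛ ⊙ aₛ ⊖ K (+ 27) ⊙ cₛ)) (K (+ 18) ⊙ (K (+ 3) ⊙ (αₛ ⊙ Yₛ) ⊕ K (+ 3) ⊙ (Yₛ ⊙ αₛ))) ⟩
    K (+ 2) ⊙ (aₛ ⊙ aₛ ⊙ aₛ ⊖ K (+ 27) ⊙ cₛ) ∎)
    where
    α≈ : αₛ ≈ Lam lα′
    α≈ = pw (Lam-swap lα)
    opaque
     unfolding _⊕_ _⊙_ neg
     eq : K (+ 6) ⊙ (Lam lK′ ⊙ Lam lα′) ⊕ K (+ 6) ⊙ (Lam lα′ ⊙ Lam lK′) ≈ K (+ 6) ⊙ Eₛ ⊖ K (+ 4) ⊙ Sₛ ⊕ K (+ 4) ⊙ αₛ ⊕ K (+ 6) ⊙ A₃ₛ ⊖ K (+ 12) ⊙ θ αₛ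
     eq = pw λ n → trans (cong₂ _+_ (mul-const (+ 6) (mul (Lam lK′) (Lam lα′)) n) (mul-const (+ 6) (mul (Lam lα′) (Lam lK′)) n)) (trans (a-identity′ n) (sym (cong₂ _-_ (cong₂ _+_ (cong₂ _+_ (cong₂ _-_ (mul-const (+ 6) Eₛ n) (mul-const (+ 4) Sₛ n))
       (trans (mul-const (+ 4) αₛ n) (cong (+ 4 *_) (at α≈ n)))) (mul-const (+ 6) A₃ₛ n)) (trans (mul-const (+ 12) (θ αₛ) n) (cong (λ z → + 12 * (+ n * z)) (at α≈ n))))))
    h : ∀ d x → (+ 2 - + 3 * x) * d ≡ + 2 * d + - + 3 * (x * d)
    h = solve-∀
    K′≈ : Lam lK′ ≈ K (+ 2) ⊙ Sₛ ⊖ K (+ 3) ⊙ Eₛ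
    K′≈ = ≈-trans (lin (+ 2) (- + 3) lK′ lS lE (λ m d → h (+ d) (e d))) (solve 2 (λ S E → con (+ 2) :* S :+ con (- + 3) :* E := con (+ 2) :* S :- con (+ 3) :* E) ≈-refl Sₛ Eₛ)

  1+3A₅≈wB : K (+ 1) ⊕ K (+ 3) ⊙ A₅ₛ ≈ wₛ ⊙ Bₛ
  1+3A₅≈wB = K-cancel (+ 4) (begin
    K (+ 4) ⊙ (K (+ 1) ⊕ K (+ 3) ⊙ A₅ₛ)
      ≈⟨ solve 3 (λ A F E → con (+ 4) :* (con (+ 1) :+ con (+ 3) :* F) := con (+ 4) :- con (+ 36) :* A :+ con (+ 48) :* E :+ con (+ 3) :* (con (+ 4) :* F :+ con (+ 12) :* A :- con (+ 16) :* E)) ≈-refl A₃ₛ A₅ₛ Eₛ ⟩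
    K (+ 4) ⊖ K (+ 36) ⊙ A₃ₛ ⊕ K (+ 48) ⊙ Eₛ ⊕ K (+ 3) ⊙ (K (+ 4) ⊙ A₅ₛ ⊕ K (+ 12) ⊙ A₃ₛ ⊖ K (+ 16) ⊙ Eₛ)
      ≈⟨ +-cong ≈-refl (*-cong ≈-refl (≈-sym eq)) ⟩
    K (+ 4) ⊖ K (+ 36) ⊙ A₃ₛ ⊕ K (+ 48) ⊙ Eₛ ⊕ K (+ 3) ⊙ (K (- + 72) ⊙ (A₃ₛ ⊙ Eₛ) ⊕ K (- + 72) ⊙ (Eₛ ⊙ A₃ₛ))
      ≈⟨ solve 2 (λ A E → con (+ 4) :- con (+ 36) :* A :+ con (+ 48) :* E :+ con (+ 3) :* (con (- + 72) :* (A :* E) :+ con (- + 72) :* (E :* A))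
           := con (+ 4) :* ((con (+ 1) :+ con (+ 12) :* E) :* (con (+ 1) :- con (+ 9) :* A))) ≈-refl A₃ₛ Eₛ ⟩
    K (+ 4) ⊙ (wₛ ⊙ Bₛ) ∎)
    where
    opaque
     unfolding _⊕_ _⊙_ neg
     eq : K (- + 72) ⊙ (A₃ₛ ⊙ Eₛ) ⊕ K (- + 72) ⊙ (Eₛ ⊙ A₃ₛ) ≈ K (+ 4) ⊙ A₅ₛ ⊕ K (+ 12) ⊙ A₃ₛ ⊖ K (+ 16) ⊙ Eₛ
     eq = pw λ n → trans (cong₂ _+_ (mul-const (- + 72) (mul A₃ₛ Eₛ) n) (mul-const (- + 72) (mul Eₛ A₃ₛ) n)) (trans (C-identity n) (sym (cong₂ _-_ (cong₂ _+_ (mul-const (+ 4) A₅ₛ n) (mul-const (+ 12) A₃ₛ n)) (mul-const (+ 16) Eₛ n))))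

  θB : θ Bₛ ≈ K (+ 3) ⊙ (yₛ ⊙ Bₛ)
  θB = begin
    θ Bₛ ≈⟨ θ-cong B≈a³-27c ⟩
    θ (aₛ ⊙ aₛ ⊙ aₛ ⊖ K (+ 27) ⊙ cₛ)
      ≈⟨ ≈-trans (θ-+ (aₛ ⊙ aₛ ⊙ aₛ) (neg (K (+ 27) ⊙ cₛ))) (+-cong cube twenty-seven) ⟩
    ((aₛ ⊙ yₛ ⊕ K (+ 9) ⊙ cₛ) ⊙ aₛ ⊕ aₛ ⊙ (aₛ ⊙ yₛ ⊕ K (+ 9) ⊙ cₛ)) ⊙ aₛ ⊕ aₛ ⊙ aₛ ⊙ (aₛ ⊙ yₛ ⊕ K (+ 9) ⊙ cₛ) ⊖ K (+ 27) ⊙ (cₛ ⊙ (K (+ 3) ⊙ yₛ ⊕ aₛ ⊙ aₛ))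
      ≈⟨ solve 3 (λ a c y → ((a :* y :+ con (+ 9) :* c) :* a :+ a :* (a :* y :+ con (+ 9) :* c)) :* a :+ a :* a :* (a :* y :+ con (+ 9) :* c) :- con (+ 27) :* (c :* (con (+ 3) :* y :+ a :* a))
           := con (+ 3) :* (y :* (a :* a :* a :- con (+ 27) :* c))) ≈-refl aₛ cₛ yₛ ⟩
    K (+ 3) ⊙ (yₛ ⊙ (aₛ ⊙ aₛ ⊙ aₛ ⊖ K (+ 27) ⊙ cₛ)) ≈⟨ *-cong ≈-refl (*-cong ≈-refl (≈-sym B≈a³-27c)) ⟩
    K (+ 3) ⊙ (yₛ ⊙ Bₛ) ∎
    where
    cube : θ (aₛ ⊙ aₛ ⊙ aₛ) ≈ ((aₛ ⊙ yₛ ⊕ K (+ 9) ⊙ cₛ) ⊙ aₛ ⊕ aₛ ⊙ (aₛ ⊙ yₛ ⊕ K (+ 9) ⊙ cₛ)) ⊙ aₛ ⊕ aₛ ⊙ aₛ ⊙ (aₛ ⊙ yₛ ⊕ K (+ 9) ⊙ cₛ)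
    cube = begin
      θ (aₛ ⊙ aₛ ⊙ aₛ)                                        ≈⟨ θ-* (aₛ ⊙ aₛ) aₛ ⟩
      θ (aₛ ⊙ aₛ) ⊙ aₛ ⊕ aₛ ⊙ aₛ ⊙ θ aₛ                       ≈⟨ +-cong (*-cong (θ-* aₛ aₛ) ≈-refl) ≈-refl ⟩
      (θ aₛ ⊙ aₛ ⊕ aₛ ⊙ θ aₛ) ⊙ aₛ ⊕ aₛ ⊙ aₛ ⊙ θ aₛ            ≈⟨ +-cong (*-cong (+-cong (*-cong θa ≈-refl) (*-cong ≈-refl θa)) ≈-refl) (*-cong ≈-refl θa) ⟩
      ((aₛ ⊙ yₛ ⊕ K (+ 9) ⊙ cₛ) ⊙ aₛ ⊕ aₛ ⊙ (aₛ ⊙ yₛ ⊕ K (+ 9) ⊙ cₛ)) ⊙ aₛ ⊕ aₛ ⊙ aₛ ⊙ (aₛ ⊙ yₛ ⊕ K (+ 9) ⊙ cₛ) ∎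
    twenty-seven : θ (neg (K (+ 27) ⊙ cₛ)) ≈ neg (K (+ 27) ⊙ (cₛ ⊙ (K (+ 3) ⊙ yₛ ⊕ aₛ ⊙ aₛ)))
    twenty-seven = begin
      θ (neg (K (+ 27) ⊙ cₛ))  ≈⟨ θ-neg (K (+ 27) ⊙ cₛ) ⟩
      neg (θ (K (+ 27) ⊙ cₛ))  ≈⟨ -‿cong (θ-K* (+ 27) cₛ) ⟩
      neg (K (+ 27) ⊙ θ cₛ)    ≈⟨ -‿cong (*-cong ≈-refl θc) ⟩
      neg (K (+ 27) ⊙ (cₛ ⊙ (K (+ 3) ⊙ yₛ ⊕ wₛ))) ≈⟨ -‿cong (*-cong ≈-refl (*-cong ≈-refl (+-cong ≈-refl (≈-sym a²≈w)))) ⟩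
      neg (K (+ 27) ⊙ (cₛ ⊙ (K (+ 3) ⊙ yₛ ⊕ aₛ ⊙ aₛ))) ∎

  mul≈⊙ : ∀ f g → mul f g ≈ f ⊙ g
  mul≈⊙ f g = pw (λ n → sym (⊙-at f g n))

  ⊙-local : ∀ n {f f′ g g′ : Series} → (∀ k → k ≤ n → f k ≡ f′ k) → (∀ k → k ≤ n → g k ≡ g′ k) → (f ⊙ g) n ≡ (f′ ⊙ g′) n
  ⊙-local n {f} {f′} {g} {g′} p q = trans (⊙-at f g n) (trans (mul-local n p q) (sym (⊙-at f′ g′ n)))

  ⊙-0 : ∀ f g → (f ⊙ g) 0 ≡ f 0 * g 0
  ⊙-0 f g = trans (⊙-at f g 0) (mul-zero f g)

  one≈K1 : one ≈ K (+ 1)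
  one≈K1 = pw one≐

  -- Inverses

  nth-++ˡ : ∀ xs ys k → k < length xs → nth (xs ++ ys) k ≡ nth xs k
  nth-++ˡ (x ∷ xs) ys zero    h       = refl
  nth-++ˡ (x ∷ xs) ys (suc k) (s≤s h) = nth-++ˡ xs ys k h

  nth-last : ∀ xs x → nth (xs ++ x ∷ []) (length xs) ≡ x
  nth-last []       x = refl
  nth-last (y ∷ xs) x = nth-last xs x

  length-invCoeffs : ∀ f n → length (invCoeffs f n) ≡ suc n
  length-invCoeffs f zero    = refl
  length-invCoeffs f (suc n) = trans (LP.length-++ (invCoeffs f n)) (trans (ℕP.+-comm _ 1) (cong suc (length-invCoeffs f n)))

  nth-invCoeffs : ∀ f {k n} → k ≤ n → nth (invCoeffs f n) k ≡ inv f k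
  nth-invCoeffs f {k} {n} k≤n with ℕP.m≤n⇒m<n∨m≡n k≤n
  ... | inj₂ refl = refl
  nth-invCoeffs f {k} {suc n} k≤n | inj₁ (s≤s k≤n′) =
    trans (nth-++ˡ (invCoeffs f n) _ k (subst (k <_) (sym (length-invCoeffs f n)) (s≤s k≤n′))) (nth-invCoeffs f k≤n′)

  inv-suc : ∀ f n → inv f (suc n) ≡ - mul (sh f) (inv f) n
  inv-suc f n = trans (subst (λ l → nth (invCoeffs f n ++ x ∷ []) l ≡ x) (length-invCoeffs f n) (nth-last (invCoeffs f n) x))
    (cong (λ z → - z) (sum-cong (suc n) (λ { i (s≤s i≤n) → cong (f (suc i) *_) (nth-invCoeffs f (ℕP.m∸n≤m n i)) })))
    where
    x = - sumℤ (suc n) (λ i → f (suc i) * nth (invCoeffs f n) (n ∸ i))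

  inv-right : ∀ f → f 0 ≡ + 1 → f ⊙ inv f ≈ K (+ 1)
  inv-right f h = pw λ n → trans (⊙-at f (inv f) n) (g n)
    where
    g : ∀ n → mul f (inv f) n ≡ K (+ 1) n
    g zero    = trans (mul-zero f (inv f)) (trans (ℤP.*-identityʳ (f 0)) h)
    g (suc n) = trans (mul-suc f (inv f) n) (trans (cong₂ (λ u v → u * v + mul (sh f) (inv f) n) h (inv-suc f n))
      (trans (cong (_+ mul (sh f) (inv f) n) (ℤP.*-identityˡ (- mul (sh f) (inv f) n))) (ℤP.+-inverseˡ (mul (sh f) (inv f) n))))

  -- Logarithmic derivatives

  LD : Series → Series → Set
  LD f L = θ f ≈ f ⊙ L

  LD-one : LD one (K (+ 0))
  LD-one = begin
    θ one            ≈⟨ θ-cong one≈K1 ⟩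
    θ (K (+ 1))      ≈⟨ θ-K (+ 1) ⟩
    K (+ 0)          ≈⟨ solve 1 (λ f → con (+ 0) := f :* con (+ 0)) ≈-refl one ⟩
    one ⊙ K (+ 0)    ∎

  LD-⊙ : ∀ {f g L M} → LD f L → LD g M → LD (f ⊙ g) (L ⊕ M)
  LD-⊙ {f} {g} {L} {M} p q = begin
    θ (f ⊙ g)                   ≈⟨ θ-* f g ⟩
    θ f ⊙ g ⊕ f ⊙ θ g           ≈⟨ +-cong (*-cong p ≈-refl) (*-cong ≈-refl q) ⟩
    f ⊙ L ⊙ g ⊕ f ⊙ (g ⊙ M)     ≈⟨ solve 4 (λ f g L M → f :* L :* g :+ f :* (g :* M) := f :* g :* (L :+ M)) ≈-refl f g L M ⟩
    f ⊙ g ⊙ (L ⊕ M)             ∎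

  LD-cong : ∀ {f g L M} → f ≈ g → L ≈ M → LD f L → LD g M
  LD-cong p q h = ≈-trans (θ-cong (≈-sym p)) (≈-trans h (*-cong p q))

  LD-pow : ∀ {f L} m → LD f L → LD (pow f m) (K (+ m) ⊙ L)
  LD-pow {f} {L} zero    h = LD-cong ≈-refl (solve 1 (λ L → con (+ 0) := con (+ 0) :* L) ≈-refl L) LD-one
  LD-pow {f} {L} (suc m) h = LD-cong (≈-sym (mul≈⊙ f (pow f m)))
    (≈-trans (solve 2 (λ L n → L :+ n :* L := (con (+ 1) :+ n) :* L) ≈-refl L (K (+ m))) (*-cong (≈-sym (Exact.const-+ (+ 1) (+ m))) ≈-refl))
    (LD-⊙ h (LD-pow m h))

  LD-inverse : ∀ {f g L} → f ⊙ g ≈ K (+ 1) → LD f L → LD g (neg L)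
  LD-inverse {f} {g} {L} fg h = begin
    θ g
      ≈⟨ solve 2 (λ t u → t := con (+ 1) :* t) ≈-refl (θ g) L ⟩
    K (+ 1) ⊙ θ g
      ≈⟨ *-cong (≈-sym fg) ≈-refl ⟩
    f ⊙ g ⊙ θ g
      ≈⟨ solve 4 (λ f g t L → f :* g :* t := g :* (f :* L :* g :+ f :* t) :- g :* (f :* g) :* L) ≈-refl f g (θ g) L ⟩
    g ⊙ (f ⊙ L ⊙ g ⊕ f ⊙ θ g) ⊖ g ⊙ (f ⊙ g) ⊙ L
      ≈⟨ +-cong (*-cong ≈-refl (≈-trans (+-cong (*-cong (≈-sym h) ≈-refl) ≈-refl) (≈-trans (≈-sym (θ-* f g)) (≈-trans (θ-cong fg) (θ-K (+ 1)))))) (-‿cong (*-cong (*-cong ≈-refl fg) ≈-refl)) ⟩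
    g ⊙ K (+ 0) ⊖ g ⊙ K (+ 1) ⊙ L
      ≈⟨ solve 2 (λ g L → g :* con (+ 0) :- g :* con (+ 1) :* L := g :* (:- L)) ≈-refl g L ⟩
    g ⊙ neg L ∎

  -- At q^n the equation for the difference reads (n - L₀) d_n = earlier terms. With L₀ = 1 it
  -- degenerates at n = 1, so the coefficient of q has to be prescribed.
  LD-unique : ∀ {f g L} → L 0 ≡ + 1 → LD f L → LD g L → f 0 ≡ g 0 → f 1 ≡ g 1 → f ≈ g
  LD-unique {f} {g} {L} L0 hf hg h₀ h₁ = pw λ n → ℤP.i-j≡0⇒i≡j (f n) (g n) (go n n ℕP.≤-refl)
    where
    d : Series
    d n = f n - g n
    rec : ∀ n → + n * d n ≡ mul d L n
    rec n = trans (trans (ℤP.*-distribˡ-+ (+ n) (f n) (- g n)) (cong (_+_ (+ n * f n)) (sym (ℤP.neg-distribʳ-* (+ n) (g n)))))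
      (trans (cong₂ _-_ (trans (at hf n) (⊙-at f L n)) (trans (at hg n) (⊙-at g L n)))
      (trans (cong (_+_ (mul f L n)) (sym (sum-neg (suc n) _))) (trans (sym (sum-+ (suc n) _ _)) (sum-cong′ (suc n) (λ k → t (f k) (g k) (L (n ∸ k)))))))
      where
      t : ∀ x y z → x * z + - (y * z) ≡ (x - y) * z
      t = solve-∀
    go : ∀ b n → n ≤ b → d n ≡ + 0
    go b       zero          h = ℤP.i≡j⇒i-j≡0 h₀
    go b       (suc zero)    h = ℤP.i≡j⇒i-j≡0 h₁
    go (suc b) (suc (suc n)) (s≤s h) = ℤP.*-cancelˡ-≡ (+ suc n) (d (suc (suc n))) (+ 0)
      (trans (s (+ suc n) (d (suc (suc n)))) (trans (cong (_- d (suc (suc n))) (trans (rec (suc (suc n)))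
        (trans (mul-sucʳ d L (suc n)) (cong₂ _+_ (sum-zero (suc (suc n)) (λ { k (s≤s k≤n) → trans (cong (_* sh L (suc n ∸ k)) (go b k (ℕP.≤-trans k≤n h))) refl }))
           (cong (d (suc (suc n)) *_) L0)))))
        (trans (u (d (suc (suc n)))) (sym (ℤP.*-zeroʳ (+ suc n))))))
      where
      s : ∀ k x → k * x ≡ (+ 1 + k) * x - x
      s = solve-∀
      u : ∀ x → (+ 0 + x * + 1) - x ≡ + 0
      u = solve-∀

  -- Eta products

  mon : ℕ → Series
  mon d n = δ d n

  δ-shift : ∀ x m n → δ (x ℕ.+ m) (x ℕ.+ n) ≡ δ m n
  δ-shift zero    m n = refl
  δ-shift (suc x) m n = δ-shift x m n

  -- The geometric series q^d + q^(2d) + ..., which is q^d / (1 - q^d).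
  divisorIndicator : ℕ → Series
  divisorIndicator d n = sumℤ n (λ a → δ (suc a ℕ.* d) n)

  oneMinusQ-mon : ∀ d n → oneMinusQ (suc d) n ≡ δ 0 n - δ (suc d) n
  oneMinusQ-mon d n with n ℕ.≟ 0 | n ℕ.≟ suc d
  ... | yes refl | _        = refl
  ... | no n≢0   | yes refl = sym (cong (λ z → + 0 - z) (δ-refl d))
  oneMinusQ-mon d zero    | no n≢0 | no n≢d = ⊥-elim (n≢0 refl)
  oneMinusQ-mon d (suc n) | no n≢0 | no n≢d = sym (cong (λ z → + 0 - z) (δ-≢ d n (λ p → n≢d (cong suc (sym p)))))

  mul-mon-< : ∀ d f n → n < d → mul (mon d) f n ≡ + 0
  mul-mon-< d f n n<d = sum-zero (suc n) (λ { k (s≤s k≤n) → cong (_* f (n ∸ k)) (δ-> (ℕP.≤-<-trans k≤n n<d)) })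

  mul-mon : ∀ d f n → mul (mon d) f (d ℕ.+ n) ≡ f n
  mul-mon zero    f n = trans (sum-head n _) (trans (cong₂ _+_ (ℤP.*-identityˡ (f n)) (sum-zero n (λ _ _ → refl))) (ℤP.+-identityʳ (f n)))
  mul-mon (suc d) f n = trans (mul-suc (mon (suc d)) f (d ℕ.+ n)) (trans (ℤP.+-identityˡ _) (mul-mon d f n))

  geometric : ∀ d → mul (oneMinusQ (suc d)) (divisorIndicator (suc d)) ≐ mon (suc d)
  geometric d n = trans (trans (mul-cong≐ {g = D} (oneMinusQ-mon d) (λ _ → refl) n)
      (trans (sum-cong′ (suc n) (λ k → trans (ℤP.*-distribʳ-+ (D (n ∸ k)) (δ 0 k) (- δ (suc d) k)) (cong (_+_ (δ 0 k * D (n ∸ k))) (sym (ℤP.neg-distribˡ-* (δ (suc d) k) (D (n ∸ k)))))))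
      (trans (sum-+ (suc n) _ _) (cong₂ _+_ (mul-mon 0 D n) (sum-neg (suc n) _))))) (final (ℕP.<-≤-connex n (suc d)))
    where
    D = divisorIndicator (suc d)
    final : n < suc d ⊎ suc d ≤ n → D n - mul (mon (suc d)) D n ≡ mon (suc d) n
    final (inj₁ n<d) = trans (cong₂ _-_ (sum-zero n (λ a _ → δ-> (ℕP.<-≤-trans n<d (ℕP.m≤n*m (suc d) (suc a))))) (mul-mon-< (suc d) D n n<d)) (sym (δ-> n<d))
    final (inj₂ d≤n) = subst (λ z → D z - mul (mon (suc d)) D z ≡ mon (suc d) z) (ℕP.m+[n∸m]≡n d≤n) (step (n ∸ suc d))
      where
      step : ∀ k → D (suc d ℕ.+ k) - mul (mon (suc d)) D (suc d ℕ.+ k) ≡ mon (suc d) (suc d ℕ.+ k)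
      step k = trans (cong₂ _-_ Dk (mul-mon (suc d) D k)) (t (δ d (d ℕ.+ k)) (D k))
        where
        t : ∀ x y → (x + y) - y ≡ x
        t = solve-∀
        Dk : D (suc d ℕ.+ k) ≡ δ d (d ℕ.+ k) + D k
        Dk = trans (sum-head (d ℕ.+ k) _) (cong₂ _+_ (cong (λ z → δ z (d ℕ.+ k)) (ℕP.+-identityʳ d))
          (trans (sum-cong′ (d ℕ.+ k) (λ a → δ-shift (suc d) (suc a ℕ.* suc d) k))
            (sum-extend (λ a → δ (suc a ℕ.* suc d) k) (ℕP.m≤n+m k d) (λ a k≤a → δ-> (ℕP.≤-trans (s≤s k≤a) (ℕP.m≤m*n (suc a) (suc d)))))))

  θ-mon : ∀ d → θ (mon d) ≐ scale (+ d) (mon d)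
  θ-mon d n = sym (δ-subst d n (λ k → + k))

  LD-oneMinusQ : ∀ d → LD (oneMinusQ (suc d)) (neg (K (+ suc d) ⊙ divisorIndicator (suc d)))
  LD-oneMinusQ d = begin
    θ (oneMinusQ (suc d))
      ≈⟨ pw (λ n → trans (cong (+ n *_) (oneMinusQ-mon d n)) (trans (t (+ n) (δ 0 n) (δ (suc d) n)) (cong₂ (λ u v → u - v) (θ-mon 0 n) (θ-mon (suc d) n)))) ⟩
    (λ n → + 0 * δ 0 n - + suc d * δ (suc d) n)
      ≈⟨ pw (λ n → trans (u (+ suc d * δ (suc d) n)) (sym (trans (neg-at (K (+ suc d) ⊙ mon (suc d)) n) (cong (λ z → - z) (at (K⊙ (+ suc d) (mon (suc d))) n))))) ⟩
    neg (K (+ suc d) ⊙ mon (suc d))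
      ≈⟨ -‿cong (*-cong ≈-refl (≈-trans (≈-sym (≐⇒≈ (geometric d))) (mul≈⊙ (oneMinusQ (suc d)) (divisorIndicator (suc d))))) ⟩
    neg (K (+ suc d) ⊙ (oneMinusQ (suc d) ⊙ divisorIndicator (suc d)))
      ≈⟨ solve 3 (λ k f g → :- (k :* (f :* g)) := f :* (:- (k :* g))) ≈-refl (K (+ suc d)) (oneMinusQ (suc d)) (divisorIndicator (suc d)) ⟩
    oneMinusQ (suc d) ⊙ neg (K (+ suc d) ⊙ divisorIndicator (suc d)) ∎
    where
    t : ∀ n x y → n * (x - y) ≡ n * x - n * y
    t = solve-∀
    u : ∀ x → + 0 - x ≡ - x
    u = solve-∀

  prodList-∷ʳ : ∀ xs x → prodList (xs ++ x ∷ []) ≈ prodList xs ⊙ x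
  prodList-∷ʳ []       x = begin
    mul x one      ≈⟨ mul≈⊙ x one ⟩
    x ⊙ one        ≈⟨ *-cong ≈-refl one≈K1 ⟩
    x ⊙ K (+ 1)    ≈⟨ solve 1 (λ x → x :* con (+ 1) := con (+ 1) :* x) ≈-refl x ⟩
    K (+ 1) ⊙ x    ≈⟨ *-cong (≈-sym one≈K1) ≈-refl ⟩
    one ⊙ x        ∎
  prodList-∷ʳ (y ∷ xs) x = begin
    mul y (prodList (xs ++ x ∷ []))  ≈⟨ mul≈⊙ y _ ⟩
    y ⊙ prodList (xs ++ x ∷ [])      ≈⟨ *-cong ≈-refl (prodList-∷ʳ xs x) ⟩
    y ⊙ (prodList xs ⊙ x)            ≈⟨ solve 3 (λ y p x → y :* (p :* x) := y :* p :* x) ≈-refl y (prodList xs) x ⟩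
    y ⊙ prodList xs ⊙ x              ≈⟨ *-cong (≈-sym (mul≈⊙ y (prodList xs))) ≈-refl ⟩
    prodList (y ∷ xs) ⊙ x            ∎

  -- The k-th factor is 1 - q^(h k + 1), with an exponent that is visibly positive. The bound `h≥`
  -- makes the coefficients up to q^n stable from the n-th partial product on, so the diagonal
  -- series `product` inherits the logarithmic derivative.
  module EtaProduct (h : ℕ → ℕ) (h≥ : ∀ k → suc k ≤ suc (h k)) where

    factor : ℕ → Series
    factor k = oneMinusQ (suc (h k))

    partial : ℕ → Series
    partial n = prodList (map factor (upTo n))

    partial-suc : ∀ n → partial (suc n) ≈ partial n ⊙ factor n
    partial-suc n = ≈-trans (≈-reflexive (cong prodList (trans (cong (map factor) (sym (LP.applyUpTo-∷ʳ (λ x → x) n))) (LP.map-++ factor (upTo n) (n ∷ [])))))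
      (prodList-∷ʳ (map factor (upTo n)) (factor n))

    logTerm : ℕ → Series
    logTerm n k = - sumℤ n (λ i → + suc (h i) * divisorIndicator (suc (h i)) k)

    LD-partial : ∀ n → LD (partial n) (logTerm n)
    LD-partial zero    = LD-cong ≈-refl (pw λ { zero → refl ; (suc n) → refl }) LD-one
    LD-partial (suc n) = LD-cong (≈-sym (partial-suc n)) (pw λ k → trans (⊕-at (logTerm n) _ k) (trans (cong (_+_ (logTerm n k)) (trans (neg-at _ k) (cong (λ z → - z) (at (K⊙ (+ suc (h n)) (divisorIndicator (suc (h n)))) k))))
        (sym (ℤP.neg-distrib-+ (sumℤ n (λ i → + suc (h i) * divisorIndicator (suc (h i)) k)) (+ suc (h n) * divisorIndicator (suc (h n)) k)))))
      (LD-⊙ (LD-partial n) (LD-oneMinusQ (h n)))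

    product : Series
    product n = partial n n

    factor-one : ∀ n k → k ≤ n → factor n k ≡ one k
    factor-one n zero    k≤n = trans (oneMinusQ-mon (h n) 0) refl
    factor-one n (suc k) k≤n = trans (oneMinusQ-mon (h n) (suc k)) (cong (λ z → + 0 - z) (δ-> {suc (h n)} {suc k} (ℕP.≤-trans (s≤s k≤n) (h≥ n))))

    partial-stable : ∀ {k n} → k ≤ n → partial n k ≡ product k
    partial-stable {k} {n} k≤n with ℕP.m≤n⇒m<n∨m≡n k≤n
    ... | inj₂ refl = refl
    partial-stable {k} {suc n} k≤n | inj₁ (s≤s k≤n′) = trans (at (partial-suc n) k)
      (trans (⊙-local k {g = factor n} {g′ = one} (λ j _ → refl) (λ j j≤k → factor-one n j (ℕP.≤-trans j≤k k≤n′)))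
      (trans (sym (at (mul≈⊙ (partial n) one) k)) (trans (mul-comm (partial n) one k) (trans (mul-one (partial n) k) (partial-stable k≤n′)))))

    logDer : Series
    logDer n = logTerm n n

    logTerm-stable : ∀ {k n} → k ≤ n → logTerm n k ≡ logDer k
    logTerm-stable {k} {n} k≤n = cong (λ z → - z) (sum-extend (λ i → + suc (h i) * divisorIndicator (suc (h i)) k) k≤n
      (λ i k≤i → *0ʳ (+ suc (h i)) (sum-zero k (λ a _ → δ-> (ℕP.≤-trans (s≤s k≤i) (ℕP.≤-trans (h≥ i) (ℕP.m≤n*m (suc (h i)) (suc a))))))))

    LD-product : LD product logDer
    LD-product = pw λ n → trans (at (LD-partial n) n) (⊙-local n (λ k k≤n → partial-stable k≤n) (λ k k≤n → logTerm-stable k≤n))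

  three-suc : ∀ k → 3 ℕ.* suc k ≡ suc (2 ℕ.+ 3 ℕ.* k)
  three-suc = ℕS.solve 1 (λ k → ℕS.con 3 ℕS.:* (ℕS.con 1 ℕS.:+ k) ℕS.:= ℕS.con 3 ℕS.:+ ℕS.con 3 ℕS.:* k) refl

  module Eta₁ = EtaProduct (λ k → k) (λ k → ℕP.≤-refl)
  module Eta₃ = EtaProduct (λ k → 2 ℕ.+ 3 ℕ.* k) (λ k → s≤s (ℕP.≤-trans (ℕP.m≤n*m k 3) (ℕP.m≤n+m (3 ℕ.* k) 2)))

  E₃≈ : E₃ ≈ Eta₃.product
  E₃≈ = pw λ n → cong (λ l → prodList l n) (LP.map-cong (λ k → cong oneMinusQ (three-suc k)) (upTo n))

  LD-E₁ : LD E₁ (neg Sₛ)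
  LD-E₁ = LD-cong ≈-refl (pw λ n → trans (cong (λ z → - z) (sum-cong′ n (λ i → sym (sum-*ˡ n (+ suc i) (λ a → δ (suc a ℕ.* suc i) n))))) (sym (neg-at Sₛ n))) Eta₁.LD-product

  -- The exponents 3k contribute the sum over d divisible by 3, and 1 - `e` selects these d.
  LD-E₃ : LD E₃ (Eₛ ⊖ Sₛ)
  LD-E₃ = LD-cong (≈-sym E₃≈) (pw λ n → trans (cong (λ z → - z) (trans (sum-cong′ n (λ i → trans (cong (λ z → + z * divisorIndicator z n) (sym (trans (ℕP.*-comm (suc i) 3) (three-suc i)))) refl))
       (trans (sym (sum-three n (λ x → + x * divisorIndicator x n) (λ x n<x → *0ʳ (+ x) (sum-zero n (λ a _ → δ-> (ℕP.≤-trans n<x (ℕP.m≤n*m x (suc a))))))))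
       (trans (sum-cong′ n (λ i → trans (sym (ℤP.*-assoc (+ 1 - e (suc i)) (+ suc i) (divisorIndicator (suc i) n))) (sym (sum-*ˡ n ((+ 1 - e (suc i)) * + suc i) (λ a → δ (suc a ℕ.* suc i) n)))))
       (trans (Lam-cong (λ m d → (+ 1 - e d) * + d) (λ m d → + 1 * lS m d + - + 1 * lE m d) (λ m d → h₁ (+ suc d) (e (suc d))) n) (Lam-lin (+ 1) (- + 1) lS lE n))))))
       (trans (h₂ (Sₛ n) (Eₛ n)) (sym (⊖-at Eₛ Sₛ n)))) Eta₃.LD-product
    where
    h₁ : ∀ d x → (+ 1 - x) * d ≡ + 1 * d + - + 1 * (x * d)
    h₁ = solve-∀
    h₂ : ∀ x y → - (+ 1 * x + - + 1 * y) ≡ y - x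
    h₂ = solve-∀

  pow-0 : ∀ f m → f 0 ≡ + 1 → pow f m 0 ≡ + 1
  pow-0 f zero    h = refl
  pow-0 f (suc m) h = trans (mul-zero f (pow f m)) (cong₂ _*_ h (pow-0 f m h))

  module Quotient (f g : Series) (f0 : f 0 ≡ + 1) (g0 : g 0 ≡ + 1) {L M : Series} (m : ℕ) (hf : LD f L) (hg : LD g M) where

    quotient : Series
    quotient = mul (pow f m) (inv (pow g m))

    quotient-0 : quotient 0 ≡ + 1
    quotient-0 = trans (mul-zero (pow f m) (inv (pow g m))) (trans (ℤP.*-identityʳ (pow f m 0)) (pow-0 f m f0))

    LD-quotient : LD quotient (K (+ m) ⊙ L ⊕ neg (K (+ m) ⊙ M))
    LD-quotient = LD-cong (≈-sym (mul≈⊙ (pow f m) (inv (pow g m)))) ≈-refl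
      (LD-⊙ (LD-pow m hf) (LD-inverse (inv-right (pow g m) (pow-0 g m g0)) (LD-pow m hg)))

  module Tau = Quotient E₃ E₁ refl refl 12 LD-E₃ LD-E₁

  opaque

    -- Sealed so that conversion does not expand the eta quotient; its constant term and its
    -- logarithmic derivative carry the argument.
    τ : Series
    τ = tOverQ

    τ≡ : τ ≡ tOverQ
    τ≡ = refl

    τ-0 : τ 0 ≡ + 1
    τ-0 = Tau.quotient-0

    LD-τ′ : LD τ (K (+ 12) ⊙ (Eₛ ⊖ Sₛ) ⊕ neg (K (+ 12) ⊙ neg Sₛ))
    LD-τ′ = Tau.LD-quotient

  -- The series S cancels. Adding the logarithmic derivative 1 of q gives θt/t = w.
  LD-τ : LD τ (wₛ ⊖ K (+ 1))
  LD-τ = LD-cong ≈-refl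
    (solve 2 (λ E S → con (+ 12) :* (E :- S) :+ (:- (con (+ 12) :* (:- S))) := (con (+ 1) :+ con (+ 12) :* E) :- con (+ 1)) ≈-refl Eₛ Sₛ) LD-τ′

  Xq : Series
  Xq = Xs one

  Xq⊙ : ∀ f → Xq ⊙ f ≈ Xs f
  Xq⊙ f = ≈-trans (≈-sym (mul≈⊙ Xq f)) (pw λ n → trans (mul-Xs one f n) (t n))
    where
    t : ∀ n → Xs (mul one f) n ≡ Xs f n
    t zero    = refl
    t (suc n) = mul-one f n

  LD-Xq : LD Xq (K (+ 1))
  LD-Xq = begin
    θ Xq          ≈⟨ pw (λ { 0 → refl ; 1 → refl ; (suc (suc n)) → ℤP.*-zeroʳ (+ suc (suc n)) }) ⟩
    Xq            ≈⟨ solve 1 (λ x → x := x :* con (+ 1)) ≈-refl Xq ⟩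
    Xq ⊙ K (+ 1)  ∎

  C-term : ∀ n → Σ (ℕ → ℤ) (λ g → C (suc n) ≡ + 3 * sumℤ (suc n) g)
  C-term n = _ , refl

  one-divisor : ∀ N q (i : ℕ) → q < N → N ≡ suc q ℕ.* suc i → sumℤ N (λ a → δ (suc a ℕ.* suc i) N) ≡ + 1
  one-divisor N q i q<N eq = trans (sum-extend (λ a → δ (suc a ℕ.* suc i) N) q<N (λ a q<a → δ-> (subst (ℕ._< suc a ℕ.* suc i) (sym eq) (ℕP.*-monoˡ-< (suc i) (s≤s q<a)))))
    (cong₂ _+_ (sum-zero q (λ a a<q → δ-≢ (suc a ℕ.* suc i) N (λ e → ℕP.<⇒≢ (ℕP.*-monoˡ-< (suc i) (s≤s a<q)) (trans e eq))))
      (trans (cong (λ z → δ z N) (sym eq)) (δ-refl N)))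

  fourth : ∀ d → + (d ℕ.^ 4) ≡ + d * + d * + d * + d
  fourth d = trans (ℤP.pos-* d (d ℕ.^ 3)) (trans (cong (+ d *_) (trans (ℤP.pos-* d (d ℕ.^ 2)) (cong (+ d *_) (trans (ℤP.pos-* d (d ℕ.^ 1)) (cong (+ d *_) (ℤP.pos-* d 1)))))) (t (+ d)))
    where
    t : ∀ x → x * (x * (x * (x * + 1))) ≡ x * x * x * x
    t = solve-∀

  C-term≡ : ∀ n i → sumℤ (suc n) (λ a → lA₅ (suc a) (suc i) * δ (suc a ℕ.* suc i) (suc n)) ≡ proj₁ (C-term n) i
  C-term≡ n i with suc i ∣? suc n
  ... | yes (ℕD.divides (suc q) eq) = trans (sum-*ˡ (suc n) (χ (suc i) * (+ suc i * + suc i * + suc i * + suc i)) (λ a → δ (suc a ℕ.* suc i) (suc n)))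
        (trans (cong (χ (suc i) * (+ suc i * + suc i * + suc i * + suc i) *_) (one-divisor (suc n) q i (subst (q <_) (sym eq) (ℕP.m≤m*n (suc q) (suc i))) eq))
        (trans (ℤP.*-identityʳ (χ (suc i) * (+ suc i * + suc i * + suc i * + suc i))) (sym (cong₂ _*_ (χ₃≡χ (suc i)) (fourth (suc i))))))
  ... | no ∤ = sum-zero (suc n) (λ a _ → *0ʳ (lA₅ (suc a) (suc i)) (δ-≢ (suc a ℕ.* suc i) (suc n) (λ e → ∤ (ℕD.divides (suc a) (sym e)))))

  C≈1+3A₅ : C ≈ K (+ 1) ⊕ K (+ 3) ⊙ A₅ₛ
  C≈1+3A₅ = pw λ { zero → sym (trans (⊕-at (K (+ 1)) (K (+ 3) ⊙ A₅ₛ) 0) (cong (_+_ (+ 1)) (at (K⊙ (+ 3) A₅ₛ) 0)))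
                 ; (suc n) → sym (trans (⊕-at (K (+ 1)) (K (+ 3) ⊙ A₅ₛ) (suc n)) (trans (ℤP.+-identityˡ ((K (+ 3) ⊙ A₅ₛ) (suc n))) (trans (at (K⊙ (+ 3) A₅ₛ) (suc n))
                     (trans (cong (+ 3 *_) (sum-cong′ (suc n) (C-term≡ n))) (sym (proj₂ (C-term n))))))) }

  C≈wB : C ≈ wₛ ⊙ Bₛ
  C≈wB = ≈-trans C≈1+3A₅ 1+3A₅≈wB

  affine-0 : ∀ k f → f 0 ≡ + 0 → (K (+ 1) ⊕ K k ⊙ f) 0 ≡ + 1
  affine-0 k f h = trans (⊕-at (K (+ 1)) (K k ⊙ f) 0) (cong (_+_ (+ 1)) (trans (at (K⊙ k f) 0) (trans (cong (k *_) h) (ℤP.*-zeroʳ k))))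

  w-0 : wₛ 0 ≡ + 1
  w-0 = affine-0 (+ 12) Eₛ refl

  B-0 : Bₛ 0 ≡ + 1
  B-0 = trans (⊖-at (K (+ 1)) (K (+ 9) ⊙ A₃ₛ) 0) (cong (λ z → + 1 - z) (at (K⊙ (+ 9) A₃ₛ) 0))

  -- Both sides have logarithmic derivative 3y + w and begin with q.
  c≈tB : cₛ ≈ Xq ⊙ τ ⊙ Bₛ
  c≈tB = LD-unique {L = K (+ 3) ⊙ yₛ ⊕ wₛ}
    (trans (⊕-at (K (+ 3) ⊙ yₛ) wₛ 0) (cong₂ _+_ (trans (at (K⊙ (+ 3) yₛ) 0) (cong (+ 3 *_) (at (K⊙ (- + 3) Yₛ) 0))) w-0))
    θc
    (LD-cong ≈-refl (solve 2 (λ y w → con (+ 1) :+ (w :- con (+ 1)) :+ con (+ 3) :* y := con (+ 3) :* y :+ w) ≈-refl yₛ wₛ)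
      (LD-⊙ (LD-⊙ LD-Xq LD-τ) (≈-trans θB (solve 2 (λ y B → con (+ 3) :* (y :* B) := B :* (con (+ 3) :* y)) ≈-refl yₛ Bₛ))))
    (sym (trans (lift 0) refl)) (sym (trans (lift 1) (trans (⊙-0 τ Bₛ) (cong₂ _*_ τ-0 B-0))))
    where
    lift : ∀ n → (Xq ⊙ τ ⊙ Bₛ) n ≡ Xs (τ ⊙ Bₛ) n
    lift n = at (≈-trans (solve 3 (λ x t b → x :* t :* b := x :* (t :* b)) ≈-refl Xq τ Bₛ) (Xq⊙ (τ ⊙ Bₛ))) n

  -- Integer powers of τ

  σ : Series
  σ = inv τ

  τσ : τ ⊙ σ ≈ K (+ 1)
  τσ = inv-right τ τ-0

  -- Powers of t are always stripped of their power of q, which survives as a shift of the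
  -- coefficient index; so negative powers remain ordinary power series.
  τ^ : ℤ → Series
  τ^ (+ n)    = pow τ n
  τ^ -[1+ n ] = pow σ (suc n)

  τ^-suc : ∀ k → τ^ (+ 1 + k) ≈ τ ⊙ τ^ k
  τ^-suc (+ n) = mul≈⊙ τ (pow τ n)
  τ^-suc -[1+ zero ] = begin
    one             ≈⟨ one≈K1 ⟩
    K (+ 1)         ≈⟨ ≈-sym τσ ⟩
    τ ⊙ σ           ≈⟨ solve 2 (λ t s → t :* s := t :* (s :* con (+ 1))) ≈-refl τ σ ⟩
    τ ⊙ (σ ⊙ K (+ 1)) ≈⟨ *-cong ≈-refl (≈-trans (*-cong ≈-refl (≈-sym one≈K1)) (≈-sym (mul≈⊙ σ one))) ⟩
    τ ⊙ mul σ one   ∎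
  τ^-suc -[1+ suc n ] = begin
    pow σ (suc n)             ≈⟨ solve 1 (λ s → s := con (+ 1) :* s) ≈-refl (pow σ (suc n)) ⟩
    K (+ 1) ⊙ pow σ (suc n)   ≈⟨ *-cong (≈-sym τσ) ≈-refl ⟩
    τ ⊙ σ ⊙ pow σ (suc n)     ≈⟨ solve 3 (λ t s r → t :* s :* r := t :* (s :* r)) ≈-refl τ σ (pow σ (suc n)) ⟩
    τ ⊙ (σ ⊙ pow σ (suc n))   ≈⟨ *-cong ≈-refl (≈-sym (mul≈⊙ σ (pow σ (suc n)))) ⟩
    τ ⊙ pow σ (suc (suc n))   ∎

  τ-cancel : ∀ {f g} → τ ⊙ f ≈ τ ⊙ g → f ≈ g
  τ-cancel {f} {g} h = begin
    f               ≈⟨ solve 1 (λ f → f := con (+ 1) :* f) ≈-refl f ⟩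
    K (+ 1) ⊙ f     ≈⟨ *-cong (≈-sym τσ) ≈-refl ⟩
    τ ⊙ σ ⊙ f       ≈⟨ solve 3 (λ t s f → t :* s :* f := s :* (t :* f)) ≈-refl τ σ f ⟩
    σ ⊙ (τ ⊙ f)     ≈⟨ *-cong ≈-refl h ⟩
    σ ⊙ (τ ⊙ g)     ≈⟨ solve 3 (λ t s f → s :* (t :* f) := t :* s :* f) ≈-refl τ σ g ⟩
    τ ⊙ σ ⊙ g       ≈⟨ *-cong τσ ≈-refl ⟩
    K (+ 1) ⊙ g     ≈⟨ solve 1 (λ f → con (+ 1) :* f := f) ≈-refl g ⟩
    g               ∎

  ℤ-induction : (P : ℤ → Set) → P (+ 0) → (∀ k → P k → P (+ 1 + k)) → (∀ k → P (+ 1 + k) → P k) → ∀ k → P k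
  ℤ-induction P z up down (+ zero)       = z
  ℤ-induction P z up down (+ suc n)      = up (+ n) (ℤ-induction P z up down (+ n))
  ℤ-induction P z up down -[1+ zero ]    = down -[1+ 0 ] z
  ℤ-induction P z up down -[1+ suc n ]   = down -[1+ suc n ] (ℤ-induction P z up down -[1+ n ])

  τ^-+ : ∀ k l → τ^ (k + l) ≈ τ^ k ⊙ τ^ l
  τ^-+ k l = ℤ-induction (λ k → τ^ (k + l) ≈ τ^ k ⊙ τ^ l)
    (≈-trans (≈-reflexive (cong τ^ (ℤP.+-identityˡ l))) (≈-trans (solve 1 (λ f → f := con (+ 1) :* f) ≈-refl (τ^ l)) (*-cong (≈-sym one≈K1) ≈-refl)))
    (λ k h → begin
      τ^ (+ 1 + k + l)       ≈⟨ ≈-reflexive (cong τ^ (ℤP.+-assoc (+ 1) k l)) ⟩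
      τ^ (+ 1 + (k + l))     ≈⟨ τ^-suc (k + l) ⟩
      τ ⊙ τ^ (k + l)         ≈⟨ *-cong ≈-refl h ⟩
      τ ⊙ (τ^ k ⊙ τ^ l)      ≈⟨ solve 3 (λ a b c → a :* (b :* c) := a :* b :* c) ≈-refl τ (τ^ k) (τ^ l) ⟩
      τ ⊙ τ^ k ⊙ τ^ l        ≈⟨ *-cong (≈-sym (τ^-suc k)) ≈-refl ⟩
      τ^ (+ 1 + k) ⊙ τ^ l    ∎)
    (λ k h → τ-cancel (begin
      τ ⊙ τ^ (k + l)         ≈⟨ ≈-sym (τ^-suc (k + l)) ⟩
      τ^ (+ 1 + (k + l))     ≈⟨ ≈-reflexive (cong τ^ (sym (ℤP.+-assoc (+ 1) k l))) ⟩
      τ^ (+ 1 + k + l)       ≈⟨ h ⟩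
      τ^ (+ 1 + k) ⊙ τ^ l    ≈⟨ *-cong (τ^-suc k) ≈-refl ⟩
      τ ⊙ τ^ k ⊙ τ^ l        ≈⟨ solve 3 (λ a b c → a :* b :* c := a :* (b :* c)) ≈-refl τ (τ^ k) (τ^ l) ⟩
      τ ⊙ (τ^ k ⊙ τ^ l)      ∎)) k

  τ^-neg : ∀ k → τ^ k ⊙ τ^ (- k) ≈ K (+ 1)
  τ^-neg k = ≈-trans (≈-sym (τ^-+ k (- k))) (≈-trans (≈-reflexive (cong τ^ (ℤP.+-inverseʳ k))) one≈K1)

  τ^-0 : ∀ k → τ^ k 0 ≡ + 1
  τ^-0 (+ n)    = pow-0 τ n τ-0
  τ^-0 -[1+ n ] = pow-0 σ (suc n) refl

  LD-τ^ : ∀ k → LD (τ^ k) (K k ⊙ (wₛ ⊖ K (+ 1)))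
  LD-τ^ (+ n)    = LD-pow n LD-τ
  LD-τ^ -[1+ n ] = LD-cong ≈-refl (≈-trans (solve 2 (λ n w → n :* (:- (w :- con (+ 1))) := (:- n) :* (w :- con (+ 1))) ≈-refl (K (+ suc n)) wₛ) (*-cong (≈-sym (Exact.const-neg (+ suc n))) ≈-refl))
    (LD-pow (suc n) (LD-inverse τσ LD-τ))

  inv-pow-τ : ∀ j → inv (pow τ j) ≈ τ^ (- + j)
  inv-pow-τ j = begin
    inv (pow τ j)                                  ≈⟨ solve 1 (λ f → f := f :* con (+ 1)) ≈-refl (inv (pow τ j)) ⟩
    inv (pow τ j) ⊙ K (+ 1)                        ≈⟨ *-cong ≈-refl (≈-sym (τ^-neg (+ j))) ⟩
    inv (pow τ j) ⊙ (pow τ j ⊙ τ^ (- + j))         ≈⟨ solve 3 (λ i p m → i :* (p :* m) := p :* i :* m) ≈-refl (inv (pow τ j)) (pow τ j) (τ^ (- + j)) ⟩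
    pow τ j ⊙ inv (pow τ j) ⊙ τ^ (- + j)           ≈⟨ *-cong (inv-right (pow τ j) (pow-0 τ j τ-0)) ≈-refl ⟩
    K (+ 1) ⊙ τ^ (- + j)                           ≈⟨ solve 1 (λ f → con (+ 1) :* f := f) ≈-refl (τ^ (- + j)) ⟩
    τ^ (- + j)                                     ∎

  Bi wi : Series
  Bi = inv Bₛ
  wi = inv wₛ

  BBi : Bₛ ⊙ Bi ≈ K (+ 1)
  BBi = inv-right Bₛ B-0

  wwi : wₛ ⊙ wi ≈ K (+ 1)
  wwi = inv-right wₛ w-0

  -- Bol's identity: θ⁴ maps the weight -3 form t⁻ⁿ/B to weight 5.  The operator θ - n on power series is
  -- θ acting on q⁻ⁿ times the series.

  ∂ : ℤ → Series → Series
  ∂ n f = θ f ⊖ K n ⊙ f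

  ∂-cong : ∀ n {f g} → f ≈ g → ∂ n f ≈ ∂ n g
  ∂-cong n h = +-cong (θ-cong h) (-‿cong (*-cong ≈-refl h))

  ∂-at : ∀ n f k → ∂ n f k ≡ (+ k - n) * f k
  ∂-at n f k = trans (⊖-at (θ f) (K n ⊙ f) k) (trans (cong (λ z → + k * f k - z) (at (K⊙ n f) k)) (t (+ k) n (f k)))
    where
    t : ∀ k n x → k * x - n * x ≡ (k - n) * x
    t = solve-∀

  -- Iterated derivatives are computed on formal polynomials in a, c, y and the constant n.
  data Expr : Set where
    num : ℤ → Expr
    ea ec ey en : Expr
    _⟨+⟩_ _⟨*⟩_ : Expr → Expr → Expr

  infixl 6 _⟨+⟩_
  infixl 7 _⟨*⟩_

  poly : Expr → Polynomial 4
  poly (num c) = con c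
  poly ea = var Fin.zero
  poly ec = var (Fin.suc Fin.zero)
  poly ey = var (Fin.suc (Fin.suc Fin.zero))
  poly en = var (Fin.suc (Fin.suc (Fin.suc Fin.zero)))
  poly (p ⟨+⟩ r) = poly p :+ poly r
  poly (p ⟨*⟩ r) = poly p :* poly r

  D : Expr → Expr
  D (num c) = num (+ 0)
  D ea = ea ⟨*⟩ ey ⟨+⟩ num (+ 9) ⟨*⟩ ec
  D ec = ec ⟨*⟩ (num (+ 3) ⟨*⟩ ey ⟨+⟩ ea ⟨*⟩ ea)
  D ey = ey ⟨*⟩ ey ⟨+⟩ num (- + 3) ⟨*⟩ (ea ⟨*⟩ ec)
  D en = num (+ 0)
  D (p ⟨+⟩ r) = D p ⟨+⟩ D r
  D (p ⟨*⟩ r) = D p ⟨*⟩ r ⟨+⟩ p ⟨*⟩ D r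

  module Bol (n : ℤ) where

    ρ : Vec Series 4
    ρ = aₛ Vec.∷ cₛ Vec.∷ yₛ Vec.∷ K n Vec.∷ Vec.[]

    eval : Expr → Series
    eval p = ⟦ poly p ⟧ ρ

    D-sound : ∀ p → θ (eval p) ≈ eval (D p)
    D-sound (num c) = θ-K c
    D-sound ea = θa
    D-sound ec = ≈-trans θc (*-cong ≈-refl (+-cong ≈-refl (≈-sym a²≈w)))
    D-sound ey = ≈-trans θy (solve 3 (λ a c y → y :* y :- con (+ 3) :* (a :* c) := y :* y :+ con (- + 3) :* (a :* c)) ≈-refl aₛ cₛ yₛ)
    D-sound en = θ-K n
    D-sound (p ⟨+⟩ r) = ≈-trans (θ-+ (eval p) (eval r)) (+-cong (D-sound p) (D-sound r))
    D-sound (p ⟨*⟩ r) = ≈-trans (θ-* (eval p) (eval r)) (+-cong (*-cong (D-sound p) ≈-refl) (*-cong ≈-refl (D-sound r)))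

    -- The logarithmic derivative of t^(-n)/B is -(nw + 3y) with w = a²; `step` is the derivation
    -- that remains when t^(-n)/B is factored out.
    step : Expr → Expr
    step p = D p ⟨+⟩ num (- + 1) ⟨*⟩ ((en ⟨*⟩ (ea ⟨*⟩ ea) ⟨+⟩ num (+ 3) ⟨*⟩ ey) ⟨*⟩ p)

    -- The form t^(-n)/B of weight -3, without its factor q^(-n).
    G : Series
    G = τ^ (- n) ⊙ Bi

    LD-G : LD G (K (- n) ⊙ (wₛ ⊖ K (+ 1)) ⊕ neg (K (+ 3) ⊙ yₛ))
    LD-G = LD-⊙ (LD-τ^ (- n)) (LD-inverse BBi (≈-trans θB (solve 2 (λ y B → con (+ 3) :* (y :* B) := B :* (con (+ 3) :* y)) ≈-refl yₛ Bₛ)))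

    ∂-step : ∀ p → ∂ n (G ⊙ eval p) ≈ G ⊙ eval (step p)
    ∂-step p = begin
      θ (G ⊙ eval p) ⊖ K n ⊙ (G ⊙ eval p)
        ≈⟨ +-cong (≈-trans (θ-* G (eval p)) (+-cong (*-cong LD-G ≈-refl) (*-cong ≈-refl (D-sound p)))) ≈-refl ⟩
      G ⊙ (K (- n) ⊙ (wₛ ⊖ K (+ 1)) ⊕ neg (K (+ 3) ⊙ yₛ)) ⊙ eval p ⊕ G ⊙ eval (D p) ⊖ K n ⊙ (G ⊙ eval p)
        ≈⟨ +-cong (+-cong (*-cong (*-cong ≈-refl (+-cong (*-cong (Exact.const-neg n) (+-cong (≈-sym a²≈w) ≈-refl)) ≈-refl)) ≈-refl) ≈-refl) ≈-refl ⟩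
      G ⊙ (neg (K n) ⊙ (aₛ ⊙ aₛ ⊖ K (+ 1)) ⊕ neg (K (+ 3) ⊙ yₛ)) ⊙ eval p ⊕ G ⊙ eval (D p) ⊖ K n ⊙ (G ⊙ eval p)
        ≈⟨ solve 6 (λ g n a y p d → g :* ((:- n) :* (a :* a :- con (+ 1)) :+ (:- (con (+ 3) :* y))) :* p :+ g :* d :- n :* (g :* p)
             := g :* (d :+ con (- + 1) :* ((n :* (a :* a) :+ con (+ 3) :* y) :* p))) ≈-refl G (K n) aₛ yₛ (eval p) (eval (D p)) ⟩
      G ⊙ eval (step p) ∎

    -- That y does not occur in `target` is Bol's identity: the fourth derivative of a form of
    -- weight -3 is modular, whereas y is only quasimodular. The rest is sorted by powers of b = a³
    -- - 27c and c, and the polynomial identity is checked by normalisation.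
    F₄ target : Expr
    F₄ = step (step (step (step (num (+ 1)))))
    b r n₁ : Expr
    b = ea ⟨*⟩ ea ⟨*⟩ ea ⟨+⟩ num (- + 27) ⟨*⟩ ec
    r = num (+ 54) ⟨*⟩ en ⟨*⟩ en ⟨*⟩ en ⟨*⟩ en ⟨+⟩ num (- + 108) ⟨*⟩ en ⟨*⟩ en ⟨*⟩ en ⟨+⟩ num (+ 102) ⟨*⟩ en ⟨*⟩ en ⟨+⟩ num (- + 48) ⟨*⟩ en ⟨+⟩ num (+ 9)
    n₁ = en ⟨+⟩ num (- + 1)
    target = ea ⟨*⟩ ea ⟨*⟩ (en ⟨*⟩ en ⟨*⟩ en ⟨*⟩ en ⟨*⟩ b ⟨*⟩ b ⟨+⟩ r ⟨*⟩ ec ⟨*⟩ b ⟨+⟩ num (+ 729) ⟨*⟩ n₁ ⟨*⟩ n₁ ⟨*⟩ n₁ ⟨*⟩ n₁ ⟨*⟩ ec ⟨*⟩ ec)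

    F₄≈target : eval F₄ ≈ eval target
    F₄≈target = prove ρ (poly F₄) (poly target) ≈-refl

    ∂⁴G : ∂ n (∂ n (∂ n (∂ n G))) ≈ G ⊙ eval target
    ∂⁴G = begin
      ∂ n (∂ n (∂ n (∂ n G)))
        ≈⟨ ∂-cong n (∂-cong n (∂-cong n (∂-cong n (solve 1 (λ g → g := g :* con (+ 1)) ≈-refl G)))) ⟩
      ∂ n (∂ n (∂ n (∂ n (G ⊙ eval (num (+ 1))))))
        ≈⟨ ∂-cong n (∂-cong n (∂-cong n (∂-step (num (+ 1))))) ⟩
      ∂ n (∂ n (∂ n (G ⊙ eval (step (num (+ 1))))))
        ≈⟨ ∂-cong n (∂-cong n (∂-step (step (num (+ 1))))) ⟩
      ∂ n (∂ n (G ⊙ eval (step (step (num (+ 1))))))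
        ≈⟨ ∂-cong n (∂-step (step (step (num (+ 1))))) ⟩
      ∂ n (G ⊙ eval (step (step (step (num (+ 1))))))
        ≈⟨ ∂-step (step (step (step (num (+ 1))))) ⟩
      G ⊙ eval F₄
        ≈⟨ *-cong ≈-refl F₄≈target ⟩
      G ⊙ eval target ∎

  -- θₜ = t d/dt = w⁻¹ θ
  θₜB θₜθₜB : Series
  θₜB = K (+ 3) ⊙ (yₛ ⊙ Bₛ) ⊙ wi
  θₜθₜB = θ θₜB ⊙ wi

  θₜB-w : θₜB ⊙ wₛ ≈ θ Bₛ
  θₜB-w = begin
    K (+ 3) ⊙ (yₛ ⊙ Bₛ) ⊙ wi ⊙ wₛ     ≈⟨ solve 3 (λ x i w → x :* i :* w := x :* (w :* i)) ≈-refl (K (+ 3) ⊙ (yₛ ⊙ Bₛ)) wi wₛ ⟩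
    K (+ 3) ⊙ (yₛ ⊙ Bₛ) ⊙ (wₛ ⊙ wi)   ≈⟨ *-cong ≈-refl wwi ⟩
    K (+ 3) ⊙ (yₛ ⊙ Bₛ) ⊙ K (+ 1)     ≈⟨ solve 1 (λ x → x :* con (+ 1) := x) ≈-refl (K (+ 3) ⊙ (yₛ ⊙ Bₛ)) ⟩
    K (+ 3) ⊙ (yₛ ⊙ Bₛ)               ≈⟨ ≈-sym θB ⟩
    θ Bₛ                              ∎

  θₜθₜB-w : θₜθₜB ⊙ wₛ ≈ θ θₜB
  θₜθₜB-w = begin
    θ θₜB ⊙ wi ⊙ wₛ     ≈⟨ solve 3 (λ x i w → x :* i :* w := x :* (w :* i)) ≈-refl (θ θₜB) wi wₛ ⟩
    θ θₜB ⊙ (wₛ ⊙ wi)   ≈⟨ *-cong ≈-refl wwi ⟩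
    θ θₜB ⊙ K (+ 1)     ≈⟨ solve 1 (λ x → x :* con (+ 1) := x) ≈-refl (θ θₜB) ⟩
    θ θₜB               ∎

  tq : Series
  tq = Xq ⊙ τ

  θw : θ wₛ ≈ K (+ 2) ⊙ (wₛ ⊙ yₛ) ⊕ K (+ 18) ⊙ (aₛ ⊙ cₛ)
  θw = begin
    θ wₛ                       ≈⟨ θ-cong (≈-sym a²≈w) ⟩
    θ (aₛ ⊙ aₛ)                ≈⟨ θ-* aₛ aₛ ⟩
    θ aₛ ⊙ aₛ ⊕ aₛ ⊙ θ aₛ      ≈⟨ +-cong (*-cong θa ≈-refl) (*-cong ≈-refl θa) ⟩
    (aₛ ⊙ yₛ ⊕ K (+ 9) ⊙ cₛ) ⊙ aₛ ⊕ aₛ ⊙ (aₛ ⊙ yₛ ⊕ K (+ 9) ⊙ cₛ)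
      ≈⟨ solve 3 (λ a c y → (a :* y :+ con (+ 9) :* c) :* a :+ a :* (a :* y :+ con (+ 9) :* c) := con (+ 2) :* (a :* a :* y) :+ con (+ 18) :* (a :* c)) ≈-refl aₛ cₛ yₛ ⟩
    K (+ 2) ⊙ (aₛ ⊙ aₛ ⊙ yₛ) ⊕ K (+ 18) ⊙ (aₛ ⊙ cₛ)   ≈⟨ +-cong (*-cong ≈-refl (*-cong a²≈w ≈-refl)) ≈-refl ⟩
    K (+ 2) ⊙ (wₛ ⊙ yₛ) ⊕ K (+ 18) ⊙ (aₛ ⊙ cₛ) ∎

  w²θₜθₜB : wₛ ⊙ wₛ ⊙ θₜθₜB ≈ K (+ 6) ⊙ (Bₛ ⊙ yₛ ⊙ yₛ) ⊖ K (+ 9) ⊙ (aₛ ⊙ Bₛ ⊙ cₛ) ⊖ K (+ 18) ⊙ (aₛ ⊙ cₛ ⊙ θₜB)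
  w²θₜθₜB = begin
    wₛ ⊙ wₛ ⊙ θₜθₜB
      ≈⟨ solve 2 (λ w h → w :* w :* h := w :* (h :* w)) ≈-refl wₛ θₜθₜB ⟩
    wₛ ⊙ (θₜθₜB ⊙ wₛ)
      ≈⟨ *-cong ≈-refl θₜθₜB-w ⟩
    wₛ ⊙ θ θₜB
      ≈⟨ solve 4 (λ w f t u → w :* t := (t :* w :+ f :* u) :- f :* u) ≈-refl wₛ θₜB (θ θₜB) (θ wₛ) ⟩
    θ θₜB ⊙ wₛ ⊕ θₜB ⊙ θ wₛ ⊖ θₜB ⊙ θ wₛ
      ≈⟨ +-cong (≈-trans (≈-sym (θ-* θₜB wₛ)) (≈-trans (θ-cong (≈-trans θₜB-w θB)) (≈-trans (θ-K* (+ 3) (yₛ ⊙ Bₛ)) (*-cong ≈-refl (≈-trans (θ-* yₛ Bₛ) (+-cong (*-cong θy ≈-refl) (*-cong ≈-refl θB))))))) (-‿cong (*-cong ≈-refl θw)) ⟩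
    K (+ 3) ⊙ ((yₛ ⊙ yₛ ⊖ K (+ 3) ⊙ (aₛ ⊙ cₛ)) ⊙ Bₛ ⊕ yₛ ⊙ (K (+ 3) ⊙ (yₛ ⊙ Bₛ))) ⊖ θₜB ⊙ (K (+ 2) ⊙ (wₛ ⊙ yₛ) ⊕ K (+ 18) ⊙ (aₛ ⊙ cₛ))
      ≈⟨ solve 6 (λ a c y B f w → con (+ 3) :* ((y :* y :- con (+ 3) :* (a :* c)) :* B :+ y :* (con (+ 3) :* (y :* B))) :- f :* (con (+ 2) :* (w :* y) :+ con (+ 18) :* (a :* c))
           := con (+ 12) :* (B :* y :* y) :- con (+ 9) :* (a :* B :* c) :- con (+ 18) :* (a :* c :* f) :- con (+ 2) :* y :* (f :* w)) ≈-refl aₛ cₛ yₛ Bₛ θₜB wₛ ⟩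
    K (+ 12) ⊙ (Bₛ ⊙ yₛ ⊙ yₛ) ⊖ K (+ 9) ⊙ (aₛ ⊙ Bₛ ⊙ cₛ) ⊖ K (+ 18) ⊙ (aₛ ⊙ cₛ ⊙ θₜB) ⊖ K (+ 2) ⊙ yₛ ⊙ (θₜB ⊙ wₛ)
      ≈⟨ +-cong ≈-refl (-‿cong (*-cong ≈-refl (≈-trans θₜB-w θB))) ⟩
    K (+ 12) ⊙ (Bₛ ⊙ yₛ ⊙ yₛ) ⊖ K (+ 9) ⊙ (aₛ ⊙ Bₛ ⊙ cₛ) ⊖ K (+ 18) ⊙ (aₛ ⊙ cₛ ⊙ θₜB) ⊖ K (+ 2) ⊙ yₛ ⊙ (K (+ 3) ⊙ (yₛ ⊙ Bₛ))
      ≈⟨ solve 5 (λ a c y B f → con (+ 12) :* (B :* y :* y) :- con (+ 9) :* (a :* B :* c) :- con (+ 18) :* (a :* c :* f) :- con (+ 2) :* y :* (con (+ 3) :* (y :* B))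
           := con (+ 6) :* (B :* y :* y) :- con (+ 9) :* (a :* B :* c) :- con (+ 18) :* (a :* c :* f)) ≈-refl aₛ cₛ yₛ Bₛ θₜB ⟩
    K (+ 6) ⊙ (Bₛ ⊙ yₛ ⊙ yₛ) ⊖ K (+ 9) ⊙ (aₛ ⊙ Bₛ ⊙ cₛ) ⊖ K (+ 18) ⊙ (aₛ ⊙ cₛ ⊙ θₜB) ∎

  -- The second order equation of B^{1/3}, written for B; z = 1 + 27t.
  quadratic : Series → Series → Series → Series → Series
  quadratic t f f′ f″ = K (+ 3) ⊙ ((K (+ 1) ⊕ K (+ 27) ⊙ t) ⊙ f ⊙ f″) ⊖ K (+ 2) ⊙ ((K (+ 1) ⊕ K (+ 27) ⊙ t) ⊙ f′ ⊙ f′)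
    ⊕ K (+ 54) ⊙ (t ⊙ f ⊙ f′) ⊕ K (+ 27) ⊙ (t ⊙ f ⊙ f)

  zB : Bₛ ⊕ K (+ 27) ⊙ cₛ ≈ aₛ ⊙ aₛ ⊙ aₛ
  zB = ≈-trans (+-cong B≈a³-27c ≈-refl) (solve 2 (λ a c → a :- c :+ c := a) ≈-refl (aₛ ⊙ aₛ ⊙ aₛ) (K (+ 27) ⊙ cₛ))

  unit-cancel : ∀ {u v f} → u ⊙ v ≈ K (+ 1) → u ⊙ f ≈ K (+ 0) → f ≈ K (+ 0)
  unit-cancel {u} {v} {f} uv h = begin
    f             ≈⟨ solve 1 (λ f → f := con (+ 1) :* f) ≈-refl f ⟩
    K (+ 1) ⊙ f   ≈⟨ *-cong (≈-sym uv) ≈-refl ⟩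
    u ⊙ v ⊙ f     ≈⟨ solve 3 (λ u v f → u :* v :* f := v :* (u :* f)) ≈-refl u v f ⟩
    v ⊙ (u ⊙ f)   ≈⟨ *-cong ≈-refl h ⟩
    v ⊙ K (+ 0)   ≈⟨ solve 1 (λ v → v :* con (+ 0) := con (+ 0)) ≈-refl v ⟩
    K (+ 0)       ∎

  -- Multiplication by the unit Bw² replaces θₜ by θ. The formulas for θy, θB and θw, with (1 +
  -- 27t)B = a³, then leave a polynomial identity.
  quadratic-B : quadratic tq Bₛ θₜB θₜθₜB ≈ K (+ 0)
  quadratic-B = unit-cancel wwi (unit-cancel wwi (unit-cancel BBi (begin
    Bₛ ⊙ (wₛ ⊙ (wₛ ⊙ quadratic tq Bₛ θₜB θₜθₜB))
      ≈⟨ solve 5 (λ t B f h w →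
           B :* (w :* (w :* (con (+ 3) :* ((con (+ 1) :+ con (+ 27) :* t) :* B :* h) :- con (+ 2) :* ((con (+ 1) :+ con (+ 27) :* t) :* f :* f) :+ con (+ 54) :* (t :* B :* f) :+ con (+ 27) :* (t :* B :* B))))
           := con (+ 3) :* (B :+ con (+ 27) :* (t :* B)) :* B :* (w :* w :* h) :- con (+ 2) :* (B :+ con (+ 27) :* (t :* B)) :* (f :* w) :* (f :* w)
              :+ con (+ 54) :* (t :* B) :* B :* (f :* w) :* w :+ con (+ 27) :* (t :* B) :* B :* B :* w :* w) ≈-refl tq Bₛ θₜB θₜθₜB wₛ ⟩
    K (+ 3) ⊙ (Bₛ ⊕ K (+ 27) ⊙ (tq ⊙ Bₛ)) ⊙ Bₛ ⊙ (wₛ ⊙ wₛ ⊙ θₜθₜB) ⊖ K (+ 2) ⊙ (Bₛ ⊕ K (+ 27) ⊙ (tq ⊙ Bₛ)) ⊙ (θₜB ⊙ wₛ) ⊙ (θₜB ⊙ wₛ)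
      ⊕ K (+ 54) ⊙ (tq ⊙ Bₛ) ⊙ Bₛ ⊙ (θₜB ⊙ wₛ) ⊙ wₛ ⊕ K (+ 27) ⊙ (tq ⊙ Bₛ) ⊙ Bₛ ⊙ Bₛ ⊙ wₛ ⊙ wₛ
      ≈⟨ +-cong (+-cong (+-cong (*-cong (*-cong (*-cong ≈-refl z≈) ≈-refl) w²θₜθₜB) (-‿cong (*-cong (*-cong (*-cong ≈-refl z≈) f≈) f≈)))
           (*-cong (*-cong (*-cong (*-cong ≈-refl (≈-sym c≈tB)) ≈-refl) ≈-refl) (≈-sym a²≈w))) (*-cong (*-cong (*-cong (*-cong (*-cong ≈-refl (≈-sym c≈tB)) ≈-refl) ≈-refl) (≈-sym a²≈w)) (≈-sym a²≈w)) ⟩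
    K (+ 3) ⊙ (aₛ ⊙ aₛ ⊙ aₛ) ⊙ Bₛ ⊙ (K (+ 6) ⊙ (Bₛ ⊙ yₛ ⊙ yₛ) ⊖ K (+ 9) ⊙ (aₛ ⊙ Bₛ ⊙ cₛ) ⊖ K (+ 18) ⊙ (aₛ ⊙ cₛ ⊙ θₜB)) ⊖ K (+ 2) ⊙ (aₛ ⊙ aₛ ⊙ aₛ) ⊙ (K (+ 3) ⊙ (yₛ ⊙ Bₛ)) ⊙ (K (+ 3) ⊙ (yₛ ⊙ Bₛ))
      ⊕ K (+ 54) ⊙ cₛ ⊙ Bₛ ⊙ (θₜB ⊙ wₛ) ⊙ (aₛ ⊙ aₛ) ⊕ K (+ 27) ⊙ cₛ ⊙ Bₛ ⊙ Bₛ ⊙ (aₛ ⊙ aₛ) ⊙ (aₛ ⊙ aₛ)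
      ≈⟨ +-cong (+-cong ≈-refl (*-cong (*-cong ≈-refl (*-cong ≈-refl (≈-sym a²≈w))) ≈-refl)) ≈-refl ⟩
    K (+ 3) ⊙ (aₛ ⊙ aₛ ⊙ aₛ) ⊙ Bₛ ⊙ (K (+ 6) ⊙ (Bₛ ⊙ yₛ ⊙ yₛ) ⊖ K (+ 9) ⊙ (aₛ ⊙ Bₛ ⊙ cₛ) ⊖ K (+ 18) ⊙ (aₛ ⊙ cₛ ⊙ θₜB)) ⊖ K (+ 2) ⊙ (aₛ ⊙ aₛ ⊙ aₛ) ⊙ (K (+ 3) ⊙ (yₛ ⊙ Bₛ)) ⊙ (K (+ 3) ⊙ (yₛ ⊙ Bₛ))
      ⊕ K (+ 54) ⊙ cₛ ⊙ Bₛ ⊙ (θₜB ⊙ (aₛ ⊙ aₛ)) ⊙ (aₛ ⊙ aₛ) ⊕ K (+ 27) ⊙ cₛ ⊙ Bₛ ⊙ Bₛ ⊙ (aₛ ⊙ aₛ) ⊙ (aₛ ⊙ aₛ)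
      ≈⟨ solve 5 (λ a c y B f → con (+ 3) :* (a :* a :* a) :* B :* (con (+ 6) :* (B :* y :* y) :- con (+ 9) :* (a :* B :* c) :- con (+ 18) :* (a :* c :* f)) :- con (+ 2) :* (a :* a :* a) :* (con (+ 3) :* (y :* B)) :* (con (+ 3) :* (y :* B))
            :+ con (+ 54) :* c :* B :* (f :* (a :* a)) :* (a :* a) :+ con (+ 27) :* c :* B :* B :* (a :* a) :* (a :* a) := con (+ 0)) ≈-refl aₛ cₛ yₛ Bₛ θₜB ⟩
    K (+ 0) ∎)))
    where
    z≈ : Bₛ ⊕ K (+ 27) ⊙ (tq ⊙ Bₛ) ≈ aₛ ⊙ aₛ ⊙ aₛ
    z≈ = ≈-trans (+-cong ≈-refl (*-cong ≈-refl (≈-sym c≈tB))) zB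
    f≈ : θₜB ⊙ wₛ ≈ K (+ 3) ⊙ (yₛ ⊙ Bₛ)
    f≈ = ≈-trans θₜB-w θB

  -- Expansion of a power series in q in powers of t: the coefficient of tⁿ is the residue of f t⁻ⁿ dt/t.

  ℰ : Series → Series
  ℰ f n = (f ⊙ wₛ ⊙ τ^ (- + n)) n

  ℰ-cong : ∀ {f g} → f ≈ g → ℰ f ≈ ℰ g
  ℰ-cong h = pw λ n → at (*-cong (*-cong h (≈-refl {wₛ})) (≈-refl {τ^ (- + n)})) n

  ℰ-+ : ∀ f g → ℰ (f ⊕ g) ≈ ℰ f ⊕ ℰ g
  ℰ-+ f g = pw λ n → trans (at (solve 4 (λ f g w t → (f :+ g) :* w :* t := f :* w :* t :+ g :* w :* t) ≈-refl f g wₛ (τ^ (- + n))) n)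
    (trans (⊕-at (f ⊙ wₛ ⊙ τ^ (- + n)) (g ⊙ wₛ ⊙ τ^ (- + n)) n) (sym (⊕-at (ℰ f) (ℰ g) n)))

  ℰ-K* : ∀ c f → ℰ (K c ⊙ f) ≈ K c ⊙ ℰ f
  ℰ-K* c f = pw λ n → trans (at (solve 4 (λ c f w t → c :* f :* w :* t := c :* (f :* w :* t)) ≈-refl (K c) f wₛ (τ^ (- + n))) n)
    (trans (at (K⊙ c (f ⊙ wₛ ⊙ τ^ (- + n))) n) (sym (at (K⊙ c (ℰ f)) n)))

  ℰ-0 : ∀ f → ℰ f 0 ≡ f 0
  ℰ-0 f = trans (⊙-0 (f ⊙ wₛ) one) (trans (ℤP.*-identityʳ ((f ⊙ wₛ) 0)) (trans (⊙-0 f wₛ) (trans (cong (f 0 *_) w-0) (ℤP.*-identityʳ (f 0)))))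

  -- The residue of an exact differential: n t^(-n) dt/t is -d(t^(-n)).
  ℰ-one : ∀ n → ℰ (K (+ 1)) n ≡ K (+ 1) n
  ℰ-one zero    = ℰ-0 (K (+ 1))
  ℰ-one (suc n) = ℤP.*-cancelˡ-≡ (+ suc n) (ℰ (K (+ 1)) (suc n)) (+ 0) (trans step (sym (ℤP.*-zeroʳ (+ suc n))))
    where
    T = τ^ (- + suc n)
    lhs : (K (+ suc n) ⊙ (K (+ 1) ⊙ wₛ ⊙ T)) (suc n) ≡ (K (+ suc n) ⊙ T ⊖ θ T) (suc n)
    lhs = sym (at (≈-trans (+-cong ≈-refl (-‿cong (≈-trans (LD-τ^ (- + suc n)) (*-cong ≈-refl (*-cong (Exact.const-neg (+ suc n)) ≈-refl)))))
      (solve 3 (λ k t w → k :* t :- t :* ((:- k) :* (w :- con (+ 1))) := k :* (con (+ 1) :* w :* t)) ≈-refl (K (+ suc n)) T wₛ)) (suc n))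
    step : + suc n * ℰ (K (+ 1)) (suc n) ≡ + 0
    step = trans (sym (at (K⊙ (+ suc n) (K (+ 1) ⊙ wₛ ⊙ T)) (suc n))) (trans lhs
      (trans (⊖-at (K (+ suc n) ⊙ T) (θ T) (suc n)) (trans (cong (_- θ T (suc n)) (at (K⊙ (+ suc n) T) (suc n))) (ℤP.+-inverseʳ (+ suc n * T (suc n))))))

  ℰ-K : ∀ c → ℰ (K c) ≈ K c
  ℰ-K c = ≈-trans (ℰ-cong (solve 1 (λ c → c := c :* con (+ 1)) ≈-refl (K c))) (≈-trans (ℰ-K* c (K (+ 1)))
    (≈-trans (*-cong ≈-refl (pw ℰ-one)) (solve 1 (λ c → c :* con (+ 1) := c) ≈-refl (K c))))

  ℰ-tq : ∀ f n → ℰ (tq ⊙ f) (suc n) ≡ ℰ f n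
  ℰ-tq f n = trans (at (≈-trans (*-cong ≈-refl (≈-sym τ≈)) (solve 5 (λ x t f w s → x :* t :* f :* w :* (s) := x :* (f :* w :* (t :* s))) ≈-refl Xq τ f wₛ (τ^ (- + suc n)))) (suc n))
    (trans (at (*-cong (≈-refl {Xq}) (*-cong (≈-refl {f ⊙ wₛ}) τ≈′)) (suc n)) (at (Xq⊙ (f ⊙ wₛ ⊙ τ^ (- + n))) (suc n)))
    where
    τ≈ : τ^ (- + suc n) ≈ τ^ (- + suc n)
    τ≈ = ≈-refl
    τ≈′ : τ ⊙ τ^ (- + suc n) ≈ τ^ (- + n)
    τ≈′ = ≈-trans (≈-sym (τ^-suc (- + suc n))) (≈-reflexive (cong τ^ (t (+ n))))
      where
      t : ∀ n → + 1 + - (+ 1 + n) ≡ - n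
      t = solve-∀

  -- This is (f - f₀)/t, the shift on expansions in t; it allows induction on the degree in t.
  quot : Series → Series
  quot f = σ ⊙ sh f

  quot-eq : ∀ f → f ≈ K (f 0) ⊕ tq ⊙ quot f
  quot-eq f = begin
    f                                 ≈⟨ pw (λ n → trans (split f n) (sym (⊕-at (K (f 0)) (Xs (sh f)) n))) ⟩
    K (f 0) ⊕ Xs (sh f)               ≈⟨ +-cong ≈-refl (≈-sym (Xq⊙ (sh f))) ⟩
    K (f 0) ⊕ Xq ⊙ sh f               ≈⟨ solve 3 (λ k x s → k :+ x :* s := k :+ x :* con (+ 1) :* s) ≈-refl (K (f 0)) Xq (sh f) ⟩
    K (f 0) ⊕ Xq ⊙ K (+ 1) ⊙ sh f     ≈⟨ +-cong ≈-refl (*-cong (*-cong ≈-refl (≈-sym τσ)) ≈-refl) ⟩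
    K (f 0) ⊕ Xq ⊙ (τ ⊙ σ) ⊙ sh f     ≈⟨ solve 5 (λ k x t s f → k :+ x :* (t :* s) :* f := k :+ x :* t :* (s :* f)) ≈-refl (K (f 0)) Xq τ σ (sh f) ⟩
    K (f 0) ⊕ tq ⊙ quot f             ∎

  ℰ-suc : ∀ f n → ℰ f (suc n) ≡ ℰ (quot f) n
  ℰ-suc f n = trans (at (≈-trans (ℰ-cong (quot-eq f)) (ℰ-+ (K (f 0)) (tq ⊙ quot f))) (suc n))
    (trans (⊕-at (ℰ (K (f 0))) (ℰ (tq ⊙ quot f)) (suc n)) (trans (cong₂ _+_ (at (ℰ-K (f 0)) (suc n)) (ℰ-tq (quot f) n)) (ℤP.+-identityˡ (ℰ (quot f) n))))

  ℰ-* : ∀ f g → ℰ (f ⊙ g) ≈ ℰ f ⊙ ℰ g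
  ℰ-* f g = pw λ n → trans (go n f g) (sym (⊙-at (ℰ f) (ℰ g) n))
    where
    go : ∀ n f g → ℰ (f ⊙ g) n ≡ mul (ℰ f) (ℰ g) n
    go zero f g = trans (ℰ-0 (f ⊙ g)) (trans (⊙-0 f g) (sym (trans (mul-zero (ℰ f) (ℰ g)) (cong₂ _*_ (ℰ-0 f) (ℰ-0 g)))))
    go (suc n) f g = trans (at (≈-trans (ℰ-cong expand) (ℰ-+ (K (f 0) ⊙ g) (tq ⊙ (quot f ⊙ g)))) (suc n))
      (trans (⊕-at (ℰ (K (f 0) ⊙ g)) (ℰ (tq ⊙ (quot f ⊙ g))) (suc n))
      (trans (cong₂ _+_ (trans (at (ℰ-K* (f 0) g) (suc n)) (at (K⊙ (f 0) (ℰ g)) (suc n))) (trans (ℰ-tq (quot f ⊙ g) n) (go n (quot f) g)))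
      (sym (trans (mul-suc (ℰ f) (ℰ g) n) (cong₂ _+_ (cong (_* ℰ g (suc n)) (ℰ-0 f)) (mul-cong≐ {g = ℰ g} (ℰ-suc f) (λ _ → refl) n))))))
      where
      expand : f ⊙ g ≈ K (f 0) ⊙ g ⊕ tq ⊙ (quot f ⊙ g)
      expand = ≈-trans (*-cong (quot-eq f) ≈-refl) (solve 4 (λ k t q g → (k :+ t :* q) :* g := k :* g :+ t :* (q :* g)) ≈-refl (K (f 0)) tq (quot f) g)

  -- Integration by parts: h dt/t = df, and the differential of f t^(-n) has no residue.
  ℰ-θ : ∀ {f h} → h ⊙ wₛ ≈ θ f → ℰ h ≈ θ (ℰ f)
  ℰ-θ {f} {h} eq = pw λ n → step n
    where
    step : ∀ n → ℰ h n ≡ + n * ℰ f n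
    step n = trans (at (*-cong eq (≈-refl {T})) n) (trans (at main n) (trans (⊕-at _ _ n) (trans (cong₂ _+_ (trans (⊖-at (θ (f ⊙ T)) (K (+ n) ⊙ (f ⊙ T)) n)
       (trans (cong (λ z → + n * (f ⊙ T) n - z) (at (K⊙ (+ n) (f ⊙ T)) n)) (ℤP.+-inverseʳ (+ n * (f ⊙ T) n)))) (at (K⊙ (+ n) (f ⊙ wₛ ⊙ T)) n)) (ℤP.+-identityˡ (+ n * ℰ f n)))))
      where
      T = τ^ (- + n)
      main : θ f ⊙ T ≈ (θ (f ⊙ T) ⊖ K (+ n) ⊙ (f ⊙ T)) ⊕ K (+ n) ⊙ (f ⊙ wₛ ⊙ T)
      main = ≈-sym (≈-trans (+-cong (+-cong (≈-trans (θ-* f T) (+-cong ≈-refl (*-cong ≈-refl (≈-trans (LD-τ^ (- + n)) (*-cong ≈-refl (*-cong (Exact.const-neg (+ n)) ≈-refl)))))) ≈-refl) ≈-refl)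
        (solve 5 (λ d f T n w → d :* T :+ f :* (T :* ((:- n) :* (w :- con (+ 1)))) :- n :* (f :* T) :+ n :* (f :* w :* T) := d :* T) ≈-refl (θ f) f T (K (+ n)) wₛ))

  -- The coefficients of B in powers of t. By `quadratic-β` this is the cube of the hypergeometric
  -- series 2F1(1/3, 1/3; 1; -27t).
  β : Series
  β = ℰ Bₛ

  ℰ-t : ℰ tq ≈ Xq
  ℰ-t = pw λ { zero → trans (ℰ-0 tq) (⊙-0 Xq τ) ; (suc n) → trans (at (ℰ-cong (solve 1 (λ t → t := t :* con (+ 1)) ≈-refl tq)) (suc n)) (trans (ℰ-tq (K (+ 1)) n) (trans (ℰ-one n) (sym (one≐ n)))) }

  ℰ-⊖ : ∀ f g → ℰ (f ⊖ g) ≈ ℰ f ⊖ ℰ g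
  ℰ-⊖ f g = ≈-trans (ℰ-cong (solve 2 (λ f g → f :- g := f :+ con (- + 1) :* g) ≈-refl f g)) (≈-trans (ℰ-+ f (K (- + 1) ⊙ g))
    (≈-trans (+-cong ≈-refl (ℰ-K* (- + 1) g)) (solve 2 (λ f g → f :+ con (- + 1) :* g := f :- g) ≈-refl (ℰ f) (ℰ g))))

  ℰ-*₃ : ∀ f g h → ℰ (f ⊙ g ⊙ h) ≈ ℰ f ⊙ ℰ g ⊙ ℰ h
  ℰ-*₃ f g h = ≈-trans (ℰ-* (f ⊙ g) h) (*-cong (ℰ-* f g) ≈-refl)

  quadratic-β : quadratic Xq β (θ β) (θ (θ β)) ≈ K (+ 0)
  quadratic-β = ≈-trans (≈-sym (≈-trans ℰ-quadratic (quadratic-cong ℰ-t h₁ h₂))) (≈-trans (ℰ-cong quadratic-B) (ℰ-K (+ 0)))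
    where
    h₁ : ℰ θₜB ≈ θ β
    h₁ = ℰ-θ θₜB-w
    h₂ : ℰ θₜθₜB ≈ θ (θ β)
    h₂ = ≈-trans (ℰ-θ θₜθₜB-w) (θ-cong h₁)
    quadratic-cong : ∀ {t t′ f f′ g g′} → t ≈ t′ → f ≈ f′ → g ≈ g′ → quadratic t β f g ≈ quadratic t′ β f′ g′
    quadratic-cong p q r = +-cong (+-cong (+-cong (*-cong ≈-refl (*-cong (*-cong (+-cong ≈-refl (*-cong ≈-refl p)) ≈-refl) r)) (-‿cong (*-cong ≈-refl (*-cong (*-cong (+-cong ≈-refl (*-cong ≈-refl p)) q) q))))
      (*-cong ≈-refl (*-cong (*-cong p ≈-refl) q))) (*-cong ≈-refl (*-cong (*-cong p ≈-refl) ≈-refl))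
    z : ℰ (K (+ 1) ⊕ K (+ 27) ⊙ tq) ≈ K (+ 1) ⊕ K (+ 27) ⊙ ℰ tq
    z = ≈-trans (ℰ-+ (K (+ 1)) (K (+ 27) ⊙ tq)) (+-cong (ℰ-K (+ 1)) (ℰ-K* (+ 27) tq))
    term : ∀ c f g h → ℰ (K c ⊙ (f ⊙ g ⊙ h)) ≈ K c ⊙ (ℰ f ⊙ ℰ g ⊙ ℰ h)
    term c f g h = ≈-trans (ℰ-K* c (f ⊙ g ⊙ h)) (*-cong ≈-refl (ℰ-*₃ f g h))
    ℰ-quadratic : ℰ (quadratic tq Bₛ θₜB θₜθₜB) ≈ quadratic (ℰ tq) β (ℰ θₜB) (ℰ θₜθₜB)
    ℰ-quadratic = ≈-trans (ℰ-+ _ _) (+-cong (≈-trans (ℰ-+ _ _) (+-cong (≈-trans (ℰ-⊖ _ _) (+-cong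
        (≈-trans (term (+ 3) (K (+ 1) ⊕ K (+ 27) ⊙ tq) Bₛ θₜθₜB) (*-cong ≈-refl (*-cong (*-cong z ≈-refl) ≈-refl)))
        (-‿cong (≈-trans (term (+ 2) (K (+ 1) ⊕ K (+ 27) ⊙ tq) θₜB θₜB) (*-cong ≈-refl (*-cong (*-cong z ≈-refl) ≈-refl))))))
      (term (+ 54) tq Bₛ θₜB))) (term (+ 27) tq Bₛ Bₛ))

-- Arithmetic of congruences, and power series modulo a prime.

exact⇒mod : ∀ {N f g} → Exact._≈_ f g → Mod._≈_ N f g
exact⇒mod {N} h = Mod.≐⇒≈ N (Exact.at h)

≡ₘ0⇒∣ : ∀ {N a} → a ≡ + 0 ⟨mod N ⟩ → + N ∣ˢ a
≡ₘ0⇒∣ {N} {a} (mod d) = subst (+ N ∣ˢ_) (ℤP.+-identityʳ a) d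

∣⇒≡ₘ0 : ∀ {N a} → + N ∣ˢ a → a ≡ + 0 ⟨mod N ⟩
∣⇒≡ₘ0 {N} {a} d = mod (subst (+ N ∣ˢ_) (sym (ℤP.+-identityʳ a)) d)

≡ₘ-difference : ∀ {N a b} → a - b ≡ + 0 ⟨mod N ⟩ → a ≡ b ⟨mod N ⟩
≡ₘ-difference h = mod (≡ₘ0⇒∣ h)

difference-≡ₘ : ∀ {N a b} → a ≡ b ⟨mod N ⟩ → a - b ≡ + 0 ⟨mod N ⟩
difference-≡ₘ (mod d) = ∣⇒≡ₘ0 d

≡ₘ-weaken : ∀ {M N a b} → M ∣ₙ N → a ≡ b ⟨mod N ⟩ → a ≡ b ⟨mod M ⟩
≡ₘ-weaken M∣N (mod d) = mod (Div.∣-trans (∣ᵤ⇒∣ M∣N) d)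

multiple≡0 : ∀ {N} q → + N * q ≡ + 0 ⟨mod N ⟩
multiple≡0 {N} q = ∣⇒≡ₘ0 (divides q (ℤP.*-comm (+ N) q))

≡ₘ-scale : ∀ {M N a b} → a ≡ b ⟨mod N ⟩ → + M * a ≡ + M * b ⟨mod M ℕ.* N ⟩
≡ₘ-scale {M} {N} {a} {b} (mod (divides q e)) = mod (divides q (trans (h (+ M) a b) (trans (cong (+ M *_) e) (trans (h₂ (+ M) q (+ N)) (cong (q *_) (sym (ℤP.pos-* M N)))))))
  where
  h : ∀ m a b → m * a - m * b ≡ m * (a - b)
  h = solve-∀
  h₂ : ∀ m q n → m * (q * n) ≡ q * (m * n)
  h₂ = solve-∀

≡ₘ-unscale : ∀ {M N a b} → .{{ℕ.NonZero M}} → + M * a ≡ + M * b ⟨mod M ℕ.* N ⟩ → a ≡ b ⟨mod N ⟩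
≡ₘ-unscale {suc M} {N} {a} {b} (mod (divides q e)) = mod (divides q (ℤP.*-cancelˡ-≡ (+ suc M) (a - b) (q * + N)
    (trans (h (+ suc M) a b) (trans e (trans (cong (q *_) (ℤP.pos-* (suc M) N)) (h₂ (+ suc M) q (+ N)))))))
  where
  h : ∀ m a b → m * (a - b) ≡ m * a - m * b
  h = solve-∀
  h₂ : ∀ m q n → q * (m * n) ≡ m * (q * n)
  h₂ = solve-∀

module WithPrime (p′ : ℕ) (prime : Prime (suc p′)) where

  p : ℕ
  p = suc p′

  euclid : ∀ a b → + p ∣ˢ a * b → + p ∣ˢ a ⊎ + p ∣ˢ b
  euclid a b d with Pr.euclidsLemma ℤ.∣ a ∣ ℤ.∣ b ∣ prime (subst (p ∣ₙ_) (ℤP.abs-* a b) (∣⇒∣ᵤ d))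
  ... | inj₁ x = inj₁ (∣ᵤ⇒∣ x)
  ... | inj₂ y = inj₂ (∣ᵤ⇒∣ y)

  euclidₘ : ∀ a b → a * b ≡ + 0 ⟨mod p ⟩ → a ≡ + 0 ⟨mod p ⟩ ⊎ b ≡ + 0 ⟨mod p ⟩
  euclidₘ a b h with euclid a b (≡ₘ0⇒∣ h)
  ... | inj₁ x = inj₁ (∣⇒≡ₘ0 x)
  ... | inj₂ y = inj₂ (∣⇒≡ₘ0 y)

  -- Powers of p are gained one at a time: once x = q p^k, Euclid's lemma applies to u q.
  unit-cancelₘ : ∀ k u x → ¬ (+ p ∣ˢ u) → u * x ≡ + 0 ⟨mod p ℕ.^ k ⟩ → x ≡ + 0 ⟨mod p ℕ.^ k ⟩
  unit-cancelₘ zero    u x p∤u h = ∣⇒≡ₘ0 (divides x (sym (ℤP.*-identityʳ x)))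
  unit-cancelₘ (suc k) u x p∤u h = step (≡ₘ0⇒∣ (unit-cancelₘ k u x p∤u (≡ₘ-weaken (ℕD.n∣m*n p) h)))
    where
    M = p ℕ.^ k
    h′ : u * x ≡ + 0 ⟨mod M ℕ.* p ⟩
    h′ = subst (λ N → u * x ≡ + 0 ⟨mod N ⟩) (ℕP.*-comm p M) h
    t : ∀ m u q → m * (u * q) ≡ u * (q * m)
    t = solve-∀
    finish : ∀ q → x ≡ q * + M → + p ∣ˢ u ⊎ + p ∣ˢ q → x ≡ + 0 ⟨mod p ℕ.* M ⟩
    finish q e (inj₁ pu) = ⊥-elim (p∤u pu)
    finish q e (inj₂ pq) = subst (λ N → x ≡ + 0 ⟨mod N ⟩) (ℕP.*-comm M p)
      (≡ₘ-trans (≡ₘ-reflexive (trans e (ℤP.*-comm q (+ M)))) (≡ₘ-trans (≡ₘ-scale {M} {p} (∣⇒≡ₘ0 pq)) (≡ₘ-reflexive (ℤP.*-zeroʳ (+ M)))))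
    step : + M ∣ˢ x → x ≡ + 0 ⟨mod p ℕ.* M ⟩
    step (divides q e) = finish q e (euclid u q (≡ₘ0⇒∣ (≡ₘ-unscale {M} {p} {u * q} {+ 0} {{ℕP.m^n≢0 p k}}
      (≡ₘ-trans (≡ₘ-reflexive (trans (t (+ M) u q) (cong (u *_) (sym e)))) (≡ₘ-trans h′ (≡ₘ-reflexive (sym (ℤP.*-zeroʳ (+ M)))))))))

  p∤small : ∀ i → 0 < i → i < p → ¬ (+ p ∣ˢ + i)
  p∤small (suc i) _ i<p d = ℕP.<⇒≱ i<p (ℕD.∣⇒≤ (∣⇒∣ᵤ d))

  -- Digits in base p

  by-digits : (P : ℕ → Set) → (∀ l i → i < p → P (i ℕ.+ l ℕ.* p)) → ∀ n → P n
  by-digits P h n = subst P (sym (DM.m≡m%n+[m/n]*n n p)) (h (n / p) (n % p) (DM.m%n<n n p))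

  V : Series → Series
  V f n with n % p
  ... | zero  = f (n / p)
  ... | suc _ = + 0

  digit-% : ∀ l i → i < p → (i ℕ.+ l ℕ.* p) % p ≡ i
  digit-% l i i<p = trans (DM.[m+kn]%n≡m%n i l p) (DM.m<n⇒m%n≡m i<p)

  V-multiple : ∀ f l → V f (l ℕ.* p) ≡ f l
  V-multiple f l with (l ℕ.* p) % p | digit-% l 0 (s≤s z≤n)
  ... | .0 | refl = cong f (DM.m*n/n≡m l p)

  V-other : ∀ f l i → suc i < p → V f (suc i ℕ.+ l ℕ.* p) ≡ + 0
  V-other f l i i<p with (suc i ℕ.+ l ℕ.* p) % p | digit-% l (suc i) i<p
  ... | .(suc i) | refl = refl

  V-ind : ∀ (f g : Series) → (∀ l → g (l ℕ.* p) ≡ f l) → (∀ l i → suc i < p → g (suc i ℕ.+ l ℕ.* p) ≡ + 0) → g ≐ V f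
  V-ind f g h₁ h₂ = by-digits (λ n → g n ≡ V f n) λ { l zero _ → trans (h₁ l) (sym (V-multiple f l)) ; l (suc i) i<p → trans (h₂ l i i<p) (sym (V-other f l i i<p)) }

  V-rec : ∀ f → V f ≐ (const (f 0) ⊕ₚ mul (mon p) (V (sh f)))
  V-rec f n = sym (V-ind f (const (f 0) ⊕ₚ mul (mon p) (V (sh f)))
      (λ { zero → trans (cong (_+_ (f 0)) (mul-mon-< p (V (sh f)) 0 (s≤s z≤n))) (ℤP.+-identityʳ (f 0))
         ; (suc l) → trans (ℤP.+-identityˡ _) (trans (mul-mon p (V (sh f)) (l ℕ.* p)) (V-multiple (sh f) l)) })
      (λ { zero i i<p → trans (ℤP.+-identityˡ _) (mul-mon-< p (V (sh f)) (suc i ℕ.+ 0) (subst (ℕ._< p) (sym (ℕP.+-identityʳ (suc i))) i<p))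
         ; (suc l) i i<p → trans (ℤP.+-identityˡ _) (trans (cong (mul (mon p) (V (sh f))) (shuffle i (l ℕ.* p))) (trans (mul-mon p (V (sh f)) (suc i ℕ.+ l ℕ.* p)) (V-other (sh f) l i i<p))) }) n)
    where
    shuffle : ∀ i x → suc i ℕ.+ (p ℕ.+ x) ≡ p ℕ.+ (suc i ℕ.+ x)
    shuffle i x = trans (sym (ℕP.+-assoc (suc i) p x)) (trans (cong (ℕ._+ x) (ℕP.+-comm (suc i) p)) (ℕP.+-assoc p (suc i) x))

  U : ℕ → Series → Series
  U i f l = f (i ℕ.+ l ℕ.* p)

  -- The projection formula: a factor g(q^p) passes through the operator that selects the residue
  -- class i.
  pairing : ∀ f g l i → i < p → mul f (V g) (i ℕ.+ l ℕ.* p) ≡ mul (U i f) g l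
  pairing f g l i i<p = trans (mul-comm f (V g) (i ℕ.+ l ℕ.* p)) (trans (go l g) (mul-comm g (U i f) l))
    where
    expand : ∀ g n → mul (V g) f n ≡ g 0 * f n + mul (mon p) (mul (V (sh g)) f) n
    expand g n = trans (mul-cong≐ {g = f} (V-rec g) (λ _ → refl) n) (trans (mul-distribʳ f (const (g 0)) (mul (mon p) (V (sh g))) n)
      (cong₂ _+_ (mul-const (g 0) f n) (mul-assoc (mon p) (V (sh g)) f n)))
    go : ∀ l g → mul (V g) f (i ℕ.+ l ℕ.* p) ≡ mul g (U i f) l
    go zero g = trans (expand g (i ℕ.+ 0)) (trans (cong (_+_ (g 0 * f (i ℕ.+ 0))) (mul-mon-< p (mul (V (sh g)) f) (i ℕ.+ 0) (subst (ℕ._< p) (sym (ℕP.+-identityʳ i)) i<p)))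
      (trans (ℤP.+-identityʳ (g 0 * f (i ℕ.+ 0))) (sym (mul-zero g (U i f)))))
    go (suc l) g = trans (expand g (i ℕ.+ (p ℕ.+ l ℕ.* p))) (trans (cong (_+_ (g 0 * f (i ℕ.+ (p ℕ.+ l ℕ.* p))))
        (trans (cong (mul (mon p) (mul (V (sh g)) f)) (shuffle i (l ℕ.* p))) (trans (mul-mon p (mul (V (sh g)) f) (i ℕ.+ l ℕ.* p)) (go l (sh g)))))
      (sym (mul-suc g (U i f) l)))
      where
      shuffle : ∀ i x → i ℕ.+ (p ℕ.+ x) ≡ p ℕ.+ (i ℕ.+ x)
      shuffle i x = trans (sym (ℕP.+-assoc i p x)) (trans (cong (ℕ._+ x) (ℕP.+-comm i p)) (ℕP.+-assoc p i x))

  V-⊙ : ∀ f g → Exact._≈_ (V (f ⊙ g)) (V f ⊙ V g)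
  V-⊙ f g = Exact.pw λ n → sym (trans (⊙-at (V f) (V g) n) (V-ind (f ⊙ g) (mul (V f) (V g))
    (λ l → trans (pairing (V f) g l 0 (s≤s z≤n)) (trans (mul-cong≐ {g = g} (V-multiple f) (λ _ → refl) l) (sym (⊙-at f g l))))
    (λ l i i<p → trans (pairing (V f) g l (suc i) i<p) (sum-zero (suc l) (λ k _ → cong (_* g (l ∸ k)) (V-other f k i i<p)))) n))

  V-K : ∀ c → Exact._≈_ (V (K c)) (K c)
  V-K c = Exact.pw λ n → sym (V-ind (K c) (K c) (λ { zero → refl ; (suc l) → refl }) (λ l i _ → refl) n)

  V-cong≈ : ∀ {f g} → Exact._≈_ f g → Exact._≈_ (V f) (V g)
  V-cong≈ {f} {g} h = Exact.pw (by-digits (λ n → V f n ≡ V g n)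
    λ { l zero _ → trans (V-multiple f l) (trans (Exact.at h l) (sym (V-multiple g l)))
      ; l (suc i) i<p → trans (V-other f l i i<p) (sym (V-other g l i i<p)) })

  θV : ∀ f → Mod._≈_ p (θ (V f)) (K (+ 0))
  θV f = Mod.pw (by-digits (λ n → θ (V f) n ≡ K (+ 0) n ⟨mod p ⟩)
    λ { l zero _ → ≡ₘ-trans (≡ₘ-reflexive (trans (cong (_* V f (l ℕ.* p)) (trans (ℤP.pos-* l p) (ℤP.*-comm (+ l) (+ p)))) (ℤP.*-assoc (+ p) (+ l) (V f (l ℕ.* p)))))
           (≡ₘ-trans (multiple≡0 (+ l * V f (l ℕ.* p))) (≡ₘ-reflexive (sym (K0 (l ℕ.* p)))))
      ; l (suc i) i<p → ≡ₘ-reflexive (trans (cong (+ (suc i ℕ.+ l ℕ.* p) *_) (V-other f l i i<p)) (ℤP.*-zeroʳ (+ (suc i ℕ.+ l ℕ.* p)))) })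
    where
    K0 : ∀ n → K (+ 0) n ≡ + 0
    K0 zero    = refl
    K0 (suc n) = refl

  -- Frobenius

  p∤factorial : ∀ k → k < p → ¬ (p ∣ₙ k ℕ.!)
  p∤factorial zero    k<p d = Pr.¬prime[1] (subst Prime (ℕD.∣1⇒≡1 d) prime)
  p∤factorial (suc k) k<p d with Pr.euclidsLemma (suc k) (k ℕ.!) prime d
  ... | inj₁ x = ℕP.<⇒≱ k<p (ℕD.∣⇒≤ x)
  ... | inj₂ y = p∤factorial k (ℕP.<-trans (ℕP.n<1+n k) k<p) y

  p∣binomial : ∀ k → 0 < k → k < p → p ∣ₙ p choose k
  p∣binomial k 0<k k<p with Pr.euclidsLemma (p choose k) (k ℕ.! ℕ.* (p ∸ k) ℕ.!) prime
      (subst (p ∣ₙ_) (sym (trans (cong (ℕ._* (k ℕ.! ℕ.* (p ∸ k) ℕ.!)) (nCk≡n!/k![n-k]! (ℕP.<⇒≤ k<p)))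
        (DM.m/n*n≡m {{ℕP.m*n≢0 (k ℕ.!) ((p ∸ k) ℕ.!) {{ℕP._!≢0 k}} {{ℕP._!≢0 (p ∸ k)}}}} (k![n∸k]!∣n! (ℕP.<⇒≤ k<p))))) (ℕD.m∣m*n (p′ ℕ.!)))
  ... | inj₁ x = x
  ... | inj₂ y with Pr.euclidsLemma (k ℕ.!) ((p ∸ k) ℕ.!) prime y
  ... | inj₁ z = ⊥-elim (p∤factorial k k<p z)
  ... | inj₂ z = ⊥-elim (p∤factorial (p ∸ k) (ℕP.∸-monoʳ-< {p} {k} {0} 0<k (ℕP.<⇒≤ k<p)) z)

module Frobenius (p′ : ℕ) (prime : Prime (suc p′)) where

  open WithPrime p′ prime public

  private
    R = Mod.ring p
    module R = CommutativeRing R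
    module Bin = Binomial R.commutativeSemiring
    module Ex = Exp R.semiring
    module Mu = Mult R.+-monoid
    module Su = MSum R.+-monoid
  open Mod p using () renaming (_≈_ to _≈ₚ_)
  open Mod.Solver p using (solve; con; _:+_; _:*_; _:-_; :-_; _:=_)

  ×≈K : ∀ n f → n Mu.× f ≈ₚ K (+ n) ⊙ f
  ×≈K zero    f = solve 1 (λ f → con (+ 0) := con (+ 0) :* f) R.refl f
  ×≈K (suc n) f = R.trans (R.+-cong R.refl (×≈K n f)) (R.trans (solve 2 (λ f k → f :+ k :* f := (con (+ 1) :+ k) :* f) R.refl f (K (+ n)))
    (R.*-cong (R.sym (Mod.const-+ p (+ 1) (+ n))) R.refl))

  K-multiple : ∀ {n} → p ∣ₙ n → K (+ n) ≈ₚ K (+ 0)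
  K-multiple {n} d = Mod.pw λ { zero → ∣⇒≡ₘ0 (∣ᵤ⇒∣ d) ; (suc k) → ≡ₘ-refl }

  ^≈pow : ∀ f n → f Ex.^ n ≈ₚ pow f n
  ^≈pow f zero    = R.refl
  ^≈pow f (suc n) = R.trans (R.*-cong R.refl (^≈pow f n)) (exact⇒mod (Exact.≈-sym (mul≈⊙ f (pow f n))))

  pow-cong : ∀ n {f g} → f ≈ₚ g → pow f n ≈ₚ pow g n
  pow-cong zero    h = R.refl
  pow-cong (suc n) {f} {g} h = R.trans (exact⇒mod (mul≈⊙ f (pow f n))) (R.trans (R.*-cong h (pow-cong n h)) (exact⇒mod (Exact.≈-sym (mul≈⊙ g (pow g n)))))

  pow-⊙ : ∀ n f g → pow (f ⊙ g) n ≈ₚ pow f n ⊙ pow g n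
  pow-⊙ zero    f g = R.trans (exact⇒mod one≈K1) (R.trans (solve 0 (con (+ 1) := con (+ 1) :* con (+ 1)) R.refl) (R.*-cong (R.sym (exact⇒mod one≈K1)) (R.sym (exact⇒mod one≈K1))))
  pow-⊙ (suc n) f g = R.trans (exact⇒mod (mul≈⊙ (f ⊙ g) (pow (f ⊙ g) n))) (R.trans (R.*-cong R.refl (pow-⊙ n f g))
    (R.trans (solve 4 (λ f g F G → f :* g :* (F :* G) := f :* F :* (g :* G)) R.refl f g (pow f n) (pow g n))
    (R.*-cong (exact⇒mod (Exact.≈-sym (mul≈⊙ f (pow f n)))) (exact⇒mod (Exact.≈-sym (mul≈⊙ g (pow g n)))))))

  pow-+ : ∀ f g → pow (f ⊕ g) p ≈ₚ pow f p ⊕ pow g p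
  pow-+ f g = R.trans (R.sym (^≈pow (f ⊕ g) p)) (R.trans (Bin.theorem p f g) (R.trans (R.+-cong head tail) (R.+-comm (pow g p) (pow f p))))
    where
    t : Fin (suc p) → Series
    t = Bin.binomialTerm f g p
    head : t Fin.zero ≈ₚ pow g p
    head = R.trans (×≈K 1 _) (R.trans (R.*-cong R.refl (R.*-cong (exact⇒mod one≈K1) (^≈pow g p)))
      (solve 1 (λ g → con (+ 1) :* (con (+ 1) :* g) := g) R.refl (pow g p)))
    mid : Fin p′ → Series
    mid k = t (Fin.suc (Fin.inject₁ k))
    mid0 : ∀ k → mid k ≈ₚ R.0#
    mid0 k = R.trans (×≈K (p choose suc (toℕ (Fin.inject₁ k))) _) (R.trans (R.*-cong (K-multiple (p∣binomial (suc (toℕ (Fin.inject₁ k))) (s≤s z≤n) (s≤s (subst (ℕ._< p′) (sym (FinP.toℕ-inject₁ k)) (FinP.toℕ<n k))))) R.refl)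
      (solve 1 (λ f → con (+ 0) :* f := con (+ 0)) R.refl _))
    last : t (Fin.fromℕ p) ≈ₚ pow f p
    last = R.trans (×≈K (p choose toℕ (Fin.fromℕ p)) _) (R.trans (R.reflexive (cong (λ z → K (+ (p choose z)) ⊙ ((f Ex.^ z) ⊙ (g Ex.^ (p ∸ z)))) (FinP.toℕ-fromℕ p)))
      (R.trans (R.reflexive (cong₂ (λ u v → K (+ u) ⊙ ((f Ex.^ p) ⊙ (g Ex.^ v))) (nCn≡1 p) (ℕP.n∸n≡0 p)))
      (R.trans (R.*-cong R.refl (R.*-cong (^≈pow f p) (exact⇒mod one≈K1))) (solve 1 (λ f → con (+ 1) :* (f :* con (+ 1)) := f) R.refl (pow f p)))))
    tail : Su.sum (λ k → t (Fin.suc k)) ≈ₚ pow f p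
    tail = R.trans (Su.sum-init-last (λ k → t (Fin.suc k))) (R.trans (R.+-cong (R.trans (Su.sum-cong-≋ mid0) (Su.sum-replicate-zero p′)) last)
      (solve 1 (λ f → con (+ 0) :+ f := f) R.refl (pow f p)))

  pow-one : ∀ n → pow (K (+ 1)) n ≈ₚ K (+ 1)
  pow-one zero    = exact⇒mod one≈K1
  pow-one (suc n) = R.trans (exact⇒mod (mul≈⊙ (K (+ 1)) (pow (K (+ 1)) n))) (R.trans (R.*-cong R.refl (pow-one n)) (solve 0 (con (+ 1) :* con (+ 1) := con (+ 1)) R.refl))

  fermat : ∀ c → pow (K c) p ≈ₚ K c
  fermat = ℤ-induction (λ c → pow (K c) p ≈ₚ K c)
    (R.trans (exact⇒mod (mul≈⊙ (K (+ 0)) (pow (K (+ 0)) p′))) (solve 1 (λ f → con (+ 0) :* f := con (+ 0)) R.refl (pow (K (+ 0)) p′)))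
    (λ c h → R.trans (up c) (R.trans (R.+-cong R.refl h) (R.sym (Mod.const-+ p (+ 1) c))))
    (λ c h → R.trans (solve 1 (λ f → f := con (+ 1) :+ f :- con (+ 1)) R.refl (pow (K c) p)) (R.trans (R.+-cong (R.trans (R.sym (up c)) (R.trans h (Mod.const-+ p (+ 1) c))) R.refl)
      (solve 1 (λ f → con (+ 1) :+ f :- con (+ 1) := f) R.refl (K c))))
    where
    up : ∀ c → pow (K (+ 1 + c)) p ≈ₚ K (+ 1) ⊕ pow (K c) p
    up c = R.trans (pow-cong p (Mod.const-+ p (+ 1) c)) (R.trans (pow-+ (K (+ 1)) (K c)) (R.+-cong (pow-one p) R.refl))

  pow-Xq : ∀ n → Exact._≈_ (pow Xq n) (mon n)
  pow-Xq zero    = Exact.pw λ { zero → refl ; (suc n) → refl }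
  pow-Xq (suc n) = Exact.≈-trans (mul≈⊙ Xq (pow Xq n)) (Exact.≈-trans (Xq⊙ (pow Xq n)) (Exact.pw λ { zero → refl ; (suc k) → Exact.at (pow-Xq n) k }))

  -- From f = f₀ + q · `sh f` and additivity of the p-th power, the coefficient at n is reduced to
  -- that of `sh f` at n - p.
  frobenius : ∀ f → pow f p ≈ₚ V f
  frobenius f = Mod.pw λ n → go n n f ℕP.≤-refl
    where
    expand : ∀ f → pow f p ≈ₚ K (f 0) ⊕ mon p ⊙ pow (sh f) p
    expand f = R.trans (pow-cong p (Mod.pw λ n → ≡ₘ-reflexive (trans (split f n) (sym (trans (⊕-at (K (f 0)) (Xq ⊙ sh f) n) (cong (_+_ (K (f 0) n)) (Exact.at (Xq⊙ (sh f)) n)))))))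
      (R.trans (pow-+ (K (f 0)) (Xq ⊙ sh f)) (R.+-cong (fermat (f 0)) (R.trans (pow-⊙ p Xq (sh f)) (R.*-cong (exact⇒mod (pow-Xq p)) R.refl))))
    go : ∀ b n f → n ≤ b → pow f p n ≡ V f n ⟨mod p ⟩
    go b n f n≤b = ≡ₘ-trans (Mod.at (expand f) n) (≡ₘ-trans (≡ₘ-reflexive (⊕-at (K (f 0)) (mon p ⊙ pow (sh f) p) n))
      (≡ₘ-trans (≡ₘ-+ (≡ₘ-refl {a = const (f 0) n}) (≡ₘ-trans (≡ₘ-reflexive (⊙-at (mon p) (pow (sh f) p) n)) (inner b n n≤b (ℕP.<-≤-connex n p)))) (≡ₘ-reflexive (sym (V-rec f n)))))
      where
      inner : ∀ b n → n ≤ b → n < p ⊎ p ≤ n → mul (mon p) (pow (sh f) p) n ≡ mul (mon p) (V (sh f)) n ⟨mod p ⟩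
      inner b n n≤b (inj₁ n<p) = ≡ₘ-reflexive (trans (mul-mon-< p (pow (sh f) p) n n<p) (sym (mul-mon-< p (V (sh f)) n n<p)))
      inner zero    n n≤b (inj₂ p≤n) = ⊥-elim (ℕP.<⇒≱ (s≤s z≤n) (ℕP.≤-trans p≤n n≤b))
      inner (suc b) n n≤b (inj₂ p≤n) = subst (λ z → mul (mon p) (pow (sh f) p) z ≡ mul (mon p) (V (sh f)) z ⟨mod p ⟩) (ℕP.m+[n∸m]≡n p≤n)
        (≡ₘ-trans (≡ₘ-reflexive (mul-mon p (pow (sh f) p) (n ∸ p))) (≡ₘ-trans (go b (n ∸ p) (sh f) (ℕP.≤-trans (ℕP.∸-monoˡ-≤ p n≤b) (ℕP.m∸n≤m b p′))) (≡ₘ-reflexive (sym (mul-mon p (V (sh f)) (n ∸ p))))))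

module _ where

  open import Relation.Binary.Reasoning.Setoid setoid
  open Exact.Solver using (solve; con; _:+_; _:*_; _:-_; :-_; _:=_)

  -- The coefficients of Bol's identity

  fourthℤ : ℤ → ℤ
  fourthℤ x = x * x * x * x

  middle : ℤ → ℤ
  middle n = + 54 * n * n * n * n + - + 108 * n * n * n + + 102 * n * n + - + 48 * n + + 9

  K-* : ∀ a b → K a ⊙ K b ≈ K (a * b)
  K-* a b = ≈-sym (Exact.const-* a b)

  module _ (n : ℤ) where

    private
      N = K n
      b₀ = Bol.b n
      r₀ = Bol.r n

    fourth-K : K n ⊙ K n ⊙ K n ⊙ K n ≈ K (fourthℤ n)
    fourth-K = ≈-trans (*-cong (≈-trans (*-cong (K-* n n) ≈-refl) (K-* (n * n) n)) ≈-refl) (K-* (n * n * n) n)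

    middle-K : Bol.eval n r₀ ≈ K (middle n)
    middle-K = ≈-trans (+-cong (+-cong (+-cong (+-cong
        (≈-trans (*-cong (≈-trans (*-cong (≈-trans (*-cong (K-* (+ 54) n) ≈-refl) (K-* (+ 54 * n) n)) ≈-refl) (K-* (+ 54 * n * n) n)) ≈-refl) (K-* (+ 54 * n * n * n) n))
        (≈-trans (*-cong (≈-trans (*-cong (K-* (- + 108) n) ≈-refl) (K-* (- + 108 * n) n)) ≈-refl) (K-* (- + 108 * n * n) n)))
        (≈-trans (*-cong (K-* (+ 102) n) ≈-refl) (K-* (+ 102 * n) n))) (K-* (- + 48) n)) ≈-refl)
      (≈-trans (+-cong (+-cong (+-cong (k+ (+ 54 * n * n * n * n) (- + 108 * n * n * n)) ≈-refl) ≈-refl) ≈-refl)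
      (≈-trans (+-cong (+-cong (k+ (+ 54 * n * n * n * n + - + 108 * n * n * n) (+ 102 * n * n)) ≈-refl) ≈-refl)
      (≈-trans (+-cong (k+ (+ 54 * n * n * n * n + - + 108 * n * n * n + + 102 * n * n) (- + 48 * n)) ≈-refl) (k+ (+ 54 * n * n * n * n + - + 108 * n * n * n + + 102 * n * n + - + 48 * n) (+ 9)))))
      where
      k+ : ∀ a b → K a ⊕ K b ≈ K (a + b)
      k+ a b = ≈-sym (Exact.const-+ a b)

    n-1-K : K n ⊕ K (- + 1) ≈ K (n - + 1)
    n-1-K = ≈-sym (Exact.const-+ n (- + 1))

    n-1⁴-K : (K n ⊕ K (- + 1)) ⊙ (K n ⊕ K (- + 1)) ⊙ (K n ⊕ K (- + 1)) ⊙ (K n ⊕ K (- + 1)) ≈ K (fourthℤ (n - + 1))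
    n-1⁴-K = ≈-trans (*-cong (*-cong (*-cong n-1-K n-1-K) n-1-K) n-1-K)
      (≈-trans (*-cong (≈-trans (*-cong (K-* (n - + 1) (n - + 1)) ≈-refl) (K-* ((n - + 1) * (n - + 1)) (n - + 1))) ≈-refl) (K-* ((n - + 1) * (n - + 1) * (n - + 1)) (n - + 1)))

    b≈B : Bol.eval n b₀ ≈ Bₛ
    b≈B = ≈-trans (solve 2 (λ a c → a :* a :* a :+ con (- + 27) :* c := a :* a :* a :- con (+ 27) :* c) ≈-refl aₛ cₛ) (≈-sym B≈a³-27c)

    -- With b = B, c = tB and wB = C, the three monomials of `Bol.target` become C times t^(-n),
    -- t^(1-n) and t^(2-n); the surplus powers of q appear as `Xq`.
    bol : ∂ n (∂ n (∂ n (∂ n (Bol.G n)))) ≈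
      K (fourthℤ n) ⊙ (C ⊙ τ^ (- n)) ⊕ K (middle n) ⊙ (Xq ⊙ (C ⊙ τ^ (+ 1 + (- n)))) ⊕ K (+ 729 * fourthℤ (n - + 1)) ⊙ (Xq ⊙ (Xq ⊙ (C ⊙ τ^ (+ 1 + (+ 1 + (- n))))))
    bol = begin
      ∂ n (∂ n (∂ n (∂ n (Bol.G n)))) ≈⟨ Bol.∂⁴G n ⟩
      T ⊙ Bi ⊙ (aₛ ⊙ aₛ ⊙ (N ⊙ N ⊙ N ⊙ N ⊙ Bol.eval n b₀ ⊙ Bol.eval n b₀ ⊕ Bol.eval n r₀ ⊙ cₛ ⊙ Bol.eval n b₀ ⊕ K (+ 729) ⊙ (N ⊕ K (- + 1)) ⊙ (N ⊕ K (- + 1)) ⊙ (N ⊕ K (- + 1)) ⊙ (N ⊕ K (- + 1)) ⊙ cₛ ⊙ cₛ))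
        ≈⟨ *-cong ≈-refl (*-cong a²≈w (+-cong (+-cong (*-cong (*-cong fourth-K b≈B) b≈B) (*-cong (*-cong middle-K c≈tB) b≈B)) (*-cong (*-cong ≈-refl c≈tB) c≈tB))) ⟩
      T ⊙ Bi ⊙ (wₛ ⊙ (K (fourthℤ n) ⊙ Bₛ ⊙ Bₛ ⊕ K (middle n) ⊙ (Xq ⊙ τ ⊙ Bₛ) ⊙ Bₛ ⊕ K (+ 729) ⊙ (N ⊕ K (- + 1)) ⊙ (N ⊕ K (- + 1)) ⊙ (N ⊕ K (- + 1)) ⊙ (N ⊕ K (- + 1)) ⊙ (Xq ⊙ τ ⊙ Bₛ) ⊙ (Xq ⊙ τ ⊙ Bₛ)))
        ≈⟨ solve 9 (λ T i w f B m X t q → T :* i :* (w :* (f :* B :* B :+ m :* (X :* t :* B) :* B :+ con (+ 729) :* q :* q :* q :* q :* (X :* t :* B) :* (X :* t :* B)))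
             := (B :* i) :* (f :* (w :* B :* T) :+ m :* (X :* (w :* B :* (t :* T))) :+ con (+ 729) :* (q :* q :* q :* q) :* (X :* (X :* (w :* B :* (t :* (t :* T))))))) ≈-refl
             T Bi wₛ (K (fourthℤ n)) Bₛ (K (middle n)) Xq τ (N ⊕ K (- + 1)) ⟩
      Bₛ ⊙ Bi ⊙ (K (fourthℤ n) ⊙ (wₛ ⊙ Bₛ ⊙ T) ⊕ K (middle n) ⊙ (Xq ⊙ (wₛ ⊙ Bₛ ⊙ (τ ⊙ T))) ⊕ K (+ 729) ⊙ ((N ⊕ K (- + 1)) ⊙ (N ⊕ K (- + 1)) ⊙ (N ⊕ K (- + 1)) ⊙ (N ⊕ K (- + 1))) ⊙ (Xq ⊙ (Xq ⊙ (wₛ ⊙ Bₛ ⊙ (τ ⊙ (τ ⊙ T))))))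
        ≈⟨ *-cong BBi (+-cong (+-cong (*-cong ≈-refl (*-cong (≈-sym C≈wB) ≈-refl)) (*-cong ≈-refl (*-cong ≈-refl (*-cong (≈-sym C≈wB) (≈-sym (τ^-suc (- n)))))))
             (*-cong (≈-trans (*-cong ≈-refl n-1⁴-K) (K-* (+ 729) (fourthℤ (n - + 1)))) (*-cong ≈-refl (*-cong ≈-refl (*-cong (≈-sym C≈wB) (≈-sym (≈-trans (τ^-suc (+ 1 + (- n))) (*-cong ≈-refl (τ^-suc (- n)))))))))) ⟩
      K (+ 1) ⊙ (K (fourthℤ n) ⊙ (C ⊙ T) ⊕ K (middle n) ⊙ (Xq ⊙ (C ⊙ τ^ (+ 1 + (- n)))) ⊕ K (+ 729 * fourthℤ (n - + 1)) ⊙ (Xq ⊙ (Xq ⊙ (C ⊙ τ^ (+ 1 + (+ 1 + (- n)))))))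
        ≈⟨ solve 1 (λ x → con (+ 1) :* x := x) ≈-refl _ ⟩
      K (fourthℤ n) ⊙ (C ⊙ T) ⊕ K (middle n) ⊙ (Xq ⊙ (C ⊙ τ^ (+ 1 + (- n)))) ⊕ K (+ 729 * fourthℤ (n - + 1)) ⊙ (Xq ⊙ (Xq ⊙ (C ⊙ τ^ (+ 1 + (+ 1 + (- n)))))) ∎
      where
      T = τ^ (- n)

    bol-at : ∀ k → fourthℤ (+ k - n) * Bol.G n k ≡
      fourthℤ n * (C ⊙ τ^ (- n)) k + middle n * (Xq ⊙ (C ⊙ τ^ (+ 1 + (- n)))) k + + 729 * fourthℤ (n - + 1) * (Xq ⊙ (Xq ⊙ (C ⊙ τ^ (+ 1 + (+ 1 + (- n)))))) k
    bol-at k = trans (sym (trans (∂-at n _ k) (trans (cong ((+ k - n) *_) (trans (∂-at n _ k) (cong ((+ k - n) *_) (trans (∂-at n _ k) (cong ((+ k - n) *_) (∂-at n (Bol.G n) k)))))) (t (+ k - n) (Bol.G n k)))))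
      (trans (at bol k) (trans (⊕-at _ _ k) (cong₂ _+_ (trans (⊕-at _ _ k) (cong₂ _+_ (at (K⊙ (fourthℤ n) _) k) (at (K⊙ (middle n) _) k))) (at (K⊙ (+ 729 * fourthℤ (n - + 1)) _) k))))
      where
      t : ∀ x g → x * (x * (x * (x * g))) ≡ x * x * x * x * g
      t = solve-∀

  _⊠_ : T3 → T3 → T3
  t0 ⊠ t = t0
  t1 ⊠ t = t
  t2 ⊠ t = t ⊞ t

  χ-* : ∀ m n → χ (m ℕ.* n) ≡ χ m * χ n
  χ-* m n = trans (cong ⌊_⌋ (cl-* m)) (h (cl m) (cl n))
    where
    cl-* : ∀ m → cl (m ℕ.* n) ≡ cl m ⊠ cl n
    cl-* zero    = refl
    cl-* (suc m) = trans (cl-+ n (m ℕ.* n)) (trans (cong (cl n ⊞_) (cl-* m)) (g (cl m) (cl n)))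
      where
      g : ∀ s t → t ⊞ (s ⊠ t) ≡ succ s ⊠ t
      g t0 t0 = refl
      g t0 t1 = refl
      g t0 t2 = refl
      g t1 t = refl
      g t2 t0 = refl
      g t2 t1 = refl
      g t2 t2 = refl
    h : ∀ s t → ⌊ s ⊠ t ⌋ ≡ ⌊ s ⌋ * ⌊ t ⌋
    h t0 t  = refl
    h t1 t0 = refl
    h t1 t1 = refl
    h t1 t2 = refl
    h t2 t0 = refl
    h t2 t1 = refl
    h t2 t2 = refl

  sum-≡ₘ : ∀ {N} n {f g : ℕ → ℤ} → (∀ k → k < n → f k ≡ g k ⟨mod N ⟩) → sumℤ n f ≡ sumℤ n g ⟨mod N ⟩
  sum-≡ₘ {N} = Mod.sum-∼ N

  -- The operator U_p modulo p⁴: eigenfunctions and the recurrence inside a block.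

  module Coefficients (p′ : ℕ) (prime : Prime (suc p′)) (5≤p : 5 ≤ suc p′) where

    open Frobenius p′ prime public

    p⁴ : ℕ
    p⁴ = p ℕ.^ 4

    p∣p⁴ : p ∣ₙ p⁴
    p∣p⁴ = ℕD.m∣m*n (p ℕ.^ 3)

    p⁴-fourth : ∀ x → fourthℤ (+ p * x) ≡ + 0 ⟨mod p⁴ ⟩
    p⁴-fourth x = ≡ₘ-trans (≡ₘ-reflexive (trans (t (+ p) x) (cong (_* fourthℤ x) (sym (fourth p))))) (multiple≡0 (fourthℤ x))
      where
      t : ∀ p x → (p * x) * (p * x) * (p * x) * (p * x) ≡ (p * p * p * p) * (x * x * x * x)
      t = solve-∀

    δ-cancel : ∀ x n → δ (x ℕ.* p) (n ℕ.* p) ≡ δ x n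
    δ-cancel zero    zero    = refl
    δ-cancel zero    (suc n) = refl
    δ-cancel (suc x) zero    = refl
    δ-cancel (suc x) (suc n) = trans (δ-shift p (x ℕ.* p) (n ℕ.* p)) (δ-cancel x n)

    -- Divisors divisible by p contribute nothing mod p⁴, so that f(pm,d) = κ f(m,d) gives a U_p-eigenfunction.
    Lam-eigen : ∀ (f : ℕ → ℕ → ℤ) κ → (∀ m d → f m (d ℕ.* p) ≡ + 0 ⟨mod p⁴ ⟩) → (∀ m d → f (m ℕ.* p) d ≡ κ * f m d) →
      ∀ n → Lam f (n ℕ.* p) ≡ κ * Lam f n ⟨mod p⁴ ⟩
    Lam-eigen f κ hd hm n = ≡ₘ-trans (sum-≡ₘ (n ℕ.* p) (λ i _ → row i (suc p′ ℕD.∣? suc i)))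
      (≡ₘ-reflexive (trans (sum-*ˡ (n ℕ.* p) κ (λ i → sumℤ n (λ a → f (suc a) (suc i) * δ (suc a ℕ.* suc i) n)))
        (cong (κ *_) (sum-extend (λ i → sumℤ n (λ a → f (suc a) (suc i) * δ (suc a ℕ.* suc i) n)) (ℕP.m≤m*n n p)
          (λ i n≤i → sum-zero n (λ a _ → *0ʳ (f (suc a) (suc i)) (δ-> (ℕP.≤-trans (s≤s n≤i) (ℕP.m≤n*m (suc i) (suc a))))))))))
      where
      zero-term : ∀ {a} x y → x ≡ y → f a y ≡ + 0 ⟨mod p⁴ ⟩ → f a x ≡ + 0 ⟨mod p⁴ ⟩
      zero-term x .x refl h = h
      vanish : ∀ i N → p ∣ₙ suc i → ∀ M → sumℤ M (λ a → f (suc a) (suc i) * δ (suc a ℕ.* suc i) N) ≡ + 0 ⟨mod p⁴ ⟩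
      vanish i N (ℕD.divides q e) M = ≡ₘ-trans (sum-≡ₘ M {g = λ _ → + 0} (λ a _ → ≡ₘ-trans (≡ₘ-* (zero-term (suc i) (q ℕ.* p) e (hd (suc a) q)) ≡ₘ-refl) (≡ₘ-reflexive (ℤP.*-zeroˡ (δ (suc a ℕ.* suc i) N)))))
        (≡ₘ-reflexive (sum-zero M (λ _ _ → refl)))
      row : ∀ i → Dec (p ∣ₙ suc i) → sumℤ (n ℕ.* p) (λ a → f (suc a) (suc i) * δ (suc a ℕ.* suc i) (n ℕ.* p)) ≡ κ * sumℤ n (λ a → f (suc a) (suc i) * δ (suc a ℕ.* suc i) n) ⟨mod p⁴ ⟩
      row i (yes p∣i) = ≡ₘ-trans (vanish i (n ℕ.* p) p∣i (n ℕ.* p)) (≡ₘ-sym (≡ₘ-trans (≡ₘ-* (≡ₘ-refl {a = κ}) (vanish i n p∣i n)) (≡ₘ-reflexive (ℤP.*-zeroʳ κ))))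
      row i (no p∤i) = ≡ₘ-reflexive (trans (sum-multiples p′ n (λ a → f a (suc i) * δ (a ℕ.* suc i) (n ℕ.* p)) (λ a p∤a → *0ʳ (f a (suc i)) (δ-≢ (a ℕ.* suc i) (n ℕ.* p) (no-divisor a p∤a))))
        (trans (sum-cong′ n (λ a → trans (cong₂ _*_ (hm (suc a) (suc i)) (trans (cong (λ z → δ z (n ℕ.* p)) (rearrange (suc a) (suc i))) (δ-cancel (suc a ℕ.* suc i) n))) (ℤP.*-assoc κ (f (suc a) (suc i)) (δ (suc a ℕ.* suc i) n))))
          (sum-*ˡ n κ (λ a → f (suc a) (suc i) * δ (suc a ℕ.* suc i) n))))
        where
        rearrange : ∀ x y → x ℕ.* p ℕ.* y ≡ x ℕ.* y ℕ.* p
        rearrange x y = trans (ℕP.*-assoc x p y) (trans (cong (x ℕ.*_) (ℕP.*-comm p y)) (sym (ℕP.*-assoc x y p)))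
        either : ∀ a → ¬ (p ∣ₙ a) → p ∣ₙ a ⊎ p ∣ₙ suc i → Data.Empty.⊥
        either a p∤a (inj₁ x) = p∤a x
        either a p∤a (inj₂ y) = p∤i y
        no-divisor : ∀ a → ¬ (p ∣ₙ a) → a ℕ.* suc i ≡ n ℕ.* p → Data.Empty.⊥
        no-divisor a p∤a e = either a p∤a (Pr.euclidsLemma a (suc i) prime (subst (p ∣ₙ_) (sym e) (ℕD.n∣m*n n)))

    private
      fourth-power : ∀ x d → x * (+ (d ℕ.* p) * + (d ℕ.* p) * + (d ℕ.* p) * + (d ℕ.* p)) ≡ + 0 ⟨mod p⁴ ⟩
      fourth-power x d = ≡ₘ-trans (≡ₘ-* (≡ₘ-refl {a = x}) (≡ₘ-trans (≡ₘ-reflexive (cong fourthℤ (trans (ℤP.pos-* d p) (ℤP.*-comm (+ d) (+ p))))) (p⁴-fourth (+ d)))) (≡ₘ-reflexive (ℤP.*-zeroʳ x))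

    C-eigen : ∀ n → C (n ℕ.* p) ≡ C n ⟨mod p⁴ ⟩
    C-eigen n = ≡ₘ-trans (≡ₘ-reflexive (expand (n ℕ.* p))) (≡ₘ-trans (≡ₘ-+ (≡ₘ-reflexive (const-p n))
        (≡ₘ-* (≡ₘ-refl {a = + 3}) (≡ₘ-trans (Lam-eigen lA₅ (+ 1) (λ m d → fourth-power (χ (d ℕ.* p)) d) (λ m d → sym (ℤP.*-identityˡ (lA₅ m d))) n) (≡ₘ-reflexive (ℤP.*-identityˡ (A₅ₛ n))))))
      (≡ₘ-reflexive (sym (expand n))))
      where
      expand : ∀ n → C n ≡ K (+ 1) n + + 3 * A₅ₛ n
      expand n = trans (at C≈1+3A₅ n) (trans (⊕-at (K (+ 1)) (K (+ 3) ⊙ A₅ₛ) n) (cong (_+_ (K (+ 1) n)) (at (K⊙ (+ 3) A₅ₛ) n)))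
      const-p : ∀ n → K (+ 1) (n ℕ.* p) ≡ K (+ 1) n
      const-p zero    = refl
      const-p (suc n) = refl

    C*-eigen : ∀ n → C*ₛ (n ℕ.* p) ≡ χ p * C*ₛ n ⟨mod p⁴ ⟩
    C*-eigen = Lam-eigen lC (χ p) (λ m d → fourth-power (χ m) d)
      (λ m d → trans (cong (_* (+ d * + d * + d * + d)) (trans (χ-* m p) (ℤP.*-comm (χ m) (χ p)))) (ℤP.*-assoc (χ p) (χ m) (+ d * + d * + d * + d)))

    χp² : χ p * χ p ≡ + 1
    χp² = sym (ℤP.i-j≡0⇒i≡j (+ 1) (e p) (three∤ p (λ d → no3 (Pr.prime⇒irreducible prime d))))
      where
      no3 : 3 ≡ 1 ⊎ 3 ≡ p → Data.Empty.⊥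
      no3 (inj₂ q) = ℕP.<⇒≢ (ℕP.≤-trans (s≤s (s≤s (s≤s (s≤s z≤n)))) 5≤p) q

    -- Y r i = Σ_N [q^{pN+i}] (C τ^{-(pr+i)}) q^N, that is U_p (C t^{-(pr+i)}) up to a power of q.

    weight : ℤ → ℕ → ℤ
    weight r i = + p * r + + i

    Y : ℤ → ℕ → Series
    Y r i N = (C ⊙ τ^ (- weight r i)) (i ℕ.+ N ℕ.* p)

    u : ℤ → ℕ → ℤ
    u r i = Y r i 0

    u-0 : ∀ r → u r 0 ≡ + 1
    u-0 r = trans (⊙-0 C (τ^ (- weight r 0))) (trans (ℤP.*-identityˡ (τ^ (- weight r 0) 0)) (τ^-0 (- weight r 0)))

    p∤weight : ∀ r i → 0 < i → i < p → ¬ (+ p ∣ˢ fourthℤ (weight r i))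
    p∤weight r i 0<i i<p d = p∤small i 0<i i<p (reduce (four (euclid _ n d)))
      where
      n = weight r i
      two : + p ∣ˢ n ⊎ + p ∣ˢ n → + p ∣ˢ n
      two (inj₁ x) = x
      two (inj₂ x) = x
      three : + p ∣ˢ n * n ⊎ + p ∣ˢ n → + p ∣ˢ n
      three (inj₁ x) = two (euclid n n x)
      three (inj₂ x) = x
      four : + p ∣ˢ n * n * n ⊎ + p ∣ˢ n → + p ∣ˢ n
      four (inj₁ x) = three (euclid (n * n) n x)
      four (inj₂ x) = x
      reduce : + p ∣ˢ n → + p ∣ˢ + i
      reduce x = subst (+ p ∣ˢ_) (t (+ p * r) (+ i)) (Div.∣m∣n⇒∣m-n x (divides r (ℤP.*-comm (+ p) r)))
        where
        t : ∀ x y → (x + y) - x ≡ y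
        t = solve-∀

    private
      τ-index : ∀ {k l} i → k ≡ l → (C ⊙ τ^ k) i ≡ (C ⊙ τ^ l) i
      τ-index i refl = refl

      -- The left side of Bol's identity vanishes modulo p⁴: the index k = i + 1 + pN and the
      -- exponent n = pr + i + 1 differ by p(N - r), and (k - n)⁴ is a factor.
      bol₀ : ∀ r i N → fourthℤ (weight r (suc i)) * Y r (suc i) N + middle (weight r (suc i)) * Y r i N
         + + 729 * fourthℤ (weight r (suc i) - + 1) * (Xq ⊙ (Xq ⊙ (C ⊙ τ^ (+ 1 + (+ 1 + (- weight r (suc i))))))) (suc i ℕ.+ N ℕ.* p) ≡ + 0 ⟨mod p⁴ ⟩
      bol₀ r i N = ≡ₘ-trans (≡ₘ-reflexive (trans (cong (λ z → fourthℤ n * Y r (suc i) N + middle n * z + T) (sym y)) (sym (bol-at n k))))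
        (≡ₘ-trans (≡ₘ-* (≡ₘ-trans (≡ₘ-reflexive (cong fourthℤ diff)) (p⁴-fourth (+ N - r))) (≡ₘ-refl {a = Bol.G n k})) (≡ₘ-reflexive (ℤP.*-zeroˡ (Bol.G n k))))
        where
        n = weight r (suc i)
        k = suc i ℕ.+ N ℕ.* p
        T = + 729 * fourthℤ (n - + 1) * (Xq ⊙ (Xq ⊙ (C ⊙ τ^ (+ 1 + (+ 1 + (- n)))))) k
        y : (Xq ⊙ (C ⊙ τ^ (+ 1 + (- n)))) k ≡ Y r i N
        y = trans (at (Xq⊙ (C ⊙ τ^ (+ 1 + (- n)))) k) (τ-index (i ℕ.+ N ℕ.* p) (t (+ p * r) (+ i)))
          where
          t : ∀ x i → + 1 + - (x + (+ 1 + i)) ≡ - (x + i)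
          t = solve-∀
        diff : + k - n ≡ + p * (+ N - r)
        diff = trans (cong (λ z → + suc i + z - n) (ℤP.pos-* N p)) (t (+ suc i) (+ N) (+ p) r)
          where
          t : ∀ i N p r → i + N * p - (p * r + i) ≡ p * (N - r)
          t = solve-∀

    -- At n = pr + 1 the last coefficient 729(n - 1)⁴ is a multiple of p⁴. Hence the recurrence does
    -- not reach back before i = 0, and one initial value determines the block.
    Y-rec₁ : ∀ r N → fourthℤ (weight r 1) * Y r 1 N + middle (weight r 1) * Y r 0 N ≡ + 0 ⟨mod p⁴ ⟩
    Y-rec₁ r N = ≡ₘ-trans (≡ₘ-sym (≡ₘ-trans (≡ₘ-+ (≡ₘ-refl {a = main}) tail) (≡ₘ-reflexive (ℤP.+-identityʳ main)))) (bol₀ r 0 N)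
      where
      main = fourthℤ (weight r 1) * Y r 1 N + middle (weight r 1) * Y r 0 N
      X = (Xq ⊙ (Xq ⊙ (C ⊙ τ^ (+ 1 + (+ 1 + (- weight r 1)))))) (1 ℕ.+ N ℕ.* p)
      t : ∀ x → x + + 1 - + 1 ≡ x
      t = solve-∀
      tail : + 729 * fourthℤ (weight r 1 - + 1) * X ≡ + 0 ⟨mod p⁴ ⟩
      tail = ≡ₘ-trans (≡ₘ-* (≡ₘ-* (≡ₘ-refl {a = + 729}) (≡ₘ-trans (≡ₘ-reflexive (cong fourthℤ (t (+ p * r)))) (p⁴-fourth r))) (≡ₘ-refl {a = X})) (≡ₘ-reflexive (ℤP.*-zeroˡ X))

    Y-rec : ∀ r i N → fourthℤ (weight r (2 ℕ.+ i)) * Y r (2 ℕ.+ i) N + middle (weight r (2 ℕ.+ i)) * Y r (suc i) N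
      + + 729 * fourthℤ (weight r (suc i)) * Y r i N ≡ + 0 ⟨mod p⁴ ⟩
    Y-rec r i N = ≡ₘ-trans (≡ₘ-reflexive (cong₂ (λ a b → fourthℤ (weight r (2 ℕ.+ i)) * Y r (2 ℕ.+ i) N + middle (weight r (2 ℕ.+ i)) * Y r (suc i) N + + 729 * fourthℤ a * b)
        (t₁ (+ p * r) (+ i)) (sym (trans (at (Xq⊙ (Xq ⊙ (C ⊙ τ^ (+ 1 + (+ 1 + (- n)))))) (2 ℕ.+ (i ℕ.+ N ℕ.* p))) (trans (at (Xq⊙ (C ⊙ τ^ (+ 1 + (+ 1 + (- n))))) (1 ℕ.+ (i ℕ.+ N ℕ.* p))) (τ-index (i ℕ.+ N ℕ.* p) (t₂ (+ p * r) (+ i)))))))) (bol₀ r (suc i) N)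
      where
      n = weight r (2 ℕ.+ i)
      t₁ : ∀ x i → x + (+ 1 + i) ≡ x + (+ 2 + i) - + 1
      t₁ = solve-∀
      t₂ : ∀ x i → + 1 + (+ 1 + - (x + (+ 2 + i))) ≡ - (x + i)
      t₂ = solve-∀

    -- The coefficients of the recurrence do not depend on N, and the leading one is a unit for 0 <
    -- i < p. So for every N the solution is the initial value `Y r 0 N` times the solution that
    -- starts with 1.
    Y-block : ∀ r i → i < p → ∀ N → Y r i N ≡ u r i * Y r 0 N ⟨mod p⁴ ⟩
    Y-block r zero i<p N = ≡ₘ-reflexive (sym (trans (cong (_* Y r 0 N) (u-0 r)) (ℤP.*-identityˡ (Y r 0 N))))
    Y-block r (suc zero) i<p N = ≡ₘ-difference (unit-cancelₘ 4 (fourthℤ (weight r 1)) _ (p∤weight r 1 (s≤s z≤n) i<p)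
       (≡ₘ-trans (≡ₘ-reflexive (t (fourthℤ (weight r 1)) (Y r 1 N) (u r 1) (Y r 0 N) (middle (weight r 1))))
       (≡ₘ-+ (Y-rec₁ r N) (≡ₘ-neg (≡ₘ-trans (≡ₘ-* (≡ₘ-refl {a = Y r 0 N}) (≡ₘ-trans (≡ₘ-reflexive (cong (λ z → fourthℤ (weight r 1) * u r 1 + middle (weight r 1) * z) (sym (u-0 r)))) (Y-rec₁ r 0))) (≡ₘ-reflexive (ℤP.*-zeroʳ (Y r 0 N))))))))
      where
      t : ∀ f x v c m → f * (x - v * c) ≡ (f * x + m * c) - (c * (f * v + m * + 1))
      t = solve-∀
    Y-block r (suc (suc i)) i<p N = ≡ₘ-difference (unit-cancelₘ 4 f _ (p∤weight r (2 ℕ.+ i) (s≤s z≤n) i<p)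
       (≡ₘ-trans (≡ₘ-reflexive (t f (Y r (2 ℕ.+ i) N) (u r (2 ℕ.+ i)) c m (Y r (suc i) N) (u r (suc i)) s (Y r i N) (u r i)))
       (≡ₘ-+ (≡ₘ-+ (≡ₘ-+ (Y-rec r i N) (≡ₘ-neg (kill c (Y-rec r i 0)))) (≡ₘ-neg (kill m (difference-≡ₘ (Y-block r (suc i) (ℕP.<-trans (ℕP.n<1+n _) i<p) N)))))
         (≡ₘ-neg (kill s (difference-≡ₘ (Y-block r i (ℕP.<-trans (ℕP.n<1+n _) (ℕP.<-trans (ℕP.n<1+n _) i<p)) N)))))))
      where
      f = fourthℤ (weight r (2 ℕ.+ i))
      m = middle (weight r (2 ℕ.+ i))
      s = + 729 * fourthℤ (weight r (suc i))
      c = Y r 0 N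
      kill : ∀ a {b} → b ≡ + 0 ⟨mod p⁴ ⟩ → a * b ≡ + 0 ⟨mod p⁴ ⟩
      kill a h = ≡ₘ-trans (≡ₘ-* (≡ₘ-refl {a = a}) h) (≡ₘ-reflexive (ℤP.*-zeroʳ a))
      t : ∀ f x v c m y v₁ s z v₂ → f * (x - v * c) ≡ (f * x + m * y + s * z) - (c * (f * v + m * v₁ + s * v₂)) - (m * (y - v₁ * c)) - (s * (z - v₂ * c))
      t = solve-∀

  -- The series M_j and their expansion in powers of t.

  τ^-≡ : ∀ {k l} → k ≡ l → τ^ k ≈ τ^ l
  τ^-≡ h = ≈-reflexive (cong τ^ h)

  ℰ-mod : ∀ {N f g} → Mod._≈_ N f g → Mod._≈_ N (ℰ f) (ℰ g)
  ℰ-mod {N} h = Mod.pw λ n → Mod.at (Mod.*-cong N (Mod.*-cong N h (Mod.≈-refl N {wₛ})) (Mod.≈-refl N {τ^ (- + n)})) n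

  -- The constant term of f is that of its expansion; the remaining coefficients come from τ ·
  -- `quot f`, whose second factor has the shifted expansion.
  ℰ-injective : ∀ {N} f → (∀ n → ℰ f n ≡ + 0 ⟨mod N ⟩) → ∀ n → f n ≡ + 0 ⟨mod N ⟩
  ℰ-injective {N} f h n = go n n f h ℕP.≤-refl
    where
    go : ∀ b n f → (∀ n → ℰ f n ≡ + 0 ⟨mod N ⟩) → n ≤ b → f n ≡ + 0 ⟨mod N ⟩
    go b zero f h n≤b = ≡ₘ-trans (≡ₘ-reflexive (sym (ℰ-0 f))) (h 0)
    go (suc b) (suc n) f h (s≤s n≤b) = ≡ₘ-trans (≡ₘ-reflexive (trans (at (quot-eq f) (suc n)) (trans (⊕-at (K (f 0)) (tq ⊙ quot f) (suc n)) (trans (ℤP.+-identityˡ ((tq ⊙ quot f) (suc n)))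
         (trans (at (≈-trans (solve 3 (λ x t q → x :* t :* q := x :* (t :* q)) ≈-refl Xq τ (quot f)) (Xq⊙ (τ ⊙ quot f))) (suc n)) (⊙-at τ (quot f) n))))))
       (≡ₘ-trans (sum-≡ₘ (suc n) {g = λ _ → + 0} (λ k _ → ≡ₘ-trans (≡ₘ-* (≡ₘ-refl {a = τ k}) (go b (n ∸ k) (quot f) (λ m → ≡ₘ-trans (≡ₘ-reflexive (sym (ℰ-suc f m))) (h (suc m))) (ℕP.≤-trans (ℕP.m∸n≤m n k) n≤b))) (≡ₘ-reflexive (ℤP.*-zeroʳ (τ k)))))
         (≡ₘ-reflexive (sum-zero (suc n) (λ _ _ → refl))))

  module Expansion (p′ : ℕ) (prime : Prime (suc p′)) (5≤p : 5 ≤ suc p′) where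

    open Coefficients p′ prime 5≤p public

    -- The factor q^(pj) of V(t^j) cancels against t^(-pj), so the formula may be written with τ in
    -- place of t.
    M : ℤ → Series
    M j = Bₛ ⊙ V (τ^ j ⊙ Bi) ⊙ τ^ (- (+ p * j))

    M-square : ∀ j → M (+ 1 + j) ⊙ M (- + 1 + j) ≈ M j ⊙ M j
    M-square j = begin
      M (+ 1 + j) ⊙ M (- + 1 + j)
        ≈⟨ solve 5 (λ B v t v′ t′ → B :* v :* t :* (B :* v′ :* t′) := B :* B :* (v :* v′) :* (t :* t′)) ≈-refl Bₛ (V (τ^ (+ 1 + j) ⊙ Bi)) (τ^ (- (+ p * (+ 1 + j)))) (V (τ^ (- + 1 + j) ⊙ Bi)) (τ^ (- (+ p * (- + 1 + j)))) ⟩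
      Bₛ ⊙ Bₛ ⊙ (V (τ^ (+ 1 + j) ⊙ Bi) ⊙ V (τ^ (- + 1 + j) ⊙ Bi)) ⊙ (τ^ (- (+ p * (+ 1 + j))) ⊙ τ^ (- (+ p * (- + 1 + j))))
        ≈⟨ *-cong (*-cong ≈-refl (≈-trans (≈-sym (V-⊙ _ _)) (≈-trans (V-cong≈ inner) (V-⊙ _ _)))) (same (- (+ p * (+ 1 + j))) (- (+ p * (- + 1 + j))) (- (+ p * j)) (t₂ (+ p) j)) ⟩
      Bₛ ⊙ Bₛ ⊙ (V (τ^ j ⊙ Bi) ⊙ V (τ^ j ⊙ Bi)) ⊙ (τ^ (- (+ p * j)) ⊙ τ^ (- (+ p * j)))
        ≈⟨ solve 3 (λ B v t → B :* B :* (v :* v) :* (t :* t) := B :* v :* t :* (B :* v :* t)) ≈-refl Bₛ (V (τ^ j ⊙ Bi)) (τ^ (- (+ p * j))) ⟩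
      M j ⊙ M j ∎
      where
      t₁ : ∀ j → (+ 1 + j) + (- + 1 + j) ≡ j + j
      t₁ = solve-∀
      t₂ : ∀ p j → - (p * (+ 1 + j)) + - (p * (- + 1 + j)) ≡ - (p * j) + - (p * j)
      t₂ = solve-∀
      same : ∀ k l m → k + l ≡ m + m → τ^ k ⊙ τ^ l ≈ τ^ m ⊙ τ^ m
      same k l m h = ≈-trans (≈-sym (τ^-+ k l)) (≈-trans (τ^-≡ h) (τ^-+ m m))
      inner : τ^ (+ 1 + j) ⊙ Bi ⊙ (τ^ (- + 1 + j) ⊙ Bi) ≈ τ^ j ⊙ Bi ⊙ (τ^ j ⊙ Bi)
      inner = begin
        τ^ (+ 1 + j) ⊙ Bi ⊙ (τ^ (- + 1 + j) ⊙ Bi)   ≈⟨ solve 3 (λ x b y → x :* b :* (y :* b) := x :* y :* (b :* b)) ≈-refl (τ^ (+ 1 + j)) Bi (τ^ (- + 1 + j)) ⟩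
        τ^ (+ 1 + j) ⊙ τ^ (- + 1 + j) ⊙ (Bi ⊙ Bi)   ≈⟨ *-cong (same (+ 1 + j) (- + 1 + j) j (t₁ j)) ≈-refl ⟩
        τ^ j ⊙ τ^ j ⊙ (Bi ⊙ Bi)                     ≈⟨ solve 2 (λ x b → x :* x :* (b :* b) := x :* b :* (x :* b)) ≈-refl (τ^ j) Bi ⟩
        τ^ j ⊙ Bi ⊙ (τ^ j ⊙ Bi)                     ∎

    -- The coefficient of t^l in U_p(C t^(-pr)) t^r / C: the factor w of the residue formula turns
    -- 1/C = 1/(wB) into 1/B.
    D′ : ℤ → ℕ → ℤ
    D′ r l = mul (Y r 0) (τ^ (r - + l) ⊙ Bi) l

    -- At degree n = i + lp the exponents -pj and -n add up to -(p(j + l) + i), so r = j + l.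
    -- `pairing` then takes V(t^j/B) out of the coefficient.
    ℰM : ∀ j l i → i < p → ℰ (M j) (i ℕ.+ l ℕ.* p) ≡ mul (Y (j + + l) i) (τ^ j ⊙ Bi) l
    ℰM j l i i<p = trans (at split′ n) (trans (⊙-at (C ⊙ τ^ (- weight (j + + l) i)) (V (τ^ j ⊙ Bi)) n) (pairing (C ⊙ τ^ (- weight (j + + l) i)) (τ^ j ⊙ Bi) l i i<p))
      where
      n = i ℕ.+ l ℕ.* p
      exponent : - (+ p * j) + - + n ≡ - weight (j + + l) i
      exponent = trans (cong (λ z → - (+ p * j) + - (+ i + z)) (ℤP.pos-* l p)) (t (+ p) j (+ i) (+ l))
        where
        t : ∀ p j i l → - (p * j) + - (i + l * p) ≡ - (p * (j + l) + i)
        t = solve-∀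
      split′ : M j ⊙ wₛ ⊙ τ^ (- + n) ≈ C ⊙ τ^ (- weight (j + + l) i) ⊙ V (τ^ j ⊙ Bi)
      split′ = begin
        M j ⊙ wₛ ⊙ τ^ (- + n)
          ≈⟨ solve 5 (λ B v t w s → B :* v :* t :* w :* s := w :* B :* (t :* s) :* v) ≈-refl Bₛ (V (τ^ j ⊙ Bi)) (τ^ (- (+ p * j))) wₛ (τ^ (- + n)) ⟩
        wₛ ⊙ Bₛ ⊙ (τ^ (- (+ p * j)) ⊙ τ^ (- + n)) ⊙ V (τ^ j ⊙ Bi)
          ≈⟨ *-cong (*-cong (≈-sym C≈wB) (≈-trans (≈-sym (τ^-+ (- (+ p * j)) (- + n))) (τ^-≡ exponent))) ≈-refl ⟩
        C ⊙ τ^ (- weight (j + + l) i) ⊙ V (τ^ j ⊙ Bi) ∎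

    ℰM-block : ∀ j l i → i < p → ℰ (M j) (i ℕ.+ l ℕ.* p) ≡ u (j + + l) i * D′ (j + + l) l ⟨mod p⁴ ⟩
    ℰM-block j l i i<p = ≡ₘ-trans (≡ₘ-reflexive (ℰM j l i i<p))
      (≡ₘ-trans (sum-≡ₘ (suc l) (λ k _ → ≡ₘ-* (Y-block (j + + l) i i<p k) (≡ₘ-refl {a = (τ^ j ⊙ Bi) (l ∸ k)})))
      (≡ₘ-reflexive (trans (mul-scaleˡ (u (j + + l) i) (Y (j + + l) 0) (τ^ j ⊙ Bi) l)
        (cong (λ z → u (j + + l) i * mul (Y (j + + l) 0) (τ^ z ⊙ Bi) l) (t j (+ l))))))
      where
      t : ∀ j l → j ≡ j + l - l
      t = solve-∀

    ℰ-C : ∀ r l → (C ⊙ τ^ (- r) ⊙ (τ^ (r - + l) ⊙ Bi)) l ≡ K (+ 1) l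
    ℰ-C r l = trans (at (begin
      C ⊙ τ^ (- r) ⊙ (τ^ (r - + l) ⊙ Bi)           ≈⟨ solve 4 (λ c s t b → c :* s :* (t :* b) := c :* b :* (s :* t)) ≈-refl C (τ^ (- r)) (τ^ (r - + l)) Bi ⟩
      C ⊙ Bi ⊙ (τ^ (- r) ⊙ τ^ (r - + l))           ≈⟨ *-cong (*-cong C≈wB ≈-refl) (≈-trans (≈-sym (τ^-+ (- r) (r - + l))) (τ^-≡ (t r (+ l)))) ⟩
      wₛ ⊙ Bₛ ⊙ Bi ⊙ τ^ (- + l)                    ≈⟨ solve 4 (λ w b i t → w :* b :* i :* t := b :* i :* w :* t) ≈-refl wₛ Bₛ Bi (τ^ (- + l)) ⟩
      Bₛ ⊙ Bi ⊙ wₛ ⊙ τ^ (- + l)                    ≈⟨ *-cong (*-cong BBi ≈-refl) ≈-refl ⟩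
      K (+ 1) ⊙ wₛ ⊙ τ^ (- + l)                    ∎) l) (ℰ-one l)
      where
      t : ∀ r l → - r + (r - l) ≡ - l
      t = solve-∀

    Y≈⇒D : ∀ {N} r → (∀ n → Y r 0 n ≡ (C ⊙ τ^ (- r)) n ⟨mod N ⟩) → ∀ l → D′ r l ≡ K (+ 1) l ⟨mod N ⟩
    Y≈⇒D r h l = ≡ₘ-trans (sum-≡ₘ (suc l) (λ k _ → ≡ₘ-* (h k) (≡ₘ-refl {a = (τ^ (r - + l) ⊙ Bi) (l ∸ k)})))
      (≡ₘ-reflexive (trans (sym (⊙-at (C ⊙ τ^ (- r)) (τ^ (r - + l) ⊙ Bi) l)) (ℰ-C r l)))

    -- `ℰ-injective` is applied to the relative error U_p(C t^(-pr)) t^r / C - 1, and the unit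
    -- factor is multiplied back.
    D⇒Y≈ : ∀ {N} r → (∀ l → D′ r l ≡ K (+ 1) l ⟨mod N ⟩) → ∀ n → Y r 0 n ≡ (C ⊙ τ^ (- r)) n ⟨mod N ⟩
    D⇒Y≈ {N} r h n = ≡ₘ-difference (≡ₘ-trans (≡ₘ-reflexive (sym (trans (at recover n) (⊖-at (Y r 0) (C ⊙ τ^ (- r)) n))))
        (≡ₘ-trans (≡ₘ-reflexive (⊙-at f Cτ n)) (≡ₘ-trans (sum-≡ₘ (suc n) {g = λ _ → + 0} (λ k _ → ≡ₘ-trans (≡ₘ-* (ℰ-injective f ℰf k) (≡ₘ-refl {a = Cτ (n ∸ k)})) (≡ₘ-reflexive (ℤP.*-zeroˡ (Cτ (n ∸ k))))))
          (≡ₘ-reflexive (sum-zero (suc n) (λ _ _ → refl))))))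
      where
      Cτ = C ⊙ τ^ (- r)
      f = (Y r 0 ⊖ Cτ) ⊙ (τ^ r ⊙ Bi ⊙ wi)
      one′ : Cτ ⊙ (τ^ r ⊙ Bi ⊙ wi) ≈ K (+ 1)
      one′ = begin
        C ⊙ τ^ (- r) ⊙ (τ^ r ⊙ Bi ⊙ wi)            ≈⟨ *-cong (*-cong C≈wB ≈-refl) ≈-refl ⟩
        wₛ ⊙ Bₛ ⊙ τ^ (- r) ⊙ (τ^ r ⊙ Bi ⊙ wi)      ≈⟨ solve 6 (λ w b s t i j → w :* b :* s :* (t :* i :* j) := w :* j :* (b :* i) :* (t :* s)) ≈-refl wₛ Bₛ (τ^ (- r)) (τ^ r) Bi wi ⟩
        wₛ ⊙ wi ⊙ (Bₛ ⊙ Bi) ⊙ (τ^ r ⊙ τ^ (- r))    ≈⟨ *-cong (*-cong wwi BBi) (τ^-neg r) ⟩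
        K (+ 1) ⊙ K (+ 1) ⊙ K (+ 1)                ≈⟨ solve 0 (con (+ 1) :* con (+ 1) :* con (+ 1) := con (+ 1)) ≈-refl ⟩
        K (+ 1)                                    ∎
      recover : f ⊙ Cτ ≈ Y r 0 ⊖ Cτ
      recover = ≈-trans (solve 3 (λ y x c → y :* x :* c := y :* (c :* x)) ≈-refl (Y r 0 ⊖ Cτ) (τ^ r ⊙ Bi ⊙ wi) Cτ) (≈-trans (*-cong ≈-refl one′) (solve 1 (λ y → y :* con (+ 1) := y) ≈-refl (Y r 0 ⊖ Cτ)))
      expand : ∀ l → f ⊙ wₛ ⊙ τ^ (- + l) ≈ Y r 0 ⊙ (τ^ (r - + l) ⊙ Bi) ⊖ Cτ ⊙ (τ^ (r - + l) ⊙ Bi)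
      expand l = begin
        f ⊙ wₛ ⊙ τ^ (- + l)
          ≈⟨ *-cong (solve 6 (λ y c t i j w → (y :- c) :* (t :* i :* j) :* w := w :* j :* ((y :- c) :* (t :* i))) ≈-refl (Y r 0) Cτ (τ^ r) Bi wi wₛ) ≈-refl ⟩
        wₛ ⊙ wi ⊙ ((Y r 0 ⊖ Cτ) ⊙ (τ^ r ⊙ Bi)) ⊙ τ^ (- + l)
          ≈⟨ *-cong (*-cong wwi ≈-refl) ≈-refl ⟩
        K (+ 1) ⊙ ((Y r 0 ⊖ Cτ) ⊙ (τ^ r ⊙ Bi)) ⊙ τ^ (- + l)
          ≈⟨ solve 5 (λ y c t i s → con (+ 1) :* ((y :- c) :* (t :* i)) :* s := y :* (t :* s :* i) :- c :* (t :* s :* i)) ≈-refl (Y r 0) Cτ (τ^ r) Bi (τ^ (- + l)) ⟩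
        Y r 0 ⊙ (τ^ r ⊙ τ^ (- + l) ⊙ Bi) ⊖ Cτ ⊙ (τ^ r ⊙ τ^ (- + l) ⊙ Bi)
          ≈⟨ +-cong (*-cong ≈-refl (*-cong (≈-sym (τ^-+ r (- + l))) ≈-refl)) (-‿cong (*-cong ≈-refl (*-cong (≈-sym (τ^-+ r (- + l))) ≈-refl))) ⟩
        Y r 0 ⊙ (τ^ (r - + l) ⊙ Bi) ⊖ Cτ ⊙ (τ^ (r - + l) ⊙ Bi) ∎
      ℰf : ∀ l → ℰ f l ≡ + 0 ⟨mod N ⟩
      ℰf l = ≡ₘ-trans (≡ₘ-reflexive (trans (at (expand l) l) (trans (⊖-at (Y r 0 ⊙ (τ^ (r - + l) ⊙ Bi)) (Cτ ⊙ (τ^ (r - + l) ⊙ Bi)) l) (cong₂ _-_ (⊙-at (Y r 0) (τ^ (r - + l) ⊙ Bi) l) (ℰ-C r l)))))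
        (difference-≡ₘ (h l))

    -- The values r = 0 and r = -1 are known because C and Ct = Σ χ(m) d⁴ q^{md} are eigenfunctions of U_p mod p⁴.

    C*≈XCτ : C*ₛ ≈ Xq ⊙ (C ⊙ τ)
    C*≈XCτ = begin
      C*ₛ                          ≈⟨ C*≈wc ⟩
      wₛ ⊙ cₛ                      ≈⟨ *-cong ≈-refl c≈tB ⟩
      wₛ ⊙ (Xq ⊙ τ ⊙ Bₛ)           ≈⟨ solve 4 (λ w x t b → w :* (x :* t :* b) := x :* (w :* b :* t)) ≈-refl wₛ Xq τ Bₛ ⟩
      Xq ⊙ (wₛ ⊙ Bₛ ⊙ τ)           ≈⟨ *-cong ≈-refl (*-cong (≈-sym C≈wB) ≈-refl) ⟩
      Xq ⊙ (C ⊙ τ)                 ∎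

    Cτ-at : ∀ n → C*ₛ (suc n) ≡ (C ⊙ τ) n
    Cτ-at n = trans (at C*≈XCτ (suc n)) (at (Xq⊙ (C ⊙ τ)) (suc n))

    τ^-0≈ : ∀ {k} → k ≡ + 0 → C ⊙ τ^ k ≈ C
    τ^-0≈ refl = ≈-trans (*-cong ≈-refl one≈K1) (solve 1 (λ c → c :* con (+ 1) := c) ≈-refl C)

    τ^-1≈ : ∀ {k} → k ≡ + 1 → C ⊙ τ^ k ≈ C ⊙ τ
    τ^-1≈ refl = *-cong ≈-refl (≈-trans (mul≈⊙ τ one) (≈-trans (*-cong ≈-refl one≈K1) (solve 1 (λ t → t :* con (+ 1) := t) ≈-refl τ)))

    Y₀ : ∀ n → Y (+ 0) 0 n ≡ (C ⊙ τ^ (- + 0)) n ⟨mod p⁴ ⟩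
    Y₀ n = ≡ₘ-trans (≡ₘ-reflexive (at (τ^-0≈ (t (+ p))) (n ℕ.* p))) (≡ₘ-trans (C-eigen n) (≡ₘ-reflexive (sym (at (τ^-0≈ refl) n))))
      where
      t : ∀ p → - (p * + 0 + + 0) ≡ + 0
      t = solve-∀

    -- For r = -1 and i = p - 1 the weight is -1, so this residue class belongs to Ct itself. The
    -- index shifts by one because `C*ₛ` contains the factor q of t.
    Y₋₁-last : ∀ n → Y -[1+ 0 ] p′ n ≡ χ p * (C ⊙ τ) n ⟨mod p⁴ ⟩
    Y₋₁-last n = ≡ₘ-trans (≡ₘ-reflexive (trans (at (τ^-1≈ (t (+ p′))) (p′ ℕ.+ n ℕ.* p)) (sym (Cτ-at (p′ ℕ.+ n ℕ.* p))))) (≡ₘ-trans (C*-eigen (suc n)) (≡ₘ-reflexive (cong (χ p *_) (Cτ-at n))))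
      where
      t : ∀ x → - ((+ 1 + x) * (- + 1) + x) ≡ + 1
      t = solve-∀

    Cτ-0 : (C ⊙ τ) 0 ≡ + 1
    Cτ-0 = trans (⊙-0 C τ) (cong (+ 1 *_) τ-0)

    u₋₁ : u -[1+ 0 ] p′ ≡ χ p ⟨mod p⁴ ⟩
    u₋₁ = ≡ₘ-trans (Y₋₁-last 0) (≡ₘ-reflexive (trans (cong (χ p *_) Cτ-0) (ℤP.*-identityʳ (χ p))))

    -- `Y-block` carries the eigenvalue property from i = p - 1 back to i = 0; the proportionality
    -- factor is χ(p), whose square is 1.
    Y₋₁ : ∀ n → Y -[1+ 0 ] 0 n ≡ (C ⊙ τ^ (+ 1)) n ⟨mod p⁴ ⟩
    Y₋₁ n = ≡ₘ-trans (≡ₘ-trans (≡ₘ-reflexive (t₁ {χ p} χp² (Y -[1+ 0 ] 0 n)))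
        (≡ₘ-* (≡ₘ-refl {a = χ p}) (≡ₘ-trans (≡ₘ-* (≡ₘ-sym u₋₁) (≡ₘ-refl {a = Y -[1+ 0 ] 0 n})) (≡ₘ-trans (≡ₘ-sym (Y-block -[1+ 0 ] p′ ℕP.≤-refl n)) (Y₋₁-last n)))))
      (≡ₘ-reflexive (trans (sym (t₁ {χ p} χp² ((C ⊙ τ) n))) (sym (at (τ^-1≈ refl) n))))
      where
      t₂ : ∀ c x → c * (c * x) ≡ c * c * x
      t₂ = solve-∀
      t₁ : ∀ {c} → c * c ≡ + 1 → ∀ x → x ≡ c * (c * x)
      t₁ {c} h x = sym (trans (t₂ c x) (trans (cong (_* x) h) (ℤP.*-identityˡ x)))

-- Polynomials modulo p and their orders of vanishing.

θ-mod : ∀ {N f h} → Mod._≈_ N f h → Mod._≈_ N (θ f) (θ h)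
θ-mod {N} e = Mod.pw λ n → ≡ₘ-* (≡ₘ-refl {a = + n}) (Mod.at e n)

K-mod : ∀ {N a b} → a ≡ b ⟨mod N ⟩ → Mod._≈_ N (K a) (K b)
K-mod e = Mod.pw λ { zero → e ; (suc n) → ≡ₘ-refl }

K0-at : ∀ n → K (+ 0) n ≡ + 0
K0-at zero    = refl
K0-at (suc n) = refl

≡ₘ0? : ∀ N a → Dec (a ≡ + 0 ⟨mod N ⟩)
≡ₘ0? N a = decide (+ N Div.∣? a)
  where
  decide : Dec (+ N ∣ˢ a) → Dec (a ≡ + 0 ⟨mod N ⟩)
  decide (yes d) = yes (∣⇒≡ₘ0 d)
  decide (no ∤)  = no (λ e → ∤ (≡ₘ0⇒∣ e))

Vanishes-from : ℕ → Series → Set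
Vanishes-from N f = ∀ n → N ≤ n → f n ≡ + 0

vanishes-⊙ : ∀ {N M f h} → Vanishes-from N f → Vanishes-from M h → Vanishes-from (N ℕ.+ M) (f ⊙ h)
vanishes-⊙ {N} {M} {f} {h} vf vh n N+M≤n = trans (⊙-at f h n) (sum-zero (suc n) (λ k _ → term k (ℕP.<-≤-connex k N)))
  where
  term : ∀ k → k < N ⊎ N ≤ k → f k * h (n ∸ k) ≡ + 0
  term k (inj₁ k<N) = trans (cong (f k *_) (vh (n ∸ k) (ℕP.m+n≤o⇒m≤o∸n M (ℕP.≤-trans (ℕP.≤-trans (ℕP.≤-reflexive (ℕP.+-comm M k)) (ℕP.+-monoˡ-≤ M (ℕP.<⇒≤ k<N))) N+M≤n)))) (ℤP.*-zeroʳ (f k))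
  term k (inj₂ N≤k) = trans (cong (_* h (n ∸ k)) (vf k N≤k)) (ℤP.*-zeroˡ (h (n ∸ k)))

head-tail : ∀ f → f ≈ K (f 0) ⊕ Xq ⊙ sh f
head-tail f = pw λ n → trans (split f n) (sym (trans (⊕-at (K (f 0)) (Xq ⊙ sh f) n) (cong (_+_ (K (f 0) n)) (at (Xq⊙ (sh f)) n))))

θ-Xq : θ Xq ≈ Xq
θ-Xq = ≈-trans LD-Xq (Exact.Solver.solve 1 (λ x → x Exact.Solver.:* Exact.Solver.con (+ 1) Exact.Solver.:= x) ≈-refl Xq)

-- Substitution of v = μ (q - 1) into polynomials modulo p, which turns orders at the point -μ into orders at 0.

module Substitution (p′ : ℕ) (prime : Prime (suc p′)) (μ : ℤ) where

  open Frobenius p′ prime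
  open Mod p using () renaming (_≈_ to _≈ₚ_; pw to pwₚ; at to atₚ; ≈-refl to reflₚ; ≈-sym to symₚ; ≈-trans to transₚ; +-cong to +-congₚ; *-cong to *-congₚ; -‿cong to neg-congₚ; setoid to setoidₚ)
  open Mod.Solver p using (solve; con; _:+_; _:*_; _:-_; :-_; _:=_)
  open import Relation.Binary.Reasoning.Setoid setoidₚ

  v : Series
  v = K μ ⊙ (Xq ⊖ K (+ 1))

  -- Horner's scheme for the first N coefficients. A bound is essential, since `v` has constant term
  -- -μ and cannot be substituted into an arbitrary power series.
  Sub : ℕ → Series → Series
  Sub zero    f = K (+ 0)
  Sub (suc N) f = K (f 0) ⊕ v ⊙ Sub N (sh f)

  Sub-cong : ∀ N {f h} → f ≈ₚ h → Sub N f ≈ₚ Sub N h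
  Sub-cong zero    e = reflₚ
  Sub-cong (suc N) e = +-congₚ (K-mod (atₚ e 0)) (*-congₚ reflₚ (Sub-cong N (pwₚ λ n → atₚ e (suc n))))

  v-0 : v ⊙ K (+ 0) ≈ₚ K (+ 0)
  v-0 = solve 1 (λ v → v :* con (+ 0) := con (+ 0)) reflₚ v

  Sub-zero : ∀ N {f} → (∀ n → f n ≡ + 0 ⟨mod p ⟩) → Sub N f ≈ₚ K (+ 0)
  Sub-zero zero    h = reflₚ
  Sub-zero (suc N) h = transₚ (+-congₚ (K-mod (h 0)) (*-congₚ reflₚ (Sub-zero N (λ n → h (suc n))))) (solve 1 (λ v → con (+ 0) :+ v :* con (+ 0) := con (+ 0)) reflₚ v)

  Sub-extend : ∀ N L {f} → N ≤ L → Vanishes-from N f → Sub L f ≈ₚ Sub N f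
  Sub-extend zero    L       N≤L h = Sub-zero L (λ n → ≡ₘ-reflexive (h n z≤n))
  Sub-extend (suc N) (suc L) (s≤s N≤L) h = +-congₚ reflₚ (*-congₚ reflₚ (Sub-extend N L N≤L (λ n N≤n → h (suc n) (s≤s N≤n))))

  Sub-+ : ∀ N f h → Sub N (f ⊕ h) ≈ₚ Sub N f ⊕ Sub N h
  Sub-+ zero    f h = solve 0 (con (+ 0) := con (+ 0) :+ con (+ 0)) reflₚ
  Sub-+ (suc N) f h = begin
    K ((f ⊕ h) 0) ⊕ v ⊙ Sub N (sh (f ⊕ h))
      ≈⟨ +-congₚ (transₚ (K-mod (≡ₘ-reflexive (⊕-at f h 0))) (Mod.const-+ p (f 0) (h 0))) (*-congₚ reflₚ (transₚ (Sub-cong N (pwₚ λ n → ≡ₘ-reflexive (trans (⊕-at f h (suc n)) (sym (⊕-at (sh f) (sh h) n))))) (Sub-+ N (sh f) (sh h)))) ⟩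
    K (f 0) ⊕ K (h 0) ⊕ v ⊙ (Sub N (sh f) ⊕ Sub N (sh h))
      ≈⟨ solve 5 (λ a b v s t → a :+ b :+ v :* (s :+ t) := a :+ v :* s :+ (b :+ v :* t)) reflₚ (K (f 0)) (K (h 0)) v (Sub N (sh f)) (Sub N (sh h)) ⟩
    Sub (suc N) f ⊕ Sub (suc N) h ∎

  Sub-K* : ∀ N c f → Sub N (K c ⊙ f) ≈ₚ K c ⊙ Sub N f
  Sub-K* zero    c f = solve 1 (λ c → con (+ 0) := c :* con (+ 0)) reflₚ (K c)
  Sub-K* (suc N) c f = begin
    K ((K c ⊙ f) 0) ⊕ v ⊙ Sub N (sh (K c ⊙ f))
      ≈⟨ +-congₚ (transₚ (K-mod (≡ₘ-reflexive (at (K⊙ c f) 0))) (Mod.const-* p c (f 0))) (*-congₚ reflₚ (transₚ (Sub-cong N (pwₚ λ n → ≡ₘ-reflexive (trans (at (K⊙ c f) (suc n)) (sym (at (K⊙ c (sh f)) n))))) (Sub-K* N c (sh f)))) ⟩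
    K c ⊙ K (f 0) ⊕ v ⊙ (K c ⊙ Sub N (sh f))
      ≈⟨ solve 4 (λ c a v s → c :* a :+ v :* (c :* s) := c :* (a :+ v :* s)) reflₚ (K c) (K (f 0)) v (Sub N (sh f)) ⟩
    K c ⊙ Sub (suc N) f ∎

  Sub-Xq : ∀ N f → Sub (suc N) (Xq ⊙ f) ≈ₚ v ⊙ Sub N f
  Sub-Xq N f = transₚ (+-congₚ (K-mod (≡ₘ-reflexive (at (Xq⊙ f) 0))) (*-congₚ reflₚ (Sub-cong N (pwₚ λ n → ≡ₘ-reflexive (at (Xq⊙ f) (suc n))))))
    (solve 2 (λ v s → con (+ 0) :+ v :* s := v :* s) reflₚ v (Sub N f))

  Sub-⊙ : ∀ N M f h → Vanishes-from N f → Vanishes-from M h → Sub (N ℕ.+ M) (f ⊙ h) ≈ₚ Sub N f ⊙ Sub M h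
  Sub-⊙ zero    M f h vf vh = transₚ (Sub-zero M (λ n → ≡ₘ-reflexive (trans (⊙-at f h n) (sum-zero (suc n) (λ k _ → trans (cong (_* h (n ∸ k)) (vf k z≤n)) (ℤP.*-zeroˡ (h (n ∸ k))))))))
    (solve 1 (λ s → con (+ 0) := con (+ 0) :* s) reflₚ (Sub M h))
  Sub-⊙ (suc N) M f h vf vh = begin
    Sub (suc N ℕ.+ M) (f ⊙ h)
      ≈⟨ Sub-cong (suc N ℕ.+ M) (transₚ (*-congₚ (exact⇒mod (head-tail f)) reflₚ) (solve 4 (λ a x s h → (a :+ x :* s) :* h := a :* h :+ x :* (s :* h)) reflₚ (K (f 0)) Xq (sh f) h)) ⟩
    Sub (suc N ℕ.+ M) (K (f 0) ⊙ h ⊕ Xq ⊙ (sh f ⊙ h))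
      ≈⟨ Sub-+ (suc N ℕ.+ M) (K (f 0) ⊙ h) (Xq ⊙ (sh f ⊙ h)) ⟩
    Sub (suc N ℕ.+ M) (K (f 0) ⊙ h) ⊕ Sub (suc N ℕ.+ M) (Xq ⊙ (sh f ⊙ h))
      ≈⟨ +-congₚ (transₚ (Sub-K* (suc N ℕ.+ M) (f 0) h) (*-congₚ reflₚ (Sub-extend M (suc N ℕ.+ M) (ℕP.m≤n+m M (suc N)) vh))) (transₚ (Sub-Xq (N ℕ.+ M) (sh f ⊙ h)) (*-congₚ reflₚ (Sub-⊙ N M (sh f) h (λ n N≤n → vf (suc n) (s≤s N≤n)) vh))) ⟩
    K (f 0) ⊙ Sub M h ⊕ v ⊙ (Sub N (sh f) ⊙ Sub M h)
      ≈⟨ solve 4 (λ a h v s → a :* h :+ v :* (s :* h) := (a :+ v :* s) :* h) reflₚ (K (f 0)) (Sub M h) v (Sub N (sh f)) ⟩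
    Sub (suc N) f ⊙ Sub M h ∎

  θv : θ v ≈ₚ K μ ⊙ Xq
  θv = exact⇒mod (≈-trans (θ-K* μ (Xq ⊖ K (+ 1))) (*-cong ≈-refl (≈-trans (θ-+ Xq (neg (K (+ 1)))) (≈-trans (+-cong θ-Xq (≈-trans (θ-neg (K (+ 1))) (-‿cong (θ-K (+ 1)))))
    (Exact.Solver.solve 1 (λ x → x Exact.Solver.:- Exact.Solver.con (+ 0) Exact.Solver.:= x) ≈-refl Xq)))))

  -- (t d/dt f)(v) = v f′(v), whereas q d/dq (f(v)) = μ q f′(v).
  Sub-θ : ∀ N f → Xq ⊙ Sub N (θ f) ≈ₚ (Xq ⊖ K (+ 1)) ⊙ θ (Sub N f)
  Sub-θ zero    f = transₚ (solve 1 (λ x → x :* con (+ 0) := (x :- con (+ 1)) :* con (+ 0)) reflₚ Xq) (*-congₚ reflₚ (exact⇒mod (≈-sym (θ-K (+ 0)))))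
  Sub-θ (suc N) f = begin
    Xq ⊙ (K (+ 0) ⊕ v ⊙ Sub N (sh (θ f)))
      ≈⟨ *-congₚ reflₚ (+-congₚ reflₚ (*-congₚ reflₚ (transₚ (Sub-cong N (pwₚ λ n → ≡ₘ-reflexive (sym (trans (⊕-at (θ (sh f)) (sh f) n) (t (+ n) (f (suc n))))))) (Sub-+ N (θ (sh f)) (sh f))))) ⟩
    Xq ⊙ (K (+ 0) ⊕ v ⊙ (Sub N (θ (sh f)) ⊕ S))
      ≈⟨ solve 4 (λ x v d s → x :* (con (+ 0) :+ v :* (d :+ s)) := v :* (x :* d :+ x :* s)) reflₚ Xq v (Sub N (θ (sh f))) S ⟩
    v ⊙ (Xq ⊙ Sub N (θ (sh f)) ⊕ Xq ⊙ S)
      ≈⟨ *-congₚ reflₚ (+-congₚ (Sub-θ N (sh f)) reflₚ) ⟩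
    v ⊙ ((Xq ⊖ K (+ 1)) ⊙ θ S ⊕ Xq ⊙ S)
      ≈⟨ solve 4 (λ x m d s → m :* (x :- con (+ 1)) :* ((x :- con (+ 1)) :* d :+ x :* s) := (x :- con (+ 1)) :* (con (+ 0) :+ (m :* x :* s :+ m :* (x :- con (+ 1)) :* d))) reflₚ Xq (K μ) (θ S) S ⟩
    (Xq ⊖ K (+ 1)) ⊙ (K (+ 0) ⊕ (K μ ⊙ Xq ⊙ S ⊕ v ⊙ θ S))
      ≈⟨ *-congₚ reflₚ (symₚ (transₚ (exact⇒mod (≈-trans (θ-+ (K (f 0)) (v ⊙ S)) (+-cong (θ-K (f 0)) (θ-* v S)))) (+-congₚ reflₚ (+-congₚ (*-congₚ θv reflₚ) reflₚ)))) ⟩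
    (Xq ⊖ K (+ 1)) ⊙ θ (Sub (suc N) f) ∎
    where
    S = Sub N (sh f)
    t : ∀ n x → n * x + x ≡ (+ 1 + n) * x
    t = solve-∀

  v⊙-at : ∀ f n → (v ⊙ f) (suc n) ≡ μ * (f n - f (suc n))
  v⊙-at f n = trans (at expand (suc n)) (trans (at (K⊙ μ (Xq ⊙ f ⊖ f)) (suc n)) (cong (μ *_) (trans (⊖-at (Xq ⊙ f) f (suc n)) (cong (_- f (suc n)) (at (Xq⊙ f) (suc n))))))
    where
    expand : v ⊙ f ≈ K μ ⊙ (Xq ⊙ f ⊖ f)
    expand = Exact.Solver.solve 3 (λ m x f → m Exact.Solver.:* (x Exact.Solver.:- Exact.Solver.con (+ 1)) Exact.Solver.:* f Exact.Solver.:= m Exact.Solver.:* (x Exact.Solver.:* f Exact.Solver.:- f)) ≈-refl (K μ) Xq f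

  Sub-suc-at : ∀ N f n → Sub (suc N) f (suc n) ≡ μ * (Sub N (sh f) n - Sub N (sh f) (suc n))
  Sub-suc-at N f n = trans (⊕-at (K (f 0)) (v ⊙ Sub N (sh f)) (suc n)) (trans (ℤP.+-identityˡ ((v ⊙ Sub N (sh f)) (suc n))) (v⊙-at (Sub N (sh f)) n))

  Sub-degree : ∀ N f → Vanishes-from N (Sub N f)
  Sub-degree zero    f n       h = K0-at n
  Sub-degree (suc N) f (suc n) (s≤s N≤n) = trans (Sub-suc-at N f n) (trans (cong₂ (λ a b → μ * (a - b)) (Sub-degree N (sh f) n N≤n) (Sub-degree N (sh f) (suc n) (ℕP.m≤n⇒m≤1+n N≤n))) (ℤP.*-zeroʳ μ))

  -- The coefficient of q^N in f(v) is μ^N f_N, because v is linear in q with slope μ.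
  Sub-top : ¬ (+ p ∣ˢ μ) → ∀ N f → Sub (suc N) f N ≡ + 0 ⟨mod p ⟩ → f N ≡ + 0 ⟨mod p ⟩
  Sub-top p∤μ zero    f h = ≡ₘ-trans (≡ₘ-sym (≡ₘ-trans (≡ₘ-reflexive (⊕-at (K (f 0)) (v ⊙ K (+ 0)) 0)) (≡ₘ-trans (≡ₘ-+ (≡ₘ-refl {a = f 0}) (atₚ v-0 0)) (≡ₘ-reflexive (ℤP.+-identityʳ (f 0)))))) h
  Sub-top p∤μ (suc N) f h = Sub-top p∤μ N (sh f) (either (euclidₘ μ (S N) (≡ₘ-trans (≡ₘ-reflexive (sym (trans (Sub-suc-at (suc N) f N) (cong (μ *_) (trans (cong (_-_ (S N)) (Sub-degree (suc N) (sh f) (suc N) ℕP.≤-refl)) (ℤP.+-identityʳ (S N))))))) h)))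
    where
    S = Sub (suc N) (sh f)
    either : μ ≡ + 0 ⟨mod p ⟩ ⊎ S N ≡ + 0 ⟨mod p ⟩ → S N ≡ + 0 ⟨mod p ⟩
    either (inj₁ x) = ⊥-elim (p∤μ (≡ₘ0⇒∣ x))
    either (inj₂ y) = y

  -- The degree bound is hidden in the relation, so a differential equation can be transported term
  -- by term without bookkeeping of degrees.
  record _↦_ (f F : Series) : Set where
    field
      bound  : ℕ
      finite : Vanishes-from bound f
      value  : Sub bound f ≈ₚ F
  open _↦_

  ↦-congˡ : ∀ {f h F} → f ≈ h → f ↦ F → h ↦ F
  ↦-congˡ e s = record { bound = bound s ; finite = λ n b → trans (sym (at e n)) (finite s n b) ; value = transₚ (Sub-cong (bound s) (exact⇒mod (≈-sym e))) (value s) }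

  ↦-congʳ : ∀ {f F G} → F ≈ₚ G → f ↦ F → f ↦ G
  ↦-congʳ e s = record { bound = bound s ; finite = finite s ; value = transₚ (value s) e }

  ↦-unique : ∀ {f h F H} → f ↦ F → h ↦ H → f ≈ₚ h → F ≈ₚ H
  ↦-unique {f} {h} s t e = transₚ (symₚ (value s)) (transₚ (symₚ (Sub-extend (bound s) L (ℕP.m≤m+n (bound s) (bound t)) (finite s)))
    (transₚ (Sub-cong L e) (transₚ (Sub-extend (bound t) L (ℕP.m≤n+m (bound t) (bound s)) (finite t)) (value t))))
    where
    L = bound s ℕ.+ bound t

  ↦-K : ∀ c → K c ↦ K c
  ↦-K c = record { bound = 1 ; finite = λ { (suc n) _ → refl } ; value = solve 2 (λ c v → c :+ v :* con (+ 0) := c) reflₚ (K c) v }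

  ↦-Xq : Xq ↦ v
  ↦-Xq = record { bound = 2 ; finite = λ { (suc (suc n)) _ → refl ; (suc zero) (s≤s ()) } ; value = solve 1 (λ v → con (+ 0) :+ v :* (con (+ 1) :+ v :* con (+ 0)) := v) reflₚ v }

  ↦-⊕ : ∀ {f h F H} → f ↦ F → h ↦ H → (f ⊕ h) ↦ (F ⊕ H)
  ↦-⊕ {f} {h} s t = record
    { bound  = L
    ; finite = λ n b → trans (⊕-at f h n) (cong₂ _+_ (finite s n (ℕP.≤-trans L₁ b)) (finite t n (ℕP.≤-trans L₂ b)))
    ; value  = transₚ (Sub-+ L f h) (+-congₚ (transₚ (Sub-extend (bound s) L L₁ (finite s)) (value s)) (transₚ (Sub-extend (bound t) L L₂ (finite t)) (value t))) }
    where
    L = bound s ℕ.+ bound t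
    L₁ = ℕP.m≤m+n (bound s) (bound t)
    L₂ = ℕP.m≤n+m (bound t) (bound s)

  ↦-⊙ : ∀ {f h F H} → f ↦ F → h ↦ H → (f ⊙ h) ↦ (F ⊙ H)
  ↦-⊙ {f} {h} s t = record
    { bound  = bound s ℕ.+ bound t
    ; finite = vanishes-⊙ (finite s) (finite t)
    ; value  = transₚ (Sub-⊙ (bound s) (bound t) f h (finite s) (finite t)) (*-congₚ (value s) (value t)) }

  ↦-neg : ∀ {f F} → f ↦ F → neg f ↦ neg F
  ↦-neg {f} {F} s = ↦-congˡ (S.solve 1 (λ f → S.con (- + 1) S.:* f S.:= S.:- f) ≈-refl f) (↦-congʳ (solve 1 (λ f → con (- + 1) :* f := :- f) reflₚ F) (↦-⊙ (↦-K (- + 1)) s))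
    where module S = Exact.Solver

  ↦-pow : ∀ n {f F} → f ↦ F → pow f n ↦ pow F n
  ↦-pow zero    s = ↦-congˡ (≈-sym one≈K1) (↦-congʳ (exact⇒mod (≈-sym one≈K1)) (↦-K (+ 1)))
  ↦-pow (suc n) {f} {F} s = ↦-congˡ (≈-sym (mul≈⊙ f (pow f n))) (↦-congʳ (exact⇒mod (≈-sym (mul≈⊙ F (pow F n)))) (↦-⊙ s (↦-pow n s)))

  ↦-quadratic : ∀ {t T f F f′ F′ f″ F″} → t ↦ T → f ↦ F → f′ ↦ F′ → f″ ↦ F″ → quadratic t f f′ f″ ↦ quadratic T F F′ F″
  ↦-quadratic t f f′ f″ = ↦-⊕ (↦-⊕ (↦-⊕ (↦-⊙ (↦-K (+ 3)) (↦-⊙ (↦-⊙ z f) f″)) (↦-neg (↦-⊙ (↦-K (+ 2)) (↦-⊙ (↦-⊙ z f′) f′)))) (↦-⊙ (↦-K (+ 54)) (↦-⊙ (↦-⊙ t f) f′))) (↦-⊙ (↦-K (+ 27)) (↦-⊙ (↦-⊙ t f) f))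
    where
    z = ↦-⊕ (↦-K (+ 1)) (↦-⊙ (↦-K (+ 27)) t)

  mon-shift : ∀ e f → (∀ i → i < e → f i ≡ + 0 ⟨mod p ⟩) → f ≈ₚ mon e ⊙ (λ n → f (e ℕ.+ n))
  mon-shift e f h = pwₚ λ n → case n (ℕP.<-≤-connex n e)
    where
    case : ∀ n → n < e ⊎ e ≤ n → f n ≡ (mon e ⊙ (λ n → f (e ℕ.+ n))) n ⟨mod p ⟩
    case n (inj₁ n<e) = ≡ₘ-trans (h n n<e) (≡ₘ-reflexive (sym (trans (⊙-at (mon e) (λ n → f (e ℕ.+ n)) n) (mul-mon-< e (λ n → f (e ℕ.+ n)) n n<e))))
    case n (inj₂ e≤n) = subst (λ z → f z ≡ (mon e ⊙ (λ n → f (e ℕ.+ n))) z ⟨mod p ⟩) (ℕP.m+[n∸m]≡n e≤n)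
      (≡ₘ-reflexive (sym (trans (⊙-at (mon e) (λ n → f (e ℕ.+ n)) (e ℕ.+ (n ∸ e))) (mul-mon e (λ n → f (e ℕ.+ n)) (n ∸ e)))))

  mon⊙-at : ∀ e f n → (mon e ⊙ f) (e ℕ.+ n) ≡ f n
  mon⊙-at e f n = trans (⊙-at (mon e) f (e ℕ.+ n)) (mul-mon e f n)

  mon-cancel : ∀ e {f} → mon e ⊙ f ≈ₚ K (+ 0) → f ≈ₚ K (+ 0)
  mon-cancel e {f} h = pwₚ λ n → ≡ₘ-trans (≡ₘ-reflexive (sym (mon⊙-at e f n))) (≡ₘ-trans (atₚ h (e ℕ.+ n)) (≡ₘ-reflexive (trans (K0-at (e ℕ.+ n)) (sym (K0-at n)))))

  θ-mon⊙ : ∀ e f → θ (mon e ⊙ f) ≈ mon e ⊙ (K (+ e) ⊙ f ⊕ θ f)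
  θ-mon⊙ e f = ≈-trans (θ-* (mon e) f) (≈-trans (+-cong (*-cong (≈-trans (≐⇒≈ (θ-mon e)) (≈-sym (K⊙ (+ e) (mon e)))) ≈-refl) ≈-refl)
    (S.solve 4 (λ k m f d → k S.:* m S.:* f S.:+ m S.:* d S.:= m S.:* (k S.:* f S.:+ d)) ≈-refl (K (+ e)) (mon e) f (θ f)))
    where module S = Exact.Solver

  Zero-below : Series → ℕ → Set
  Zero-below f N = ∀ i → i < N → f i ≡ + 0 ⟨mod p ⟩

  Order-below : Series → ℕ → Set
  Order-below f N = Σ ℕ λ e → e < N × ¬ (f e ≡ + 0 ⟨mod p ⟩) × Zero-below f e

  first-nonzero : ∀ f N → Zero-below f N ⊎ Order-below f N
  first-nonzero f zero    = inj₁ λ i ()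
  first-nonzero f (suc N) = step (first-nonzero f N) (≡ₘ0? p (f N))
    where
    step : Zero-below f N ⊎ Order-below f N → Dec (f N ≡ + 0 ⟨mod p ⟩) → Zero-below f (suc N) ⊎ Order-below f (suc N)
    step (inj₂ (e , e<N , h)) _     = inj₂ (e , ℕP.m<n⇒m<1+n e<N , h)
    step (inj₁ h) (no ≢0)           = inj₂ (N , ℕP.≤-refl , ≢0 , h)
    step (inj₁ h) (yes ≡0)          = inj₁ λ i i≤N → last i (ℕP.m<1+n⇒m<n∨m≡n i≤N)
      where
      last : ∀ i → i < N ⊎ i ≡ N → f i ≡ + 0 ⟨mod p ⟩
      last i (inj₁ i<N)  = h i i<N
      last i (inj₂ refl) = ≡0

  -- The square has the unit κ₀² at q^(2e), while a multiple of q^p has nothing below q^p.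
  square-order : ∀ {Γ W} e κ → Γ ≈ₚ mon e ⊙ κ → ¬ (κ 0 ≡ + 0 ⟨mod p ⟩) → Γ ⊙ Γ ≈ₚ W ⊙ mon p → p ≤ e ℕ.+ e
  square-order {Γ} {W} e κ Γ≈ κ≢0 h = case (ℕP.<-≤-connex (e ℕ.+ e) p)
    where
    same : ∀ x → x ≡ + 0 ⟨mod p ⟩ ⊎ x ≡ + 0 ⟨mod p ⟩ → x ≡ + 0 ⟨mod p ⟩
    same x (inj₁ a) = a
    same x (inj₂ a) = a
    κ² : Γ ⊙ Γ ≈ₚ mon e ⊙ (mon e ⊙ (κ ⊙ κ))
    κ² = transₚ (*-congₚ Γ≈ Γ≈) (solve 2 (λ m k → m :* k :* (m :* k) := m :* (m :* (k :* k))) reflₚ (mon e) κ)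
    case : e ℕ.+ e < p ⊎ p ≤ e ℕ.+ e → p ≤ e ℕ.+ e
    case (inj₂ x) = x
    case (inj₁ x) = ⊥-elim (κ≢0 (same (κ 0) (euclidₘ (κ 0) (κ 0) (≡ₘ-trans (≡ₘ-reflexive (sym (trans (trans (cong (mon e ⊙ (mon e ⊙ (κ ⊙ κ))) (cong (e ℕ.+_) (sym (ℕP.+-identityʳ e))))
        (trans (mon⊙-at e (mon e ⊙ (κ ⊙ κ)) (e ℕ.+ 0)) (mon⊙-at e (κ ⊙ κ) 0))) (⊙-0 κ κ))))
      (≡ₘ-trans (atₚ (transₚ (symₚ κ²) (transₚ h (solve 2 (λ w m → w :* m := m :* w) reflₚ W (mon p)))) (e ℕ.+ e)) (≡ₘ-reflexive (trans (⊙-at (mon p) W (e ℕ.+ e)) (mul-mon-< p W (e ℕ.+ e) x))))))))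

  -- For Γ = q^e κ one has θΓ = q^e κ₁ and θ²Γ = q^e κ₂. Multiplying the quadratic equation by q²
  -- and removing q^(2e) leaves (q - 1)Φ; `Φ′` is Φ divided by q in the case 1 + 27v = q.
  module LeadingTerm (e : ℕ) (κ : Series) where

    κ₁ κ₂ : Series
    κ₁ = K (+ e) ⊙ κ ⊕ θ κ
    κ₂ = K (+ e) ⊙ κ₁ ⊕ θ κ₁

    X-1 : Series
    X-1 = Xq ⊖ K (+ 1)

    Φ : Series → Series
    Φ z = K (+ 3) ⊙ (z ⊙ κ ⊙ (X-1 ⊙ κ₂ ⊕ κ₁)) ⊖ K (+ 2) ⊙ (z ⊙ X-1 ⊙ κ₁ ⊙ κ₁) ⊕ K (+ 54) ⊙ (K μ ⊙ Xq ⊙ X-1 ⊙ κ ⊙ κ₁) ⊕ K (+ 27) ⊙ (K μ ⊙ Xq ⊙ Xq ⊙ κ ⊙ κ)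

    Φ′ : Series
    Φ′ = K (+ 3) ⊙ (κ ⊙ (X-1 ⊙ κ₂ ⊕ κ₁)) ⊖ K (+ 2) ⊙ (X-1 ⊙ κ₁ ⊙ κ₁) ⊕ K (+ 54) ⊙ (K μ ⊙ X-1 ⊙ κ ⊙ κ₁) ⊕ K (+ 27) ⊙ (K μ ⊙ Xq ⊙ κ ⊙ κ)

    equation : ∀ {Γ Γ₁ Γ₂} → Γ ≈ₚ mon e ⊙ κ → Xq ⊙ Γ₁ ≈ₚ X-1 ⊙ θ Γ → Xq ⊙ Γ₂ ≈ₚ X-1 ⊙ θ Γ₁ → quadratic v Γ Γ₁ Γ₂ ≈ₚ K (+ 0) →
      X-1 ⊙ Φ (K (+ 1) ⊕ K (+ 27) ⊙ v) ≈ₚ K (+ 0)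
    equation {Γ} {Γ₁} {Γ₂} Γ≈ h₁ h₂ ode = mon-cancel e (mon-cancel e (begin
      m ⊙ (m ⊙ (X-1 ⊙ Φ (K (+ 1) ⊕ K (+ 27) ⊙ v)))
        ≈⟨ solve 6 (λ m x μ k k₁ k₂ → let x-1 = x :- con (+ 1) ; v = μ :* (x :- con (+ 1)) ; z = con (+ 1) :+ con (+ 27) :* v in
             m :* (m :* (x-1 :* (con (+ 3) :* (z :* k :* (x-1 :* k₂ :+ k₁)) :- con (+ 2) :* (z :* x-1 :* k₁ :* k₁) :+ con (+ 54) :* (μ :* x :* x-1 :* k :* k₁) :+ con (+ 27) :* (μ :* x :* x :* k :* k))))
             := con (+ 3) :* (z :* (m :* k) :* (m :* (x-1 :* (x-1 :* k₂ :+ k₁)))) :- con (+ 2) :* (z :* (m :* (x-1 :* k₁)) :* (m :* (x-1 :* k₁)))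
                :+ con (+ 54) :* (v :* x :* (m :* k) :* (m :* (x-1 :* k₁))) :+ con (+ 27) :* (v :* x :* x :* (m :* k) :* (m :* k))) reflₚ m Xq (K μ) κ κ₁ κ₂ ⟩
      K (+ 3) ⊙ (z ⊙ (m ⊙ κ) ⊙ (m ⊙ (X-1 ⊙ (X-1 ⊙ κ₂ ⊕ κ₁)))) ⊖ K (+ 2) ⊙ (z ⊙ (m ⊙ (X-1 ⊙ κ₁)) ⊙ (m ⊙ (X-1 ⊙ κ₁)))
        ⊕ K (+ 54) ⊙ (v ⊙ Xq ⊙ (m ⊙ κ) ⊙ (m ⊙ (X-1 ⊙ κ₁))) ⊕ K (+ 27) ⊙ (v ⊙ Xq ⊙ Xq ⊙ (m ⊙ κ) ⊙ (m ⊙ κ))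
        ≈⟨ +-congₚ (+-congₚ (+-congₚ (*-congₚ reflₚ (*-congₚ (*-congₚ reflₚ (symₚ Γ≈)) (symₚ Γ₂≈))) (neg-congₚ (*-congₚ reflₚ (*-congₚ (*-congₚ reflₚ (symₚ Γ₁≈)) (symₚ Γ₁≈)))))
             (*-congₚ reflₚ (*-congₚ (*-congₚ reflₚ (symₚ Γ≈)) (symₚ Γ₁≈)))) (*-congₚ reflₚ (*-congₚ (*-congₚ reflₚ (symₚ Γ≈)) (symₚ Γ≈))) ⟩
      K (+ 3) ⊙ (z ⊙ Γ ⊙ (Xq ⊙ (Xq ⊙ Γ₂))) ⊖ K (+ 2) ⊙ (z ⊙ (Xq ⊙ Γ₁) ⊙ (Xq ⊙ Γ₁)) ⊕ K (+ 54) ⊙ (v ⊙ Xq ⊙ Γ ⊙ (Xq ⊙ Γ₁)) ⊕ K (+ 27) ⊙ (v ⊙ Xq ⊙ Xq ⊙ Γ ⊙ Γ)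
        ≈⟨ solve 5 (λ x v f f₁ f₂ → let z = con (+ 1) :+ con (+ 27) :* v in
             con (+ 3) :* (z :* f :* (x :* (x :* f₂))) :- con (+ 2) :* (z :* (x :* f₁) :* (x :* f₁)) :+ con (+ 54) :* (v :* x :* f :* (x :* f₁)) :+ con (+ 27) :* (v :* x :* x :* f :* f)
             := x :* x :* (con (+ 3) :* (z :* f :* f₂) :- con (+ 2) :* (z :* f₁ :* f₁) :+ con (+ 54) :* (v :* f :* f₁) :+ con (+ 27) :* (v :* f :* f))) reflₚ Xq v Γ Γ₁ Γ₂ ⟩
      Xq ⊙ Xq ⊙ quadratic v Γ Γ₁ Γ₂
        ≈⟨ *-congₚ reflₚ ode ⟩
      Xq ⊙ Xq ⊙ K (+ 0)
        ≈⟨ solve 1 (λ x → x :* x :* con (+ 0) := con (+ 0)) reflₚ Xq ⟩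
      K (+ 0) ∎))
      where
      m = mon e
      z = K (+ 1) ⊕ K (+ 27) ⊙ v
      Γ₁≈ : Xq ⊙ Γ₁ ≈ₚ m ⊙ (X-1 ⊙ κ₁)
      Γ₁≈ = transₚ h₁ (transₚ (*-congₚ reflₚ (transₚ (θ-mod Γ≈) (exact⇒mod (θ-mon⊙ e κ)))) (solve 3 (λ x m k → x :* (m :* k) := m :* (x :* k)) reflₚ X-1 m κ₁))
      θX-1 : θ X-1 ≈ₚ Xq
      θX-1 = exact⇒mod (≈-trans (θ-+ Xq (neg (K (+ 1)))) (≈-trans (+-cong θ-Xq (≈-trans (θ-neg (K (+ 1))) (-‿cong (θ-K (+ 1)))))
        (Exact.Solver.solve 1 (λ x → x Exact.Solver.:- Exact.Solver.con (+ 0) Exact.Solver.:= x) ≈-refl Xq)))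
      Γ₂≈ : Xq ⊙ (Xq ⊙ Γ₂) ≈ₚ m ⊙ (X-1 ⊙ (X-1 ⊙ κ₂ ⊕ κ₁))
      Γ₂≈ = begin
        Xq ⊙ (Xq ⊙ Γ₂)
          ≈⟨ *-congₚ reflₚ h₂ ⟩
        Xq ⊙ (X-1 ⊙ θ Γ₁)
          ≈⟨ solve 3 (λ x f d → x :* ((x :- con (+ 1)) :* d) := (x :- con (+ 1)) :* (x :* f :+ x :* d :- x :* f)) reflₚ Xq Γ₁ (θ Γ₁) ⟩
        X-1 ⊙ (Xq ⊙ Γ₁ ⊕ Xq ⊙ θ Γ₁ ⊖ Xq ⊙ Γ₁)
          ≈⟨ *-congₚ reflₚ (+-congₚ (symₚ (exact⇒mod (≈-trans (θ-* Xq Γ₁) (+-cong (*-cong θ-Xq ≈-refl) ≈-refl)))) reflₚ) ⟩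
        X-1 ⊙ (θ (Xq ⊙ Γ₁) ⊖ Xq ⊙ Γ₁)
          ≈⟨ *-congₚ reflₚ (+-congₚ (transₚ (θ-mod Γ₁≈) (exact⇒mod (θ-mon⊙ e (X-1 ⊙ κ₁)))) (neg-congₚ Γ₁≈)) ⟩
        X-1 ⊙ (m ⊙ (K (+ e) ⊙ (X-1 ⊙ κ₁) ⊕ θ (X-1 ⊙ κ₁)) ⊖ m ⊙ (X-1 ⊙ κ₁))
          ≈⟨ *-congₚ reflₚ (+-congₚ (*-congₚ reflₚ (+-congₚ reflₚ (transₚ (exact⇒mod (θ-* X-1 κ₁)) (+-congₚ (*-congₚ θX-1 reflₚ) reflₚ)))) reflₚ) ⟩
        X-1 ⊙ (m ⊙ (K (+ e) ⊙ (X-1 ⊙ κ₁) ⊕ (Xq ⊙ κ₁ ⊕ X-1 ⊙ θ κ₁)) ⊖ m ⊙ (X-1 ⊙ κ₁))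
          ≈⟨ solve 5 (λ x m e k d → (x :- con (+ 1)) :* (m :* (e :* ((x :- con (+ 1)) :* k) :+ (x :* k :+ (x :- con (+ 1)) :* d)) :- m :* ((x :- con (+ 1)) :* k))
               := m :* ((x :- con (+ 1)) :* ((x :- con (+ 1)) :* (e :* k :+ d) :+ k))) reflₚ Xq m (K (+ e)) κ₁ (θ κ₁) ⟩
        m ⊙ (X-1 ⊙ (X-1 ⊙ κ₂ ⊕ κ₁)) ∎

    private
      infixl 6 _⊞₀_ _⊟₀_
      infixl 7 _⊠₀_
      _⊞₀_ : ∀ {f h a b} → f 0 ≡ a → h 0 ≡ b → (f ⊕ h) 0 ≡ a + b
      _⊞₀_ {f} {h} p q = trans (⊕-at f h 0) (cong₂ _+_ p q)
      _⊟₀_ : ∀ {f h a b} → f 0 ≡ a → h 0 ≡ b → (f ⊖ h) 0 ≡ a - b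
      _⊟₀_ {f} {h} p q = trans (⊖-at f h 0) (cong₂ _-_ p q)
      _⊠₀_ : ∀ {f h a b} → f 0 ≡ a → h 0 ≡ b → (f ⊙ h) 0 ≡ a * b
      _⊠₀_ {f} {h} p q = trans (⊙-0 f h) (cong₂ _*_ p q)
      k₀ : ∀ c → K c 0 ≡ c
      k₀ c = refl
      x₀ : Xq 0 ≡ + 0
      x₀ = refl
      κ₁0 : κ₁ 0 ≡ + e * κ 0
      κ₁0 = trans (k₀ (+ e) ⊠₀ refl {x = κ 0} ⊞₀ refl {x = θ κ 0}) (ℤP.+-identityʳ (+ e * κ 0))
      κ₂0 : κ₂ 0 ≡ + e * (+ e * κ 0)
      κ₂0 = trans (k₀ (+ e) ⊠₀ κ₁0 ⊞₀ refl {x = θ κ₁ 0}) (ℤP.+-identityʳ (+ e * (+ e * κ 0)))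
      X-1₀ : X-1 0 ≡ + 0 - + 1
      X-1₀ = x₀ ⊟₀ k₀ (+ 1)

    -- The indicial polynomial at a point with 1 + 27t ≠ 0: there B^(1/3) may vanish to order 0 or
    -- 1, hence B to order 0 or 3.
    Φ-0 : ∀ z → (X-1 ⊙ Φ z) 0 ≡ z 0 * (κ 0 * (κ 0 * (+ e * (+ e - + 3))))
    Φ-0 z = trans (X-1₀ ⊠₀ (k₀ (+ 3) ⊠₀ (refl {x = z 0} ⊠₀ refl {x = κ 0} ⊠₀ (X-1₀ ⊠₀ κ₂0 ⊞₀ κ₁0)) ⊟₀ k₀ (+ 2) ⊠₀ (refl {x = z 0} ⊠₀ X-1₀ ⊠₀ κ₁0 ⊠₀ κ₁0)
        ⊞₀ k₀ (+ 54) ⊠₀ (k₀ μ ⊠₀ x₀ ⊠₀ X-1₀ ⊠₀ refl {x = κ 0} ⊠₀ κ₁0) ⊞₀ k₀ (+ 27) ⊠₀ (k₀ μ ⊠₀ x₀ ⊠₀ x₀ ⊠₀ refl {x = κ 0} ⊠₀ refl {x = κ 0})))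
      (t (z 0) (κ 0) (+ e) μ)
      where
      t : ∀ z k e m → (+ 0 - + 1) * (+ 3 * (z * k * ((+ 0 - + 1) * (e * (e * k)) + e * k)) - + 2 * (z * (+ 0 - + 1) * (e * k) * (e * k)) + + 54 * (m * + 0 * (+ 0 - + 1) * k * (e * k)) + + 27 * (m * + 0 * + 0 * k * k))
        ≡ z * (k * (k * (e * (e - + 3))))
      t = solve-∀

    -- The indicial polynomial at the singular point t = -1/27, where B^(1/3) has exponents 0 and
    -- 1/3, hence B has 0 and 1. The last summand carries 1 - 27μ, which is zero modulo p in that
    -- case.
    Φ′-0 : (X-1 ⊙ Φ′) 0 ≡ κ 0 * (κ 0 * (+ e * (+ e - + 1))) - (+ 1 - + 27 * μ) * (+ 2 * (κ 0 * κ 0 * + e))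
    Φ′-0 = trans (X-1₀ ⊠₀ (k₀ (+ 3) ⊠₀ (refl {x = κ 0} ⊠₀ (X-1₀ ⊠₀ κ₂0 ⊞₀ κ₁0)) ⊟₀ k₀ (+ 2) ⊠₀ (X-1₀ ⊠₀ κ₁0 ⊠₀ κ₁0)
        ⊞₀ k₀ (+ 54) ⊠₀ (k₀ μ ⊠₀ X-1₀ ⊠₀ refl {x = κ 0} ⊠₀ κ₁0) ⊞₀ k₀ (+ 27) ⊠₀ (k₀ μ ⊠₀ x₀ ⊠₀ refl {x = κ 0} ⊠₀ refl {x = κ 0})))
      (t (κ 0) (+ e) μ)
      where
      t : ∀ k e m → (+ 0 - + 1) * (+ 3 * (k * ((+ 0 - + 1) * (e * (e * k)) + e * k)) - + 2 * ((+ 0 - + 1) * (e * k) * (e * k)) + + 54 * (m * (+ 0 - + 1) * k * (e * k)) + + 27 * (m * + 0 * k * k))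
        ≡ k * (k * (e * (e - + 1))) - (+ 1 - + 27 * m) * (+ 2 * (k * k * e))
      t = solve-∀

    Φ-X : ∀ {z} → z ≈ₚ Xq → X-1 ⊙ Φ z ≈ₚ mon 1 ⊙ (X-1 ⊙ Φ′)
    Φ-X {z} h = begin
      X-1 ⊙ Φ z
        ≈⟨ *-congₚ reflₚ (+-congₚ (+-congₚ (+-congₚ (*-congₚ reflₚ (*-congₚ (*-congₚ h reflₚ) reflₚ)) (neg-congₚ (*-congₚ reflₚ (*-congₚ (*-congₚ (*-congₚ h reflₚ) reflₚ) reflₚ)))) reflₚ) reflₚ) ⟩
      X-1 ⊙ Φ Xq
        ≈⟨ solve 5 (λ x μ k k₁ k₂ → let x-1 = x :- con (+ 1) in
             x-1 :* (con (+ 3) :* (x :* k :* (x-1 :* k₂ :+ k₁)) :- con (+ 2) :* (x :* x-1 :* k₁ :* k₁) :+ con (+ 54) :* (μ :* x :* x-1 :* k :* k₁) :+ con (+ 27) :* (μ :* x :* x :* k :* k))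
             := x :* (x-1 :* (con (+ 3) :* (k :* (x-1 :* k₂ :+ k₁)) :- con (+ 2) :* (x-1 :* k₁ :* k₁) :+ con (+ 54) :* (μ :* x-1 :* k :* k₁) :+ con (+ 27) :* (μ :* x :* k :* k)))) reflₚ Xq (K μ) κ κ₁ κ₂ ⟩
      Xq ⊙ (X-1 ⊙ Φ′)
        ≈⟨ *-congₚ (pwₚ λ { zero → ≡ₘ-refl ; (suc zero) → ≡ₘ-refl ; (suc (suc n)) → ≡ₘ-refl }) reflₚ ⟩
      mon 1 ⊙ (X-1 ⊙ Φ′) ∎

    -- The cases are whether the expansion point t = -μ is regular (e = 3) or satisfies 1 + 27t = 0
    -- modulo p (e = 1); in the latter case z = q, and one more power of q must be removed before
    -- the constant term is informative.
    exponent : X-1 ⊙ Φ (K (+ 1) ⊕ K (+ 27) ⊙ v) ≈ₚ K (+ 0) → ¬ (κ 0 ≡ + 0 ⟨mod p ⟩) → ¬ (+ e ≡ + 0 ⟨mod p ⟩) → + e - + 1 ≡ + 0 ⟨mod p ⟩ ⊎ + e - + 3 ≡ + 0 ⟨mod p ⟩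
    exponent h κ≢0 e≢0 = decide (≡ₘ0? p (+ 1 - + 27 * μ))
      where
      z = K (+ 1) ⊕ K (+ 27) ⊙ v
      z-0 : z 0 ≡ + 1 - + 27 * μ
      z-0 = trans (k₀ (+ 1) ⊞₀ k₀ (+ 27) ⊠₀ (k₀ μ ⊠₀ X-1₀)) (t μ)
        where
        t : ∀ m → + 1 + + 27 * (m * (+ 0 - + 1)) ≡ + 1 - + 27 * m
        t = solve-∀
      cancelₘ : ∀ {a b} → ¬ (a ≡ + 0 ⟨mod p ⟩) → a * b ≡ + 0 ⟨mod p ⟩ → b ≡ + 0 ⟨mod p ⟩
      cancelₘ {a} {b} a≢0 h = pick (euclidₘ a b h)
        where
        pick : a ≡ + 0 ⟨mod p ⟩ ⊎ b ≡ + 0 ⟨mod p ⟩ → b ≡ + 0 ⟨mod p ⟩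
        pick (inj₁ x) = ⊥-elim (a≢0 x)
        pick (inj₂ y) = y
      factor : ∀ x → κ 0 * (κ 0 * (+ e * x)) ≡ + 0 ⟨mod p ⟩ → x ≡ + 0 ⟨mod p ⟩
      factor x h = cancelₘ e≢0 (cancelₘ κ≢0 (cancelₘ κ≢0 h))
      decide : Dec (+ 1 - + 27 * μ ≡ + 0 ⟨mod p ⟩) → + e - + 1 ≡ + 0 ⟨mod p ⟩ ⊎ + e - + 3 ≡ + 0 ⟨mod p ⟩
      decide (no z≢0) = inj₂ (factor (+ e - + 3) (cancelₘ z≢0 (≡ₘ-trans (≡ₘ-reflexive (sym (trans (Φ-0 z) (cong (_* (κ 0 * (κ 0 * (+ e * (+ e - + 3))))) z-0)))) (atₚ h 0))))
      decide (yes z≡0) = inj₁ (factor (+ e - + 1) (≡ₘ-trans (≡ₘ-reflexive (t₂ (κ 0 * (κ 0 * (+ e * (+ e - + 1)))) ((+ 1 - + 27 * μ) * rest)))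
          (≡ₘ-trans (≡ₘ-+ (≡ₘ-trans (≡ₘ-reflexive (sym Φ′-0)) (atₚ (mon-cancel 1 (transₚ (symₚ (Φ-X z≈X)) h)) 0)) (≡ₘ-trans (≡ₘ-* z≡0 (≡ₘ-refl {a = rest})) (≡ₘ-reflexive (ℤP.*-zeroˡ rest)))) ≡ₘ-refl)))
        where
        rest = + 2 * (κ 0 * κ 0 * + e)
        t₂ : ∀ a b → a ≡ a - b + b
        t₂ = solve-∀
        z≈X : z ≈ₚ Xq
        z≈X = transₚ (solve 2 (λ x m → con (+ 1) :+ con (+ 27) :* (m :* (x :- con (+ 1))) := x :+ (x :- con (+ 1)) :* (:- (con (+ 1) :- con (+ 27) :* m))) reflₚ Xq (K μ))
          (transₚ (+-congₚ reflₚ (*-congₚ reflₚ (neg-congₚ (transₚ (symₚ const-form) (K-mod z≡0))))) (solve 1 (λ x → x :+ (x :- con (+ 1)) :* (:- con (+ 0)) := x) reflₚ Xq))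
          where
          const-form : K (+ 1 - + 27 * μ) ≈ₚ K (+ 1) ⊖ K (+ 27) ⊙ K μ
          const-form = transₚ (Mod.const-+ p (+ 1) (- (+ 27 * μ))) (+-congₚ reflₚ (transₚ (Mod.const-neg p (+ 27 * μ)) (neg-congₚ (Mod.const-* p (+ 27) μ))))

  -- As νμ = 1, the substitution turns 1 + νt^p into q^p, so the substituted square is divisible by
  -- q^p. The order so forced on f is incompatible with its differential equation.
  no-square : 7 ≤ p → ¬ (+ p ∣ˢ μ) → ∀ ν → ν * μ ≡ + 1 ⟨mod p ⟩ → ∀ f P → Vanishes-from p f → Vanishes-from p P → ¬ (f p′ ≡ + 0 ⟨mod p ⟩) →
    quadratic Xq f (θ f) (θ (θ f)) ≈ₚ K (+ 0) → ¬ (f ⊙ f ≈ₚ P ⊙ (K (+ 1) ⊕ K ν ⊙ mon p))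
  no-square 7≤p p∤μ ν νμ≡1 f P f-fin P-fin top ode square = order (first-nonzero Γ p)
    where
    Γ = Sub p f
    θ-fin : ∀ {f} → Vanishes-from p f → Vanishes-from p (θ f)
    θ-fin h n b = trans (cong (+ n *_) (h n b)) (ℤP.*-zeroʳ (+ n))
    polynomial : ∀ {f} → Vanishes-from p f → f ↦ Sub p f
    polynomial h = record { bound = p ; finite = h ; value = reflₚ }
    Γ-ode : quadratic v Γ (Sub p (θ f)) (Sub p (θ (θ f))) ≈ₚ K (+ 0)
    Γ-ode = ↦-unique (↦-quadratic ↦-Xq (polynomial f-fin) (polynomial (θ-fin f-fin)) (polynomial (θ-fin (θ-fin f-fin)))) (↦-K (+ 0)) ode
    v^p : pow v p ≈ₚ K μ ⊙ (mon p ⊕ K (- + 1))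
    v^p = transₚ (pow-⊙ p (K μ) (Xq ⊖ K (+ 1))) (*-congₚ (fermat μ) (transₚ (pow-+ Xq (neg (K (+ 1)))) (+-congₚ (exact⇒mod (pow-Xq p))
      (transₚ (pow-cong p (symₚ (Mod.const-neg p (+ 1)))) (fermat (- + 1))))))
    Γ-square : Γ ⊙ Γ ≈ₚ Sub p P ⊙ mon p
    Γ-square = transₚ (↦-unique (↦-⊙ (polynomial f-fin) (polynomial f-fin)) (↦-⊙ (polynomial P-fin) (↦-⊕ (↦-K (+ 1)) (↦-⊙ (↦-K ν) (↦-congˡ (pow-Xq p) (↦-pow p ↦-Xq))))) square)
      (*-congₚ reflₚ (transₚ (+-congₚ reflₚ (*-congₚ reflₚ v^p)) (transₚ (solve 3 (λ n m x → con (+ 1) :+ n :* (m :* (x :+ con (- + 1))) := con (+ 1) :+ n :* m :* (x :- con (+ 1))) reflₚ (K ν) (K μ) (mon p))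
        (transₚ (+-congₚ reflₚ (*-congₚ (transₚ (symₚ (Mod.const-* p ν μ)) (K-mod νμ≡1)) reflₚ)) (solve 1 (λ x → con (+ 1) :+ con (+ 1) :* (x :- con (+ 1)) := x) reflₚ (mon p))))))
    p∤difference : ∀ e c → c < e → e < p → ¬ (+ e - + c ≡ + 0 ⟨mod p ⟩)
    p∤difference e c c<e e<p h = p∤small (e ∸ c) (ℕP.m<n⇒0<n∸m c<e) (ℕP.≤-<-trans (ℕP.m∸n≤m e c) e<p)
      (≡ₘ0⇒∣ (≡ₘ-trans (≡ₘ-reflexive (sym (trans (ℤP.m-n≡m⊖n e c) (ℤP.⊖-≥ (ℕP.<⇒≤ c<e))))) h))
    order : ¬ (Zero-below Γ p ⊎ Order-below Γ p)
    order (inj₁ zeros) = top (Sub-top p∤μ p′ f (zeros p′ ℕP.≤-refl))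
    order (inj₂ (e , e<p , Γe≢0 , zeros)) = exclude (exponent (equation Γ≈ (Sub-θ p f) (Sub-θ p (θ f)) Γ-ode) κ≢0 (λ h → p∤small e (ℕP.≤-trans (s≤s z≤n) 4≤e) e<p (≡ₘ0⇒∣ h)))
      where
      κ : Series
      κ n = Γ (e ℕ.+ n)
      open LeadingTerm e κ
      Γ≈ : Γ ≈ₚ mon e ⊙ κ
      Γ≈ = mon-shift e Γ zeros
      κ≢0 : ¬ (κ 0 ≡ + 0 ⟨mod p ⟩)
      κ≢0 h = Γe≢0 (≡ₘ-trans (≡ₘ-reflexive (cong Γ (sym (ℕP.+-identityʳ e)))) h)
      -- If e ≤ 3 then 2e ≤ 6 < p. With 4 ≤ e < p, the exponent e can be congruent to neither 1 nor
      -- 3.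
      4≤e : 4 ≤ e
      4≤e = ℕP.≰⇒> λ e≤3 → ℕP.<⇒≱ (ℕP.≤-trans 7≤p (square-order e κ Γ≈ κ≢0 Γ-square)) (ℕP.+-mono-≤ e≤3 e≤3)
      exclude : ¬ (+ e - + 1 ≡ + 0 ⟨mod p ⟩ ⊎ + e - + 3 ≡ + 0 ⟨mod p ⟩)
      exclude (inj₁ h) = p∤difference e 1 (ℕP.≤-trans (s≤s (s≤s z≤n)) 4≤e) e<p h
      exclude (inj₂ h) = p∤difference e 3 4≤e e<p h

-- Reduction modulo p, and the truncation g of the expansion of B.

module _ where

  open import Relation.Binary.Reasoning.Setoid setoid
  open Exact.Solver using (solve; con; _:+_; _:*_; _:-_; :-_; _:=_)

  below : ℕ → Series → Series
  below p f n with n ℕP.<? p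
  ... | yes _ = f n
  ... | no _  = + 0

  below-< : ∀ {p} f {n} → n < p → below p f n ≡ f n
  below-< {p} f {n} n<p with n ℕP.<? p
  ... | yes _  = refl
  ... | no n≮p = ⊥-elim (n≮p n<p)

  below-≥ : ∀ {p} f {n} → p ≤ n → below p f n ≡ + 0
  below-≥ {p} f {n} p≤n with n ℕP.<? p
  ... | yes n<p = ⊥-elim (ℕP.<⇒≱ n<p p≤n)
  ... | no _    = refl

  module Reduction (p′ : ℕ) (prime : Prime (suc p′)) (5≤p : 5 ≤ suc p′) where

    open Expansion p′ prime 5≤p public
    open Mod p public using () renaming (_≈_ to _≈ₚ_; pw to pwₚ; at to atₚ; ≈-refl to reflₚ; ≈-sym to symₚ; ≈-trans to transₚ; +-cong to +-congₚ; *-cong to *-congₚ; -‿cong to neg-congₚ)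
    module Sₚ = Mod.Solver p

    τ-frobenius : ∀ k → τ^ (+ p * k) ≈ₚ V (τ^ k)
    τ-frobenius = ℤ-induction (λ k → τ^ (+ p * k) ≈ₚ V (τ^ k))
      (transₚ (exact⇒mod (≈-trans (τ^-≡ (ℤP.*-zeroʳ (+ p))) one≈K1)) (exact⇒mod (≈-trans (≈-sym (V-K (+ 1))) (V-cong≈ (≈-sym one≈K1)))))
      (λ k h → transₚ (exact⇒mod (expand k)) (transₚ (*-congₚ (frobenius τ) h) (exact⇒mod (V-suc k))))
      (λ k h → transₚ (cancel (τ^ (+ p * k))) (transₚ (*-congₚ reflₚ (transₚ (*-congₚ (symₚ (frobenius τ)) reflₚ) (transₚ (exact⇒mod (≈-sym (expand k))) (transₚ h (exact⇒mod (≈-sym (V-suc k)))))))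
         (symₚ (cancel (V (τ^ k))))))
      where
      expand : ∀ k → τ^ (+ p * (+ 1 + k)) ≈ pow τ p ⊙ τ^ (+ p * k)
      expand k = ≈-trans (τ^-≡ (t (+ p) k)) (τ^-+ (+ p) (+ p * k))
        where
        t : ∀ p k → p * (+ 1 + k) ≡ p + p * k
        t = solve-∀
      V-suc : ∀ k → V τ ⊙ V (τ^ k) ≈ V (τ^ (+ 1 + k))
      V-suc k = ≈-trans (≈-sym (V-⊙ τ (τ^ k))) (V-cong≈ (≈-sym (τ^-suc k)))
      cancel : ∀ f → f ≈ₚ V σ ⊙ (V τ ⊙ f)
      cancel f = exact⇒mod (≈-trans (solve 1 (λ f → f := con (+ 1) :* f) ≈-refl f) (≈-trans (*-cong (≈-trans (≈-sym (V-K (+ 1))) (≈-trans (V-cong≈ (≈-sym τσ)) (V-⊙ τ σ))) ≈-refl)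
        (solve 3 (λ a b f → a :* b :* f := b :* (a :* f)) ≈-refl (V τ) (V σ) f)))

    -- Modulo p the factor τ^(-pr) is V(τ^(-r)); the projection formula takes it through U_p and
    -- leaves U_p(C) ≡ C.
    Y-base : ∀ r n → Y r 0 n ≡ (C ⊙ τ^ (- r)) n ⟨mod p ⟩
    Y-base r n = ≡ₘ-trans (atₚ (transₚ (exact⇒mod (*-cong ≈-refl (τ^-≡ (t (+ p) r)))) (*-congₚ reflₚ (τ-frobenius (- r)))) (n ℕ.* p))
      (≡ₘ-trans (≡ₘ-reflexive (trans (⊙-at C (V (τ^ (- r))) (n ℕ.* p)) (pairing C (τ^ (- r)) n 0 (s≤s z≤n))))
      (≡ₘ-trans (sum-≡ₘ (suc n) (λ k _ → ≡ₘ-* (≡ₘ-weaken p∣p⁴ (C-eigen k)) (≡ₘ-refl {a = τ^ (- r) (n ∸ k)}))) (≡ₘ-reflexive (sym (⊙-at C (τ^ (- r)) n)))))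
      where
      t : ∀ p r → - (p * r + + 0) ≡ p * - r
      t = solve-∀

    D-base : ∀ r l → D′ r l ≡ K (+ 1) l ⟨mod p ⟩
    D-base r = Y≈⇒D r (Y-base r)

    β-at : ∀ i → β i ≡ (C ⊙ τ^ (- + i)) i
    β-at i = at (*-cong (≈-trans (solve 2 (λ b w → b :* w := w :* b) ≈-refl Bₛ wₛ) (≈-sym C≈wB)) ≈-refl) i

    -- Modulo p the dependence on r sits in the factor V(τ^(-r)), of which only the constant term 1
    -- reaches degrees below p. What remains is the residue defining the coefficient of B.
    u≡β : ∀ r i → i < p → u r i ≡ β i ⟨mod p ⟩
    u≡β r i i<p = ≡ₘ-trans (atₚ (transₚ (exact⇒mod split′) (*-congₚ reflₚ (τ-frobenius (- r)))) (i ℕ.+ 0))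
      (≡ₘ-reflexive (trans (⊙-at f (V (τ^ (- r))) (i ℕ.+ 0)) (trans (pairing f (τ^ (- r)) 0 i i<p) (trans (mul-zero (U i f) (τ^ (- r)))
        (trans (cong (f (i ℕ.+ 0) *_) (τ^-0 (- r))) (trans (ℤP.*-identityʳ (f (i ℕ.+ 0))) (trans (cong f (ℕP.+-identityʳ i)) (sym (β-at i)))))))))
      where
      f = C ⊙ τ^ (- + i)
      t : ∀ p r i → - (p * r + i) ≡ - i + p * - r
      t = solve-∀
      split′ : C ⊙ τ^ (- weight r i) ≈ f ⊙ τ^ (+ p * - r)
      split′ = ≈-trans (*-cong ≈-refl (≈-trans (τ^-≡ (t (+ p) r (+ i))) (τ^-+ (- + i) (+ p * - r)))) (solve 3 (λ a b c → a :* (b :* c) := a :* b :* c) ≈-refl C (τ^ (- + i)) (τ^ (+ p * - r)))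

    g : Series
    g = below p β

    below-block : ∀ f l i → i < p → below p f (i ℕ.+ l ℕ.* p) ≡ K (f i) l
    below-block f zero    i i<p = trans (cong (below p f) (ℕP.+-identityʳ i)) (below-< f i<p)
    below-block f (suc l) i i<p = below-≥ f (ℕP.≤-trans (ℕP.m≤m+n p (l ℕ.* p)) (ℕP.m≤n+m (p ℕ.+ l ℕ.* p) i))

    below-V : ∀ f h l i → i < p → (below p f ⊙ V h) (i ℕ.+ l ℕ.* p) ≡ f i * h l
    below-V f h l i i<p = trans (⊙-at (below p f) (V h) (i ℕ.+ l ℕ.* p)) (trans (pairing (below p f) h l i i<p)
      (trans (mul-cong≐ {g = h} (λ k → below-block f k i i<p) (λ _ → refl) l) (mul-const (f i) h l)))

    -- By `D-base` only the block l = 0 survives, so B(q)/B(q^p) is modulo p a polynomial in t of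
    -- degree below p.
    ℰM₀≈g : ℰ (M (+ 0)) ≈ₚ g
    ℰM₀≈g = pwₚ (by-digits (λ n → ℰ (M (+ 0)) n ≡ g n ⟨mod p ⟩) λ l i i<p → ≡ₘ-trans (≡ₘ-weaken p∣p⁴ (ℰM-block (+ 0) l i i<p))
      (≡ₘ-trans (≡ₘ-* (u≡β (+ 0 + + l) i i<p) (D-base (+ 0 + + l) l)) (≡ₘ-reflexive (trans (t l (β i)) (sym (below-block β l i i<p))))))
      where
      t : ∀ l x → x * K (+ 1) l ≡ K x l
      t zero    x = ℤP.*-identityʳ x
      t (suc l) x = ℤP.*-zeroʳ x

    k : Series
    k = ℰ (V Bₛ)

    k-0 : k 0 ≡ + 1
    k-0 = trans (ℰ-0 (V Bₛ)) (trans (V-multiple Bₛ 0) B-0)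

    kki : k ⊙ inv k ≈ K (+ 1)
    kki = inv-right k k-0

    -- A congruence of Dwork type. The factor `k` behaves as a constant for θ modulo p, and so the
    -- differential equation passes from β to g.
    β≈gk : β ≈ₚ g ⊙ k
    β≈gk = transₚ (exact⇒mod (≈-trans (ℰ-cong (≈-sym M₀VB)) (ℰ-* (M (+ 0)) (V Bₛ)))) (*-congₚ ℰM₀≈g reflₚ)
      where
      M₀VB : M (+ 0) ⊙ V Bₛ ≈ Bₛ
      M₀VB = begin
        Bₛ ⊙ V (one ⊙ Bi) ⊙ τ^ (- (+ p * + 0)) ⊙ V Bₛ
          ≈⟨ *-cong (*-cong (*-cong ≈-refl (V-⊙ one Bi)) (≈-trans (τ^-≡ (cong (λ z → - z) (ℤP.*-zeroʳ (+ p)))) one≈K1)) ≈-refl ⟩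
        Bₛ ⊙ (V one ⊙ V Bi) ⊙ K (+ 1) ⊙ V Bₛ
          ≈⟨ solve 4 (λ b o i v → b :* (o :* i) :* con (+ 1) :* v := b :* o :* (v :* i)) ≈-refl Bₛ (V one) (V Bi) (V Bₛ) ⟩
        Bₛ ⊙ V one ⊙ (V Bₛ ⊙ V Bi)
          ≈⟨ *-cong (*-cong ≈-refl (≈-trans (V-cong≈ one≈K1) (V-K (+ 1)))) (≈-trans (≈-sym (V-⊙ Bₛ Bi)) (≈-trans (V-cong≈ BBi) (V-K (+ 1)))) ⟩
        Bₛ ⊙ K (+ 1) ⊙ K (+ 1)
          ≈⟨ solve 1 (λ b → b :* con (+ 1) :* con (+ 1) := b) ≈-refl Bₛ ⟩
        Bₛ ∎

    -- θ kills V(B) modulo p, and `ℰ` carries t d/dt = w⁻¹θ on series in q to θ on expansions in t.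
    θk : θ k ≈ₚ K (+ 0)
    θk = transₚ (exact⇒mod (≈-sym (ℰ-θ h-w))) (transₚ (ℰ-mod (transₚ (*-congₚ (θV Bₛ) reflₚ) (Sₚ.solve 1 (λ w → Sₚ.con (+ 0) Sₚ.:* w Sₚ.:= Sₚ.con (+ 0)) reflₚ wi))) (exact⇒mod (ℰ-K (+ 0))))
      where
      h-w : θ (V Bₛ) ⊙ wi ⊙ wₛ ≈ θ (V Bₛ)
      h-w = ≈-trans (solve 3 (λ x i w → x :* i :* w := x :* (w :* i)) ≈-refl (θ (V Bₛ)) wi wₛ) (≈-trans (*-cong ≈-refl wwi) (solve 1 (λ x → x :* con (+ 1) := x) ≈-refl (θ (V Bₛ))))

    θ-k : ∀ f → θ (f ⊙ k) ≈ₚ θ f ⊙ k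
    θ-k f = transₚ (exact⇒mod (θ-* f k)) (transₚ (+-congₚ reflₚ (*-congₚ reflₚ θk)) (Sₚ.solve 3 (λ d k f → d Sₚ.:* k Sₚ.:+ f Sₚ.:* Sₚ.con (+ 0) Sₚ.:= d Sₚ.:* k) reflₚ (θ f) k f))

    quadratic-congₚ : ∀ {t t′ f f′ g g′ h h′} → t ≈ₚ t′ → f ≈ₚ f′ → g ≈ₚ g′ → h ≈ₚ h′ → quadratic t f g h ≈ₚ quadratic t′ f′ g′ h′
    quadratic-congₚ t f g h = +-congₚ (+-congₚ (+-congₚ (*-congₚ reflₚ (*-congₚ (*-congₚ z f) h)) (neg-congₚ (*-congₚ reflₚ (*-congₚ (*-congₚ z g) g))))
      (*-congₚ reflₚ (*-congₚ (*-congₚ t f) g))) (*-congₚ reflₚ (*-congₚ (*-congₚ t f) f))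
      where
      z = +-congₚ reflₚ (*-congₚ reflₚ t)

    -- The equation is homogeneous of degree 2 in the unknown and its derivatives, so k² factors
    -- out, and k is invertible.
    quadratic-g : quadratic Xq g (θ g) (θ (θ g)) ≈ₚ K (+ 0)
    quadratic-g = transₚ (cancel (quadratic Xq g (θ g) (θ (θ g)))) (transₚ (*-congₚ reflₚ (transₚ (symₚ (transₚ (quadratic-congₚ reflₚ β≈gk θβ (transₚ (θ-mod θβ) (θ-k (θ g)))) homogeneous)) (exact⇒mod quadratic-β)))
        (Sₚ.solve 1 (λ x → x Sₚ.:* x Sₚ.:* Sₚ.con (+ 0) Sₚ.:= Sₚ.con (+ 0)) reflₚ (inv k)))
      where
      θβ : θ β ≈ₚ θ g ⊙ k
      θβ = transₚ (θ-mod β≈gk) (θ-k g)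
      homogeneous : quadratic Xq (g ⊙ k) (θ g ⊙ k) (θ (θ g) ⊙ k) ≈ₚ k ⊙ k ⊙ quadratic Xq g (θ g) (θ (θ g))
      homogeneous = exact⇒mod (solve 5 (λ t f f′ f″ k →
          con (+ 3) :* ((con (+ 1) :+ con (+ 27) :* t) :* (f :* k) :* (f″ :* k)) :- con (+ 2) :* ((con (+ 1) :+ con (+ 27) :* t) :* (f′ :* k) :* (f′ :* k)) :+ con (+ 54) :* (t :* (f :* k) :* (f′ :* k)) :+ con (+ 27) :* (t :* (f :* k) :* (f :* k))
          := k :* k :* (con (+ 3) :* ((con (+ 1) :+ con (+ 27) :* t) :* f :* f″) :- con (+ 2) :* ((con (+ 1) :+ con (+ 27) :* t) :* f′ :* f′) :+ con (+ 54) :* (t :* f :* f′) :+ con (+ 27) :* (t :* f :* f))) ≈-refl Xq g (θ g) (θ (θ g)) k)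
      cancel : ∀ f → f ≈ₚ inv k ⊙ inv k ⊙ (k ⊙ k ⊙ f)
      cancel f = exact⇒mod (≈-sym (≈-trans (solve 3 (λ k i f → i :* i :* (k :* k :* f) := k :* i :* (k :* i) :* f) ≈-refl k (inv k) f)
        (≈-trans (*-cong (*-cong kki kki) ≈-refl) (solve 1 (λ f → con (+ 1) :* con (+ 1) :* f := f) ≈-refl f))))

    -- This top coefficient is congruent to the proportionality factor at r = -1, i = p - 1, which
    -- the eigenfunction Ct shows to be χ(p).
    p∤g-last : ¬ (g p′ ≡ + 0 ⟨mod p ⟩)
    p∤g-last h = p∤small 1 (s≤s z≤n) (ℕP.≤-trans (s≤s (s≤s z≤n)) 5≤p) (≡ₘ0⇒∣ (≡ₘ-trans (≡ₘ-reflexive (sym χp²)) (≡ₘ-trans (≡ₘ-* χ≡0 (≡ₘ-refl {a = χ p})) (≡ₘ-reflexive (ℤP.*-zeroˡ (χ p))))))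
      where
      χ≡0 : χ p ≡ + 0 ⟨mod p ⟩
      χ≡0 = ≡ₘ-trans (≡ₘ-sym (≡ₘ-weaken p∣p⁴ u₋₁)) (≡ₘ-trans (u≡β -[1+ 0 ] p′ ℕP.≤-refl) (≡ₘ-trans (≡ₘ-reflexive (sym (below-< β ℕP.≤-refl))) h))

  degree-0 : ∀ f → Vanishes-from 1 f → f ≐ const (f 0)
  degree-0 f vf zero    = refl
  degree-0 f vf (suc k) = vf (suc k) (s≤s z≤n)

  degree-⊙ : ∀ N M f h → Vanishes-from (suc N) f → Vanishes-from (suc M) h → Vanishes-from (suc (N ℕ.+ M)) (f ⊙ h)
  degree-⊙ N M f h vf vh n b = trans (⊙-at f h n) (go N f vf n b)
    where
    go : ∀ N f → Vanishes-from (suc N) f → ∀ n → suc (N ℕ.+ M) ≤ n → mul f h n ≡ + 0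
    go zero f vf n b = trans (mul-cong≐ {f} {const (f 0)} {h} {h} (degree-0 f vf) (λ _ → refl) n) (trans (mul-const (f 0) h n) (trans (cong (f 0 *_) (vh n b)) (ℤP.*-zeroʳ (f 0))))
    go (suc N) f vf (suc n) (s≤s b) = trans (mul-suc f h n) (cong₂ _+_ (trans (cong (f 0 *_) (vh (suc n) (s≤s (ℕP.≤-trans (ℕP.m≤n+m M (suc N)) b)))) (ℤP.*-zeroʳ (f 0)))
      (go N (sh f) (λ k k≥ → vf (suc k) (s≤s k≥)) n b))

  leading-⊙ : ∀ N M f h → Vanishes-from (suc N) f → Vanishes-from (suc M) h → (f ⊙ h) (N ℕ.+ M) ≡ f N * h M
  leading-⊙ N M f h vf vh = trans (⊙-at f h (N ℕ.+ M)) (go N f vf)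
    where
    go : ∀ N f → Vanishes-from (suc N) f → mul f h (N ℕ.+ M) ≡ f N * h M
    go zero f vf = trans (mul-cong≐ {f} {const (f 0)} {h} {h} (degree-0 f vf) (λ _ → refl) M) (mul-const (f 0) h M)
    go (suc N) f vf = trans (mul-suc f h (N ℕ.+ M)) (trans (cong₂ _+_ (trans (cong (f 0 *_) (vh (suc N ℕ.+ M) (s≤s (ℕP.m≤n+m M N)))) (ℤP.*-zeroʳ (f 0)))
      (go N (sh f) (λ k k≥ → vf (suc k) (s≤s k≥)))) (ℤP.+-identityˡ (f (suc N) * h M)))

  mul-linear : ∀ a b l → Vanishes-from 2 a → mul a b (suc l) ≡ a 0 * b (suc l) + a 1 * b l
  mul-linear a b l va = trans (mul-suc a b l) (cong (_+_ (a 0 * b (suc l))) (trans (mul-cong≐ {sh a} {const (a 1)} {b} {b} (degree-0 (sh a) (λ k 1≤k → va (suc k) (s≤s 1≤k))) (λ _ → refl) l) (mul-const (a 1) b l)))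

  -- Lifting the congruence to higher powers of p.

  module Descent (p′ : ℕ) (prime : Prime (suc p′)) (5≤p : 5 ≤ suc p′) where

    open Reduction p′ prime 5≤p public

    1≢0 : ¬ (+ 1 ≡ + 0 ⟨mod p ⟩)
    1≢0 h = p∤small 1 (s≤s z≤n) (ℕP.≤-trans (s≤s (s≤s z≤n)) 5≤p) (≡ₘ0⇒∣ h)

    cancelₘ : ∀ {a b} → ¬ (a ≡ + 0 ⟨mod p ⟩) → a * b ≡ + 0 ⟨mod p ⟩ → b ≡ + 0 ⟨mod p ⟩
    cancelₘ {a} {b} a≢0 h = pick (euclidₘ a b h)
      where
      pick : a ≡ + 0 ⟨mod p ⟩ ⊎ b ≡ + 0 ⟨mod p ⟩ → b ≡ + 0 ⟨mod p ⟩
      pick (inj₁ x) = ⊥-elim (a≢0 x)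
      pick (inj₂ y) = y

    zeroʳₘ : ∀ {N b} a → b ≡ + 0 ⟨mod N ⟩ → a * b ≡ + 0 ⟨mod N ⟩
    zeroʳₘ a h = ≡ₘ-trans (≡ₘ-* (≡ₘ-refl {a = a}) h) (≡ₘ-reflexive (ℤP.*-zeroʳ a))

    -- The inverse is a^(p-2), by Fermat's theorem.
    inverseₘ : ∀ a → ¬ (a ≡ + 0 ⟨mod p ⟩) → Σ ℤ λ b → a * b ≡ + 1 ⟨mod p ⟩
    inverseₘ a a≢0 = go p′ (ℕP.≤-trans (s≤s z≤n) (ℕP.≤-pred 5≤p)) refl
      where
      go : ∀ n → 1 ≤ n → n ≡ p′ → Σ ℤ λ b → a * b ≡ + 1 ⟨mod p ⟩
      go (suc q) _ e = b , ≡ₘ-difference (cancelₘ a≢0 (≡ₘ-trans (≡ₘ-reflexive (t a b)) (difference-≡ₘ (≡ₘ-trans (≡ₘ-reflexive power) (atₚ (fermat a) 0)))))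
        where
        b = pow (K a) q 0
        t : ∀ a b → a * (a * b - + 1) ≡ a * (a * b) - a
        t = solve-∀
        power : a * (a * b) ≡ pow (K a) p 0
        power = trans (cong (a *_) (sym (mul-zero (K a) (pow (K a) q)))) (trans (sym (mul-zero (K a) (pow (K a) (suc q)))) (cong (λ n → pow (K a) (suc n) 0) e))

    s : Series
    s = g ⊙ g

    g-degree : Vanishes-from p g
    g-degree n p≤n = below-≥ β p≤n

    s-degree : Vanishes-from (suc (p′ ℕ.+ p′)) s
    s-degree = degree-⊙ p′ p′ g g g-degree g-degree

    g-0 : g 0 ≡ + 1
    g-0 = trans (below-< {p} β (s≤s z≤n)) (trans (ℰ-0 Bₛ) B-0)

    s-0 : s 0 ≡ + 1
    s-0 = trans (⊙-0 g g) (cong₂ _*_ g-0 g-0)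

    -- For ε₁ ≢ 0 these relations make g² = P (1 + ν tᵖ) with P of degree < p.
    s-block : ∀ ε l i → i < p → (s ⊙ V ε) (i ℕ.+ suc l ℕ.* p) ≡ s (i ℕ.+ 0) * ε (suc l) + s (i ℕ.+ 1 ℕ.* p) * ε l
    s-block ε l i i<p = trans (⊙-at s (V ε) (i ℕ.+ suc l ℕ.* p)) (trans (pairing s ε (suc l) i i<p) (mul-linear (U i s) ε l
      (λ k 2≤k → s-degree (i ℕ.+ k ℕ.* p) (ℕP.≤-trans (ℕP.≤-trans (ℕP.+-mono-≤ {1} {1} (s≤s z≤n) (ℕP.+-monoʳ-≤ p′ (ℕP.n≤1+n p′))) (ℕP.≤-reflexive (cong (λ z → p ℕ.+ z) (sym (ℕP.+-identityʳ p))))) (ℕP.≤-trans (ℕP.*-monoˡ-≤ p 2≤k) (ℕP.m≤n+m (k ℕ.* p) i))))))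

    -- The bound p′ + p = 2p - 1 is one more than the degree of g². In each block of p coefficients,
    -- two consecutive values of ε multiply the lower and the upper half of g², so the vanishing
    -- from 2p on is a linear recurrence for ε.
    module Rigidity (ε : Series) (ε-0 : ε 0 ≡ + 0) (high : ∀ n → p′ ℕ.+ p ≤ n → (s ⊙ V ε) n ≡ + 0 ⟨mod p ⟩) where

      relation : ∀ l i → i < p → s i * ε (2 ℕ.+ l) + s (i ℕ.+ 1 ℕ.* p) * ε (suc l) ≡ + 0 ⟨mod p ⟩
      relation l i i<p = ≡ₘ-trans (≡ₘ-reflexive (trans (cong (λ z → s z * ε (2 ℕ.+ l) + s (i ℕ.+ 1 ℕ.* p) * ε (suc l)) (sym (ℕP.+-identityʳ i))) (sym (s-block ε (suc l) i i<p))))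
        (high (i ℕ.+ (2 ℕ.+ l) ℕ.* p) (ℕP.≤-trans (ℕP.≤-trans (ℕP.+-mono-≤ (ℕP.n≤1+n p′) (ℕP.m≤m+n p (l ℕ.* p))) ℕP.≤-refl) (ℕP.m≤n+m ((2 ℕ.+ l) ℕ.* p) i)))

      ν : ℤ
      ν = s (1 ℕ.* p)

      ε-step : ∀ l → ε (2 ℕ.+ l) ≡ - (ν * ε (suc l)) ⟨mod p ⟩
      ε-step l = ≡ₘ-trans (≡ₘ-reflexive (trans (t (ε (2 ℕ.+ l)) (ν * ε (suc l))) (cong (λ z → z * ε (2 ℕ.+ l) + ν * ε (suc l) + - (ν * ε (suc l))) (sym s-0))))
        (≡ₘ-trans (≡ₘ-+ (relation l 0 (s≤s z≤n)) (≡ₘ-refl {a = - (ν * ε (suc l))})) (≡ₘ-reflexive (ℤP.+-identityˡ (- (ν * ε (suc l))))))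
        where
        t : ∀ x y → x ≡ + 1 * x + y + - y
        t = solve-∀

      propagate : ε 1 ≡ + 0 ⟨mod p ⟩ → ∀ l → ε l ≡ + 0 ⟨mod p ⟩
      propagate h zero          = ≡ₘ-reflexive ε-0
      propagate h (suc zero)    = h
      propagate h (suc (suc l)) = ≡ₘ-trans (ε-step l) (≡ₘ-neg (zeroʳₘ ν (propagate h (suc l))))

      module _ (ε₁≢0 : ¬ (ε 1 ≡ + 0 ⟨mod p ⟩)) where

        periodic : ∀ i → i < p → s (i ℕ.+ 1 ℕ.* p) ≡ s i * ν ⟨mod p ⟩
        periodic i i<p = ≡ₘ-difference (cancelₘ ε₁≢0 (≡ₘ-trans (≡ₘ-reflexive (t (ε 1) (s (i ℕ.+ 1 ℕ.* p)) (s i) ν (ε 2)))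
          (≡ₘ-+ (relation 0 i i<p) (≡ₘ-neg (zeroʳₘ (s i) (≡ₘ-trans (≡ₘ-+ (ε-step 0) (≡ₘ-refl {a = ν * ε 1})) (≡ₘ-reflexive (ℤP.+-inverseˡ (ν * ε 1)))))))))
          where
          t : ∀ e a b n e₂ → e * (a - b * n) ≡ (b * e₂ + a * e) + - (b * (e₂ + n * e))
          t = solve-∀

        -- The leading coefficient of g² is g_(p-1)², a unit. It sits at 2p - 2 = (p - 2) + p, so
        -- periodicity makes it ν times another coefficient.
        ν≢0 : ¬ (ν ≡ + 0 ⟨mod p ⟩)
        ν≢0 h = p∤g-last (cancelₘ p∤g-last (≡ₘ-trans (≡ₘ-reflexive (trans (sym (leading-⊙ p′ p′ g g g-degree g-degree)) (cong s (sym (index p′ (ℕP.≤-trans (s≤s z≤n) (ℕP.≤-pred 5≤p)))))))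
            (≡ₘ-trans (periodic (p′ ∸ 1) (s≤s (ℕP.m∸n≤m p′ 1))) (zeroʳₘ (s (p′ ∸ 1)) h))))
          where
          index : ∀ x → 1 ≤ x → x ∸ 1 ℕ.+ (suc x ℕ.+ 0) ≡ x ℕ.+ x
          index (suc y) _ = trans (ℕP.+-suc y (suc y ℕ.+ 0)) (cong (λ z → suc (y ℕ.+ z)) (ℕP.+-identityʳ (suc y)))

        factor : Series
        factor zero          = + 1
        factor (suc zero)    = ν
        factor (suc (suc _)) = + 0

        V-factor : V factor ≈ K (+ 1) ⊕ K ν ⊙ mon p
        V-factor = ≈-trans (pw λ n → trans (V-rec factor n) (sym (trans (⊕-at (K (+ 1)) (mon p ⊙ V (sh factor)) n) (cong (_+_ (K (+ 1) n)) (⊙-at (mon p) (V (sh factor)) n)))))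
          (+-cong ≈-refl (≈-trans (*-cong ≈-refl (≈-trans (V-cong≈ (pw λ { zero → refl ; (suc n) → refl })) (V-K ν))) (solve 2 (λ m n → m :* n := n :* m) ≈-refl (mon p) (K ν))))

        s-factor : s ≈ₚ below p s ⊙ (K (+ 1) ⊕ K ν ⊙ mon p)
        s-factor = transₚ (pwₚ (by-digits (λ n → s n ≡ (below p s ⊙ V factor) n ⟨mod p ⟩) λ l i i<p → ≡ₘ-trans (digits l i i<p) (≡ₘ-reflexive (sym (below-V s factor l i i<p)))))
            (*-congₚ reflₚ (exact⇒mod V-factor))
          where
          digits : ∀ l i → i < p → s (i ℕ.+ l ℕ.* p) ≡ s i * factor l ⟨mod p ⟩
          digits zero i i<p = ≡ₘ-reflexive (trans (cong s (ℕP.+-identityʳ i)) (sym (ℤP.*-identityʳ (s i))))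
          digits (suc zero) i i<p = periodic i i<p
          digits (suc (suc l)) i i<p = ≡ₘ-reflexive (trans (s-degree (i ℕ.+ (2 ℕ.+ l) ℕ.* p) (ℕP.≤-trans (s≤s (ℕP.+-monoʳ-≤ p′ (ℕP.≤-trans (ℕP.n≤1+n p′) (ℕP.m≤m+n p (l ℕ.* p))))) (ℕP.m≤n+m ((2 ℕ.+ l) ℕ.* p) i))) (sym (ℤP.*-zeroʳ (s i))))

        impossible : ¬ (7 ≤ p)
        impossible 7≤p = use (inverseₘ ν ν≢0)
          where
          use : ¬ (Σ ℤ λ μ → ν * μ ≡ + 1 ⟨mod p ⟩)
          use (μ , νμ≡1) = Substitution.no-square p′ prime μ 7≤p (λ p∣μ → 1≢0 (≡ₘ-trans (≡ₘ-sym νμ≡1) (zeroʳₘ ν (∣⇒≡ₘ0 p∣μ)))) ν νμ≡1 g (below p s) g-degree (λ n b → below-≥ s b)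
            p∤g-last quadratic-g s-factor

      vanishes : 7 ≤ p ⊎ ε 1 ≡ + 0 ⟨mod p ⟩ → ∀ l → ε l ≡ + 0 ⟨mod p ⟩
      vanishes (inj₂ h)   = propagate h
      vanishes (inj₁ 7≤p) = decide (≡ₘ0? p (ε 1))
        where
        decide : Dec (ε 1 ≡ + 0 ⟨mod p ⟩) → ∀ l → ε l ≡ + 0 ⟨mod p ⟩
        decide (yes h)    = propagate h
        decide (no ε₁≢0) = ⊥-elim (impossible ε₁≢0 7≤p)

    V-⊕ : ∀ f h → V (f ⊕ h) ≈ V f ⊕ V h
    V-⊕ f h = pw (by-digits (λ n → V (f ⊕ h) n ≡ (V f ⊕ V h) n) λ
      { l zero _    → trans (V-multiple (f ⊕ h) l) (trans (⊕-at f h l) (sym (trans (⊕-at (V f) (V h) (l ℕ.* p)) (cong₂ _+_ (V-multiple f l) (V-multiple h l)))))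
      ; l (suc i) b → trans (V-other (f ⊕ h) l i b) (sym (trans (⊕-at (V f) (V h) (suc i ℕ.+ l ℕ.* p)) (cong₂ _+_ (V-other f l i b) (V-other h l i b)))) })

    -- The block l = 0 of the expansion of M_j modulo p⁴, where `D′` is exactly 1.
    κ : ℤ → Series
    κ j = below p (u j)

    κ≈g : ∀ j → κ j ≈ₚ g
    κ≈g j = pwₚ λ n → case n (ℕP.<-≤-connex n p)
      where
      case : ∀ n → n < p ⊎ p ≤ n → κ j n ≡ g n ⟨mod p ⟩
      case n (inj₁ n<p) = ≡ₘ-trans (≡ₘ-reflexive (below-< (u j) n<p)) (≡ₘ-trans (u≡β j n n<p) (≡ₘ-reflexive (sym (below-< β n<p))))
      case n (inj₂ p≤n) = ≡ₘ-reflexive (trans (below-≥ (u j) p≤n) (sym (below-≥ β p≤n)))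

    κ-square-defect : ℤ → Series
    κ-square-defect j = κ j ⊙ κ j ⊖ κ (+ 1 + j) ⊙ κ (- + 1 + j)

    defect-degree : ∀ j → Vanishes-from (suc (p′ ℕ.+ p′)) (κ-square-defect j)
    defect-degree j n b = trans (⊖-at (κ j ⊙ κ j) (κ (+ 1 + j) ⊙ κ (- + 1 + j)) n) (cong₂ _-_ (product j j) (product (+ 1 + j) (- + 1 + j)))
      where
      product : ∀ i j → (κ i ⊙ κ j) n ≡ + 0
      product i j = degree-⊙ p′ p′ (κ i) (κ j) (λ _ → below-≥ (u i)) (λ _ → below-≥ (u j)) n b

    -- The only obstruction left for p = 5 is the coefficient of t⁵.
    Small-prime-condition : Set
    Small-prime-condition = 7 ≤ p ⊎ (∀ j → κ-square-defect j p ≡ + 0 ⟨mod p⁴ ⟩)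

    D′-0 : ∀ r → D′ r 0 ≡ + 1
    D′-0 r = trans (mul-zero (Y r 0) (τ^ (r - + 0) ⊙ Bi)) (cong₂ _*_ (u-0 r) (trans (⊙-0 (τ^ (r - + 0)) Bi) (cong (_* Bi 0) (τ^-0 (r - + 0)))))

    -- One step from N = p^a to Np, taken for a = 1, 2, 3. As p divides N, the terms with N²
    -- disappear modulo Np.
    module Lift (condition : Small-prime-condition) (N : ℕ) .{{_ : ℕ.NonZero N}} (p∣N : p ∣ₙ N) (Np∣p⁴ : N ℕ.* p ∣ₙ p⁴)
      (D≡1 : ∀ r l → D′ r l ≡ K (+ 1) l ⟨mod N ⟩) where

      Q : ℕ
      Q = N ℕ.* p

      private
        module Q = Mod Q
        module SQ = Mod.Solver Q
        open Q using () renaming (_≈_ to _≈Q_; ≈-trans to transQ; ≈-refl to reflQ; ≈-sym to symQ; +-cong to +-congQ; *-cong to *-congQ; -‿cong to neg-congQ; setoid to setoidQ)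

      -- The error of `D′` divided by N. The value 0 at l = 0 agrees with `D′ r 0` = 1 and lets ε
      -- begin in degree 1.
      dd : ℤ → ℕ → ℤ
      dd r zero    = + 0
      dd r (suc l) = Div._∣_.quotient (divides-difference (D≡1 r (suc l)))

      D′≡ : ∀ r l → D′ r l ≡ K (+ 1) l + + N * dd r l
      D′≡ r zero    = trans (D′-0 r) (cong (_+_ (+ 1)) (sym (ℤP.*-zeroʳ (+ N))))
      D′≡ r (suc l) = trans (sym (ℤP.+-identityʳ (D′ r (suc l)))) (trans (Div._∣_.equality (divides-difference (D≡1 r (suc l)))) (trans (ℤP.*-comm (dd r (suc l)) (+ N)) (sym (ℤP.+-identityˡ (+ N * dd r (suc l))))))

      -- Reindexed by r = j + l, since the block l of M_j involves `D′` at r = j + l.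
      d : ℤ → Series
      d j l = dd (j + + l) l

      -- For l ≥ 1 the block already carries the factor N, so its coefficients u may be replaced
      -- modulo p by those of B. In the block l = 0 they are kept modulo Np, and this is `κ j`.
      ℰM≈ : ∀ j → ℰ (M j) ≈Q κ j ⊕ K (+ N) ⊙ (g ⊙ V (d j))
      ℰM≈ j = Q.pw (by-digits (λ n → ℰ (M j) n ≡ (κ j ⊕ K (+ N) ⊙ (g ⊙ V (d j))) n ⟨mod Q ⟩) λ l i i<p →
        ≡ₘ-trans (≡ₘ-weaken Np∣p⁴ (ℰM-block j l i i<p)) (≡ₘ-trans (≡ₘ-reflexive (cong (u (j + + l) i *_) (D′≡ (j + + l) l))) (≡ₘ-trans (digits l i i<p) (≡ₘ-reflexive (sym (target l i i<p))))))
        where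
        target : ∀ l i → i < p → (κ j ⊕ K (+ N) ⊙ (g ⊙ V (d j))) (i ℕ.+ l ℕ.* p) ≡ K (u j i) l + + N * (β i * d j l)
        target l i i<p = trans (⊕-at (κ j) (K (+ N) ⊙ (g ⊙ V (d j))) (i ℕ.+ l ℕ.* p)) (cong₂ _+_ (below-block (u j) l i i<p)
          (trans (at (K⊙ (+ N) (g ⊙ V (d j))) (i ℕ.+ l ℕ.* p)) (cong (+ N *_) (below-V β (d j) l i i<p))))
        digits : ∀ l i → i < p → u (j + + l) i * (K (+ 1) l + + N * d j l) ≡ K (u j i) l + + N * (β i * d j l) ⟨mod Q ⟩
        digits zero i i<p = ≡ₘ-reflexive (trans (cong (λ z → u z i * (+ 1 + + N * + 0)) (ℤP.+-identityʳ j)) (t (u j i) (+ N) (β i)))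
          where
          t : ∀ u n b → u * (+ 1 + n * + 0) ≡ u + n * (b * + 0)
          t = solve-∀
        digits (suc l) i i<p = ≡ₘ-trans (≡ₘ-reflexive (t (u (j + + suc l) i) (+ N) x)) (≡ₘ-trans (≡ₘ-scale {N} {p} (≡ₘ-* (u≡β (j + + suc l) i i<p) (≡ₘ-refl {a = x}))) (≡ₘ-reflexive (sym (ℤP.+-identityˡ (+ N * (β i * x))))))
          where
          x = d j (suc l)
          t : ∀ u n x → u * (+ 0 + n * x) ≡ n * (u * x)
          t = solve-∀

      ε : ℤ → Series
      ε j = d (+ 1 + j) ⊕ d (- + 1 + j) ⊖ K (+ 2) ⊙ d j

      ε-at : ∀ j l → ε j l ≡ d (+ 1 + j) l + d (- + 1 + j) l - + 2 * d j l
      ε-at j l = trans (⊖-at (d (+ 1 + j) ⊕ d (- + 1 + j)) (K (+ 2) ⊙ d j) l) (cong₂ _-_ (⊕-at (d (+ 1 + j)) (d (- + 1 + j)) l) (at (K⊙ (+ 2) (d j)) l))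

      V-ε : ∀ j → V (ε j) ≈ V (d (+ 1 + j)) ⊕ V (d (- + 1 + j)) ⊖ K (+ 2) ⊙ V (d j)
      V-ε j = ≈-trans (V-cong≈ (solve 3 (λ a b c → a :+ b :- con (+ 2) :* c := a :+ b :+ con (- + 2) :* c) ≈-refl (d (+ 1 + j)) (d (- + 1 + j)) (d j)))
        (≈-trans (V-⊕ (d (+ 1 + j) ⊕ d (- + 1 + j)) (K (- + 2) ⊙ d j)) (≈-trans (+-cong (V-⊕ (d (+ 1 + j)) (d (- + 1 + j))) (≈-trans (V-⊙ (K (- + 2)) (d j)) (*-cong (V-K (- + 2)) ≈-refl)))
          (solve 3 (λ a b c → a :+ b :+ con (- + 2) :* c := a :+ b :- con (+ 2) :* c) ≈-refl (V (d (+ 1 + j))) (V (d (- + 1 + j))) (V (d j)))))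

      N-scale : ∀ {f h} → f ≈ₚ h → K (+ N) ⊙ f ≈Q K (+ N) ⊙ h
      N-scale {f} {h} e = Q.pw λ n → ≡ₘ-trans (≡ₘ-reflexive (at (K⊙ (+ N) f) n)) (≡ₘ-trans (≡ₘ-scale {N} {p} (atₚ e n)) (≡ₘ-reflexive (sym (at (K⊙ (+ N) h) n))))

      N² : K (+ N) ⊙ K (+ N) ≈Q K (+ 0)
      N² = transQ (N-scale (K-mod (∣⇒≡ₘ0 (∣ᵤ⇒∣ p∣N)))) (SQ.solve 1 (λ n → n SQ.:* SQ.con (+ 0) SQ.:= SQ.con (+ 0)) reflQ (K (+ N)))

      -- The relation M_(j+1) M_(j-1) = M_j² is expanded to first order in N. In the cross terms
      -- each κ may be replaced by g, which gathers them into g² times the second difference.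
      defect : ∀ j → κ-square-defect j ≈Q K (+ N) ⊙ (s ⊙ V (ε j))
      defect j = transQ (rearrange (κ j) κ₊ κ₋ G G₊ G₋) (transQ (+-congQ (+-congQ reflQ squares) (*-congQ N² reflQ)) (transQ (SQ.solve 2 (λ a b → a SQ.:+ SQ.con (+ 0) SQ.:+ SQ.con (+ 0) SQ.:* b SQ.:= a) reflQ (K (+ N) ⊙ cross (κ j) κ₊ κ₋) (G₊ ⊙ G₋ ⊖ G ⊙ G))
          (transQ (N-scale (cross-cong)) (Mod.≈-sym Q (transQ (*-congQ reflQ (*-congQ reflQ (exact⇒mod (V-ε j)))) (SQ.solve 5 (λ n g a b c → n SQ.:* (g SQ.:* g SQ.:* (a SQ.:+ b SQ.:- SQ.con (+ 2) SQ.:* c)) SQ.:= n SQ.:* (g SQ.:* (g SQ.:* b) SQ.:+ g SQ.:* (g SQ.:* a) SQ.:- SQ.con (+ 2) SQ.:* (g SQ.:* (g SQ.:* c))))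
            reflQ (K (+ N)) g (V (d (+ 1 + j))) (V (d (- + 1 + j))) (V (d j))))))))
        where
        κ₊ = κ (+ 1 + j)
        κ₋ = κ (- + 1 + j)
        G = g ⊙ V (d j)
        G₊ = g ⊙ V (d (+ 1 + j))
        G₋ = g ⊙ V (d (- + 1 + j))
        cross : Series → Series → Series → Series
        cross k k₊ k₋ = k₊ ⊙ G₋ ⊕ k₋ ⊙ G₊ ⊖ K (+ 2) ⊙ (k ⊙ G)
        cross-cong : cross (κ j) κ₊ κ₋ ≈ₚ cross g g g
        cross-cong = +-congₚ (+-congₚ (*-congₚ (κ≈g (+ 1 + j)) reflₚ) (*-congₚ (κ≈g (- + 1 + j)) reflₚ)) (neg-congₚ (*-congₚ reflₚ (*-congₚ (κ≈g j) reflₚ)))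
        n = K (+ N)
        X = κ j ⊕ n ⊙ G
        X₊ = κ₊ ⊕ n ⊙ G₊
        X₋ = κ₋ ⊕ n ⊙ G₋
        squares : X ⊙ X ⊖ X₊ ⊙ X₋ ≈Q K (+ 0)
        squares = transQ (+-congQ (*-congQ (symQ (ℰM≈ j)) (symQ (ℰM≈ j))) (neg-congQ (*-congQ (symQ (ℰM≈ (+ 1 + j))) (symQ (ℰM≈ (- + 1 + j))))))
          (exact⇒mod (≈-trans (+-cong (≈-sym (ℰ-* (M j) (M j))) (-‿cong (≈-trans (≈-sym (ℰ-* (M (+ 1 + j)) (M (- + 1 + j)))) (ℰ-cong (M-square j))))) (solve 1 (λ a → a :- a := con (+ 0)) ≈-refl (ℰ (M j ⊙ M j)))))
        rearrange : ∀ k k₊ k₋ G G₊ G₋ → k ⊙ k ⊖ k₊ ⊙ k₋ ≈Q n ⊙ (k₊ ⊙ G₋ ⊕ k₋ ⊙ G₊ ⊖ K (+ 2) ⊙ (k ⊙ G)) ⊕ ((k ⊕ n ⊙ G) ⊙ (k ⊕ n ⊙ G) ⊖ (k₊ ⊕ n ⊙ G₊) ⊙ (k₋ ⊕ n ⊙ G₋)) ⊕ n ⊙ n ⊙ (G₊ ⊙ G₋ ⊖ G ⊙ G)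
        rearrange k k₊ k₋ G G₊ G₋ = exact⇒mod (solve 7 (λ n k k₊ k₋ G G₊ G₋ → k :* k :- k₊ :* k₋ := n :* (k₊ :* G₋ :+ k₋ :* G₊ :- con (+ 2) :* (k :* G)) :+ ((k :+ n :* G) :* (k :+ n :* G) :- (k₊ :+ n :* G₊) :* (k₋ :+ n :* G₋)) :+ n :* n :* (G₊ :* G₋ :- G :* G))
          ≈-refl n k k₊ k₋ G G₊ G₋)

      unscale : ∀ {x} → + N * x ≡ + 0 ⟨mod Q ⟩ → x ≡ + 0 ⟨mod p ⟩
      unscale {x} h = ≡ₘ-unscale {N} {p} (≡ₘ-trans h (≡ₘ-reflexive (sym (ℤP.*-zeroʳ (+ N)))))

      defect-at : ∀ j n → κ-square-defect j n ≡ + 0 ⟨mod p⁴ ⟩ → (s ⊙ V (ε j)) n ≡ + 0 ⟨mod p ⟩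
      defect-at j n h = unscale (≡ₘ-trans (≡ₘ-reflexive (sym (at (K⊙ (+ N) (s ⊙ V (ε j))) n))) (≡ₘ-trans (≡ₘ-sym (Q.at (defect j) n)) (≡ₘ-weaken Np∣p⁴ h)))

      ε-0 : ∀ j → ε j 0 ≡ + 0
      ε-0 j = ε-at j 0

      ε≡0 : ∀ j l → ε j l ≡ + 0 ⟨mod p ⟩
      ε≡0 j = Rigidity.vanishes (ε j) (ε-0 j) (λ n b → defect-at j n (≡ₘ-reflexive (defect-degree j n (ℕP.≤-trans (ℕP.≤-reflexive (sym (ℕP.+-suc p′ p′))) b)))) (first condition)
        where
        first : Small-prime-condition → 7 ≤ p ⊎ ε j 1 ≡ + 0 ⟨mod p ⟩
        first (inj₁ 7≤p) = inj₁ 7≤p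
        -- In degree p the coefficient of g² V(ε) is s₀ε₁ + s_p ε₀ = ε₁.
        first (inj₂ h)   = inj₂ (≡ₘ-trans (≡ₘ-reflexive (sym (trans (cong (s ⊙ V (ε j)) (sym (ℕP.*-identityˡ p))) (trans (s-block (ε j) 0 0 (s≤s z≤n)) (trans (cong₂ (λ a b → a * ε j 1 + s (1 ℕ.* p) * b) s-0 (ε-0 j)) (t (ε j 1) (s (1 ℕ.* p)))))))) (defect-at j p (h j)))
          where
          t : ∀ x y → + 1 * x + y * + 0 ≡ x
          t = solve-∀

      -- With j = r - l, the shift by l built into `d` turns the second difference in j into one in
      -- r at a fixed l.
      second-difference : ∀ l r → dd (+ 1 + r) l + dd (- + 1 + r) l - + 2 * dd r l ≡ + 0 ⟨mod p ⟩
      second-difference l r = ≡ₘ-trans (≡ₘ-reflexive (sym (trans (ε-at (r - + l) l) (trans (cong₂ (λ a b → dd a l + dd b l - + 2 * d (r - + l) l) (t₁ r (+ l)) (t₂ r (+ l))) (cong (λ z → dd (+ 1 + r) l + dd (- + 1 + r) l - + 2 * dd z l) (t₀ r (+ l))))))) (ε≡0 (r - + l) l)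
        where
        t₀ : ∀ r l → r - l + l ≡ r
        t₀ = solve-∀
        t₁ : ∀ r l → + 1 + (r - l) + l ≡ + 1 + r
        t₁ = solve-∀
        t₂ : ∀ r l → - + 1 + (r - l) + l ≡ - + 1 + r
        t₂ = solve-∀

      known : ∀ r → (∀ n → Y r 0 n ≡ (C ⊙ τ^ (- r)) n ⟨mod p⁴ ⟩) → ∀ l → dd r l ≡ + 0 ⟨mod p ⟩
      known r h l = unscale (≡ₘ-trans (≡ₘ-reflexive (trans (t (K (+ 1) l) (+ N * dd r l)) (cong (_- K (+ 1) l) (sym (D′≡ r l))))) (difference-≡ₘ (≡ₘ-weaken Np∣p⁴ (Y≈⇒D r h l))))
        where
        t : ∀ k x → x ≡ k + x - k
        t = solve-∀

      -- A sequence with vanishing second differences and two consecutive zeros is zero.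
      dd≡0 : ∀ r l → dd r l ≡ + 0 ⟨mod p ⟩
      dd≡0 r l = proj₁ (ℤ-induction (λ r → dd r l ≡ + 0 ⟨mod p ⟩ × dd (- + 1 + r) l ≡ + 0 ⟨mod p ⟩)
        (known (+ 0) Y₀ l , known -[1+ 0 ] Y₋₁ l)
        (λ r (h₀ , h₋) → ≡ₘ-trans (≡ₘ-reflexive (t₁ (dd (+ 1 + r) l) (dd (- + 1 + r) l) (dd r l))) (≡ₘ-+ (≡ₘ-+ (second-difference l r) (zeroʳₘ (+ 2) h₀)) (≡ₘ-neg h₋)) , ≡ₘ-trans (index r) h₀)
        (λ r (h₊ , h₀) → ≡ₘ-trans (≡ₘ-sym (index r)) h₀ , ≡ₘ-trans (≡ₘ-reflexive (t₁′ (dd (+ 1 + r) l) (dd (- + 1 + r) l) (dd r l))) (≡ₘ-+ (≡ₘ-+ (second-difference l r) (zeroʳₘ (+ 2) (≡ₘ-trans (≡ₘ-sym (index r)) h₀))) (≡ₘ-neg h₊)))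
        r)
        where
        t₁ : ∀ a b c → a ≡ a + b - + 2 * c + + 2 * c + - b
        t₁ = solve-∀
        t₁′ : ∀ a b c → b ≡ a + b - + 2 * c + + 2 * c + - a
        t₁′ = solve-∀
        index : ∀ r → dd (- + 1 + (+ 1 + r)) l ≡ dd r l ⟨mod p ⟩
        index r = ≡ₘ-reflexive (cong (λ z → dd z l) (t r))
          where
          t : ∀ r → - + 1 + (+ 1 + r) ≡ r
          t = solve-∀

      D≡1-lifted : ∀ r l → D′ r l ≡ K (+ 1) l ⟨mod N ℕ.* p ⟩
      D≡1-lifted r l = ≡ₘ-trans (≡ₘ-reflexive (D′≡ r l)) (≡ₘ-trans (≡ₘ-+ (≡ₘ-refl {a = K (+ 1) l}) (≡ₘ-trans (≡ₘ-scale {N} {p} (dd≡0 r l)) (≡ₘ-reflexive (ℤP.*-zeroʳ (+ N))))) (≡ₘ-reflexive (ℤP.+-identityʳ (K (+ 1) l))))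

    Y≡Cτ : Small-prime-condition → ∀ r n → Y r 0 n ≡ (C ⊙ τ^ (- r)) n ⟨mod p⁴ ⟩
    Y≡Cτ condition r = D⇒Y≈ r λ l → subst (λ N → D′ r l ≡ K (+ 1) l ⟨mod N ⟩) p⁴≡ (D₄ r l)
      where
      p⁴≡ : p ℕ.* p ℕ.* p ℕ.* p ≡ p⁴
      p⁴≡ = trans (ℕP.*-assoc (p ℕ.* p) p p) (trans (ℕP.*-assoc p p (p ℕ.* p)) (cong (λ z → p ℕ.* (p ℕ.* (p ℕ.* z))) (sym (ℕP.*-identityʳ p))))
      ∣p⁴ : ∀ {N} → N ∣ₙ p ℕ.* p ℕ.* p ℕ.* p → N ∣ₙ p⁴
      ∣p⁴ {N} = subst (N ∣ₙ_) p⁴≡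
      D₂ = Lift.D≡1-lifted condition p (ℕD.∣-refl) (∣p⁴ (ℕD.∣m⇒∣m*n p (ℕD.m∣m*n p))) D-base
      D₃ = Lift.D≡1-lifted condition (p ℕ.* p) (ℕD.m∣m*n p) (∣p⁴ (ℕD.m∣m*n p)) D₂
      D₄ = Lift.D≡1-lifted condition (p ℕ.* p ℕ.* p) (ℕD.∣m⇒∣m*n p (ℕD.m∣m*n p)) (∣p⁴ ℕD.∣-refl) D₃

-- Univariate polynomials as coefficient lists; closed computations decide identities between them.

eval : List ℤ → ℤ → ℤ
eval []      x = + 0
eval (c ∷ l) x = c + x * eval l x

scaleᴾ : ℤ → List ℤ → List ℤ
scaleᴾ c = map (c *_)

infixl 6 _+ᴾ_
infixl 7 _*ᴾ_
_+ᴾ_ _*ᴾ_ : List ℤ → List ℤ → List ℤ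
[]      +ᴾ m       = m
(c ∷ l) +ᴾ []      = c ∷ l
(c ∷ l) +ᴾ (d ∷ m) = (c + d) ∷ (l +ᴾ m)
[]      *ᴾ m = []
(c ∷ l) *ᴾ m = scaleᴾ c m +ᴾ (+ 0 ∷ (l *ᴾ m))

shiftᴾ : ℤ → List ℤ → List ℤ
shiftᴾ s []      = []
shiftᴾ s (c ∷ l) = (c ∷ []) +ᴾ (s ∷ + 1 ∷ []) *ᴾ shiftᴾ s l

eval-scale : ∀ c l x → eval (scaleᴾ c l) x ≡ c * eval l x
eval-scale c []      x = sym (ℤP.*-zeroʳ c)
eval-scale c (d ∷ l) x = trans (cong (λ z → c * d + x * z) (eval-scale c l x)) (t c d x (eval l x))
  where
  t : ∀ c d x y → c * d + x * (c * y) ≡ c * (d + x * y)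
  t = solve-∀

eval-+ : ∀ l m x → eval (l +ᴾ m) x ≡ eval l x + eval m x
eval-+ []      m       x = sym (ℤP.+-identityˡ (eval m x))
eval-+ (c ∷ l) []      x = sym (ℤP.+-identityʳ (c + x * eval l x))
eval-+ (c ∷ l) (d ∷ m) x = trans (cong (λ z → c + d + x * z) (eval-+ l m x)) (t c d x (eval l x) (eval m x))
  where
  t : ∀ c d x y z → c + d + x * (y + z) ≡ c + x * y + (d + x * z)
  t = solve-∀

eval-* : ∀ l m x → eval (l *ᴾ m) x ≡ eval l x * eval m x
eval-* []      m x = sym (ℤP.*-zeroˡ (eval m x))
eval-* (c ∷ l) m x = trans (eval-+ (scaleᴾ c m) (+ 0 ∷ (l *ᴾ m)) x) (trans (cong₂ (λ y z → y + (+ 0 + x * z)) (eval-scale c m x) (eval-* l m x)) (t c x (eval l x) (eval m x)))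
  where
  t : ∀ c x y z → c * z + (+ 0 + x * (y * z)) ≡ (c + x * y) * z
  t = solve-∀

eval-shift : ∀ s l x → eval (shiftᴾ s l) x ≡ eval l (s + x)
eval-shift s []      x = refl
eval-shift s (c ∷ l) x = trans (eval-+ (c ∷ []) ((s ∷ + 1 ∷ []) *ᴾ shiftᴾ s l) x) (trans (cong (_+_ (c + x * + 0)) (trans (eval-* (s ∷ + 1 ∷ []) (shiftᴾ s l) x) (cong (eval (s ∷ + 1 ∷ []) x *_) (eval-shift s l x)))) (t c s x (eval l (s + x))))
  where
  t : ∀ c s x y → c + x * + 0 + (s + x * (+ 1 + x * + 0)) * y ≡ c + (s + x) * y
  t = solve-∀

infixl 6 _∔_
infixl 7 _∙_
data Poly : Set where
  cst     : ℤ → Poly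
  var     : Poly
  shifted : ℤ → List ℤ → Poly
  _∔_ _∙_ : Poly → Poly → Poly

⟦_⟧ : Poly → ℤ → ℤ
⟦ cst c ⟧       x = c
⟦ var ⟧         x = x
⟦ shifted s l ⟧ x = eval l (s + x)
⟦ P ∔ Q ⟧       x = ⟦ P ⟧ x + ⟦ Q ⟧ x
⟦ P ∙ Q ⟧       x = ⟦ P ⟧ x * ⟦ Q ⟧ x

coefficients : Poly → List ℤ
coefficients (cst c)       = c ∷ []
coefficients var           = + 0 ∷ + 1 ∷ []
coefficients (shifted s l) = shiftᴾ s l
coefficients (P ∔ Q)       = coefficients P +ᴾ coefficients Q
coefficients (P ∙ Q)       = coefficients P *ᴾ coefficients Q

eval-coefficients : ∀ P x → eval (coefficients P) x ≡ ⟦ P ⟧ x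
eval-coefficients (cst c)       x = trans (cong (_+_ c) (ℤP.*-zeroʳ x)) (ℤP.+-identityʳ c)
eval-coefficients var           x = t x
  where
  t : ∀ x → + 0 + x * (+ 1 + x * + 0) ≡ x
  t = solve-∀
eval-coefficients (shifted s l) x = eval-shift s l x
eval-coefficients (P ∔ Q)       x = trans (eval-+ (coefficients P) (coefficients Q) x) (cong₂ _+_ (eval-coefficients P x) (eval-coefficients Q x))
eval-coefficients (P ∙ Q)       x = trans (eval-* (coefficients P) (coefficients Q) x) (cong₂ _*_ (eval-coefficients P x) (eval-coefficients Q x))

-- The hypothesis is an equation of closed lists, settled by `refl` at each use: dividing the
-- coefficients by N and multiplying back recovers them.
all-multiples : ∀ N .{{_ : ℕ.NonZero N}} P → coefficients P ≡ scaleᴾ (+ N) (map (ℤ._/ℕ N) (coefficients P)) → ∀ x → ⟦ P ⟧ x ≡ + 0 ⟨mod N ⟩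
all-multiples N P h x = ≡ₘ-trans (≡ₘ-reflexive (trans (sym (eval-coefficients P x)) (trans (cong (λ l → eval l x) h) (eval-scale (+ N) (map (ℤ._/ℕ N) (coefficients P)) x)))) (multiple≡0 {N} _)

-- For p = 5 the numbers u_{j,i} are cubic polynomials in 5j modulo 625.

module Five (prime : Prime 5) where

  open Descent 4 prime ℕP.≤-refl

  -- Obtained by solving the recurrence in powers of x = 5j, where x⁴ vanishes modulo 625. The
  -- constant terms are the coefficients -9, 135, -2439, 48519 of B in t, modulo 625.
  U₁ U₂ U₃ U₄ : List ℤ
  U₁ = - + 9 ∷ - + 60 ∷ []
  U₂ = + 135 ∷ - + 80 ∷ - + 75 ∷ []
  U₃ = + 61 ∷ + 240 ∷ - + 250 ∷ + 250 ∷ []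
  U₄ = - + 231 ∷ - + 305 ∷ - + 200 ∷ - + 125 ∷ []

  W : ℕ → Poly
  W i = cst (+ 5) ∙ var ∔ cst (+ i)

  fourthᴾ middleᴾ : Poly → Poly
  fourthᴾ n = n ∙ n ∙ n ∙ n
  middleᴾ n = cst (+ 54) ∙ n ∙ n ∙ n ∙ n ∔ cst (- + 108) ∙ n ∙ n ∙ n ∔ cst (+ 102) ∙ n ∙ n ∔ cst (- + 48) ∙ n ∔ cst (+ 9)

  value : List ℤ → ℤ → ℤ
  value l j = eval l (+ 0 + j)

  recurrence : ℕ → List ℤ → List ℤ → List ℤ → Poly
  recurrence i A B C = fourthᴾ (W (suc i)) ∙ shifted (+ 0) A ∔ middleᴾ (W (suc i)) ∙ shifted (+ 0) B ∔ cst (+ 729) ∙ fourthᴾ (W i) ∙ shifted (+ 0) C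

  -- The leading coefficient is a unit for 0 < i < 5, so two solutions of the recurrence with the
  -- same two preceding values agree.
  determined : ∀ j i → 0 < i → i < 5 → ∀ {m s a b c A B C} → fourthℤ (weight j i) * a + m * b + s * c ≡ + 0 ⟨mod p⁴ ⟩ → fourthℤ (weight j i) * A + m * B + s * C ≡ + 0 ⟨mod p⁴ ⟩ →
    b ≡ B ⟨mod p⁴ ⟩ → c ≡ C ⟨mod p⁴ ⟩ → a ≡ A ⟨mod p⁴ ⟩
  determined j i 0<i i<5 {m} {s} {a} {b} {c} {A} {B} {C} h H b≡ c≡ = ≡ₘ-difference (unit-cancelₘ 4 f (a - A) (p∤weight j i 0<i i<5)
    (≡ₘ-trans (≡ₘ-reflexive (t f m s a b c A B C)) (≡ₘ-+ (≡ₘ-+ (≡ₘ-+ h (≡ₘ-neg H)) (≡ₘ-neg (zeroʳₘ m (difference-≡ₘ b≡)))) (≡ₘ-neg (zeroʳₘ s (difference-≡ₘ c≡))))))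
    where
    f = fourthℤ (weight j i)
    t : ∀ f m s a b c A B C → f * (a - A) ≡ f * a + m * b + s * c + - (f * A + m * B + s * C) + - (m * (b - B)) + - (s * (c - C))
    t = solve-∀

  u₀ : ∀ j → u j 0 ≡ value (+ 1 ∷ []) j ⟨mod p⁴ ⟩
  u₀ j = ≡ₘ-reflexive (trans (u-0 j) (sym (cong (_+_ (+ 1)) (ℤP.*-zeroʳ (+ 0 + j)))))

  u₁ : ∀ j → u j 1 ≡ value U₁ j ⟨mod p⁴ ⟩
  u₁ j = determined j 1 (s≤s z≤n) (s≤s (s≤s z≤n)) {middle (weight j 1)} {+ 729 * fourthℤ (weight j 0)} {u j 1} {u j 0} {+ 0} {value U₁ j} {value (+ 1 ∷ []) j} {+ 0}
    (≡ₘ-trans (≡ₘ-+ (Y-rec₁ j 0) (≡ₘ-reflexive (ℤP.*-zeroʳ (+ 729 * fourthℤ (weight j 0))))) ≡ₘ-refl)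
    -- The empty list fills the place of the term before i = 0; its coefficient 729(5j)⁴ vanishes
    -- modulo 625 in any case.
    (all-multiples 625 (recurrence 0 U₁ (+ 1 ∷ []) []) refl j) (u₀ j) ≡ₘ-refl

  u₂ : ∀ j → u j 2 ≡ value U₂ j ⟨mod p⁴ ⟩
  u₂ j = determined j 2 (s≤s z≤n) (s≤s (s≤s (s≤s z≤n))) {middle (weight j 2)} {+ 729 * fourthℤ (weight j 1)} (Y-rec j 0 0) (all-multiples 625 (recurrence 1 U₂ U₁ (+ 1 ∷ [])) refl j) (u₁ j) (u₀ j)

  u₃ : ∀ j → u j 3 ≡ value U₃ j ⟨mod p⁴ ⟩
  u₃ j = determined j 3 (s≤s z≤n) (s≤s (s≤s (s≤s (s≤s z≤n)))) {middle (weight j 3)} {+ 729 * fourthℤ (weight j 2)} (Y-rec j 1 0) (all-multiples 625 (recurrence 2 U₃ U₂ U₁) refl j) (u₂ j) (u₁ j)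

  u₄ : ∀ j → u j 4 ≡ value U₄ j ⟨mod p⁴ ⟩
  u₄ j = determined j 4 (s≤s z≤n) (s≤s (s≤s (s≤s (s≤s (s≤s z≤n))))) {middle (weight j 4)} {+ 729 * fourthℤ (weight j 3)} (Y-rec j 2 0) (all-multiples 625 (recurrence 3 U₄ U₃ U₂) refl j) (u₃ j) (u₂ j)

  -- The products of indices 0 and 5 are missing because each `κ` stops at degree 4. The initial
  -- zero matches the shape of the sum in `product-at`.
  fifth : ℤ → ℤ → Poly
  fifth k l = cst (+ 0) ∔ shifted k U₁ ∙ shifted l U₄ ∔ shifted k U₂ ∙ shifted l U₃ ∔ shifted k U₃ ∙ shifted l U₂ ∔ shifted k U₄ ∙ shifted l U₁

  product-at : ∀ a b → (κ a ⊙ κ b) 5 ≡ + 0 + u a 1 * u b 4 + u a 2 * u b 3 + u a 3 * u b 2 + u a 4 * u b 1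
  product-at a b = trans (⊙-at (κ a) (κ b) 5) (t (u a 0) (u b 0) (u a 1 * u b 4) (u a 2 * u b 3) (u a 3 * u b 2) (u a 4 * u b 1))
    where
    t : ∀ x y q r s t → + 0 + x * + 0 + q + r + s + t + + 0 * y ≡ + 0 + q + r + s + t
    t = solve-∀

  product≡ : ∀ k l j → (κ (k + j) ⊙ κ (l + j)) 5 ≡ ⟦ fifth k l ⟧ j ⟨mod p⁴ ⟩
  product≡ k l j = ≡ₘ-trans (≡ₘ-reflexive (product-at (k + j) (l + j)))
    (≡ₘ-+ (≡ₘ-+ (≡ₘ-+ (≡ₘ-+ (≡ₘ-refl {a = + 0}) (≡ₘ-* (v 1 U₁ u₁ k) (v 4 U₄ u₄ l))) (≡ₘ-* (v 2 U₂ u₂ k) (v 3 U₃ u₃ l))) (≡ₘ-* (v 3 U₃ u₃ k) (v 2 U₂ u₂ l))) (≡ₘ-* (v 4 U₄ u₄ k) (v 1 U₁ u₁ l)))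
    where
    v : ∀ i A → (∀ j → u j i ≡ value A j ⟨mod p⁴ ⟩) → ∀ k → u (k + j) i ≡ eval A (k + j) ⟨mod p⁴ ⟩
    v i A h k = ≡ₘ-trans (h (k + j)) (≡ₘ-reflexive (cong (eval A) (ℤP.+-identityˡ (k + j))))

  defect≡0 : ∀ j → κ-square-defect j 5 ≡ + 0 ⟨mod p⁴ ⟩
  defect≡0 j = ≡ₘ-trans (≡ₘ-reflexive (trans (⊖-at (κ j ⊙ κ j) (κ (+ 1 + j) ⊙ κ (- + 1 + j)) 5) (trans (cong (λ z → (κ z ⊙ κ z) 5 - (κ (+ 1 + j) ⊙ κ (- + 1 + j)) 5) (sym (ℤP.+-identityˡ j))) (t ((κ (+ 0 + j) ⊙ κ (+ 0 + j)) 5) ((κ (+ 1 + j) ⊙ κ (- + 1 + j)) 5)))))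
    (≡ₘ-trans (≡ₘ-+ (product≡ (+ 0) (+ 0) j) (≡ₘ-* (≡ₘ-refl {a = - + 1}) (product≡ (+ 1) (- + 1) j))) (all-multiples 625 (fifth (+ 0) (+ 0) ∔ cst (- + 1) ∙ fifth (+ 1) (- + 1)) refl j))
    where
    t : ∀ a b → a - b ≡ a + - + 1 * b
    t = solve-∀

-- Return to the Laurent series F.

shiftDown-+ : ∀ j f n {k} → n + + j ≡ + k → shiftDown j f n ≡ f k
shiftDown-+ j f n h with n + + j | h
... | .(+ _) | refl = refl

shiftDown-neg : ∀ j f n {k} → n + + j ≡ -[1+ k ] → shiftDown j f n ≡ + 0
shiftDown-neg j f n h with n + + j | h
... | .(-[1+ _ ]) | refl = refl

quotient≈ : ∀ j → mul C (inv (pow tOverQ j)) ≈ C ⊙ τ^ (- + j)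
quotient≈ j = ≈-trans (mul≈⊙ C (inv (pow tOverQ j))) (*-cong ≈-refl (subst (λ t → inv (pow t j) ≈ τ^ (- + j)) τ≡ (inv-pow-τ j)))

-- For p = 5 the condition of the descent is met by the computation modulo 625, for p ≥ 7 by the
-- size of p. The clause p′ = 5 discards the composite number 6.
U-congruence : ∀ p′ → Prime (suc p′) → 5 ≤ suc p′ → ∀ r N →
  (C ⊙ τ^ (- (+ suc p′ * r + + 0))) (N ℕ.* suc p′) ≡ (C ⊙ τ^ (- r)) N ⟨mod suc p′ ℕ.^ 4 ⟩
U-congruence 4 h _ = Descent.Y≡Cτ 4 h ℕP.≤-refl (inj₂ (Five.defect≡0 h))
U-congruence 5 h _ = ⊥-elim (six (Pr.prime⇒irreducible h (ℕD.divides 3 refl)))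
  where
  six : ¬ (2 ≡ 1 ⊎ 2 ≡ 6)
  six (inj₁ ())
  six (inj₂ ())
U-congruence p′@(suc (suc (suc (suc (suc (suc k)))))) h 5≤p = Descent.Y≡Cτ p′ h 5≤p (inj₁ (ℕP.m≤m+n 7 k))
U-congruence 0 _ (s≤s ())
U-congruence 1 _ (s≤s (s≤s ()))
U-congruence 2 _ (s≤s (s≤s (s≤s ())))
U-congruence 3 _ (s≤s (s≤s (s≤s (s≤s ()))))

-- Multiplying the index by p turns the shift by rp into (n + r)p. So the two coefficients sit at (n
-- + r)p and n + r, which are negative together, and then both are zero.
F≡0 : ∀ p′ → Prime (suc p′) → 5 ≤ suc p′ → ∀ r n m → n + + r ≡ m → F (suc p′) r n ≡ + 0 ⟨mod suc p′ ℕ.^ 4 ⟩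
F≡0 p′ p-prime 5≤p r n m n+r≡m = cases m n+r≡m (trans (trans (cong (_+_ (n * + p)) (ℤP.pos-* r p)) (sym (ℤP.*-distribʳ-+ (+ p) n (+ r)))) (cong (_* + p) n+r≡m))
  where
  p = suc p′
  cases : ∀ m → n + + r ≡ m → n * + p + + (r ℕ.* p) ≡ m * + p → F p r n ≡ + 0 ⟨mod p ℕ.^ 4 ⟩
  cases (+ N) h hp = ≡ₘ-trans (≡ₘ-reflexive (cong₂ _-_
      (trans (shiftDown-+ (r ℕ.* p) _ (n * + p) (trans hp (sym (ℤP.pos-* N p)))) (trans (at (quotient≈ (r ℕ.* p)) (N ℕ.* p)) (cong (λ k → (C ⊙ τ^ k) (N ℕ.* p)) (trans (cong (λ z → - z) (ℤP.pos-* r p)) (t (+ p) (+ r))))))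
      (trans (shiftDown-+ r _ n h) (at (quotient≈ r) N))))
    (difference-≡ₘ (U-congruence p′ p-prime 5≤p (+ r) N))
    where
    t : ∀ p r → - (r * p) ≡ - (p * r + + 0)
    t = solve-∀
  cases -[1+ k ] h hp = ≡ₘ-reflexive (cong₂ _-_ (shiftDown-neg (r ℕ.* p) _ (n * + p) hp) (shiftDown-neg r _ n h))

theorem7p3 : (p : ℕ) → Prime p → 5 ≤ p → (r : ℕ) → 1 ≤ r → r ≤ 3 →
    (n : ℤ) → (+ (p ^ 4)) ∣ F p r n
theorem7p3 (suc p′) p-prime 5≤p r _ _ n = ∣⇒∣ᵤ (≡ₘ0⇒∣ (F≡0 p′ p-prime 5≤p r n (n + + r) refl))
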